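{- For every integer $n\ge 0$, \[\sum_{W}2^{\kappa(W)}=\frac{4^n}{(n+1)(2n+1)}\binom{3n}{n},\] where the sum is over all Kreweras webs $W$ with $3n$ boundary vertices and $\kappa(W)$ is the number of connected components of $W$. Moreover, for every $n\ge1$, the number of connected Kreweras webs with $3n$ boundary vertices is $2^n\,\frac{(4n-3)!}{(3n-1)!\,n!}$.
   Context: An $\mathfrak{sl}_3$-web is a planar graph embedded in a disk, with boundary vertices labeled $1,\dots,m$ arranged counterclockwise on the rim of the disk and any number of unlabeled internal vertices, such that every boundary vertex has degree one, every internal vertex has degree three, and the vertices are colored black and white with every edge joining vertices of opposite colors. Faces other than the one containing the boundary vertices are internal. A web is irreducible if it has no internal face with fewer than $6$ sides. A Kreweras web is an irreducible $\mathfrak{sl}_3$-web all of whose boundary vertices are white and which has no internal face whose number of sides is a multiple of $4$. Webs are counted up to isotopy of the disk fixing the labeled boundary. -}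

module Defs where

open import Data.Nat using (ℕ; zero; suc; _+_; _≤_; _<_)
open import Data.Nat.Divisibility using (_∣_)
open import Data.Fin using (Fin; zero; suc; fromℕ; inject₁; _↑ˡ_)
open import Data.Product using (Σ; ∃; _×_)
open import Data.Sum using (_⊎_)
open import Data.Unit using (⊤)
open import Data.List using (List)
open import Data.List.Relation.Unary.All using (All)
open import Data.List.Relation.Unary.Any using (Any)
open import Data.List.Relation.Unary.AllPairs using (AllPairs)
open import Relation.Nullary using (¬_)
open import Relation.Binary.PropositionalEquality using (_≡_; _≢_)
open import Relation.Binary.Construct.Closure.Equivalence using (EqClosure)

data Color : Set where
  black white : Color

iter : {A : Set} → (A → A) → ℕ → A → A
iter f zero x = x
iter f (suc n) x = f (iter f n x)

Period : ∀ {d} → (Fin d → Fin d) → Fin d → ℕ → Set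
Period f x ℓ = (1 ≤ ℓ) × (iter f ℓ x ≡ x) × (∀ j → 1 ≤ j → j < ℓ → iter f j x ≢ x)

record NumClasses {d : ℕ} (S : Fin d → Set) (R : Fin d → Fin d → Set) (N : ℕ) : Set where
  field
    rep      : Fin N → Fin d
    rep-in   : ∀ i → S (rep i)
    cover    : ∀ x → S x → ∃ λ i → EqClosure R (rep i) x
    distinct : ∀ i j → EqClosure R (rep i) (rep j) → i ≡ j

NumOrbits : ∀ {d} → (Fin d → Fin d) → ℕ → Set
NumOrbits π N = NumClasses (λ _ → ⊤) (λ x y → π x ≡ y) N

prev : ∀ {m} → Fin m → Fin m
prev {suc m} zero = fromℕ m
prev {suc m} (suc i) = inject₁ i

-- Webs with m boundary vertices, encoded as combinatorial maps.
--
-- The disk is capped off by a "hub" vertex H lying outside the disk,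
-- joined by one edge to each boundary vertex; the result is a map on the
-- sphere.  Darts are Fin (m + k); darts i ↑ˡ k (i : Fin m) are the
-- darts at the hub, the edge from H to boundary vertex i.  α is the edge
-- involution, σ the counterclockwise rotation around vertices, col the
-- colouring (only meaningful on non-hub darts).  Seen around H (from
-- outside the disk) the counterclockwise order 1..m of the rim is
-- reversed, hence σ (hub i) = hub (i - 1).

record RawWeb (m : ℕ) : Set where
  field
    k   : ℕ
    α   : Fin (m + k) → Fin (m + k)
    σ   : Fin (m + k) → Fin (m + k)
    σ⁻  : Fin (m + k) → Fin (m + k)
    col : Fin (m + k) → Color

module _ {m : ℕ} (W : RawWeb m) where
  open RawWeb W

  hub : Fin m → Fin (m + k)
  hub i = i ↑ˡ k

  NonHub : Fin (m + k) → Set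
  NonHub x = ∀ i → x ≢ hub i

  bnd : Fin m → Fin (m + k)
  bnd i = α (hub i)

  -- face permutation
  φ : Fin (m + k) → Fin (m + k)
  φ x = σ (α x)

  Connected : Set
  Connected = NumClasses (λ _ → ⊤) (λ x y → (σ x ≡ y) ⊎ (α x ≡ y)) 1

  -- Euler's formula V - E + F = 2 : the (connected) capped map is planar
  Spherical : Set
  Spherical = Σ ℕ λ V → Σ ℕ λ E → Σ ℕ λ F →
    NumOrbits σ V × NumOrbits α E × NumOrbits φ F × (V + F ≡ 2 + E)

  record IsWeb : Set where
    field
      α-invol    : ∀ x → α (α x) ≡ x
      α-nofix    : ∀ x → α x ≢ x
      σ-inv₁     : ∀ x → σ (σ⁻ x) ≡ x
      σ-inv₂     : ∀ x → σ⁻ (σ x) ≡ x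
      hub-rot    : ∀ i → σ (hub i) ≡ hub (prev i)
      -- boundary vertices: degree one in the web (degree two in the capped map)
      bnd-nonhub : ∀ i → NonHub (bnd i)
      bnd-deg    : ∀ i → σ (σ (bnd i)) ≡ bnd i
      bnd-sep    : ∀ i j → σ (bnd i) ≢ bnd j
      int-deg    : ∀ x → NonHub x → (∀ i → x ≢ bnd i) → (∀ i → x ≢ σ (bnd i)) →
                   (σ x ≢ x) × (σ (σ (σ x)) ≡ x)
      col-vertex : ∀ x → NonHub x → col (σ x) ≡ col x
      col-edge   : ∀ x → NonHub x → NonHub (α x) → col (α x) ≢ col x
      planar     : (m + k ≡ 0) ⊎ (Connected × Spherical)

  -- internal faces: faces of the capped map not incident to the hub
  InternalFace : Fin (m + k) → Set
  InternalFace x = ∀ j i → iter φ j x ≢ hub i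

  record IsKreweras : Set where
    field
      bnd-white : ∀ i → col (bnd i) ≡ white
      faces     : ∀ x ℓ → InternalFace x → Period φ x ℓ → (6 ≤ ℓ) × ¬ (4 ∣ ℓ)

  -- κ(W) = c : the web (capped map minus the hub) has c connected components
  NumComponents : ℕ → Set
  NumComponents c = NumClasses NonHub
    (λ x y → NonHub x × NonHub y × ((σ x ≡ y) ⊎ (α x ≡ y))) c

-- isotopy of webs = isomorphism of capped maps fixing the hub darts
record Iso {m : ℕ} (W W′ : RawWeb m) : Set where
  private
    module A = RawWeb W
    module B = RawWeb W′
  field
    f     : Fin (m + A.k) → Fin (m + B.k)
    g     : Fin (m + B.k) → Fin (m + A.k)
    gf    : ∀ x → g (f x) ≡ x
    fg    : ∀ y → f (g y) ≡ y
    f-hub : ∀ i → f (hub W i) ≡ hub W′ i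
    f-α   : ∀ x → f (A.α x) ≡ B.α (f x)
    f-σ   : ∀ x → f (A.σ x) ≡ B.σ (f x)
    f-col : ∀ x → NonHub W x → B.col (f x) ≡ A.col x

record KWeb (m : ℕ) : Set where
  field
    web   : RawWeb m
    isWeb : IsWeb web
    isKr  : IsKreweras web
    κ     : ℕ
    κ-ok  : NumComponents web κ

open KWeb public

IsTransversal : ∀ {m} → (RawWeb m → Set) → List (KWeb m) → Set
IsTransversal {m} Q L =
  All (λ e → Q (web e)) L ×
  (∀ (W : RawWeb m) → IsWeb W → IsKreweras W → Q W → Any (λ e → Iso W (web e)) L) ×
  AllPairs (λ a b → ¬ Iso (web a) (web b)) L

{-# OPTIONS --safe #-}
module Submission where

-- A web is recorded by the rotations of its edges around black and white
-- vertices.  Euler's formula and discharging show that an H or a tripod can be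
-- taken off the boundary of every Kreweras web; always taking off the last one
-- gives each web a unique code.  Fix a word of colours for the outermost strands:
-- the codes compatible with it, weighted by 2 per component, or those of one
-- component, are counted by numbers that depend only on how often each colour
-- occurs and obey the recursion of Kreweras walks.  The kernel equation of their
-- generating function yields an identity D (x) = D (y), so both sides are constant
-- and one catalytic variable remains; the resulting quadratic equation is solved
-- by P (C - v C^2) for a Catalan series C, and the coefficients of the algebraic
-- series P are Raney numbers.

-- Power series

-- The face condition and the colours are two sides of one thing. A face with 2 l sides passes l
-- black vertices, so the Kreweras condition says that l is odd and at least 3. Strands next to each
-- other in one component get equal colours exactly when the gap between them passes an even number
-- of black vertices. Gluing an H to two strands leaves a gap past one black vertex between the new
-- strands and adds one to both neighbouring gaps. Across a closed gap its face is odd exactly when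
-- the two colours differ, and the colours are then exchanged. The bound 3 is automatic in a code,
-- since no pattern may lie to the right of the last one. A component has two colourings, whence the
-- weight 2. For connected webs finished components get weight 0, and an unknown series makes up for
-- the missing colourings: in the first count the kernel coefficient is 1 and the value at the empty
-- word is unknown, in the second the value at the empty word is 1 and the kernel coefficient is
-- unknown. The counts are natural numbers and the kernel argument avoids subtraction; integers
-- enter because the explicit solution contains 1 - v.

module PowerSeries where

  open import Algebra.Bundles using (CommutativeSemiring; CommutativeRing)
  open import Level using (0ℓ)
  open import Data.Nat as ℕ using (ℕ; zero; suc; _≤_; _<_; z≤n; s≤s)
  import Data.Nat.Properties as ℕₚ
  open import Data.Product using (Σ; ∃; _×_; _,_; proj₁; proj₂)
  open import Relation.Binary.PropositionalEquality as ≡ using (_≡_)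
  open import Relation.Binary.Structures using (IsEquivalence)
  import Relation.Binary.Reasoning.Setoid as SetoidReasoning
  open import Data.Nat.Induction using (<-rec)
  import Algebra.Solver.Ring.NaturalCoefficients.Default as NatSolver
  open import Data.Sum using (_⊎_; inj₁; inj₂; [_,_]′)

  Semi : Set₁
  Semi = CommutativeSemiring 0ℓ 0ℓ

  module Series (R : Semi) where
    open CommutativeSemiring R hiding (zero)

    PS : Set
    PS = ℕ → Carrier

    infix 4 _≋_
    _≋_ : PS → PS → Set
    f ≋ g = ∀ n → f n ≈ g n

    infixl 7 _⊛_
    infixl 6 _⊕_
    _⊛_ _⊕_ : PS → PS → PS
    (f ⊛ g) zero = f 0 * g 0
    (f ⊛ g) (suc n) = f 0 * g (suc n) + ((λ m → f (suc m)) ⊛ g) n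
    (f ⊕ g) n = f n + g n

    tail : PS → PS
    tail f n = f (suc n)

    const : Carrier → PS
    const a zero = a
    const a (suc n) = 0#

    0ₛ 1ₛ X : PS
    0ₛ n = 0#
    1ₛ = const 1#
    X zero = 0#
    X (suc n) = const 1# n

    private
      swap₃ : ∀ a b c → a + (b + c) ≈ b + (a + c)
      swap₃ a b c = trans (sym (+-assoc a b c)) (trans (+-congʳ (+-comm a b)) (+-assoc b a c))
      swap₄ : ∀ a b c d → (a + b) + (c + d) ≈ (a + c) + (b + d)
      swap₄ a b c d = trans (+-assoc a b (c + d)) (trans (+-congˡ (swap₃ b c d)) (sym (+-assoc a c (b + d))))

    ⊛-cong : ∀ {f f′ g g′} → f ≋ f′ → g ≋ g′ → f ⊛ g ≋ f′ ⊛ g′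
    ⊛-cong p q zero = *-cong (p 0) (q 0)
    ⊛-cong p q (suc n) = +-cong (*-cong (p 0) (q (suc n))) (⊛-cong (λ m → p (suc m)) q n)

    ⊛-right : ∀ f g n → (f ⊛ g) (suc n) ≈ f (suc n) * g 0 + (f ⊛ tail g) n
    ⊛-right f g zero = +-comm _ _
    ⊛-right f g (suc n) = trans (+-congˡ (⊛-right (tail f) g n)) (swap₃ _ _ _)

    ⊛-comm : ∀ f g → f ⊛ g ≋ g ⊛ f
    ⊛-comm f g zero = *-comm _ _
    ⊛-comm f g (suc n) = trans (+-cong (*-comm _ _) (⊛-comm (tail f) g n)) (sym (⊛-right g f n))

    ⊛-distribʳ : ∀ h f g → (f ⊕ g) ⊛ h ≋ (f ⊛ h) ⊕ (g ⊛ h)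
    ⊛-distribʳ h f g zero = distribʳ _ _ _
    ⊛-distribʳ h f g (suc n) = trans (+-cong (distribʳ _ _ _) (⊛-distribʳ h (tail f) (tail g) n)) (swap₄ _ _ _ _)

    ⊛-scale : ∀ a f g → (λ n → a * f n) ⊛ g ≋ (λ n → a * (f ⊛ g) n)
    ⊛-scale a f g zero = *-assoc _ _ _
    ⊛-scale a f g (suc n) = trans (+-cong (*-assoc _ _ _) (⊛-scale a (tail f) g n)) (sym (distribˡ _ _ _))

    ⊛-assoc : ∀ f g h → (f ⊛ g) ⊛ h ≋ f ⊛ (g ⊛ h)
    ⊛-assoc f g h zero = *-assoc _ _ _
    ⊛-assoc f g h (suc n) = begin
      f 0 * g 0 * h (suc n) + (tail (f ⊛ g) ⊛ h) n  ≈⟨ +-congˡ (⊛-distribʳ h (λ m → f 0 * g (suc m)) (tail f ⊛ g) n) ⟩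
      f 0 * g 0 * h (suc n) + (((λ m → f 0 * g (suc m)) ⊛ h) n + ((tail f ⊛ g) ⊛ h) n)  ≈⟨ +-cong (*-assoc _ _ _) (+-cong (⊛-scale (f 0) (tail g) h n) (⊛-assoc (tail f) g h n)) ⟩
      f 0 * (g 0 * h (suc n)) + (f 0 * (tail g ⊛ h) n + (tail f ⊛ (g ⊛ h)) n)  ≈⟨ sym (+-assoc _ _ _) ⟩
      f 0 * (g 0 * h (suc n)) + f 0 * (tail g ⊛ h) n + (tail f ⊛ (g ⊛ h)) n  ≈⟨ +-congʳ (sym (distribˡ _ _ _)) ⟩
      f 0 * (g 0 * h (suc n) + (tail g ⊛ h) n) + (tail f ⊛ (g ⊛ h)) n ∎
      where open SetoidReasoning setoid

    ⊛-zeroˡ : ∀ g → 0ₛ ⊛ g ≋ 0ₛ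
    ⊛-zeroˡ g zero = zeroˡ _
    ⊛-zeroˡ g (suc n) = trans (+-cong (zeroˡ _) (⊛-zeroˡ g n)) (+-identityˡ _)

    const-⊛ : ∀ a g → const a ⊛ g ≋ (λ n → a * g n)
    const-⊛ a g zero = refl
    const-⊛ a g (suc n) = trans (+-congˡ (⊛-zeroˡ g n)) (+-identityʳ _)

    ⊛-identityˡ : ∀ g → 1ₛ ⊛ g ≋ g
    ⊛-identityˡ g n = trans (const-⊛ 1# g n) (*-identityˡ _)

    X-⊛ : ∀ g n → (X ⊛ g) (suc n) ≈ g n
    X-⊛ g n = trans (+-cong (zeroˡ _) (⊛-identityˡ g n)) (+-identityˡ _)

    X-⊛-0 : ∀ g → (X ⊛ g) 0 ≈ 0#
    X-⊛-0 g = zeroˡ _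

    lowest : ∀ f g n → (∀ m → m < n → f m ≈ 0#) → (f ⊛ g) n ≈ f n * g 0
    lowest f g zero h = refl
    lowest f g (suc n) h = trans (+-cong (trans (*-congʳ (h 0 (s≤s z≤n))) (zeroˡ _)) (lowest (tail f) g n (λ m lt → h (suc m) (s≤s lt)))) (+-identityˡ _)

    below : ∀ f g n → (∀ m → m ≤ n → f m ≈ 0#) → (f ⊛ g) n ≈ 0#
    below f g n h = trans (lowest f g n (λ m lt → h m (ℕₚ.<⇒≤ lt))) (trans (*-congʳ (h n ℕₚ.≤-refl)) (zeroˡ _))

    Agree : ℕ → PS → PS → Set
    Agree n f g = ∀ m → m < n → f m ≈ g m

    ⊛-agree : ∀ {f f′ g g′} n → Agree n f f′ → Agree n g g′ → Agree n (f ⊛ g) (f′ ⊛ g′)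
    ⊛-agree {f} {f′} {g} {g′} (suc n) p q zero lt = *-cong (p 0 lt) (q 0 lt)
    ⊛-agree (suc n) p q (suc m) (s≤s lt) = +-cong (*-cong (p 0 (s≤s z≤n)) (q (suc m) (s≤s lt)))
      (⊛-agree n (λ k l → p (suc k) (s≤s l)) (λ k l → q k (ℕₚ.<-trans l ℕₚ.≤-refl)) m lt)

    -- By `ok` a coefficient of `G f` uses only coefficients of f up to the same index, so f = a + X
    -- G f determines the coefficients of f one after another; `approx k` is correct below index k.
    module Fixpoint (a : Carrier) (G : PS → PS) (ok : ∀ n f g → Agree n f g → Agree n (G f) (G g)) where

      approx : ℕ → PS
      approx zero = 0ₛ
      approx (suc k) zero = a
      approx (suc k) (suc n) = G (approx k) n

      fix : PS
      fix n = approx (suc n) n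

      stable : ∀ k → Agree k (approx k) (approx (suc k))
      stable (suc k) zero lt = refl
      stable (suc k) (suc m) (s≤s lt) = ok k _ _ (stable k) m lt

      fix-approx : ∀ k → Agree k fix (approx k)
      fix-approx (suc k) m lt with ℕₚ.m<1+n⇒m<n∨m≡n lt
      ... | inj₁ l = trans (fix-approx k m l) (stable k m l)
      ... | inj₂ ≡.refl = refl

      fix-suc : ∀ n → fix (suc n) ≈ G fix n
      fix-suc n = sym (ok (suc n) fix (approx (suc n)) (fix-approx (suc n)) n ℕₚ.≤-refl)

      fix-eq : fix ≋ const a ⊕ X ⊛ G fix
      fix-eq zero = sym (trans (+-congˡ (X-⊛-0 (G fix))) (+-identityʳ _))
      fix-eq (suc n) = trans (fix-suc n) (sym (trans (+-cong refl (X-⊛ (G fix) n)) (+-identityˡ _)))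

    psSemiring : Semi
    psSemiring = record
      { Carrier = PS ; _≈_ = _≋_ ; _+_ = _⊕_ ; _*_ = _⊛_ ; 0# = 0ₛ ; 1# = 1ₛ
      ; isCommutativeSemiring = IsCommutativeSemiringˡ.isCommutativeSemiring record
        { +-isCommutativeMonoid = record
          { isMonoid = record
            { isSemigroup = record
              { isMagma = record { isEquivalence = equiv ; ∙-cong = λ p q n → +-cong (p n) (q n) }
              ; assoc = λ f g h n → +-assoc _ _ _ }
            ; identity = (λ f n → +-identityˡ _) , (λ f n → +-identityʳ _) }
          ; comm = λ f g n → +-comm _ _ }
        ; *-isCommutativeMonoid = record
          { isMonoid = record
            { isSemigroup = record { isMagma = record { isEquivalence = equiv ; ∙-cong = ⊛-cong } ; assoc = ⊛-assoc }
            ; identity = ⊛-identityˡ , (λ f n → trans (⊛-comm f 1ₛ n) (⊛-identityˡ f n)) }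
          ; comm = ⊛-comm }
        ; distribʳ = ⊛-distribʳ
        ; zeroˡ = ⊛-zeroˡ } }
      where
      open import Algebra.Structures.Biased _≋_ using (module IsCommutativeSemiringˡ)
      equiv : IsEquivalence _≋_
      equiv = record { refl = λ n → refl ; sym = λ p n → sym (p n) ; trans = λ p q n → trans (p n) (q n) }

  record Hom (R R′ : Semi) : Set where
    private
      module A = CommutativeSemiring R
      module B = CommutativeSemiring R′
    field
      ⟦_⟧ : A.Carrier → B.Carrier
      hcong : ∀ {x y} → x A.≈ y → ⟦ x ⟧ B.≈ ⟦ y ⟧
      h+ : ∀ x y → ⟦ x A.+ y ⟧ B.≈ ⟦ x ⟧ B.+ ⟦ y ⟧
      h* : ∀ x y → ⟦ x A.* y ⟧ B.≈ ⟦ x ⟧ B.* ⟦ y ⟧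
      h0 : ⟦ A.0# ⟧ B.≈ B.0#
      h1 : ⟦ A.1# ⟧ B.≈ B.1#

  open Hom public

  map-hom : ∀ {R R′} → Hom R R′ → Hom (Series.psSemiring R) (Series.psSemiring R′)
  map-hom {R} {R′} h = record
    { ⟦_⟧ = λ f n → ⟦ h ⟧ (f n) ; hcong = λ p n → hcong h (p n) ; h+ = λ f g n → h+ h _ _ ; h* = mul ; h0 = λ n → h0 h
    ; h1 = λ { zero → h1 h ; (suc n) → h0 h } }
    where
    module A = Series R
    module B = Series R′
    open CommutativeSemiring R′ hiding (zero)
    mul : ∀ f g n → ⟦ h ⟧ ((f A.⊛ g) n) ≈ ((λ n → ⟦ h ⟧ (f n)) B.⊛ (λ n → ⟦ h ⟧ (g n))) n
    mul f g zero = h* h _ _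
    mul f g (suc n) = trans (h+ h _ _) (+-cong (h* h _ _) (mul (A.tail f) g n))

  const-hom : ∀ R → Hom R (Series.psSemiring R)
  const-hom R = record { ⟦_⟧ = S.const ; hcong = λ { p zero → p ; p (suc n) → refl } ; h+ = λ { x y zero → refl ; x y (suc n) → sym (+-identityˡ _) }
    ; h* = λ { x y zero → refl ; x y (suc n) → sym (trans (S.const-⊛ x (S.const y) (suc n)) (zeroʳ _)) } ; h0 = λ { zero → refl ; (suc n) → refl } ; h1 = λ n → refl }
    where
    module S = Series R
    open CommutativeSemiring R hiding (zero)

  eval-hom : ∀ R → Hom (Series.psSemiring R) R
  eval-hom R = record { ⟦_⟧ = λ f → f 0 ; hcong = λ p → p 0 ; h+ = λ f g → refl ; h* = λ f g → refl ; h0 = refl ; h1 = refl }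
    where open CommutativeSemiring R hiding (zero)

  -- Kernel equations over cancellative semirings

  Cancels : Semi → Set
  Cancels R = ∀ x y z → x + z ≈ y + z → x ≈ y
    where open CommutativeSemiring R

  module KernelIdentity (R : Semi) (cancel : Cancels R) where
    open CommutativeSemiring R hiding (zero)
    open NatSolver R

    -- The difference of the two sides is the multiple (x a − y b) t x y − (x − y) of the kernel equation.
    kernel-identity : ∀ t x y k q a b c →
      k * (x * y) * q + t * (y * b + x * a) ≈ x * y + t * ((x + y + x * x * (y * y)) * q) →
      let d⁺ = λ x a → k * (x * a) + (t * c + t * c)
          d⁻ = λ x a → x + (t * a + t * a) + t * t * (x * x * (a * a))
          m⁺ = x * a * (1# + t * (x * y * q)) + y * q
          m⁻ = y * b * (1# + t * (x * y * q)) + x * q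
      in x * (y * (d⁺ x a + d⁻ y b)) + (t * ((x + y + x * x * (y * y)) * m⁺) + x * (y * (k * m⁻)))
       ≈ x * (y * (d⁺ y b + d⁻ x a)) + (t * ((x + y + x * x * (y * y)) * m⁻) + x * (y * (k * m⁺)))
    kernel-identity t x y k q a b c e = cancel _ _ _ (trans (solve 8
      (λ t x y k q a b c →
        let d⁺ = λ x a → k :* (x :* a) :+ (t :* c :+ t :* c)
            d⁻ = λ x a → x :+ (t :* a :+ t :* a) :+ t :* t :* (x :* x :* (a :* a))
            m⁺ = x :* a :* (con 1 :+ t :* (x :* y :* q)) :+ y :* q
            m⁻ = y :* b :* (con 1 :+ t :* (x :* y :* q)) :+ x :* q
            k′ = x :+ y :+ x :* x :* (y :* y)
            p₁ = k :* (x :* y) :* q :+ t :* (y :* b :+ x :* a)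
            p₂ = x :* y :+ t :* (k′ :* q)
            c⁺ = x :* a :* (t :* (x :* y)) :+ y
            c⁻ = y :* b :* (t :* (x :* y)) :+ x
        in x :* (y :* (d⁺ x a :+ d⁻ y b)) :+ (t :* (k′ :* m⁺) :+ x :* (y :* (k :* m⁻))) :+ (c⁺ :* p₁ :+ c⁻ :* p₂)
         := x :* (y :* (d⁺ y b :+ d⁻ x a)) :+ (t :* (k′ :* m⁻) :+ x :* (y :* (k :* m⁺))) :+ (c⁺ :* p₂ :+ c⁻ :* p₁))
      refl t x y k q a b c)
      (+-congˡ (+-cong (*-congˡ (sym e)) (*-congˡ e))))

    -- `m-at-x` and `m-at-y` isolate the values at x = 0 and at y = 0. Used for both m⁺ and m⁻, with
    -- x and y exchanged, they show that these agree on the two axes.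
    m-at-x : ∀ t x y q a → x * a * (1# + t * (x * y * q)) + y * q ≈ y * q + x * (a * (1# + t * (x * y * q)))
    m-at-x t x y q a = trans (+-comm _ _) (+-congˡ (*-assoc _ _ _))

    m-at-y : ∀ t x y q a → x * a * (1# + t * (x * y * q)) + y * q ≈ x * a + y * (x * a * (t * (x * q)) + q)
    m-at-y = solve 5 (λ t x y q a → x :* a :* (con 1 :+ t :* (x :* y :* q)) :+ y :* q := x :* a :+ y :* (x :* a :* (t :* (x :* q)) :+ q)) refl

    m-swap : ∀ t x y q → 1# + t * (x * y * q) ≈ 1# + t * (y * x * q)
    m-swap t x y q = +-congˡ (*-congˡ (*-congʳ (*-comm x y)))

  -- The instances are the series free of x and the series free of y, by which the two sides of D
  -- (x) = D (y) are separated.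
  record Sub (R : Semi) (P : CommutativeSemiring.Carrier R → Set) : Set where
    open CommutativeSemiring R
    field
      resp : ∀ {x y} → x ≈ y → P x → P y
      sub+ : ∀ {x y} → P x → P y → P (x + y)
      sub* : ∀ {x y} → P x → P y → P (x * y)
      sub0 : P 0#

  series-sub : ∀ {R P} → Sub R P → Sub (Series.psSemiring R) (λ f → ∀ n → P (f n))
  series-sub {R} {P} A = record { resp = λ e p n → resp (e n) (p n) ; sub+ = λ p q n → sub+ (p n) (q n) ; sub* = λ {f} {g} → mul f g ; sub0 = λ n → sub0 }
    where
    open Sub A
    open Series R
    mul : ∀ f g → (∀ n → P (f n)) → (∀ n → P (g n)) → ∀ n → P ((f ⊛ g) n)
    mul f g p q zero = sub* (p 0) (q 0)
    mul f g p q (suc n) = sub+ (sub* (p 0) (q (suc n))) (mul (tail f) g (λ m → p (suc m)) q n)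

  Constant : (R : Semi) → Series.PS R → Set
  Constant R f = ∀ n → f (suc n) ≈ 0#
    where open CommutativeSemiring R

  constant-sub : ∀ R → Sub (Series.psSemiring R) (Constant R)
  constant-sub R = record { resp = λ e p n → trans (sym (e (suc n))) (p n) ; sub+ = λ p q n → trans (+-cong (p n) (q n)) (+-identityˡ _)
    ; sub* = λ {f} {g} p q n → trans (+-cong (trans (*-congˡ (q n)) (zeroʳ _)) (below (tail f) g n (λ m _ → p m))) (+-identityˡ _) ; sub0 = λ n → refl }
    where
    open CommutativeSemiring R hiding (zero)
    open Series R

  series-cancels : ∀ {R} → Cancels R → Cancels (Series.psSemiring R)
  series-cancels c f g h e n = c (f n) (g n) (h n) (e n)

  -- Series in t over series in x over series in y. Inductions run on the power of t, the outermost
  -- variable, while x and y may occur in any degree.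
  module Tower (B : Semi) where
    R₁ R₂ R₃ : Semi
    R₁ = Series.psSemiring B
    R₂ = Series.psSemiring R₁
    R₃ = Series.psSemiring R₂
    module B = CommutativeSemiring B
    module S₁ = Series B
    module S₂ = Series R₁
    module S₃ = Series R₂
    module R₁ = CommutativeSemiring R₁
    module R₂ = CommutativeSemiring R₂
    open CommutativeSemiring R₃ public hiding (zero)

    t x y : Carrier
    t = S₃.X
    x = S₃.const S₂.X
    y = S₃.const (S₂.const S₁.X)

    at-x0 at-y0 at-xy0 : Carrier → Carrier
    at-x0 f n = S₂.const (f n 0)
    at-y0 f n i = S₁.const (f n i 0)
    at-xy0 f n = S₂.const (S₁.const (f n 0 0))

    XFree YFree : Carrier → Set
    XFree f = ∀ n → Constant R₁ (f n)
    YFree f = ∀ n i → Constant B (f n i)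

    module XF = Sub (series-sub (constant-sub R₁))
    module YF = Sub (series-sub (series-sub (constant-sub B)))

    t-0 : ∀ f → (t * f) 0 R₂.≈ R₂.0#
    t-0 = S₃.X-⊛-0

    t-suc : ∀ f n → (t * f) (suc n) R₂.≈ f n
    t-suc = S₃.X-⊛

    x-0 : ∀ f n → (x * f) n 0 R₁.≈ R₁.0#
    x-0 f n = R₁.trans (S₃.const-⊛ S₂.X f n 0) (S₂.X-⊛-0 (f n))

    x-suc : ∀ f n i → (x * f) n (suc i) R₁.≈ f n i
    x-suc f n i = R₁.trans (S₃.const-⊛ S₂.X f n (suc i)) (S₂.X-⊛ (f n) i)

    y-at : ∀ f n i → (y * f) n i R₁.≈ S₁.X R₁.* f n i
    y-at f n i = R₁.trans (S₃.const-⊛ (S₂.const S₁.X) f n i) (S₂.const-⊛ S₁.X (f n) i)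

    y-0 : ∀ f n i → (y * f) n i 0 B.≈ B.0#
    y-0 f n i = B.trans (y-at f n i 0) (S₁.X-⊛-0 (f n i))

    y-suc : ∀ f n i j → (y * f) n i (suc j) B.≈ f n i j
    y-suc f n i j = B.trans (y-at f n i (suc j)) (S₁.X-⊛ (f n i) j)

    t-xfree : XFree t
    t-xfree zero i j = B.refl
    t-xfree (suc zero) i j = B.refl
    t-xfree (suc (suc n)) i j = B.refl

    t-yfree : YFree t
    t-yfree zero i j = B.refl
    t-yfree (suc zero) zero j = B.refl
    t-yfree (suc zero) (suc i) j = B.refl
    t-yfree (suc (suc n)) i j = B.refl

    x-yfree : YFree x
    x-yfree zero zero j = B.refl
    x-yfree zero (suc zero) j = B.refl
    x-yfree zero (suc (suc i)) j = B.refl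
    x-yfree (suc n) i j = B.refl

    y-xfree : XFree y
    y-xfree zero i j = B.refl
    y-xfree (suc n) i j = B.refl

  -- With subtraction, `identity` says x y (U - V) = (k x y - t k′) (m⁺ - m⁻), and U - V is D (x) -
  -- D (y). No term of U - V is divisible by x y, whereas m⁺ - m⁻ vanishes at x = 0 and at y = 0.
  -- Since k begins with 1, comparing coefficients of t^n shows by induction that both differences
  -- are 0. No root of the kernel is substituted.
  module Kernel (B : Semi) (cancel : Cancels B) where
    open Tower B

    cancel₃ : Cancels R₃
    cancel₃ = series-cancels {R₂} (series-cancels {R₁} (series-cancels {B} cancel))

    module I = KernelIdentity R₃ cancel₃

    module _ (k q : Carrier) (k-0 : k 0 R₂.≈ R₂.1#) (k-x : XFree k) (k-y : YFree k)
      (kernel : k * (x * y) * q + t * (y * at-x0 q + x * at-y0 q) ≈ x * y + t * ((x + y + x * x * (y * y)) * q)) where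

      private
        a b c u m⁺ m⁻ k′ : Carrier
        a = at-y0 q
        b = at-x0 q
        c = at-xy0 q
        u = 1# + t * (x * y * q)
        m⁺ = x * a * u + y * q
        m⁻ = y * b * u + x * q
        k′ = x + y + x * x * (y * y)
        d⁺ d⁻ : Carrier → Carrier → Carrier
        d⁺ x a = k * (x * a) + (t * c + t * c)
        d⁻ x a = x + (t * a + t * a) + t * t * (x * x * (a * a))
        U V : Carrier
        U = d⁺ x a + d⁻ y b
        V = d⁺ y b + d⁻ x a

        identity : x * (y * U) + (t * (k′ * m⁺) + x * (y * (k * m⁻))) ≈ x * (y * V) + (t * (k′ * m⁻) + x * (y * (k * m⁺)))
        identity = I.kernel-identity t x y k q a b c kernel

        a-yfree : YFree a
        a-yfree n i j = B.refl
        b-xfree : XFree b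
        b-xfree n i j = B.refl
        c-yfree : YFree c
        c-yfree n zero j = B.refl
        c-yfree n (suc i) j = B.refl
        c-xfree : XFree c
        c-xfree n i j = B.refl

        d⁺x-yfree : YFree (d⁺ x a)
        d⁺x-yfree = YF.sub+ {k * (x * a)} {t * c + t * c} (YF.sub* {k} {x * a} k-y (YF.sub* {x} {a} x-yfree a-yfree)) (YF.sub+ {t * c} {t * c} tc tc)
          where
          tc : YFree (t * c)
          tc = YF.sub* {t} {c} t-yfree c-yfree
        d⁺y-xfree : XFree (d⁺ y b)
        d⁺y-xfree = XF.sub+ {k * (y * b)} {t * c + t * c} (XF.sub* {k} {y * b} k-x (XF.sub* {y} {b} y-xfree b-xfree)) (XF.sub+ {t * c} {t * c} tc tc)
          where
          tc : XFree (t * c)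
          tc = XF.sub* {t} {c} t-xfree c-xfree
        d⁻x-yfree : YFree (d⁻ x a)
        d⁻x-yfree = YF.sub+ {x + (t * a + t * a)} {t * t * (x * x * (a * a))} (YF.sub+ {x} {t * a + t * a} x-yfree (YF.sub+ {t * a} {t * a} ta ta))
          (YF.sub* {t * t} {x * x * (a * a)} (YF.sub* {t} {t} t-yfree t-yfree) (YF.sub* {x * x} {a * a} (YF.sub* {x} {x} x-yfree x-yfree) (YF.sub* {a} {a} a-yfree a-yfree)))
          where
          ta : YFree (t * a)
          ta = YF.sub* {t} {a} t-yfree a-yfree
        d⁻y-xfree : XFree (d⁻ y b)
        d⁻y-xfree = XF.sub+ {y + (t * b + t * b)} {t * t * (y * y * (b * b))} (XF.sub+ {y} {t * b + t * b} y-xfree (XF.sub+ {t * b} {t * b} tb tb))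
          (XF.sub* {t * t} {y * y * (b * b)} (XF.sub* {t} {t} t-xfree t-xfree) (XF.sub* {y * y} {b * b} (XF.sub* {y} {y} y-xfree y-xfree) (XF.sub* {b} {b} b-xfree b-xfree)))
          where
          tb : XFree (t * b)
          tb = XF.sub* {t} {b} t-xfree b-xfree

        m-x0 : ∀ n → m⁺ n 0 R₁.≈ m⁻ n 0
        m-x0 n = R₁.trans (I.m-at-x t x y q a n 0) (R₁.trans (R₁.+-congˡ (x-0 (a * u) n)) (R₁.trans (R₁.+-congʳ (R₁.trans (y-at q n 0) (R₁.sym (y-at b n 0))))
          (R₁.trans (R₁.+-congˡ (R₁.sym (x-0 (y * b * (t * (y * q)) + q) n))) (R₁.sym (form n 0)))))
          where
          form : m⁻ ≈ y * b + x * (y * b * (t * (y * q)) + q)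
          form = trans (+-congʳ (*-congˡ (I.m-swap t x y q))) (I.m-at-y t y x q b)

        m-y0 : ∀ n i → m⁺ n i 0 B.≈ m⁻ n i 0
        m-y0 n i = B.trans (I.m-at-y t x y q a n i 0) (B.trans (B.+-congˡ (y-0 (x * a * (t * (x * q)) + q) n i)) (B.trans (B.+-congʳ (same i))
          (B.trans (B.+-congˡ (B.sym (y-0 (b * (1# + t * (y * x * q))) n i))) (B.sym (form n i 0)))))
          where
          form : m⁻ ≈ x * q + y * (b * (1# + t * (y * x * q)))
          form = trans (+-congʳ (*-congˡ (I.m-swap t x y q))) (I.m-at-x t y x q b)
          same : ∀ i → (x * a) n i 0 B.≈ (x * q) n i 0
          same zero = B.trans (x-0 a n 0) (B.sym (x-0 q n 0))
          same (suc i) = B.trans (x-suc a n i 0) (B.sym (x-suc q n i 0))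

        t-agree : ∀ n f g → S₃.Agree n f g → (t * (k′ * f)) n R₂.≈ (t * (k′ * g)) n
        t-agree zero f g h = R₂.trans (t-0 (k′ * f)) (R₂.sym (t-0 (k′ * g)))
        t-agree (suc n) f g h = R₂.trans (t-suc (k′ * f) n) (R₂.trans (S₃.⊛-agree {k′} {k′} {f} {g} (suc n) (λ _ _ → R₂.refl) h n ℕₚ.≤-refl) (R₂.sym (t-suc (k′ * g) n)))

        k-agree : ∀ n f g → S₃.Agree n f g → (k * f) n R₂.+ g n R₂.≈ (k * g) n R₂.+ f n
        k-agree zero f g h = R₂.trans (R₂.+-congʳ (k0 (f 0))) (R₂.trans (R₂.+-comm (f 0) (g 0)) (R₂.+-congʳ (R₂.sym (k0 (g 0)))))
          where
          k0 : ∀ z → k 0 R₂.* z R₂.≈ z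
          k0 z = R₂.trans (R₂.*-congʳ k-0) (R₂.*-identityˡ z)
        k-agree (suc n) f g h = R₂.trans (R₂.+-congʳ (R₂.+-cong (k0 (f (suc n))) (S₃.⊛-agree {S₃.tail k} {S₃.tail k} {f} {g} (suc n) (λ _ _ → R₂.refl) h n ℕₚ.≤-refl)))
          (R₂.trans (shuffle (f (suc n)) ((S₃.tail k * g) n) (g (suc n))) (R₂.+-congʳ (R₂.+-congʳ (R₂.sym (k0 (g (suc n)))))))
          where
          k0 : ∀ z → k 0 R₂.* z R₂.≈ z
          k0 z = R₂.trans (R₂.*-congʳ k-0) (R₂.*-identityˡ z)
          shuffle : ∀ p r s → (p R₂.+ r) R₂.+ s R₂.≈ (s R₂.+ r) R₂.+ p
          shuffle p r s = R₂.trans (R₂.+-comm _ s) (R₂.trans (R₂.+-congˡ (R₂.+-comm p r)) (R₂.sym (R₂.+-assoc s r p)))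

        -- The coefficient of t^n x^(i+1) y^(j+1) of `identity`: the summand with the factor t sees
        -- only m⁺ and m⁻ below n, and k has constant term 1, so U - V = m⁺ - m⁻ at t^n x^i y^j is
        -- left.
        balance : ∀ n i j → S₃.Agree n m⁺ m⁻ → U n i j B.+ m⁻ n i j B.≈ V n i j B.+ m⁺ n i j
        balance n i j h = cancel _ _ (T⁺ B.+ (k * m⁺) n i j) (B.trans (solve 4 (λ u m t k → (u :+ m) :+ (t :+ k) := (u :+ t) :+ (k :+ m)) B.refl (U n i j) (m⁻ n i j) T⁺ ((k * m⁺) n i j))
          (B.trans (B.+-congˡ (B.sym (k-agree n m⁻ m⁺ (λ l lt → R₂.sym (h l lt)) i j)))
          (B.trans (solve 4 (λ u t k m → (u :+ t) :+ (k :+ m) := (u :+ (t :+ k)) :+ m) B.refl (U n i j) T⁺ ((k * m⁻) n i j) (m⁺ n i j))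
          (B.trans (B.+-congʳ at)
          (B.trans (solve 4 (λ v t k m → (v :+ (t :+ k)) :+ m := (v :+ m) :+ (t :+ k)) B.refl (V n i j) T⁻ ((k * m⁺) n i j) (m⁺ n i j)) (B.+-congˡ (B.+-congʳ (B.sym (ts (suc i) (suc j))))))))))
          where
          open NatSolver B
          T⁺ T⁻ : B.Carrier
          T⁺ = (t * (k′ * m⁺)) n (suc i) (suc j)
          T⁻ = (t * (k′ * m⁻)) n (suc i) (suc j)
          ts : (t * (k′ * m⁺)) n R₂.≈ (t * (k′ * m⁻)) n
          ts = t-agree n m⁺ m⁻ h
          xy : ∀ f → (x * (y * f)) n (suc i) (suc j) B.≈ f n i j
          xy f = B.trans (x-suc (y * f) n i (suc j)) (y-suc f n i j)
          at : U n i j B.+ (T⁺ B.+ (k * m⁻) n i j) B.≈ V n i j B.+ (T⁻ B.+ (k * m⁺) n i j)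
          at = B.trans (B.+-cong (B.sym (xy U)) (B.+-congˡ (B.sym (xy (k * m⁻))))) (B.trans (identity n (suc i) (suc j)) (B.+-cong (xy V) (B.+-congˡ (xy (k * m⁺)))))

        UV0 : ∀ n i j → U n (suc i) (suc j) B.≈ V n (suc i) (suc j)
        UV0 n i j = B.trans (B.+-cong (d⁺x-yfree n (suc i) j) (d⁻y-xfree n i (suc j))) (B.sym (B.+-cong (d⁺y-xfree n i (suc j)) (d⁻x-yfree n (suc i) j)))

        m-eq : ∀ n → m⁺ n R₂.≈ m⁻ n
        m-eq = <-rec (λ n → m⁺ n R₂.≈ m⁻ n) step
          where
          step : ∀ n → (∀ {l} → l < n → m⁺ l R₂.≈ m⁻ l) → m⁺ n R₂.≈ m⁻ n
          step n h zero j = m-x0 n j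
          step n h (suc i) zero = m-y0 n (suc i)
          step n h (suc i) (suc j) = cancel _ _ (U n (suc i) (suc j)) (B.sym (B.trans (B.+-comm _ _) (B.trans (balance n (suc i) (suc j) (λ l lt → h lt)) (B.trans (B.+-comm _ _) (B.+-congˡ (B.sym (UV0 n i j)))))))

        UV : ∀ n i j → U n i j B.≈ V n i j
        UV n i j = cancel _ _ (m⁺ n i j) (B.trans (B.+-congˡ (m-eq n i j)) (balance n i j (λ l _ → m-eq l)))

      -- D (x) = D (y) makes both sides free of x and y. The summand `t * c + t * c`, which cancels
      -- in the difference, is chosen so that the remaining constant term is 0.
      invariant : k * (x * a) + (t * c + t * c) ≈ x + (t * a + t * a) + t * t * (x * x * (a * a))
      invariant n i (suc j) = B.trans (d⁺x-yfree n i j) (B.sym (d⁻x-yfree n i j))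
      invariant n (suc i) zero = B.trans (B.sym (B.+-identityʳ _)) (B.trans (B.+-congˡ (B.sym (d⁻y-xfree n i 0))) (B.trans (UV n (suc i) 0) (B.trans (B.+-congʳ (d⁺y-xfree n i 0)) (B.+-identityˡ _))))
      invariant n zero zero = B.trans (B.+-congʳ (kx n)) (B.trans (B.+-identityˡ _) (B.trans (B.+-cong (ca n) (ca n)) (B.sym (B.trans (B.+-cong (B.trans (B.+-congʳ (x00 n)) (B.+-identityˡ _)) (tail0 n)) (B.+-identityʳ _)))))
        where
        x00 : ∀ n → x n 0 0 B.≈ B.0#
        x00 zero = B.refl
        x00 (suc n) = B.refl
        kx : ∀ n → (k * (x * a)) n 0 0 B.≈ B.0#
        kx n = B.trans (*-x k a n 0 0) (x-0 (k * a) n 0)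
          where
          *-x : ∀ f g → f * (x * g) ≈ x * (f * g)
          *-x f g n i = swap f x g n i
            where
            swap : ∀ f h g → f * (h * g) ≈ h * (f * g)
            swap f h g = trans (sym (*-assoc f h g)) (trans (*-congʳ (*-comm f h)) (*-assoc h f g))
        ca : ∀ n → (t * c) n 0 0 B.≈ (t * a) n 0 0
        ca zero = B.trans (t-0 c 0 0) (B.sym (t-0 a 0 0))
        ca (suc n) = B.trans (t-suc c n 0 0) (B.sym (t-suc a n 0 0))
        tail0 : ∀ n → (t * t * (x * x * (a * a))) n 0 0 B.≈ B.0#
        tail0 n = B.trans (pull n 0 0) (x-0 (t * t * (x * (a * a))) n 0)
          where
          pull : t * t * (x * x * (a * a)) ≈ x * (t * t * (x * (a * a)))
          pull = trans (*-congˡ (*-assoc x x (a * a))) (trans (sym (*-assoc (t * t) x (x * (a * a)))) (trans (*-congʳ (*-comm (t * t) x)) (*-assoc x (t * t) (x * (a * a)))))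

  kernel-form : ∀ (R : Semi) → let open CommutativeSemiring R in ∀ t x y k q a b →
    x * (y * (k * q)) + t * (y * b + x * a) ≈ x * (y * 1#) + t * (x * q + (y * q + x * (y * (x * (y * q))))) →
    k * (x * y) * q + t * (y * b + x * a) ≈ x * y + t * ((x + y + x * x * (y * y)) * q)
  kernel-form R t x y k q a b e = trans (+-congʳ (solve 4 (λ k x y q → k :* (x :* y) :* q := x :* (y :* (k :* q))) refl k x y q))
    (trans e (+-cong (*-congˡ (*-identityʳ y)) (*-congˡ (solve 3 (λ x y q → x :* q :+ (y :* q :+ x :* (y :* (x :* (y :* q)))) := (x :+ y :+ x :* x :* (y :* y)) :* q) refl x y q))))
    where
    open CommutativeSemiring R
    open NatSolver R

  -- The quadratic equation for a with x as its only catalytic variable; c stands for the value of a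
  -- at x = 0.
  Invariant : (R : Semi) → let open CommutativeSemiring R in (t x k a c : Carrier) → Set
  Invariant R t x k a c = k * (x * a) + (t * c + t * c) ≈ x + (t * a + t * a) + t * t * (x * x * (a * a))
    where open CommutativeSemiring R

  -- The parametrisation a = P (C − v C²), with m standing for −1.
  parametrisation : ∀ (R : Semi) → Cancels R → let open CommutativeSemiring R in ∀ t x k P v C m →
    k * P ≈ 1# + (v + v) → v ≈ t * (t * (t * (P * (P * P) + P * (P * P)))) → C ≈ 1# + t * (t * (x * (P * P * (C * C)))) → m + 1# ≈ 0# →
    Invariant R t x k (P * (C + m * v * (C * C))) (P * (1# + m * v))
  parametrisation R cancel t x k P v C m h₁ h₂ h₃ h₄ = cancel _ _ _ (trans (solve 7
      (λ t x k P v C m →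
        let y = t :* (t :* (x :* (P :* P :* (C :* C))))
            s = C :+ m :* v :* (C :* C)
            r = con 1 :+ m :* v
            a = P :* s
            c = P :* r
            w = con 1 :+ m :* v :* (C :+ con 1)
            l = con 1 :+ m :* v :* C
            v′ = t :* (t :* (t :* (P :* (P :* P) :+ P :* (P :* P))))
        in k :* (x :* a) :+ (t :* c :+ t :* c) :+ (x :* s :* (con 1 :+ (v :+ v)) :+ x :* (C :* C) :* w :* v′ :+ (x :* (l :* l) :* (con 1 :+ y) :+ con 2 :* t :* P :* w :* C)
             :+ (x :* (v :* v :* (C :* C) :* m :+ con 2 :* v :* C) :* con 0 :+ x :* (v :* v :* (C :* C :* C) :* m :+ v :* (C :* C)) :* (m :+ con 1)))
         := x :+ (t :* a :+ t :* a) :+ t :* t :* (x :* x :* (a :* a)) :+ (x :* s :* (k :* P) :+ x :* (C :* C) :* w :* v :+ (x :* (l :* l) :* C :+ con 2 :* t :* P :* w :* (con 1 :+ y))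
             :+ (x :* (v :* v :* (C :* C) :* m :+ con 2 :* v :* C) :* (m :+ con 1) :+ x :* (v :* v :* (C :* C :* C) :* m :+ v :* (C :* C)) :* con 0)))
      refl t x k P v C m)
      (+-congˡ (+-cong (+-cong (+-cong (*-congˡ h₁) (*-congˡ h₂)) (+-cong (*-congˡ h₃) (*-congˡ (sym h₃)))) (+-cong (*-congˡ h₄) (*-congˡ (sym h₄))))))
    where
    open CommutativeSemiring R
    open NatSolver R

  module _ {R R′ : Semi} (h : Hom R R′) where
    private
      module A = CommutativeSemiring R
    open CommutativeSemiring R′ hiding (zero)

    hom-invariant : ∀ {t x k a c t′ x′} → ⟦ h ⟧ t ≈ t′ → ⟦ h ⟧ x ≈ x′ → Invariant R t x k a c → Invariant R′ t′ x′ (⟦ h ⟧ k) (⟦ h ⟧ a) (⟦ h ⟧ c)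
    hom-invariant {t} {x} {k} {a} {c} {t′} {x′} et ex e = trans (sym left) (trans (hcong h e) right)
      where
      mul : ∀ {p q p′ q′} → ⟦ h ⟧ p ≈ p′ → ⟦ h ⟧ q ≈ q′ → ⟦ h ⟧ (p A.* q) ≈ p′ * q′
      mul e f = trans (h* h _ _) (*-cong e f)
      add : ∀ {p q p′ q′} → ⟦ h ⟧ p ≈ p′ → ⟦ h ⟧ q ≈ q′ → ⟦ h ⟧ (p A.+ q) ≈ p′ + q′
      add e f = trans (h+ h _ _) (+-cong e f)
      left : ⟦ h ⟧ (k A.* (x A.* a) A.+ (t A.* c A.+ t A.* c)) ≈ ⟦ h ⟧ k * (x′ * ⟦ h ⟧ a) + (t′ * ⟦ h ⟧ c + t′ * ⟦ h ⟧ c)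
      left = add (mul refl (mul ex refl)) (add (mul et refl) (mul et refl))
      right : ⟦ h ⟧ (x A.+ (t A.* a A.+ t A.* a) A.+ t A.* t A.* (x A.* x A.* (a A.* a))) ≈ x′ + (t′ * ⟦ h ⟧ a + t′ * ⟦ h ⟧ a) + t′ * t′ * (x′ * x′ * (⟦ h ⟧ a * ⟦ h ⟧ a))
      right = add (add ex (add (mul et refl) (mul et refl))) (mul (mul et et) (mul (mul ex ex) (mul refl refl)))

  -- Uniqueness of the solution, and the explicit solution

  module Uniqueness (B : Semi) (cancel : Cancels B) where
    open Tower B

    cancel₂ : Cancels R₂
    cancel₂ = series-cancels {R₁} (series-cancels {B} cancel)

    refl-agree : ∀ {f} n → S₃.Agree n f f
    refl-agree n m lt = R₂.refl

    t-agree : ∀ {f f′} n → S₃.Agree n f f′ → S₃.Agree (suc n) (t * f) (t * f′)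
    t-agree {f} {f′} n p zero lt = R₂.trans (t-0 f) (R₂.sym (t-0 f′))
    t-agree {f} {f′} n p (suc m) (s≤s lt) = R₂.trans (t-suc f m) (R₂.trans (p m lt) (R₂.sym (t-suc f′ m)))

    at-x0-agree : ∀ {f f′} n → S₃.Agree n f f′ → S₃.Agree n (at-x0 f) (at-x0 f′)
    at-x0-agree n p m lt zero j = p m lt 0 j
    at-x0-agree n p m lt (suc i) j = B.refl

    -- Apart from k x a, every summand that involves a carries a factor t. Hence the coefficient of
    -- t^n in k a is determined by the coefficients of a below n.
    below-product : ∀ {k a k′ a′} n → Invariant R₃ t x k a (at-x0 a) → Invariant R₃ t x k′ a′ (at-x0 a′) → S₃.Agree n a a′ → (k * a) n R₂.≈ (k′ * a′) n
    below-product {k} {a} {k′} {a′} n e e′ p i = R₁.trans (R₁.sym (x-suc (k * a) n i)) (R₁.trans (go (suc i)) (x-suc (k′ * a′) n i))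
      where
      pull : ∀ k a → k * (x * a) ≈ x * (k * a)
      pull k a = trans (sym (*-assoc k x a)) (trans (*-congʳ (*-comm k x)) (*-assoc x k a))
      c c′ : Carrier
      c = at-x0 a
      c′ = at-x0 a′
      w-agree : (t * c + t * c) n R₂.≈ (t * c′ + t * c′) n
      w-agree = R₂.+-cong (t-agree n (at-x0-agree n p) n ℕₚ.≤-refl) (t-agree n (at-x0-agree n p) n ℕₚ.≤-refl)
      z-agree : (x + (t * a + t * a) + t * t * (x * x * (a * a))) n R₂.≈ (x + (t * a′ + t * a′) + t * t * (x * x * (a′ * a′))) n
      z-agree = R₂.+-cong (R₂.+-cong R₂.refl (R₂.+-cong (ta n ℕₚ.≤-refl) (ta n ℕₚ.≤-refl)))
        (R₂.trans (*-assoc t t (x * x * (a * a)) n) (R₂.trans (t-agree n (λ l lt → t-agree l (sq l (ℕₚ.<⇒≤ lt)) l ℕₚ.≤-refl) n ℕₚ.≤-refl) (R₂.sym (*-assoc t t (x * x * (a′ * a′)) n))))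
        where
        ta : S₃.Agree (suc n) (t * a) (t * a′)
        ta = t-agree n p
        sq : ∀ l → l ≤ n → S₃.Agree l (x * x * (a * a)) (x * x * (a′ * a′))
        sq l le = S₃.⊛-agree l (refl-agree l) (S₃.⊛-agree l (λ m lt → p m (ℕₚ.<-≤-trans lt le)) (λ m lt → p m (ℕₚ.<-≤-trans lt le)))
      go : (x * (k * a)) n R₂.≈ (x * (k′ * a′)) n
      go = cancel₂ _ _ ((t * c + t * c) n) (R₂.trans (R₂.+-congʳ (sym (pull k a) n)) (R₂.trans (e n) (R₂.trans z-agree (R₂.trans (R₂.sym (e′ n))
        (R₂.trans (R₂.+-congʳ (pull k′ a′ n)) (R₂.+-congˡ (R₂.sym w-agree)))))))

    unique-a : ∀ {k k′ a a′} → k ≈ k′ → k 0 R₂.≈ R₂.1# → Invariant R₃ t x k a (at-x0 a) → Invariant R₃ t x k′ a′ (at-x0 a′) → a ≈ a′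
    unique-a {k} {k′} {a} {a′} ek k0 e e′ = <-rec (λ n → a n R₂.≈ a′ n) (λ n ih → go n (λ l lt → ih lt))
      where
      go : ∀ n → S₃.Agree n a a′ → a n R₂.≈ a′ n
      go n p = top n p (R₂.trans (below-product n e e′ p) (sym (*-congʳ ek) n))
        where
        k1 : ∀ z → k 0 R₂.* z R₂.≈ z
        k1 z = R₂.trans (R₂.*-congʳ k0) (R₂.*-identityˡ z)
        top : ∀ n → S₃.Agree n a a′ → (k * a) n R₂.≈ (k * a′) n → a n R₂.≈ a′ n
        top zero p q = R₂.trans (R₂.sym (k1 (a 0))) (R₂.trans q (k1 (a′ 0)))
        top (suc n) p q = cancel₂ _ _ _ (R₂.trans (R₂.+-congʳ (R₂.sym (k1 (a (suc n))))) (R₂.trans q (R₂.+-cong (k1 (a′ (suc n)))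
          (R₂.sym (S₃.⊛-agree {S₃.tail k} (suc n) (λ _ _ → R₂.refl) p n ℕₚ.≤-refl)))))

    -- Here k is unknown as well, but it is free of x and a is 1 at x = 0. At each power of t the
    -- value of k a at x = 0 yields k, and then the whole of k a yields a.
    unique-k : ∀ {k k′ a a′} → XFree k → XFree k′ → at-x0 a ≈ 1# → at-x0 a′ ≈ 1# → k 0 R₂.≈ R₂.1# → k′ 0 R₂.≈ R₂.1# →
      Invariant R₃ t x k a (at-x0 a) → Invariant R₃ t x k′ a′ (at-x0 a′) → k ≈ k′
    unique-k {k} {k′} {a} {a′} kx kx′ a0 a0′ k0 k0′ e e′ n = proj₁ (<-rec (λ n → (k n R₂.≈ k′ n) × (a n R₂.≈ a′ n)) step n)
      where
      E : Hom R₃ (Series.psSemiring R₁)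
      E = map-hom (eval-hom R₁)
      ka0 : ∀ {k a} → at-x0 a ≈ 1# → ∀ n → (k * a) n 0 R₁.≈ k n 0
      ka0 {k} {a} a0 n = R₁.trans (h* E k a n) (R₁.trans (P.*-congˡ {⟦ E ⟧ k} a1 n) (P.*-identityʳ (⟦ E ⟧ k) n))
        where
        module P = CommutativeSemiring (Series.psSemiring R₁)
        a1 : ⟦ E ⟧ a P.≈ P.1#
        a1 zero = a0 0 0
        a1 (suc n) = a0 (suc n) 0
      k1 : ∀ z → k 0 R₂.* z R₂.≈ z
      k1 z = R₂.trans (R₂.*-congʳ k0) (R₂.*-identityˡ z)
      k1′ : ∀ z → k′ 0 R₂.* z R₂.≈ z
      k1′ z = R₂.trans (R₂.*-congʳ k0′) (R₂.*-identityˡ z)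
      step : ∀ n → (∀ {l} → l < n → (k l R₂.≈ k′ l) × (a l R₂.≈ a′ l)) → (k n R₂.≈ k′ n) × (a n R₂.≈ a′ n)
      step n ih = kn , top n (λ l lt → proj₂ (ih lt)) (λ l lt → [ (λ l< → proj₁ (ih l<)) , (λ { ≡.refl → kn }) ]′ (ℕₚ.m<1+n⇒m<n∨m≡n lt)) prod
        where
        prod : (k * a) n R₂.≈ (k′ * a′) n
        prod = below-product n e e′ (λ l lt → proj₂ (ih lt))
        kn : k n R₂.≈ k′ n
        kn zero = R₁.trans (R₁.sym (ka0 {k} {a} a0 n)) (R₁.trans (prod 0) (ka0 {k′} {a′} a0′ n))
        kn (suc i) = R₁.trans (kx n i) (R₁.sym (kx′ n i))
        top : ∀ n → S₃.Agree n a a′ → S₃.Agree (suc n) k k′ → (k * a) n R₂.≈ (k′ * a′) n → a n R₂.≈ a′ n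
        top zero p r q = R₂.trans (R₂.sym (k1 (a 0))) (R₂.trans q (k1′ (a′ 0)))
        top (suc n) p r q = cancel₂ _ _ _ (R₂.trans (R₂.+-congʳ (R₂.sym (k1 (a (suc n))))) (R₂.trans q (R₂.+-cong (k1′ (a′ (suc n)))
          (R₂.sym (S₃.⊛-agree {S₃.tail k} {S₃.tail k′} (suc n) (λ l lt → r (suc l) (s≤s lt)) p n ℕₚ.≤-refl)))))

    at-x0-split : ∀ {a c h} → XFree c → a ≈ c + x * h → at-x0 a ≈ c
    at-x0-split {a} {c} {h} cx e n zero = R₁.trans (e n 0) (R₁.trans (R₁.+-congˡ (x-0 h n)) (R₁.+-identityʳ (c n 0)))
    at-x0-split {a} {c} {h} cx e n (suc i) = R₁.sym (cx n i)

    -- `C` is the Catalan generating function at t² x P². It is 1 at x = 0, where the solution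
    -- therefore becomes P (1 - v); this is the value that both counts use.
    module Explicit (k P v m : Carrier) (Px : XFree P) (vx : XFree v) (mx : XFree m)
      (h₁ : k * P ≈ 1# + (v + v)) (h₂ : v ≈ t * (t * (t * (P * (P * P) + P * (P * P))))) (h₄ : m + 1# ≈ 0#) where

      G : Carrier → Carrier
      G f = t * (x * (P * P * (f * f)))

      G-ok : ∀ n f h → S₃.Agree n f h → S₃.Agree n (G f) (G h)
      G-ok n f h p = S₃.⊛-agree n (refl-agree n) (S₃.⊛-agree n (refl-agree n) (S₃.⊛-agree n (refl-agree n) (S₃.⊛-agree n p p)))

      module Cat = S₃.Fixpoint R₂.1# G G-ok

      C : Carrier
      C = Cat.fix

      a c : Carrier
      a = P * (C + m * v * (C * C))
      c = P * (1# + m * v)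

      c-xfree : XFree c
      c-xfree = XF.sub* {P} {1# + m * v} Px (XF.sub+ {1#} {m * v} one (XF.sub* {m} {v} mx vx))
        where
        one : XFree 1#
        one zero i j = B.refl
        one (suc n) i j = B.refl

      C-split : ∃ λ h → C ≈ 1# + x * h
      C-split = t * (t * (P * P * (C * C))) , trans Cat.fix-eq (+-congˡ (trans (*-congˡ (swap t x _)) (swap t x _)))
        where
        swap : ∀ p q r → p * (q * r) ≈ q * (p * r)
        swap p q r = trans (sym (*-assoc p q r)) (trans (*-congʳ (*-comm p q)) (*-assoc q p r))

      at-x0-a : at-x0 a ≈ c
      at-x0-a = at-x0-split {a} {c} {P * (h + m * v * (h + h + x * (h * h)))} c-xfree (trans (*-congˡ (+-cong eC (*-congˡ (*-cong eC eC))))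
        (solve 5 (λ P m v x h → P :* (con 1 :+ x :* h :+ m :* v :* ((con 1 :+ x :* h) :* (con 1 :+ x :* h))) := P :* (con 1 :+ m :* v) :+ x :* (P :* (h :+ m :* v :* (h :+ h :+ x :* (h :* h))))) refl P m v x h))
        where
        open NatSolver R₃
        h = proj₁ C-split
        eC = proj₂ C-split

      explicit : Invariant R₃ t x k a (at-x0 a)
      explicit = trans (+-congˡ (+-cong (*-congˡ at-x0-a) (*-congˡ at-x0-a))) (parametrisation R₃ (series-cancels {R₂} cancel₂) t x k P v C m h₁ h₂ Cat.fix-eq h₄)

open import Defs
open import Algebra.Bundles using (CommutativeSemiring; CommutativeRing)
open import Algebra.Properties.Group using (∙-cancelʳ)
open import Data.Bool using (Bool; true; false; not; if_then_else_; _xor_)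
open import Data.Bool.Properties using (not-involutive)
open import Data.Empty using (⊥; ⊥-elim)
open import Data.Fin as Fin using (Fin; zero; suc; toℕ; punchIn; punchOut; inject₁; fromℕ; _↑ˡ_; _↑ʳ_; splitAt)
import Data.Fin.Properties as Finₚ
open import Data.Fin.Properties using (any?; all?)
open import Data.Fin.Relation.Unary.Top using (view; ‵fromℕ; ‵inject₁; view-fromℕ; view-inject₁)
import Data.Integer as ℤ
import Data.Integer.Properties as ℤₚ
open import Data.List using (List; []; _∷_; length; _++_; concatMap; map; replicate)
open import Data.List.Membership.Propositional using (_∈_; lose)
import Data.List.Membership.Propositional.Properties as Memₚ
import Data.List.Properties as Listₚ
import Data.List.Relation.Unary.All as All′
import Data.List.Relation.Unary.All.Properties as Allₚ
open import Data.List.Relation.Unary.AllPairs as AllPairs using (AllPairs)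
import Data.List.Relation.Unary.AllPairs.Properties as AllPairsₚ
open import Data.List.Relation.Unary.Any using (Any; here; there)
open import Data.List.Relation.Unary.Unique.Propositional using (Unique)
import Data.List.Relation.Unary.Unique.Propositional.Properties as Uniqueₚ
open import Data.Maybe as Maybe using (Maybe; just; nothing)
open import Data.Nat as ℕ using (ℕ; zero; suc; _+_; _*_; _^_; _≤_; _<_; z≤n; s≤s)
open import Data.Nat.Divisibility using (_∣_; divides)
open import Data.Nat.ListAction using (sum)
import Data.Nat.Properties as ℕₚ
open import Data.Nat.Tactic.RingSolver using (solve-∀)
open import Data.Product using (Σ; ∃; _×_; _,_; proj₁; proj₂)
open import Data.Sum using (_⊎_; inj₁; inj₂; [_,_]′; swap) renaming (map to map⊎)
import Data.Sum.Properties as Sumₚ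
open import Data.Unit using (⊤; tt)
open import Function.Bundles using (mk↔ₛ′)
open import Relation.Binary.Construct.Closure.Equivalence using (EqClosure)
import Relation.Binary.Construct.Closure.Equivalence as Eq
open import Relation.Binary.Construct.Closure.ReflexiveTransitive using (ε; _◅_; _◅◅_)
open import Relation.Binary.Construct.Closure.Symmetric using (fwd; bwd)
open import Relation.Binary.PropositionalEquality using (_≡_; _≢_; refl; sym; trans; cong; cong₂; subst; module ≡-Reasoning)
open import Relation.Nullary using (¬_; Dec; yes; no; _×-dec_; _⊎-dec_; ¬?; map′)
open import Algebra.Properties.CommutativeMonoid.Sum ℕₚ.+-0-commutativeMonoid using (sum-cong-≗; ∑-distrib-+; ∑-comm; sum-permute) renaming (sum to ∑F)

-- Counting equivalence classes

E-sym : {A : Set} {R : A → A → Set} {x y : A} → EqClosure R x y → EqClosure R y x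
E-sym = Eq.symmetric _

E-≡ : {A : Set} {R : A → A → Set} {x y : A} → x ≡ y → EqClosure R x y
E-≡ refl = ε

E-bind : {A B : Set} {R : A → A → Set} {S : B → B → Set} (f : A → B) →
  (∀ {x y} → R x y → EqClosure S (f x) (f y)) → ∀ {x y} → EqClosure R x y → EqClosure S (f x) (f y)
E-bind {S = S} f h = Eq.gfold (Eq.isEquivalence S) f h

E-const : {A B : Set} {R : A → A → Set} (f : A → B) →
  (∀ {x y} → R x y → f x ≡ f y) → ∀ {x y} → EqClosure R x y → f x ≡ f y
E-const f h ε = refl
E-const f h (fwd r ◅ rs) = trans (h r) (E-const f h rs)
E-const f h (bwd r ◅ rs) = trans (sym (h r)) (E-const f h rs)

Graph : {A : Set} → (A → A) → A → A → Set
Graph f x y = f x ≡ y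

step : {A : Set} {f : A → A} (x : A) → EqClosure (Graph f) x (f x)
step x = Eq.return refl

-- A quotient map onto `Fin N` with a section. Having the label as a function makes it possible to
-- follow the component of each boundary edge through the gluings.
record Classes {A : Set} (R : A → A → Set) (N : ℕ) : Set where
  field
    lab      : A → Fin N
    rep      : Fin N → A
    sound    : ∀ {x y} → R x y → lab x ≡ lab y
    complete : ∀ {x y} → lab x ≡ lab y → EqClosure R x y
    lab-rep  : ∀ i → lab (rep i) ≡ i

  soundE : ∀ {x y} → EqClosure R x y → lab x ≡ lab y
  soundE = E-const lab sound

open Classes public

classes-≤ : {A : Set} {R : A → A → Set} {M N : ℕ} → Classes R M → Classes R N → M ≤ N
classes-≤ c d = Finₚ.injective⇒≤ {f = λ i → lab d (rep c i)} λ {i} {j} eq →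
  trans (sym (lab-rep c i)) (trans (soundE c (complete d eq)) (lab-rep c j))

classes-unique : {A : Set} {R : A → A → Set} {M N : ℕ} → Classes R M → Classes R N → M ≡ N
classes-unique c d = ℕₚ.≤-antisym (classes-≤ c d) (classes-≤ d c)

-- Made for gluings: B contains a copy of A, and every element of B is joined to an old element or
-- belongs to one of `c` new classes; `r` says which.
transfer : {A B : Set} {R : A → A → Set} {S : B → B → Set} {N c : ℕ}
  (r : B → A ⊎ Fin c) (e : A → B) (new : Fin c → B) →
  (∀ {x y} → R x y → EqClosure S (e x) (e y)) →
  (∀ {x y} → S x y → (∃ λ a → ∃ λ b → r x ≡ inj₁ a × r y ≡ inj₁ b × EqClosure R a b) ⊎ (r x ≡ r y)) →
  (∀ y → EqClosure S ([ e , new ]′ (r y)) y) →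
  (∀ x → r (e x) ≡ inj₁ x) → (∀ i → r (new i) ≡ inj₂ i) →
  Classes R N → Classes S (c + N)
transfer {A} {B} {R} {S} {N} {c} r e new up down ir re rn C = record
  { lab = λ y → L (r y)
  ; rep = λ i → [ (λ j → new j) , (λ j → e (rep C j)) ]′ (splitAt c i)
  ; sound = λ s → snd s (down s)
  ; complete = λ {x} {y} eq → E-sym (ir x) ◅◅ (cmp (r x) (r y) eq ◅◅ ir y)
  ; lab-rep = lr }
  where
  L : A ⊎ Fin c → Fin (c + N)
  L (inj₁ a) = c ↑ʳ lab C a
  L (inj₂ j) = j ↑ˡ N
  snd : ∀ {x y} → S x y → (∃ λ a → ∃ λ b → r x ≡ inj₁ a × r y ≡ inj₁ b × EqClosure R a b) ⊎ (r x ≡ r y) → L (r x) ≡ L (r y)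
  snd s (inj₁ (a , b , p , q , ab)) rewrite p | q = cong (c ↑ʳ_) (soundE C ab)
  snd s (inj₂ eq) = cong L eq
  cmp : ∀ u v → L u ≡ L v → EqClosure S ([ e , new ]′ u) ([ e , new ]′ v)
  cmp (inj₁ a) (inj₁ b) eq = E-bind e up (complete C (Finₚ.↑ʳ-injective c _ _ eq))
  cmp (inj₂ a) (inj₂ b) eq with Finₚ.↑ˡ-injective N _ _ eq
  ... | refl = ε
  cmp (inj₁ a) (inj₂ b) eq with trans (sym (Finₚ.splitAt-↑ʳ c N (lab C a))) (trans (cong (splitAt c) eq) (Finₚ.splitAt-↑ˡ c b N))
  ... | ()
  cmp (inj₂ a) (inj₁ b) eq with trans (sym (Finₚ.splitAt-↑ˡ c a N)) (trans (cong (splitAt c) eq) (Finₚ.splitAt-↑ʳ c N (lab C b)))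
  ... | ()
  lr : ∀ i → L (r ([ (λ j → new j) , (λ j → e (rep C j)) ]′ (splitAt c i))) ≡ i
  lr i with splitAt c i in eq
  ... | inj₁ j rewrite rn j = Finₚ.splitAt⁻¹-↑ˡ eq
  ... | inj₂ j rewrite re (rep C j) | lab-rep C j = Finₚ.splitAt⁻¹-↑ʳ eq

transferGraph : {A B : Set} {f : A → A} {g : B → B} {N c : ℕ}
  (r : B → A ⊎ Fin c) (e : A → B) (new : Fin c → B) →
  (∀ x → r (g (e x)) ≡ inj₁ (f x)) →
  (∀ y → (∃ λ x → y ≡ e x) ⊎ (r (g y) ≡ r y)) →
  (∀ y → EqClosure (Graph g) ([ e , new ]′ (r y)) y) →
  (∀ x → r (e x) ≡ inj₁ x) → (∀ i → r (new i) ≡ inj₂ i) →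
  Classes (Graph f) N → Classes (Graph g) (c + N)
transferGraph {A} {B} {f} {g} {N} {c} r e new rge old ir re rn =
  transfer r e new up down ir re rn
  where
  up : ∀ {x y} → f x ≡ y → EqClosure (Graph g) (e x) (e y)
  up {x} refl = step (e x) ◅◅ E-sym (subst (λ u → EqClosure (Graph g) ([ e , new ]′ u) (g (e x))) (rge x) (ir (g (e x))))
  down : ∀ {x y} → g x ≡ y → (∃ λ a → ∃ λ b → r x ≡ inj₁ a × r y ≡ inj₁ b × EqClosure (Graph f) a b) ⊎ (r x ≡ r y)
  down {y} refl with old y
  ... | inj₁ (x , refl) = inj₁ (x , f x , re x , rge x , step x)
  ... | inj₂ eq = inj₂ (sym eq)

transfer-≅ : {A B : Set} {R : A → A → Set} {S : B → B → Set} {N : ℕ} (r : B → A) (e : A → B) →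
  (∀ {x y} → R x y → EqClosure S (e x) (e y)) → (∀ {x y} → S x y → EqClosure R (r x) (r y)) →
  (∀ y → EqClosure S (e (r y)) y) → (∀ x → EqClosure R (r (e x)) x) → Classes R N → Classes S N
transfer-≅ r e up down er re C = record
  { lab = λ y → lab C (r y)
  ; rep = λ i → e (rep C i)
  ; sound = λ s → soundE C (down s)
  ; complete = λ {x} {y} eq → E-sym (er x) ◅◅ (E-bind e up (complete C eq) ◅◅ er y)
  ; lab-rep = λ i → trans (soundE C (re (rep C i))) (lab-rep C i) }

transferGraph-≅ : {A B : Set} {f : A → A} {g : B → B} {N : ℕ} (r : B → A) (e : A → B) →
  (∀ x → g (e x) ≡ e (f x)) → (∀ y → e (r y) ≡ y) → (∀ x → r (e x) ≡ x) →
  Classes (Graph f) N → Classes (Graph g) N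
transferGraph-≅ {f = f} {g} r e ge er re = transfer-≅ r e
  (λ {x} {y} p → Eq.return (trans (ge x) (cong e p)))
  (λ {x} {y} p → Eq.return (trans (sym (re _)) (trans (cong r (sym (ge (r x)))) (cong r (trans (cong g (er x)) p)))))
  (λ y → E-≡ (er y)) (λ x → E-≡ (re x))

collapse : ∀ {N} {i j : Fin (suc N)} → i ≢ j → Fin (suc N) → Fin N
collapse {i = i} i≢j k with i Finₚ.≟ k
... | yes _ = punchOut i≢j
... | no i≢k = punchOut i≢k

collapse-i : ∀ {N} {i j : Fin (suc N)} (i≢j : i ≢ j) → collapse i≢j i ≡ collapse i≢j j
collapse-i {i = i} {j} i≢j with i Finₚ.≟ i | i Finₚ.≟ j
... | yes _ | no _ = Finₚ.punchOut-cong i refl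
... | no n | _ = ⊥-elim (n refl)
... | _ | yes p = ⊥-elim (i≢j p)

collapse-inv : ∀ {N} {i j : Fin (suc N)} (i≢j : i ≢ j) (k l : Fin (suc N)) → collapse i≢j k ≡ collapse i≢j l →
  k ≡ l ⊎ ((k ≡ i × l ≡ j) ⊎ (k ≡ j × l ≡ i))
collapse-inv {i = i} i≢j k l eq with i Finₚ.≟ k | i Finₚ.≟ l
... | yes p | yes q = inj₁ (trans (sym p) q)
... | yes p | no q = inj₂ (inj₁ (sym p , sym (Finₚ.punchOut-injective i≢j q eq)))
... | no p | yes q = inj₂ (inj₂ (Finₚ.punchOut-injective p i≢j eq , sym q))
... | no p | no q = inj₁ (Finₚ.punchOut-injective p q eq)

collapse-punchIn : ∀ {N} {i j : Fin (suc N)} (i≢j : i ≢ j) k → collapse i≢j (punchIn i k) ≡ k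
collapse-punchIn {i = i} i≢j k with i Finₚ.≟ punchIn i k
... | yes p = ⊥-elim (Finₚ.punchInᵢ≢i i k (sym p))
... | no p = trans (Finₚ.punchOut-cong i refl) (Finₚ.punchOut-punchIn i)

merge : {A : Set} {R S : A → A → Set} {N : ℕ} {a b : A} (C : Classes R (suc N)) → (n : lab C a ≢ lab C b) →
  (∀ {x y} → R x y → S x y) → S a b → (∀ {x y} → S x y → EqClosure R x y ⊎ (x ≡ a × y ≡ b)) →
  Σ (Classes S N) λ C′ → ∀ x → lab C′ x ≡ collapse n (lab C x)
merge {A} {R} {S} {N} {a} {b} C n R⊆S sab inv = record
  { lab = λ x → collapse n (lab C x)
  ; rep = λ i → rep C (punchIn (lab C a) i)
  ; sound = snd
  ; complete = λ {x} {y} eq → cmp (collapse-inv n _ _ eq)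
  ; lab-rep = λ i → trans (cong (collapse n) (lab-rep C _)) (collapse-punchIn n i) } , λ _ → refl
  where
  snd : ∀ {x y} → S x y → collapse n (lab C x) ≡ collapse n (lab C y)
  snd s with inv s
  ... | inj₁ r = cong (collapse n) (soundE C r)
  ... | inj₂ (refl , refl) = collapse-i n
  up : ∀ {x y} → EqClosure R x y → EqClosure S x y
  up = Eq.map R⊆S
  cmp : ∀ {x y} → lab C x ≡ lab C y ⊎ ((lab C x ≡ lab C a × lab C y ≡ lab C b) ⊎ (lab C x ≡ lab C b × lab C y ≡ lab C a)) → EqClosure S x y
  cmp (inj₁ eq) = up (complete C eq)
  cmp (inj₂ (inj₁ (p , q))) = up (complete C p) ◅◅ (Eq.return sab ◅◅ E-sym (up (complete C q)))
  cmp (inj₂ (inj₂ (p , q))) = up (complete C p) ◅◅ (E-sym (Eq.return sab) ◅◅ E-sym (up (complete C q)))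

-- The pairs x, f x enter one at a time, each merging two classes or changing nothing. This supplies
-- the faces of a web from which a piece has been taken off.
orbits-exist : ∀ {n} (f : Fin n → Fin n) → ∃ λ N → Classes (Graph f) N
orbits-exist {n} f with go n ℕₚ.≤-refl
  where
  Part : ℕ → Fin n → Fin n → Set
  Part k x y = toℕ x < k × f x ≡ y
  go : ∀ k → k ≤ n → ∃ λ N → Classes (Part k) N
  go zero _ = n , record { lab = λ x → x ; rep = λ x → x ; sound = λ () ; complete = E-≡ ; lab-rep = λ _ → refl }
  go (suc k) k<n with go k (ℕₚ.<⇒≤ k<n)
  ... | N , C = ext N C
    where
    a : Fin n
    a = Fin.fromℕ< k<n
    a≡ : toℕ a ≡ k
    a≡ = Finₚ.toℕ-fromℕ< k<n
    split : ∀ {x y} → Part (suc k) x y → EqClosure (Part k) x y ⊎ (x ≡ a × y ≡ f a)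
    split {x} (s≤s p , refl) with ℕₚ.m≤n⇒m<n∨m≡n p
    ... | inj₁ q = inj₁ (Eq.return (q , refl))
    ... | inj₂ q with Finₚ.toℕ-injective (trans q (sym a≡))
    ... | refl = inj₂ (refl , refl)
    sab : Part (suc k) a (f a)
    sab = s≤s (ℕₚ.≤-reflexive a≡) , refl
    inc : ∀ {x y} → Part k x y → Part (suc k) x y
    inc (p , q) = ℕₚ.m≤n⇒m≤1+n p , q
    ext : ∀ N → Classes (Part k) N → ∃ λ M → Classes (Part (suc k)) M
    ext zero C with lab C a
    ... | ()
    ext (suc N) C with lab C a Finₚ.≟ lab C (f a)
    ... | no n = N , proj₁ (merge C n inc sab split)
    ... | yes eq = suc N , record
      { lab = lab C ; rep = rep C
      ; sound = λ s → snd (split s)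
      ; complete = λ e → Eq.map inc (complete C e)
      ; lab-rep = lab-rep C }
      where
      snd : ∀ {x y} → EqClosure (Part k) x y ⊎ (x ≡ a × y ≡ f a) → lab C x ≡ lab C y
      snd (inj₁ r) = soundE C r
      snd (inj₂ (refl , refl)) = eq
... | N , C = N , record
  { lab = lab C ; rep = rep C
  ; sound = λ {x} e → sound C (Finₚ.toℕ<n x , e)
  ; complete = λ e → Eq.map proj₂ (complete C e)
  ; lab-rep = lab-rep C }

-- Webs as dessins

next : ∀ {m} → Fin m → Fin m
next {suc m} i with view i
... | ‵fromℕ = zero
... | ‵inject₁ j = suc j

prev-next : ∀ {m} (i : Fin m) → prev (next i) ≡ i
prev-next {suc m} i with view i
... | ‵fromℕ = refl
... | ‵inject₁ j = refl

next-prev : ∀ {m} (i : Fin m) → next (prev i) ≡ i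
next-prev {suc m} zero rewrite view-fromℕ m = refl
next-prev {suc m} (suc i) rewrite view-inject₁ i = refl

-- Edge set: the edges at the boundary, then those at internal white vertices.
-- τ rotates around the black vertices, ρ around the internal white ones, and
-- the whole boundary is rotated by prev as around a single white hub vertex.
record Dessin (m : ℕ) : Set where
  constructor dessin
  field
    s : ℕ
    τ : Fin m ⊎ Fin s → Fin m ⊎ Fin s
    ρ : Fin s → Fin s

open Dessin public

Edge : ∀ {m} → Dessin m → Set
Edge {m} X = Fin m ⊎ Fin (s X)

hubρ : ∀ {m} (X : Dessin m) → Edge X → Edge X
hubρ X = map⊎ prev (ρ X)

-- The face permutation on edges, two sides of the web at a time: past a black vertex, then past a
-- white one. The boundary vertices act as one hub, so each gap between neighbouring boundary edges
-- is a face too.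
ψ : ∀ {m} (X : Dessin m) → Edge X → Edge X
ψ X x = hubρ X (τ X x)

record Cubic {m} (X : Dessin m) : Set where
  field
    τ³ : ∀ x → τ X (τ X (τ X x)) ≡ x
    τ≢ : ∀ x → τ X x ≢ x
    ρ³ : ∀ x → ρ X (ρ X (ρ X x)) ≡ x
    ρ≢ : ∀ x → ρ X x ≢ x

open Cubic public

-- Connectivity of the web itself; `HubLink` is that of the capped map, where the hub also joins the
-- boundary edges.
data Link {m} (X : Dessin m) : Edge X → Edge X → Set where
  lτ : ∀ x → Link X x (τ X x)
  lρ : ∀ u → Link X (inj₂ u) (inj₂ (ρ X u))

data HubLink {m} (X : Dessin m) : Edge X → Edge X → Set where
  hτ : ∀ x → HubLink X x (τ X x)
  hρ : ∀ x → HubLink X x (hubρ X x)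

-- A walk along a face, one black vertex per step, defined as long as it does not reach the
-- boundary.
data Run {m} (X : Dessin m) : Edge X → ℕ → Edge X → Set where
  here  : ∀ {x} → Run X x 0 x
  there : ∀ {x u n y} → τ X x ≡ inj₂ u → Run X (inj₂ (ρ X u)) n y → Run X x (suc n) y

odd : ℕ → Bool
odd zero = false
odd (suc n) = not (odd n)

-- A shortest closed walk of ℓ steps bounds a face with 2 ℓ sides, and 2 ℓ is at least 6 and no
-- multiple of 4 exactly when ℓ is odd and at least 3.
Kr : ∀ {m} → Dessin m → Set
Kr X = ∀ x ℓ → 1 ≤ ℓ → Run X x ℓ x → (∀ j → 1 ≤ j → j < ℓ → ¬ Run X x j x) → (3 ≤ ℓ) × odd ℓ ≡ true

-- The walk passes j + 1 black vertices, the last of which carries the boundary edge c.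
Arr : ∀ {m} (X : Dessin m) → Edge X → ℕ → Fin m → Set
Arr X x j c = ∃ λ y → Run X x j y × τ X y ≡ inj₁ c

run-det : ∀ {m} {X : Dessin m} {x n y z} → Run X x n y → Run X x n z → y ≡ z
run-det here here = refl
run-det {X = X} (there p r) (there q r′) with trans (sym p) q
... | refl = run-det {X = X} r r′

run-++ : ∀ {m} {X : Dessin m} {x n y k z} → Run X x n y → Run X y k z → Run X x (n + k) z
run-++ here r = r
run-++ (there p r) r′ = there p (run-++ r r′)

run-snoc : ∀ {m} {X : Dessin m} {x n y u} → Run X x n y → τ X y ≡ inj₂ u → Run X x (suc n) (inj₂ (ρ X u))
run-snoc here p = there p here
run-snoc (there q r) p = there q (run-snoc r p)

run-prefix : ∀ {m} {X : Dessin m} {x n y} k → k ≤ n → Run X x n y → ∃ λ z → Run X x k z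
run-prefix zero _ r = _ , here
run-prefix (suc k) (s≤s le) (there p r) with run-prefix k le r
... | z , r′ = z , there p r′

run-inner : ∀ {m} {X : Dessin m} {x n y} → 1 ≤ n → Run X x n y → ∃ λ u → y ≡ inj₂ u
run-inner {n = suc zero} _ (there p here) = _ , refl
run-inner {n = suc (suc n)} _ (there p r) = run-inner (s≤s z≤n) r

arr-det : ∀ {m} {X : Dessin m} {x j k c d} → Arr X x j c → Arr X x k d → j ≡ k × c ≡ d
arr-det (y , here , p) (z , here , q) with trans (sym p) q
... | refl = refl , refl
arr-det (y , here , p) (z , there q r , _) with trans (sym p) q
... | ()
arr-det (y , there q r , _) (z , here , p) with trans (sym p) q
... | ()
arr-det {X = X} (y , there p r , e) (z , there q r′ , e′) with trans (sym p) q
... | refl with arr-det {X = X} (y , r , e) (z , r′ , e′)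
... | refl , eq = refl , eq

run-link : ∀ {m} {X : Dessin m} {x n y} → Run X x n y → EqClosure (Link X) x y
run-link here = ε
run-link {X = X} {x} (there p r) = Eq.return (subst (Link X x) p (lτ x)) ◅◅ (Eq.return (lρ _) ◅◅ run-link r)

arr-link : ∀ {m} {X : Dessin m} {x j c} → Arr X x j c → EqClosure (Link X) x (inj₁ c)
arr-link {X = X} (y , r , p) = run-link r ◅◅ Eq.return (subst (Link X y) p (lτ y))

-- Relabelling the boundary by a rotation pb and the inner edges by f.
record Conj {m} (X Y : Dessin m) : Set where
  field
    pb pb⁻ : Fin m → Fin m
    f : Fin (s X) → Fin (s Y)
    g : Fin (s Y) → Fin (s X)
    pb-inv : ∀ c → pb (pb⁻ c) ≡ c
    pb-inv′ : ∀ c → pb⁻ (pb c) ≡ c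
    f-inv : ∀ u → f (g u) ≡ u
    f-inv′ : ∀ u → g (f u) ≡ u
    pb-prev : ∀ c → prev (pb c) ≡ pb (prev c)
    f-τ : ∀ x → τ Y (map⊎ pb f x) ≡ map⊎ pb f (τ X x)
    f-ρ : ∀ u → ρ Y (f u) ≡ f (ρ X u)

  to : Edge X → Edge Y
  to = map⊎ pb f

  from : Edge Y → Edge X
  from = map⊎ pb⁻ g

  to-from : ∀ y → to (from y) ≡ y
  to-from (inj₁ c) = cong inj₁ (pb-inv c)
  to-from (inj₂ u) = cong inj₂ (f-inv u)

  from-to : ∀ y → from (to y) ≡ y
  from-to (inj₁ c) = cong inj₁ (pb-inv′ c)
  from-to (inj₂ u) = cong inj₂ (f-inv′ u)

open Conj public

conj-refl : ∀ {m} (X : Dessin m) → Conj X X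
conj-refl X = record { pb = λ c → c ; pb⁻ = λ c → c ; f = λ u → u ; g = λ u → u
  ; pb-inv = λ _ → refl ; pb-inv′ = λ _ → refl ; f-inv = λ _ → refl ; f-inv′ = λ _ → refl
  ; pb-prev = λ _ → refl ; f-τ = h ; f-ρ = λ _ → refl }
  where
  idd : ∀ (x : Edge X) → map⊎ (λ c → c) (λ u → u) x ≡ x
  idd (inj₁ _) = refl
  idd (inj₂ _) = refl
  h : ∀ x → τ X (map⊎ (λ c → c) (λ u → u) x) ≡ map⊎ (λ c → c) (λ u → u) (τ X x)
  h x = trans (cong (τ X) (idd x)) (sym (idd (τ X x)))

conj-sym : ∀ {m} {X Y : Dessin m} → Conj X Y → Conj Y X
conj-sym {X = X} {Y} C = record { pb = pb⁻ C ; pb⁻ = pb C ; f = g C ; g = f C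
  ; pb-inv = pb-inv′ C ; pb-inv′ = pb-inv C ; f-inv = f-inv′ C ; f-inv′ = f-inv C
  ; pb-prev = λ c → trans (sym (pb-inv′ C _)) (cong (pb⁻ C) (trans (sym (pb-prev C _)) (cong prev (pb-inv C c))))
  ; f-τ = λ x → trans (sym (from-to C _)) (cong (from C) (trans (sym (f-τ C (from C x))) (cong (τ Y) (to-from C x))))
  ; f-ρ = λ x → trans (sym (f-inv′ C _)) (cong (g C) (trans (sym (f-ρ C (g C x))) (cong (ρ Y) (f-inv C x)))) }

conj-trans : ∀ {m} {X Y Z : Dessin m} → Conj X Y → Conj Y Z → Conj X Z
conj-trans {X = X} {Y} {Z} C D = record { pb = λ c → pb D (pb C c) ; pb⁻ = λ c → pb⁻ C (pb⁻ D c)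
  ; f = λ u → f D (f C u) ; g = λ u → g C (g D u)
  ; pb-inv = λ c → trans (cong (pb D) (pb-inv C _)) (pb-inv D c)
  ; pb-inv′ = λ c → trans (cong (pb⁻ C) (pb-inv′ D _)) (pb-inv′ C c)
  ; f-inv = λ u → trans (cong (f D) (f-inv C _)) (f-inv D u)
  ; f-inv′ = λ u → trans (cong (g C) (f-inv′ D _)) (f-inv′ C u)
  ; pb-prev = λ c → trans (pb-prev D _) (cong (pb D) (pb-prev C c))
  ; f-τ = λ x → trans (cong (τ Z) (comp x)) (trans (f-τ D _) (trans (cong (to D) (f-τ C x)) (sym (comp (τ X x)))))
  ; f-ρ = λ u → trans (f-ρ D _) (cong (f D) (f-ρ C u)) }
  where
  comp : ∀ x → map⊎ (λ c → pb D (pb C c)) (λ u → f D (f C u)) x ≡ to D (to C x)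
  comp (inj₁ _) = refl
  comp (inj₂ _) = refl

infix 4 _≅_
-- Isotopy in terms of dessins: the boundary is fixed edge by edge, whereas a `Conj` may rotate it.
_≅_ : ∀ {m} → Dessin m → Dessin m → Set
X ≅ Y = Σ (Conj X Y) λ C → ∀ c → pb C c ≡ c

≅-refl : ∀ {m} (X : Dessin m) → X ≅ X
≅-refl X = conj-refl X , λ _ → refl

≅-sym : ∀ {m} {X Y : Dessin m} → X ≅ Y → Y ≅ X
≅-sym (C , h) = conj-sym C , λ c → trans (cong (pb⁻ C) (sym (h c))) (pb-inv′ C c)

≅-trans : ∀ {m} {X Y Z : Dessin m} → X ≅ Y → Y ≅ Z → X ≅ Z
≅-trans (C , h) (D , k) = conj-trans C D , λ c → trans (cong (pb D) (h c)) (k c)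

module _ {m} {X Y : Dessin m} (C : Conj X Y) where

  hubρ-to : ∀ x → hubρ Y (to C x) ≡ to C (hubρ X x)
  hubρ-to (inj₁ c) = cong inj₁ (pb-prev C c)
  hubρ-to (inj₂ u) = cong inj₂ (f-ρ C u)

  ψ-to : ∀ x → ψ Y (to C x) ≡ to C (ψ X x)
  ψ-to x = trans (cong (hubρ Y) (f-τ C x)) (hubρ-to (τ X x))

  run-to : ∀ {x n y} → Run X x n y → Run Y (to C x) n (to C y)
  run-to here = here
  run-to {x} (there {u = u} p r) = there (trans (f-τ C x) (cong (to C) p))
    (subst (λ v → Run Y (inj₂ v) _ _) (sym (f-ρ C u)) (run-to r))

  arr-to : ∀ {x j c} → Arr X x j c → Arr Y (to C x) j (pb C c)
  arr-to (y , r , p) = to C y , run-to r , trans (f-τ C y) (cong (to C) p)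

  link-to : ∀ {x y} → Link X x y → EqClosure (Link Y) (to C x) (to C y)
  link-to (lτ x) = Eq.return (subst (Link Y (to C x)) (f-τ C x) (lτ _))
  link-to (lρ u) = Eq.return (subst (λ v → Link Y (inj₂ (f C u)) (inj₂ v)) (f-ρ C u) (lρ _))

  hublink-to : ∀ {x y} → HubLink X x y → EqClosure (HubLink Y) (to C x) (to C y)
  hublink-to (hτ x) = Eq.return (subst (HubLink Y (to C x)) (f-τ C x) (hτ _))
  hublink-to (hρ x) = Eq.return (subst (HubLink Y (to C x)) (hubρ-to x) (hρ _))

module _ {m} {X Y : Dessin m} (C : Conj X Y) where
  private C⁻ = conj-sym C

  to-inj : ∀ {x y} → to C x ≡ to C y → x ≡ y
  to-inj {x} {y} p = trans (sym (from-to C x)) (trans (cong (from C) p) (from-to C y))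

  cubic-to : Cubic X → Cubic Y
  cubic-to c = record
    { τ³ = λ y → subst (λ v → τ Y (τ Y (τ Y v)) ≡ v) (to-from C y)
        (trans (cong (λ v → τ Y (τ Y v)) (f-τ C (from C y))) (trans (cong (τ Y) (f-τ C _)) (trans (f-τ C _) (cong (to C) (τ³ c _)))))
    ; τ≢ = λ y p → τ≢ c (from C y) (to-inj (trans (sym (f-τ C _)) (trans (cong (τ Y) (to-from C y)) (trans p (sym (to-from C y))))))
    ; ρ³ = λ u → subst (λ v → ρ Y (ρ Y (ρ Y v)) ≡ v) (f-inv C u)
        (trans (cong (λ v → ρ Y (ρ Y v)) (f-ρ C (g C u))) (trans (cong (ρ Y) (f-ρ C _)) (trans (f-ρ C _) (cong (f C) (ρ³ c _)))))
    ; ρ≢ = λ u p → ρ≢ c (g C u) (trans (sym (f-inv′ C _)) (trans (cong (g C) (trans (sym (f-ρ C _)) (trans (cong (ρ Y) (f-inv C u)) p))) refl)) }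

  kr-to : Kr X → Kr Y
  kr-to k y ℓ 1≤ℓ r min = k (from C y) ℓ 1≤ℓ (run-to C⁻ r) λ j 1≤j j<ℓ r′ →
    min j 1≤j j<ℓ (subst (λ v → Run Y v j y) (to-from C y) (subst (λ v → Run Y (to C (from C y)) j v) (to-from C y) (run-to C r′)))

  ψ-classes-to : ∀ {N} → Classes (Graph (ψ X)) N → Classes (Graph (ψ Y)) N
  ψ-classes-to = transferGraph-≅ (from C) (to C) (ψ-to C) (to-from C) (from-to C)

  τ-classes-to : ∀ {N} → Classes (Graph (τ X)) N → Classes (Graph (τ Y)) N
  τ-classes-to = transferGraph-≅ (from C) (to C) (f-τ C) (to-from C) (from-to C)

  ρ-classes-to : ∀ {N} → Classes (Graph (ρ X)) N → Classes (Graph (ρ Y)) N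
  ρ-classes-to = transferGraph-≅ (g C) (f C) (f-ρ C) (f-inv C) (f-inv′ C)

  link-classes-to : ∀ {N} → Classes (Link X) N → Classes (Link Y) N
  link-classes-to = transfer-≅ (from C) (to C) (link-to C) (link-to C⁻) (λ y → E-≡ (to-from C y)) (λ y → E-≡ (from-to C y))

  hub-to : (∀ x y → EqClosure (HubLink X) x y) → ∀ x y → EqClosure (HubLink Y) x y
  hub-to h x y = E-≡ (sym (to-from C x)) ◅◅ (E-bind (to C) (hublink-to C) (h (from C x) (from C y)) ◅◅ E-≡ (to-from C y))

-- Edge 1 becomes edge 0. All gluings take place at edge 0, so this moves a pointer to the next
-- boundary edge.
rot : ∀ {m} → Dessin m → Dessin m
rot X = dessin (s X) (λ x → map⊎ prev (λ u → u) (τ X (map⊎ next (λ u → u) x))) (ρ X)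

unrot : ∀ {m} → Dessin m → Dessin m
unrot X = dessin (s X) (λ x → map⊎ next (λ u → u) (τ X (map⊎ prev (λ u → u) x))) (ρ X)

rot-conj : ∀ {m} (X : Dessin m) → Conj X (rot X)
rot-conj X = record { pb = prev ; pb⁻ = next ; f = λ u → u ; g = λ u → u
  ; pb-inv = prev-next ; pb-inv′ = next-prev ; f-inv = λ _ → refl ; f-inv′ = λ _ → refl
  ; pb-prev = λ _ → refl
  ; f-τ = λ x → cong (λ v → map⊎ prev (λ u → u) (τ X v)) (h x) ; f-ρ = λ _ → refl }
  where
  h : ∀ x → map⊎ next (λ u → u) (map⊎ prev (λ u → u) x) ≡ x
  h (inj₁ c) = cong inj₁ (next-prev c)
  h (inj₂ u) = refl

unrot-conj : ∀ {m} (X : Dessin m) → Conj X (unrot X)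
unrot-conj X = record { pb = next ; pb⁻ = prev ; f = λ u → u ; g = λ u → u
  ; pb-inv = next-prev ; pb-inv′ = prev-next ; f-inv = λ _ → refl ; f-inv′ = λ _ → refl
  ; pb-prev = λ c → trans (prev-next c) (sym (next-prev c))
  ; f-τ = λ x → cong (λ v → map⊎ next (λ u → u) (τ X v)) (h x) ; f-ρ = λ _ → refl }
  where
  h : ∀ x → map⊎ prev (λ u → u) (map⊎ next (λ u → u) x) ≡ x
  h (inj₁ c) = cong inj₁ (prev-next c)
  h (inj₂ u) = refl

rot-unrot : ∀ {m} (X : Dessin m) → X ≅ rot (unrot X)
rot-unrot X = conj-trans (unrot-conj X) (rot-conj (unrot X)) , prev-next

unrot-rot : ∀ {m} (X : Dessin m) → X ≅ unrot (rot X)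
unrot-rot X = conj-trans (rot-conj X) (unrot-conj (rot X)) , next-prev

rot-cong : ∀ {m} {X Y : Dessin m} → X ≅ Y → rot X ≅ rot Y
rot-cong {X = X} {Y} (C , h) = conj-trans (conj-sym (rot-conj X)) (conj-trans C (rot-conj Y)) ,
  λ c → trans (cong prev (h (next c))) (prev-next c)

unrot-cong : ∀ {m} {X Y : Dessin m} → X ≅ Y → unrot X ≅ unrot Y
unrot-cong {X = X} {Y} (C , h) = conj-trans (conj-sym (unrot-conj X)) (conj-trans C (unrot-conj Y)) ,
  λ c → trans (cong next (h (prev c))) (next-prev c)

-- Gluing an H or a tripod to the boundary

pattern 1F = suc zero
pattern 2F = suc (suc zero)
pattern 3+ x = suc (suc (suc x))

module _ {m : ℕ} where

  -- An H is glued to the boundary edges 0 and 1, which become the inner edges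
  -- 0 and 1; inner edge 2 joins the two new vertices.
  emb : ∀ {n} → Fin (2 + m) ⊎ Fin n → Fin (2 + m) ⊎ Fin (3 + n)
  emb (inj₁ zero) = inj₂ zero
  emb (inj₁ 1F) = inj₂ 1F
  emb (inj₁ (suc (suc d))) = inj₁ (suc (suc d))
  emb (inj₂ u) = inj₂ (3+ u)

  data EmbView {n} : Fin (2 + m) ⊎ Fin (3 + n) → Set where
    old : ∀ x → EmbView (emb x)
    f1 : EmbView (inj₁ zero)
    f2 : EmbView (inj₁ 1F)
    f3 : EmbView (inj₂ 2F)

  embView : ∀ {n} (y : Fin (2 + m) ⊎ Fin (3 + n)) → EmbView y
  embView (inj₁ zero) = f1
  embView (inj₁ 1F) = f2
  embView (inj₁ (suc (suc d))) = old (inj₁ (suc (suc d)))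
  embView (inj₂ zero) = old (inj₁ zero)
  embView (inj₂ 1F) = old (inj₁ 1F)
  embView (inj₂ 2F) = f3
  embView (inj₂ (3+ u)) = old (inj₂ u)

  unemb : ∀ {n} → Fin (2 + m) ⊎ Fin (3 + n) → Fin (2 + m) ⊎ Fin n
  unemb (inj₁ zero) = inj₁ zero
  unemb (inj₁ 1F) = inj₁ 1F
  unemb (inj₁ (suc (suc d))) = inj₁ (suc (suc d))
  unemb (inj₂ zero) = inj₁ zero
  unemb (inj₂ 1F) = inj₁ 1F
  -- The middle edge lies on the face before boundary edge 0, and so does the last boundary edge.
  unemb (inj₂ 2F) = inj₁ (prev zero)
  unemb (inj₂ (3+ u)) = inj₂ u

  unemb-emb : ∀ {n} (x : Fin (2 + m) ⊎ Fin n) → unemb (emb x) ≡ x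
  unemb-emb (inj₁ zero) = refl
  unemb-emb (inj₁ 1F) = refl
  unemb-emb (inj₁ (suc (suc d))) = refl
  unemb-emb (inj₂ u) = refl

  emb-inj : ∀ {n} {x y : Fin (2 + m) ⊎ Fin n} → emb x ≡ emb y → x ≡ y
  emb-inj {x = x} {y} p = trans (sym (unemb-emb x)) (trans (cong unemb p) (unemb-emb y))

  emb≢f1 : ∀ {n} (x : Fin (2 + m) ⊎ Fin n) → emb x ≢ inj₁ zero
  emb≢f1 (inj₁ zero) ()
  emb≢f1 (inj₁ 1F) ()
  emb≢f1 (inj₁ (suc (suc d))) ()
  emb≢f1 (inj₂ u) ()

  emb≢f2 : ∀ {n} (x : Fin (2 + m) ⊎ Fin n) → emb x ≢ inj₁ 1F
  emb≢f2 (inj₁ zero) ()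
  emb≢f2 (inj₁ 1F) ()
  emb≢f2 (inj₁ (suc (suc d))) ()
  emb≢f2 (inj₂ u) ()

  emb≢f3 : ∀ {n} (x : Fin (2 + m) ⊎ Fin n) → emb x ≢ inj₂ 2F
  emb≢f3 (inj₁ zero) ()
  emb≢f3 (inj₁ 1F) ()
  emb≢f3 (inj₁ (suc (suc d))) ()
  emb≢f3 (inj₂ u) ()

  Hτ : ∀ {n} → (Fin (2 + m) ⊎ Fin n → Fin (2 + m) ⊎ Fin n) → Fin (2 + m) ⊎ Fin (3 + n) → Fin (2 + m) ⊎ Fin (3 + n)
  Hτ t (inj₁ zero) = inj₁ 1F
  Hτ t (inj₁ 1F) = inj₂ 2F
  Hτ t (inj₁ (suc (suc d))) = emb (t (inj₁ (suc (suc d))))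
  Hτ t (inj₂ zero) = emb (t (inj₁ zero))
  Hτ t (inj₂ 1F) = emb (t (inj₁ 1F))
  Hτ t (inj₂ 2F) = inj₁ zero
  Hτ t (inj₂ (3+ u)) = emb (t (inj₂ u))

  Hρ : ∀ {n} → (Fin n → Fin n) → Fin (3 + n) → Fin (3 + n)
  Hρ r zero = 2F
  Hρ r 1F = zero
  Hρ r 2F = 1F
  Hρ r (3+ u) = 3+ (r u)

  -- The new black vertex carries the boundary edges 0 and 1 and the inner edge 2; the new white
  -- vertex joins inner edge 2 to the old boundary edges, now the inner edges 0 and 1.
  H : Dessin (2 + m) → Dessin (2 + m)
  H X = dessin (3 + s X) (Hτ (τ X)) (Hρ (ρ X))

  module _ (X : Dessin (2 + m)) where

    Hτ-emb : ∀ x → τ (H X) (emb x) ≡ emb (τ X x)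
    Hτ-emb (inj₁ zero) = refl
    Hτ-emb (inj₁ 1F) = refl
    Hτ-emb (inj₁ (suc (suc d))) = refl
    Hτ-emb (inj₂ u) = refl

    Hτ³-emb : ∀ x → τ (H X) (τ (H X) (τ (H X) (emb x))) ≡ emb (τ X (τ X (τ X x)))
    Hτ³-emb x = trans (cong (λ v → τ (H X) (τ (H X) v)) (Hτ-emb x)) (trans (cong (τ (H X)) (Hτ-emb _)) (Hτ-emb _))

    H-cubic : Cubic X → Cubic (H X)
    H-cubic c = record { τ³ = t3 ; τ≢ = tn ; ρ³ = r3 ; ρ≢ = rn }
      where
      t3 : ∀ y → τ (H X) (τ (H X) (τ (H X) y)) ≡ y
      t3 y with embView y
      ... | old x = trans (Hτ³-emb x) (cong emb (τ³ c x))
      ... | f1 = refl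
      ... | f2 = refl
      ... | f3 = refl
      tn : ∀ y → τ (H X) y ≢ y
      tn y p with embView y
      ... | old x = τ≢ c x (emb-inj (trans (sym (Hτ-emb x)) p))
      tn y () | f1
      tn y () | f2
      tn y () | f3
      r3 : ∀ u → ρ (H X) (ρ (H X) (ρ (H X) u)) ≡ u
      r3 zero = refl
      r3 1F = refl
      r3 2F = refl
      r3 (3+ u) = cong 3+ (ρ³ c u)
      rn : ∀ u → ρ (H X) u ≢ u
      rn zero ()
      rn 1F ()
      rn 2F ()
      rn (3+ u) p = ρ≢ c u (Finₚ.suc-injective (Finₚ.suc-injective (Finₚ.suc-injective p)))

    H-cubic⁻ : Cubic (H X) → Cubic X
    H-cubic⁻ c = record
      { τ³ = λ x → emb-inj (trans (sym (Hτ³-emb x)) (τ³ c (emb x)))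
      ; τ≢ = λ x p → τ≢ c (emb x) (trans (Hτ-emb x) (cong emb p))
      ; ρ³ = λ u → Finₚ.suc-injective (Finₚ.suc-injective (Finₚ.suc-injective (ρ³ c (3+ u))))
      ; ρ≢ = λ u p → ρ≢ c (3+ u) (cong 3+ p) }

    run-emb : ∀ {x n y} → Run X x n y → Run (H X) (emb x) n (emb y)
    run-emb here = here
    run-emb {x} (there p r) = there (trans (Hτ-emb x) (cong emb p)) (run-emb r)

    arr-emb : ∀ {x j d} → Arr X x j (suc (suc d)) → Arr (H X) (emb x) j (suc (suc d))
    arr-emb (y , r , p) = emb y , run-emb r , trans (Hτ-emb y) (cong emb p)

    arr-emb-0 : ∀ {x j} → Arr X x j zero → Arr (H X) (emb x) (suc j) zero
    arr-emb-0 (y , r , p) = inj₂ 2F , run-snoc (run-emb r) (trans (Hτ-emb y) (cong emb p)) , refl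

    arr-from-1 : ∀ {j c} → Arr (H X) (emb (inj₁ 1F)) j c → Arr (H X) (inj₁ 1F) (suc j) c
    arr-from-1 (y , r , p) = y , there refl r , p

    -- A run of H X starting at an old edge is an old run, unless it passes
    -- through the old boundary edge 1 or ends at the middle edge of the H.
    data Split (x : Edge X) (n : ℕ) (y : Edge (H X)) : Set where
      stays  : ∀ z → y ≡ emb z → Run X x n z → Split x n y
      passes : ∀ z n₁ n₂ → Run X x n₁ z → τ X z ≡ inj₁ 1F → Run (H X) (emb (inj₁ zero)) n₂ y → n ≡ n₁ + suc n₂ → Split x n y
      stops  : y ≡ inj₂ 2F → Split x n y

    split : ∀ {x n y} → Run (H X) (emb x) n y → Split x n y
    split here = stays _ refl here
    split {x} (there {u = u} p r) = go (τ X x) refl (trans (sym (Hτ-emb x)) p) r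
      where
      go : ∀ {n y} t → τ X x ≡ t → emb t ≡ inj₂ u → Run (H X) (inj₂ (Hρ (ρ X) u)) n y → Split x (suc n) y
      go (inj₁ zero) q refl here = stops refl
      go (inj₁ zero) q refl (there () r)
      go (inj₁ 1F) q refl r = passes x 0 _ here q r refl
      go (inj₁ (suc (suc d))) q () r
      go (inj₂ v) q refl r with split {inj₂ (ρ X v)} r
      ... | stays z e r′ = stays z e (there q r′)
      ... | passes z a b r₁ e r₂ eq = passes z (suc a) b (there q r₁) e r₂ (cong suc eq)
      ... | stops e = stops e

    -- Gluing the H shuts the gap between the edges 0 and 1. A closed gap past j + 1 black vertices
    -- becomes a face with 2 (j + 1) sides; otherwise no internal face arises.
    Closable : Set
    Closable = ∀ j → Arr X (inj₁ zero) j 1F → (3 ≤ suc j) × odd (suc j) ≡ true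

    -- A shortest closed walk either stays among old edges, where it was a closed walk before, or
    -- passes the old boundary edge 1 exactly once; then, started elsewhere, it is the gap that the
    -- H has shut.
    H-kr : Closable → Kr X → Kr (H X)
    H-kr cl k y ℓ 1≤ℓ r min with embView y
    ... | f1 = ⊥-elim (no-f1 1≤ℓ r)
      where
      no-f1 : ∀ {ℓ y} → 1 ≤ ℓ → ¬ Run (H X) (inj₁ zero) ℓ y
      no-f1 _ (there () r)
    ... | f2 with run-inner 1≤ℓ r
    ... | _ , ()
    H-kr cl k y ℓ 1≤ℓ r min | f3 = ⊥-elim (no-f3 1≤ℓ r)
      where
      no-f3 : ∀ {ℓ y} → 1 ≤ ℓ → ¬ Run (H X) (inj₂ 2F) ℓ y
      no-f3 _ (there () r)
    H-kr cl k y ℓ 1≤ℓ r min | old x with split {x} r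
    ... | stops e = ⊥-elim (emb≢f3 x e)
    ... | stays z e r′ with emb-inj {x = x} {z} e
    ... | refl = k x ℓ 1≤ℓ r′ λ j a b q → min j a b (run-emb q)
    H-kr cl k y ℓ 1≤ℓ r min | old x | passes z a b r₁ e r₂ refl with split {inj₁ zero} r₂
    ... | stops e′ = ⊥-elim (emb≢f3 x e′)
    ... | stays w e′ r′ with emb-inj {x = x} {w} e′
    ... | refl = subst (λ v → (3 ≤ v) × odd v ≡ true) (trans (cong suc (ℕₚ.+-comm b a)) (sym (ℕₚ.+-suc a b)))
                   (cl (b + a) (z , run-++ r′ r₁ , e))
    -- Cutting out the part between two passages would leave a shorter closed walk.
    H-kr cl k y ℓ 1≤ℓ r min | old x | passes z a b r₁ e r₂ refl | passes w c d r₃ e′ r₄ refl =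
      ⊥-elim (min (a + suc d) (subst (1 ≤_) (sym (ℕₚ.+-suc a d)) (s≤s z≤n))
        (ℕₚ.+-monoʳ-< a (s≤s (ℕₚ.m≤n+m (suc d) c)))
        (run-++ (run-emb r₁) (there (trans (Hτ-emb z) (cong emb e)) r₄)))

    H-kr⁻ : Kr (H X) → Kr X
    H-kr⁻ k x ℓ 1≤ℓ r min = k (emb x) ℓ 1≤ℓ (run-emb r) λ j 1≤j j<ℓ r′ →
      let (z , p) = run-prefix j (ℕₚ.<⇒≤ j<ℓ) r
      in min j 1≤j j<ℓ (subst (Run X x j) (emb-inj (run-det (run-emb p) r′)) p)

    H-closable⁻ : Kr (H X) → Closable
    H-closable⁻ k j (z , r , e) = k (emb (inj₁ zero)) (suc j) (s≤s z≤n) cyc λ i 1≤i i<j r′ →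
      let (w , p) = run-prefix i (ℕₚ.≤-pred i<j) r
          (u , q) = run-inner 1≤i p
      in no-inner u (emb-inj (trans (sym (cong emb q)) (run-det (run-emb p) r′)))
      where
      cyc : Run (H X) (emb (inj₁ zero)) (suc j) (emb (inj₁ zero))
      cyc = run-snoc (run-emb r) (trans (Hτ-emb z) (cong emb e))
      no-inner : ∀ u → inj₂ u ≢ inj₁ zero
      no-inner u ()

    private
      S*ψ = EqClosure (Graph (ψ (H X)))

    f2~ : S*ψ (emb (inj₁ 1F)) (inj₁ 1F)
    f2~ = E-sym (step (inj₁ 1F))

    bdry~ : ∀ c → c ≢ zero → S*ψ (emb (inj₁ c)) (inj₁ c)
    bdry~ zero n = ⊥-elim (n refl)
    bdry~ 1F n = f2~
    bdry~ (suc (suc c)) n = ε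

    -- The one additional face is the new gap at edge 0, an orbit with a single element. The old gap
    -- there becomes internal, and the two gaps beside it grow.
    H-ψ-classes : ∀ {N} → Classes (Graph (ψ X)) N → Classes (Graph (ψ (H X))) (1 + N)
    H-ψ-classes = transferGraph r emb (λ _ → inj₁ zero) rge oldnew ir re rn
      where
      r : Edge (H X) → Edge X ⊎ Fin 1
      r (inj₁ zero) = inj₂ zero
      r y@(inj₁ (suc _)) = inj₁ (unemb y)
      r y@(inj₂ _) = inj₁ (unemb y)
      re : ∀ x → r (emb x) ≡ inj₁ x
      re (inj₁ zero) = refl
      re (inj₁ 1F) = refl
      re (inj₁ (suc (suc d))) = refl
      re (inj₂ u) = refl
      rn : ∀ i → r (inj₁ zero) ≡ inj₂ i
      rn zero = refl
      rprev : ∀ (d : Fin (suc m)) → r (inj₁ (suc d)) ≡ inj₁ (inj₁ (suc d))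
      rprev zero = refl
      rprev (suc d) = refl
      hubr : ∀ x → r (hubρ (H X) (emb x)) ≡ inj₁ (hubρ X x)
      hubr (inj₁ zero) = refl
      hubr (inj₁ 1F) = refl
      hubr (inj₁ 2F) = refl
      hubr (inj₁ (3+ d)) = refl
      hubr (inj₂ u) = refl
      rge : ∀ x → r (ψ (H X) (emb x)) ≡ inj₁ (ψ X x)
      rge x = trans (cong (λ v → r (hubρ (H X) v)) (Hτ-emb x)) (hubr (τ X x))
      oldnew : ∀ y → (∃ λ x → y ≡ emb x) ⊎ (r (ψ (H X) y) ≡ r y)
      oldnew y with embView y
      ... | old x = inj₁ (x , refl)
      ... | f1 = inj₂ refl
      ... | f2 = inj₂ refl
      ... | f3 = inj₂ (rprev (fromℕ m))
      ir : ∀ y → S*ψ ([ emb , (λ _ → inj₁ zero) ]′ (r y)) y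
      ir y with embView y
      ... | old x = E-≡ (cong [ emb , (λ _ → inj₁ zero) ]′ (re x))
      ... | f1 = ε
      ... | f2 = f2~
      ... | f3 = bdry~ (prev zero) (λ ()) ◅◅ E-sym (step (inj₂ 2F))

    H-τ-classes : ∀ {N} → Classes (Graph (τ X)) N → Classes (Graph (τ (H X))) (1 + N)
    H-τ-classes = transferGraph r emb (λ _ → inj₁ zero) (λ x → trans (cong r (Hτ-emb x)) (re (τ X x))) oldnew ir re rn
      where
      r : Edge (H X) → Edge X ⊎ Fin 1
      r (inj₁ zero) = inj₂ zero
      r (inj₁ 1F) = inj₂ zero
      r (inj₂ 2F) = inj₂ zero
      r y@(inj₁ (suc (suc _))) = inj₁ (unemb y)
      r y@(inj₂ zero) = inj₁ (unemb y)
      r y@(inj₂ 1F) = inj₁ (unemb y)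
      r y@(inj₂ (3+ _)) = inj₁ (unemb y)
      re : ∀ x → r (emb x) ≡ inj₁ x
      re (inj₁ zero) = refl
      re (inj₁ 1F) = refl
      re (inj₁ (suc (suc d))) = refl
      re (inj₂ u) = refl
      rn : ∀ i → r (inj₁ zero) ≡ inj₂ i
      rn zero = refl
      oldnew : ∀ y → (∃ λ x → y ≡ emb x) ⊎ (r (τ (H X) y) ≡ r y)
      oldnew y with embView y
      ... | old x = inj₁ (x , refl)
      ... | f1 = inj₂ refl
      ... | f2 = inj₂ refl
      ... | f3 = inj₂ refl
      ir : ∀ y → EqClosure (Graph (τ (H X))) ([ emb , (λ _ → inj₁ zero) ]′ (r y)) y
      ir y with embView y
      ... | old x = E-≡ (cong [ emb , (λ _ → inj₁ zero) ]′ (re x))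
      ... | f1 = ε
      ... | f2 = step (inj₁ zero)
      ... | f3 = step (inj₁ zero) ◅◅ step (inj₁ 1F)

    H-ρ-classes : ∀ {N} → Classes (Graph (ρ X)) N → Classes (Graph (ρ (H X))) (1 + N)
    H-ρ-classes = transferGraph r 3+ (λ _ → zero) (λ _ → refl) oldnew ir (λ _ → refl) rn
      where
      r : Fin (3 + s X) → Fin (s X) ⊎ Fin 1
      r zero = inj₂ zero
      r 1F = inj₂ zero
      r 2F = inj₂ zero
      r (3+ u) = inj₁ u
      rn : ∀ i → inj₂ zero ≡ inj₂ i
      rn zero = refl
      oldnew : ∀ y → (∃ λ x → y ≡ 3+ x) ⊎ (r (ρ (H X) y) ≡ r y)
      oldnew zero = inj₂ refl
      oldnew 1F = inj₂ refl
      oldnew 2F = inj₂ refl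
      oldnew (3+ u) = inj₁ (u , refl)
      ir : ∀ y → EqClosure (Graph (ρ (H X))) ([ 3+ , (λ _ → zero) ]′ (r y)) y
      ir zero = ε
      ir 1F = E-sym (step 1F)
      ir 2F = step zero
      ir (3+ u) = ε

    H-hub : (∀ x y → EqClosure (HubLink X) x y) → ∀ x y → EqClosure (HubLink (H X)) x y
    H-hub h x y = E-sym (to0 x) ◅◅ to0 y
      where
      lt : ∀ x → EqClosure (HubLink (H X)) x (τ (H X) x)
      lt x = Eq.return (hτ x)
      lr : ∀ x → EqClosure (HubLink (H X)) x (hubρ (H X) x)
      lr x = Eq.return (hρ x)
      f13 : EqClosure (HubLink (H X)) (inj₁ zero) (inj₂ 2F)
      f13 = lt (inj₁ zero) ◅◅ lt (inj₁ 1F)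
      b : ∀ c → EqClosure (HubLink (H X)) (inj₁ c) (emb (inj₁ c))
      b zero = f13 ◅◅ E-sym (lr (inj₂ zero))
      b 1F = lt (inj₁ 1F) ◅◅ lr (inj₂ 2F)
      b (suc (suc d)) = ε
      up : ∀ {x y} → HubLink X x y → EqClosure (HubLink (H X)) (emb x) (emb y)
      up (hτ x) = lt (emb x) ◅◅ E-≡ (Hτ-emb x)
      up (hρ (inj₁ c)) = E-sym (b c) ◅◅ (lr (inj₁ c) ◅◅ b (prev c))
      up (hρ (inj₂ u)) = lr (inj₂ (3+ u))
      to0 : ∀ y → EqClosure (HubLink (H X)) (inj₁ zero) y
      to0 y with embView y
      ... | old x = b zero ◅◅ E-bind emb up (h (inj₁ zero) x)
      ... | f1 = ε
      ... | f2 = lt (inj₁ zero)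
      ... | f3 = f13

    H-hub⁻ : (∀ x y → EqClosure (HubLink (H X)) x y) → ∀ x y → EqClosure (HubLink X) x y
    H-hub⁻ h x y = E-≡ (sym (unemb-emb x)) ◅◅ (E-bind unemb down (h (emb x) (emb y)) ◅◅ E-≡ (unemb-emb y))
      where
      p0 : ∀ c → EqClosure (HubLink X) (inj₁ c) (inj₁ (prev c))
      p0 c = Eq.return (hρ (inj₁ c))
      downρ : ∀ y → EqClosure (HubLink X) (unemb y) (unemb (hubρ (H X) y))
      downρ (inj₁ zero) = p0 zero ◅◅ E-≡ (sym (bd (suc (fromℕ m))))
        where
        bd : ∀ c → unemb {s X} (inj₁ c) ≡ inj₁ c
        bd zero = refl
        bd 1F = refl
        bd (suc (suc d)) = refl
      downρ (inj₁ 1F) = p0 1F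
      downρ (inj₁ 2F) = p0 2F
      downρ (inj₁ (3+ d)) = p0 (3+ d)
      downρ (inj₂ zero) = p0 zero
      downρ (inj₂ 1F) = p0 1F
      downρ (inj₂ 2F) = E-sym (p0 zero) ◅◅ E-sym (p0 1F)
      downρ (inj₂ (3+ u)) = Eq.return (hρ (inj₂ u))
      down : ∀ {x y} → HubLink (H X) x y → EqClosure (HubLink X) (unemb x) (unemb y)
      down (hρ y) = downρ y
      down (hτ y) with embView y
      ... | old x = E-≡ (unemb-emb x) ◅◅ (Eq.return (hτ x) ◅◅ E-≡ (sym (trans (cong unemb (Hτ-emb x)) (unemb-emb (τ X x)))))
      ... | f1 = E-sym (p0 1F)
      ... | f2 = p0 1F ◅◅ p0 zero
      ... | f3 = E-sym (p0 zero)

    -- As far as components are concerned, an H is one extra link between the edges 0 and 1: it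
    -- merges two components or changes nothing.
    data Link⁺ : Edge X → Edge X → Set where
      link : ∀ {x y} → Link X x y → Link⁺ x y
      extra : Link⁺ (inj₁ zero) (inj₁ 1F)

    glue : Fin (2 + m) → Fin (2 + m)
    glue 1F = zero
    glue c = c

    H-link-classes : ∀ {N} (C : Classes Link⁺ N) →
      Σ (Classes (Link (H X)) N) λ C′ → ∀ c → lab C′ (inj₁ c) ≡ lab C (inj₁ (glue c))
    H-link-classes C = transfer-≅ r emb up down ir (λ x → E-≡ (re x)) C ,
      λ { zero → refl ; 1F → refl ; (suc (suc c)) → refl }
      where
      r : Edge (H X) → Edge X
      r (inj₁ zero) = inj₁ zero
      r (inj₁ 1F) = inj₁ zero
      r (inj₁ (suc (suc d))) = inj₁ (suc (suc d))
      r (inj₂ zero) = inj₁ zero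
      r (inj₂ 1F) = inj₁ 1F
      r (inj₂ 2F) = inj₁ zero
      r (inj₂ (3+ u)) = inj₂ u
      re : ∀ x → r (emb x) ≡ x
      re (inj₁ zero) = refl
      re (inj₁ 1F) = refl
      re (inj₁ (suc (suc d))) = refl
      re (inj₂ u) = refl
      lt : ∀ x → EqClosure (Link (H X)) x (τ (H X) x)
      lt x = Eq.return (lτ x)
      lr : ∀ u → EqClosure (Link (H X)) (inj₂ u) (inj₂ (ρ (H X) u))
      lr u = Eq.return (lρ u)
      up : ∀ {x y} → Link⁺ x y → EqClosure (Link (H X)) (emb x) (emb y)
      up (link (lτ x)) = lt (emb x) ◅◅ E-≡ (Hτ-emb x)
      up (link (lρ u)) = lr (3+ u)
      up extra = lr zero ◅◅ lr 2F
      down : ∀ {x y} → Link (H X) x y → EqClosure Link⁺ (r x) (r y)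
      down (lτ y) with embView y
      ... | old x = E-≡ (re x) ◅◅ (Eq.return (link (lτ x)) ◅◅ E-≡ (sym (trans (cong r (Hτ-emb x)) (re (τ X x)))))
      ... | f1 = ε
      ... | f2 = ε
      ... | f3 = ε
      down (lρ zero) = ε
      down (lρ 1F) = E-sym (Eq.return extra)
      down (lρ 2F) = Eq.return extra
      down (lρ (3+ u)) = Eq.return (link (lρ u))
      ir : ∀ y → EqClosure (Link (H X)) (emb (r y)) y
      ir y with embView y
      ... | old x = E-≡ (cong emb (re x))
      ... | f1 = lr zero ◅◅ lt (inj₂ 2F)
      ... | f2 = lr zero ◅◅ (lt (inj₂ 2F) ◅◅ lt (inj₁ zero))
      ... | f3 = lr zero

    H-link-same : ∀ {N} (C : Classes (Link X) N) → lab C (inj₁ zero) ≡ lab C (inj₁ 1F) →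
      Σ (Classes (Link (H X)) N) λ C′ → ∀ c → lab C′ (inj₁ c) ≡ lab C (inj₁ c)
    H-link-same C eq = proj₁ D , λ { zero → proj₂ D zero ; 1F → trans (proj₂ D 1F) eq ; (suc (suc c)) → proj₂ D (suc (suc c)) }
      where
      D = H-link-classes record
        { lab = lab C ; rep = rep C ; sound = λ { (link l) → sound C l ; extra → eq }
        ; complete = λ e → Eq.map link (complete C e) ; lab-rep = lab-rep C }

    H-link-merge : ∀ {N} (C : Classes (Link X) (suc N)) (n : lab C (inj₁ zero) ≢ lab C (inj₁ 1F)) →
      Σ (Classes (Link (H X)) N) λ C′ → ∀ c → lab C′ (inj₁ c) ≡ collapse n (lab C (inj₁ c))
    H-link-merge C n = proj₁ D , λ { zero → proj₂ D zero ; 1F → trans (proj₂ D 1F) (collapse-i n) ; (suc (suc c)) → proj₂ D (suc (suc c)) }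
      where
      M = merge C n link extra λ { (link l) → inj₁ (Eq.return l) ; extra → inj₂ (refl , refl) }
      D′ = H-link-classes (proj₁ M)
      D : Σ (Classes (Link (H X)) _) λ C′ → ∀ c → lab C′ (inj₁ c) ≡ collapse n (lab C (inj₁ (glue c)))
      D = proj₁ D′ , λ c → trans (proj₂ D′ c) (proj₂ M _)

module _ {m : ℕ} where

  embT : ∀ {n} → Fin m ⊎ Fin n → Fin (3 + m) ⊎ Fin n
  embT (inj₁ c) = inj₁ (3+ c)
  embT (inj₂ u) = inj₂ u

  Tτ : ∀ {n} → (Fin m ⊎ Fin n → Fin m ⊎ Fin n) → Fin (3 + m) ⊎ Fin n → Fin (3 + m) ⊎ Fin n
  Tτ t (inj₁ zero) = inj₁ 1F
  Tτ t (inj₁ 1F) = inj₁ 2F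
  Tτ t (inj₁ 2F) = inj₁ zero
  Tτ t (inj₁ (3+ c)) = embT (t (inj₁ c))
  Tτ t (inj₂ u) = embT (t (inj₂ u))

  T : Dessin m → Dessin (3 + m)
  T X = dessin (s X) (Tτ (τ X)) (ρ X)

  data TView {n} : Fin (3 + m) ⊎ Fin n → Set where
    old : ∀ x → TView (embT x)
    n1 : TView (inj₁ zero)
    n2 : TView (inj₁ 1F)
    n3 : TView (inj₁ 2F)

  tView : ∀ {n} (y : Fin (3 + m) ⊎ Fin n) → TView y
  tView (inj₁ zero) = n1
  tView (inj₁ 1F) = n2
  tView (inj₁ 2F) = n3
  tView (inj₁ (3+ c)) = old (inj₁ c)
  tView (inj₂ u) = old (inj₂ u)

  embT-inj : ∀ {n} {x y : Fin m ⊎ Fin n} → embT x ≡ embT y → x ≡ y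
  embT-inj {x = inj₁ c} {inj₁ .c} refl = refl
  embT-inj {x = inj₂ u} {inj₂ .u} refl = refl

  embT-old : ∀ {n} (x : Fin m ⊎ Fin n) (c : Fin 3) → embT x ≢ inj₁ (c ↑ˡ m)
  embT-old (inj₁ c) zero ()
  embT-old (inj₁ c) 1F ()
  embT-old (inj₁ c) 2F ()
  embT-old (inj₂ c) _ ()

  module _ (X : Dessin m) where

    Tτ-emb : ∀ x → τ (T X) (embT x) ≡ embT (τ X x)
    Tτ-emb (inj₁ c) = refl
    Tτ-emb (inj₂ u) = refl

    Tτ³-emb : ∀ x → τ (T X) (τ (T X) (τ (T X) (embT x))) ≡ embT (τ X (τ X (τ X x)))
    Tτ³-emb x = trans (cong (λ v → τ (T X) (τ (T X) v)) (Tτ-emb x)) (trans (cong (τ (T X)) (Tτ-emb _)) (Tτ-emb _))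

    T-cubic : Cubic X → Cubic (T X)
    T-cubic c = record { τ³ = t3 ; τ≢ = tn ; ρ³ = ρ³ c ; ρ≢ = ρ≢ c }
      where
      t3 : ∀ y → τ (T X) (τ (T X) (τ (T X) y)) ≡ y
      t3 y with tView y
      ... | old x = trans (Tτ³-emb x) (cong embT (τ³ c x))
      ... | n1 = refl
      ... | n2 = refl
      ... | n3 = refl
      tn : ∀ y → τ (T X) y ≢ y
      tn y p with tView y
      ... | old x = τ≢ c x (embT-inj (trans (sym (Tτ-emb x)) p))
      tn y () | n1
      tn y () | n2
      tn y () | n3

    T-cubic⁻ : Cubic (T X) → Cubic X
    T-cubic⁻ c = record
      { τ³ = λ x → embT-inj (trans (sym (Tτ³-emb x)) (τ³ c (embT x)))
      ; τ≢ = λ x p → τ≢ c (embT x) (trans (Tτ-emb x) (cong embT p))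
      ; ρ³ = ρ³ c ; ρ≢ = ρ≢ c }

    run-embT : ∀ {x n y} → Run X x n y → Run (T X) (embT x) n (embT y)
    run-embT here = here
    run-embT {x} (there p r) = there (trans (Tτ-emb x) (cong embT p)) (run-embT r)

    arr-embT : ∀ {x j c} → Arr X x j c → Arr (T X) (embT x) j (3+ c)
    arr-embT (y , r , p) = embT y , run-embT r , trans (Tτ-emb y) (cong embT p)

    run-embT⁻ : ∀ {x n y} → Run (T X) (embT x) n y → ∃ λ z → y ≡ embT z × Run X x n z
    run-embT⁻ here = _ , refl , here
    run-embT⁻ {x} (there {u = u} p r) = go (τ X x) refl (trans (sym (Tτ-emb x)) p) r
      where
      go : ∀ {n y} t → τ X x ≡ t → embT t ≡ inj₂ u → Run (T X) (inj₂ (ρ X u)) n y → ∃ λ z → y ≡ embT z × Run X x (suc n) z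
      go (inj₂ v) q refl r with run-embT⁻ {inj₂ (ρ X v)} r
      ... | z , e , r′ = z , e , there q r′

    T-kr : Kr X → Kr (T X)
    T-kr k y ℓ 1≤ℓ r min with run-inner 1≤ℓ r
    ... | u , refl with run-embT⁻ {inj₂ u} r
    ... | inj₂ .u , refl , r′ = k (inj₂ u) ℓ 1≤ℓ r′ λ j a b q → min j a b (run-embT q)

    T-kr⁻ : Kr (T X) → Kr X
    T-kr⁻ k x ℓ 1≤ℓ r min = k (embT x) ℓ 1≤ℓ (run-embT r) λ j a b q → m′ j a b (run-embT⁻ q)
      where
      m′ : ∀ j → 1 ≤ j → j < ℓ → (∃ λ z → embT x ≡ embT z × Run X x j z) → ⊥
      m′ j a b (z , e , q) with embT-inj {x = x} {z} e
      ... | refl = min j a b q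

    T-τ-classes : ∀ {N} → Classes (Graph (τ X)) N → Classes (Graph (τ (T X))) (1 + N)
    T-τ-classes = transferGraph r embT (λ _ → inj₁ zero) (λ x → trans (cong r (Tτ-emb x)) (re (τ X x))) oldnew ir re rn
      where
      r : Edge (T X) → Edge X ⊎ Fin 1
      r (inj₁ zero) = inj₂ zero
      r (inj₁ 1F) = inj₂ zero
      r (inj₁ 2F) = inj₂ zero
      r (inj₁ (3+ c)) = inj₁ (inj₁ c)
      r (inj₂ u) = inj₁ (inj₂ u)
      re : ∀ x → r (embT x) ≡ inj₁ x
      re (inj₁ c) = refl
      re (inj₂ u) = refl
      rn : ∀ i → r (inj₁ zero) ≡ inj₂ i
      rn zero = refl
      oldnew : ∀ y → (∃ λ x → y ≡ embT x) ⊎ (r (τ (T X) y) ≡ r y)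
      oldnew y with tView y
      ... | old x = inj₁ (x , refl)
      ... | n1 = inj₂ refl
      ... | n2 = inj₂ refl
      ... | n3 = inj₂ refl
      ir : ∀ y → EqClosure (Graph (τ (T X))) ([ embT , (λ _ → inj₁ zero) ]′ (r y)) y
      ir y with tView y
      ... | old x = E-≡ (cong [ embT , (λ _ → inj₁ zero) ]′ (re x))
      ... | n1 = ε
      ... | n2 = step (inj₁ zero)
      ... | n3 = step (inj₁ zero) ◅◅ step (inj₁ 1F)

    T-link-classes : ∀ {N} (C : Classes (Link X) N) →
      Σ (Classes (Link (T X)) (1 + N)) λ C′ → lab C′ (inj₁ zero) ≡ zero × lab C′ (inj₁ 1F) ≡ zero × lab C′ (inj₁ 2F) ≡ zero ×
        (∀ c → lab C′ (inj₁ (3+ c)) ≡ suc (lab C (inj₁ c)))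
    T-link-classes C = transfer r embT (λ _ → inj₁ zero) up (λ l → down l) ir re rn C , refl , refl , refl , λ _ → refl
      where
      r : Edge (T X) → Edge X ⊎ Fin 1
      r (inj₁ zero) = inj₂ zero
      r (inj₁ 1F) = inj₂ zero
      r (inj₁ 2F) = inj₂ zero
      r (inj₁ (3+ c)) = inj₁ (inj₁ c)
      r (inj₂ u) = inj₁ (inj₂ u)
      re : ∀ x → r (embT x) ≡ inj₁ x
      re (inj₁ c) = refl
      re (inj₂ u) = refl
      rn : ∀ i → r (inj₁ zero) ≡ inj₂ i
      rn zero = refl
      lt : ∀ x → EqClosure (Link (T X)) x (τ (T X) x)
      lt x = Eq.return (lτ x)
      up : ∀ {x y} → Link X x y → EqClosure (Link (T X)) (embT x) (embT y)
      up (lτ x) = lt (embT x) ◅◅ E-≡ (Tτ-emb x)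
      up (lρ u) = Eq.return (lρ u)
      down : ∀ {x y} → Link (T X) x y → (∃ λ a → ∃ λ b → r x ≡ inj₁ a × r y ≡ inj₁ b × EqClosure (Link X) a b) ⊎ (r x ≡ r y)
      down (lρ u) = inj₁ (_ , _ , refl , refl , Eq.return (lρ u))
      down (lτ y) with tView y
      ... | old x = inj₁ (x , τ X x , re x , trans (cong r (Tτ-emb x)) (re (τ X x)) , Eq.return (lτ x))
      ... | n1 = inj₂ refl
      ... | n2 = inj₂ refl
      ... | n3 = inj₂ refl
      ir : ∀ y → EqClosure (Link (T X)) ([ embT , (λ _ → inj₁ zero) ]′ (r y)) y
      ir y with tView y
      ... | old x = E-≡ (cong [ embT , (λ _ → inj₁ zero) ]′ (re x))
      ... | n1 = ε
      ... | n2 = lt (inj₁ zero)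
      ... | n3 = lt (inj₁ zero) ◅◅ lt (inj₁ 1F)

module _ {m : ℕ} (X : Dessin (suc m)) where

  -- The new faces are the gaps after the edges 0 and 1; the gap after edge 2 is part of the gap
  -- that receives the tripod. For an empty boundary there is no such gap, hence the index `suc m`.
  T-ψ-classes : ∀ {N} → Classes (Graph (ψ X)) N → Classes (Graph (ψ (T X))) (2 + N)
  T-ψ-classes = transferGraph r embT new rge oldnew ir re rn
    where
    new : Fin 2 → Edge (T X)
    new zero = inj₁ zero
    new 1F = inj₁ 1F
    r : Edge (T X) → Edge X ⊎ Fin 2
    r (inj₁ zero) = inj₂ zero
    r (inj₁ 1F) = inj₂ 1F
    r (inj₁ 2F) = inj₁ (inj₁ (fromℕ m))
    r (inj₁ (3+ c)) = inj₁ (inj₁ c)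
    r (inj₂ u) = inj₁ (inj₂ u)
    re : ∀ x → r (embT x) ≡ inj₁ x
    re (inj₁ c) = refl
    re (inj₂ u) = refl
    rn : ∀ i → r (new i) ≡ inj₂ i
    rn zero = refl
    rn 1F = refl
    hubr : ∀ x → r (hubρ (T X) (embT x)) ≡ inj₁ (hubρ X x)
    hubr (inj₁ zero) = refl
    hubr (inj₁ (suc d)) = refl
    hubr (inj₂ u) = refl
    rge : ∀ x → r (ψ (T X) (embT x)) ≡ inj₁ (ψ X x)
    rge x = trans (cong (λ v → r (hubρ (T X) v)) (Tτ-emb X x)) (hubr (τ X x))
    oldnew : ∀ y → (∃ λ x → y ≡ embT x) ⊎ (r (ψ (T X) y) ≡ r y)
    oldnew y with tView y
    ... | old x = inj₁ (x , refl)
    ... | n1 = inj₂ refl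
    ... | n2 = inj₂ refl
    ... | n3 = inj₂ refl
    ir : ∀ y → EqClosure (Graph (ψ (T X))) ([ embT , new ]′ (r y)) y
    ir y with tView y
    ... | old x = E-≡ (cong [ embT , new ]′ (re x))
    ... | n1 = ε
    ... | n2 = ε
    ... | n3 = E-sym (step (inj₁ 2F))

  T-hub : (∀ x y → EqClosure (HubLink X) x y) → ∀ x y → EqClosure (HubLink (T X)) x y
  T-hub h x y = E-sym (to0 x) ◅◅ to0 y
    where
    lt : ∀ x → EqClosure (HubLink (T X)) x (τ (T X) x)
    lt x = Eq.return (hτ x)
    lr : ∀ x → EqClosure (HubLink (T X)) x (hubρ (T X) x)
    lr x = Eq.return (hρ x)
    up : ∀ {x y} → HubLink X x y → EqClosure (HubLink (T X)) (embT x) (embT y)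
    up (hτ x) = lt (embT x) ◅◅ E-≡ (Tτ-emb X x)
    up (hρ (inj₁ zero)) = lr (inj₁ (3+ zero)) ◅◅ (lr (inj₁ 2F) ◅◅ (lr (inj₁ 1F) ◅◅ lr (inj₁ zero)))
    up (hρ (inj₁ (suc d))) = lr (inj₁ (3+ (suc d)))
    up (hρ (inj₂ u)) = lr (inj₂ u)
    to0 : ∀ y → EqClosure (HubLink (T X)) (inj₁ zero) y
    to0 y with tView y
    ... | old x = lr (inj₁ zero) ◅◅ E-bind embT up (h (inj₁ (fromℕ m)) x)
    ... | n1 = ε
    ... | n2 = lt (inj₁ zero)
    ... | n3 = lt (inj₁ zero) ◅◅ lt (inj₁ 1F)

  T-hub⁻ : (∀ x y → EqClosure (HubLink (T X)) x y) → ∀ x y → EqClosure (HubLink X) x y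
  T-hub⁻ h x y = E-≡ (sym (re x)) ◅◅ (E-bind r down (h (embT x) (embT y)) ◅◅ E-≡ (re y))
    where
    r : Edge (T X) → Edge X
    r (inj₁ zero) = inj₁ zero
    r (inj₁ 1F) = inj₁ zero
    r (inj₁ 2F) = inj₁ zero
    r (inj₁ (3+ c)) = inj₁ c
    r (inj₂ u) = inj₂ u
    re : ∀ x → r (embT x) ≡ x
    re (inj₁ c) = refl
    re (inj₂ u) = refl
    downρ : ∀ y → EqClosure (HubLink X) (r y) (r (hubρ (T X) y))
    downρ (inj₁ zero) = Eq.return (hρ (inj₁ zero))
    downρ (inj₁ 1F) = ε
    downρ (inj₁ 2F) = ε
    downρ (inj₁ (3+ zero)) = ε
    downρ (inj₁ (3+ (suc c))) = Eq.return (hρ (inj₁ (suc c)))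
    downρ (inj₂ u) = Eq.return (hρ (inj₂ u))
    down : ∀ {x y} → HubLink (T X) x y → EqClosure (HubLink X) (r x) (r y)
    down (hρ y) = downρ y
    down (hτ y) with tView y
    ... | old x = E-≡ (re x) ◅◅ (Eq.return (hτ x) ◅◅ E-≡ (sym (trans (cong r (Tτ-emb X x)) (re (τ X x)))))
    ... | n1 = ε
    ... | n2 = ε
    ... | n3 = ε

-- With no further boundary edges nothing links the tripod to an inner edge, so in a connected
-- capped map the tripod is alone.
T-hub-0 : (X : Dessin 0) → (∀ x y → EqClosure (HubLink (T X)) x y) → ¬ Fin (s X)
T-hub-0 X h u = absurd (E-const isInner inv (h (inj₁ zero) (inj₂ u)))
  where
  isInner : Edge (T X) → Bool
  isInner (inj₁ _) = false
  isInner (inj₂ _) = true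
  emb-inner : (x : Edge X) → isInner (embT x) ≡ true
  emb-inner (inj₂ _) = refl
  inv : ∀ {x y} → HubLink (T X) x y → isInner x ≡ isInner y
  inv (hρ (inj₁ _)) = refl
  inv (hρ (inj₂ _)) = refl
  inv (hτ (inj₁ zero)) = refl
  inv (hτ (inj₁ 1F)) = refl
  inv (hτ (inj₁ 2F)) = refl
  inv (hτ (inj₂ u)) = sym (emb-inner (τ X (inj₂ u)))
  absurd : false ≢ true
  absurd ()

≅-ext : ∀ {m n} {t t′ : Fin m ⊎ Fin n → Fin m ⊎ Fin n} {r r′ : Fin n → Fin n} →
  (∀ x → t x ≡ t′ x) → (∀ u → r u ≡ r′ u) → dessin n t r ≅ dessin n t′ r′
≅-ext {m} {n} {t} {t′} p q = record { pb = λ c → c ; pb⁻ = λ c → c ; f = λ u → u ; g = λ u → u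
  ; pb-inv = λ _ → refl ; pb-inv′ = λ _ → refl ; f-inv = λ _ → refl ; f-inv′ = λ _ → refl
  ; pb-prev = λ _ → refl
  ; f-τ = λ x → trans (cong t′ (idd x)) (trans (sym (p x)) (sym (idd (t x)))) ; f-ρ = λ u → sym (q u) } , λ _ → refl
  where
  idd : ∀ (x : Fin m ⊎ Fin n) → map⊎ (λ c → c) (λ u → u) x ≡ x
  idd (inj₁ _) = refl
  idd (inj₂ _) = refl

mk≅ : ∀ {m} {X Y : Dessin m} (f : Fin (s X) → Fin (s Y)) (g : Fin (s Y) → Fin (s X)) →
  (∀ u → f (g u) ≡ u) → (∀ u → g (f u) ≡ u) → (∀ x → τ Y (map⊎ (λ c → c) f x) ≡ map⊎ (λ c → c) f (τ X x)) →
  (∀ u → ρ Y (f u) ≡ f (ρ X u)) → X ≅ Y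
mk≅ f g fg gf t r = record { pb = λ c → c ; pb⁻ = λ c → c ; f = f ; g = g
  ; pb-inv = λ _ → refl ; pb-inv′ = λ _ → refl ; f-inv = fg ; f-inv′ = gf
  ; pb-prev = λ _ → refl ; f-τ = t ; f-ρ = r } , λ _ → refl

module ≅-lemmas {m} {X Y : Dessin m} (I : X ≅ Y) where
  F = f (proj₁ I)
  G = g (proj₁ I)
  FG = f-inv (proj₁ I)
  GF = f-inv′ (proj₁ I)
  F-inj : ∀ {u v} → F u ≡ F v → u ≡ v
  F-inj {u} {v} p = trans (sym (GF u)) (trans (cong G p) (GF v))
  to-id : ∀ x → to (proj₁ I) x ≡ map⊎ (λ c → c) F x
  to-id (inj₁ c) = cong inj₁ (proj₂ I c)
  to-id (inj₂ u) = refl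
  Fτ : ∀ x → τ Y (map⊎ (λ c → c) F x) ≡ map⊎ (λ c → c) F (τ X x)
  Fτ x = trans (cong (τ Y) (sym (to-id x))) (trans (f-τ (proj₁ I) x) (to-id (τ X x)))
  Fρ = f-ρ (proj₁ I)

emb-map : ∀ {m n n′} (f : Fin n → Fin n′) (g : Fin (3 + n) → Fin (3 + n′)) → g zero ≡ zero → g 1F ≡ 1F → (∀ u → g (3+ u) ≡ 3+ (f u)) →
  ∀ (x : Fin (2 + m) ⊎ Fin n) → map⊎ (λ c → c) g (emb x) ≡ emb (map⊎ (λ c → c) f x)
emb-map f g a b c (inj₁ zero) = cong inj₂ a
emb-map f g a b c (inj₁ 1F) = cong inj₂ b
emb-map f g a b c (inj₁ (suc (suc d))) = refl
emb-map f g a b c (inj₂ u) = cong inj₂ (c u)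

H-cong : ∀ {m} {X Y : Dessin (2 + m)} → X ≅ Y → H X ≅ H Y
H-cong {m} {X} {Y} I = mk≅ f3+ g3+ (inv FG) (inv′ GF) τ-ok rr
  where
  open ≅-lemmas I
  f3+ : Fin (3 + s X) → Fin (3 + s Y)
  f3+ zero = zero
  f3+ 1F = 1F
  f3+ 2F = 2F
  f3+ (3+ u) = 3+ (F u)
  g3+ : Fin (3 + s Y) → Fin (3 + s X)
  g3+ zero = zero
  g3+ 1F = 1F
  g3+ 2F = 2F
  g3+ (3+ u) = 3+ (G u)
  inv : (∀ u → F (G u) ≡ u) → ∀ u → f3+ (g3+ u) ≡ u
  inv h zero = refl
  inv h 1F = refl
  inv h 2F = refl
  inv h (3+ u) = cong 3+ (h u)
  inv′ : (∀ u → G (F u) ≡ u) → ∀ u → g3+ (f3+ u) ≡ u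
  inv′ h zero = refl
  inv′ h 1F = refl
  inv′ h 2F = refl
  inv′ h (3+ u) = cong 3+ (h u)
  τ-ok : ∀ y → τ (H Y) (map⊎ (λ c → c) f3+ y) ≡ map⊎ (λ c → c) f3+ (τ (H X) y)
  τ-ok y with embView y
  ... | old x = trans (cong (τ (H Y)) (emb-map F f3+ refl refl (λ _ → refl) x)) (trans (Hτ-emb Y _) (trans (cong emb (Fτ x))
      (sym (trans (cong (map⊎ (λ c → c) f3+) (Hτ-emb X x)) (emb-map F f3+ refl refl (λ _ → refl) (τ X x))))))
  ... | f1 = refl
  ... | f2 = refl
  ... | f3 = refl
  rr : ∀ u → ρ (H Y) (f3+ u) ≡ f3+ (ρ (H X) u)
  rr zero = refl
  rr 1F = refl
  rr 2F = refl
  rr (3+ u) = cong 3+ (Fρ u)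

-- The glued piece is recognisable from the boundary: τ leads from edge 1 to inner edge 2, and ρ
-- leads on to 1 and to 0. So an isomorphism of glued webs restricts to the old webs.
H-fix : ∀ {m} {X Y : Dessin (2 + m)} (I : H X ≅ H Y) → let open ≅-lemmas I in F zero ≡ zero × F 1F ≡ 1F × F 2F ≡ 2F
H-fix {m} {X} {Y} I = e0 , e1 , e2
  where
  open ≅-lemmas I
  e2 : F 2F ≡ 2F
  e2 with Fτ (inj₁ 1F)
  ... | p = sym (Sumₚ.inj₂-injective p)
  e1 : F 1F ≡ 1F
  e1 = trans (sym (Fρ 2F)) (cong (Hρ {m} (ρ Y)) e2)
  e0 : F zero ≡ zero
  e0 = trans (sym (Fρ 1F)) (cong (Hρ {m} (ρ Y)) e1)

3+-inj : ∀ {n} {x y : Fin n} → Fin.suc (Fin.suc (Fin.suc x)) ≡ 3+ y → x ≡ y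
3+-inj refl = refl

H-shift : ∀ {m} {X Y : Dessin (2 + m)} (I : H X ≅ H Y) → let open ≅-lemmas I in ∀ u → ∃ λ v → F (3+ u) ≡ 3+ v
H-shift I u = go (F (3+ u)) refl
  where
  open ≅-lemmas I
  fx = H-fix I
  go : ∀ w → F (3+ u) ≡ w → ∃ λ v → w ≡ 3+ v
  go zero p with F-inj (trans p (sym (proj₁ fx)))
  ... | ()
  go 1F p with F-inj (trans p (sym (proj₁ (proj₂ fx))))
  ... | ()
  go 2F p with F-inj (trans p (sym (proj₂ (proj₂ fx))))
  ... | ()
  go (3+ v) p = v , refl

H-cancel : ∀ {m} {X Y : Dessin (2 + m)} → H X ≅ H Y → X ≅ Y
H-cancel {m} {X} {Y} I = mk≅ f° g° fg gf τ-ok rr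
  where
  open ≅-lemmas I
  J = ≅-sym I
  module J = ≅-lemmas J
  f° : Fin (s X) → Fin (s Y)
  f° u = proj₁ (H-shift I u)
  g° : Fin (s Y) → Fin (s X)
  g° u = proj₁ (H-shift J u)
  f≡ : ∀ u → F (3+ u) ≡ 3+ (f° u)
  f≡ u = proj₂ (H-shift I u)
  g≡ : ∀ u → G (3+ u) ≡ 3+ (g° u)
  g≡ u = proj₂ (H-shift J u)
  fg : ∀ u → f° (g° u) ≡ u
  fg u = 3+-inj (trans (sym (f≡ _)) (trans (cong F (sym (g≡ u))) (FG (3+ u))))
  gf : ∀ u → g° (f° u) ≡ u
  gf u = 3+-inj (trans (sym (g≡ _)) (trans (cong G (sym (f≡ u))) (GF (3+ u))))
  em : ∀ x → map⊎ (λ c → c) F (emb x) ≡ emb (map⊎ (λ c → c) f° x)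
  em = emb-map f° F (proj₁ (H-fix I)) (proj₁ (proj₂ (H-fix I))) f≡
  τ-ok : ∀ x → τ Y (map⊎ (λ c → c) f° x) ≡ map⊎ (λ c → c) f° (τ X x)
  τ-ok x = emb-inj (trans (sym (Hτ-emb Y _)) (trans (cong (τ (H Y)) (sym (em x))) (trans (Fτ (emb x))
    (trans (cong (map⊎ (λ c → c) F) (Hτ-emb X x)) (em (τ X x))))))
  rr : ∀ u → ρ Y (f° u) ≡ f° (ρ X u)
  rr u = 3+-inj (trans (cong (Hρ {m} (ρ Y)) (sym (f≡ u))) (trans (Fρ (3+ u)) (f≡ (ρ X u))))

embT-map : ∀ {m n n′} (f : Fin n → Fin n′) (x : Fin m ⊎ Fin n) → map⊎ (λ c → c) f (embT x) ≡ embT (map⊎ (λ c → c) f x)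
embT-map f (inj₁ c) = refl
embT-map f (inj₂ u) = refl

T-cong : ∀ {m} {X Y : Dessin m} → X ≅ Y → T X ≅ T Y
T-cong {m} {X} {Y} I = mk≅ F G FG GF τ-ok Fρ
  where
  open ≅-lemmas I
  τ-ok : ∀ y → τ (T Y) (map⊎ (λ c → c) F y) ≡ map⊎ (λ c → c) F (τ (T X) y)
  τ-ok y with tView y
  ... | old x = trans (cong (τ (T Y)) (embT-map F x)) (trans (Tτ-emb Y _) (trans (cong embT (Fτ x))
      (sym (trans (cong (map⊎ (λ c → c) F) (Tτ-emb X x)) (embT-map F (τ X x))))))
  ... | n1 = refl
  ... | n2 = refl
  ... | n3 = refl

T-cancel : ∀ {m} {X Y : Dessin m} → T X ≅ T Y → X ≅ Y
T-cancel {m} {X} {Y} I = mk≅ F G FG GF τ-ok Fρ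
  where
  open ≅-lemmas I
  τ-ok : ∀ x → τ Y (map⊎ (λ c → c) F x) ≡ map⊎ (λ c → c) F (τ X x)
  τ-ok x = embT-inj (trans (sym (Tτ-emb Y _)) (trans (cong (τ (T Y)) (sym (embT-map F x))) (trans (Fτ (embT x))
    (trans (cong (map⊎ (λ c → c) F) (Tτ-emb X x)) (embT-map F (τ X x))))))

rot-cancel : ∀ {m} {X Y : Dessin m} → rot X ≅ rot Y → X ≅ Y
rot-cancel {X = X} {Y} I = ≅-trans (unrot-rot X) (≅-trans (unrot-cong I) (≅-sym (unrot-rot Y)))

unrot-cancel : ∀ {m} {X Y : Dessin m} → unrot X ≅ unrot Y → X ≅ Y
unrot-cancel {X = X} {Y} I = ≅-trans (rot-unrot X) (≅-trans (rot-cong I) (≅-sym (rot-unrot Y)))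

record Bij (a b : ℕ) : Set where
  field
    fw : Fin a → Fin b
    bw : Fin b → Fin a
    fb : ∀ y → fw (bw y) ≡ y
    bf : ∀ x → bw (fw x) ≡ x

open Bij public

bij-inj : ∀ {a b} (p : Bij a b) {x y} → fw p x ≡ fw p y → x ≡ y
bij-inj p e = trans (sym (bf p _)) (trans (cong (bw p) e) (bf p _))

bij-∘ : ∀ {a b c} → Bij a b → Bij b c → Bij a c
bij-∘ p q = record { fw = λ x → fw q (fw p x) ; bw = λ y → bw p (bw q y)
  ; fb = λ y → trans (cong (fw q) (fb p _)) (fb q y) ; bf = λ x → trans (cong (bw p) (bf q _)) (bf p x) }

bij-suc : ∀ {a b} → Bij a b → Bij (suc a) (suc b)
bij-suc p = record { fw = λ { zero → zero ; (suc x) → suc (fw p x) } ; bw = λ { zero → zero ; (suc x) → suc (bw p x) }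
  ; fb = λ { zero → refl ; (suc x) → cong suc (fb p x) } ; bf = λ { zero → refl ; (suc x) → cong suc (bf p x) } }

front : ∀ {n} (x : Fin (suc n)) → Σ (Bij (suc n) (suc n)) λ p → fw p x ≡ zero
front {n} x = record { fw = fr ; bw = bk ; fb = frbk ; bf = bkfr } , fr-x
  where
  fr : Fin (suc n) → Fin (suc n)
  fr k with x Finₚ.≟ k
  ... | yes _ = zero
  ... | no x≢k = suc (punchOut x≢k)
  bk : Fin (suc n) → Fin (suc n)
  bk zero = x
  bk (suc k) = punchIn x k
  fr-x : fr x ≡ zero
  fr-x with x Finₚ.≟ x
  ... | yes _ = refl
  ... | no n = ⊥-elim (n refl)
  frbk : ∀ k → fr (bk k) ≡ k
  frbk zero = fr-x
  frbk (suc k) with x Finₚ.≟ punchIn x k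
  ... | yes p = ⊥-elim (Finₚ.punchInᵢ≢i x k (sym p))
  ... | no p = cong suc (trans (Finₚ.punchOut-cong x refl) (Finₚ.punchOut-punchIn x))
  bkfr : ∀ k → bk (fr k) ≡ k
  bkfr k with x Finₚ.≟ k
  ... | yes p = p
  ... | no p = Finₚ.punchIn-punchOut p

-- Inner edges carry numbers, so the three edges of an H found in a web must first be renumbered to
-- 0, 1 and 2.
front3 : ∀ {n} (x y z : Fin n) → x ≢ y → x ≢ z → y ≢ z →
  ∃ λ k → Σ (Bij n (3 + k)) λ p → fw p x ≡ zero × fw p y ≡ 1F × fw p z ≡ 2F
front3 {suc n} x y z x≢y x≢z y≢z with front x
... | p , px = go2 (fw p y) (fw p z) refl refl
  where
  go2 : ∀ y′ z′ → fw p y ≡ y′ → fw p z ≡ z′ → ∃ λ k → Σ (Bij (suc n) (3 + k)) λ q → fw q x ≡ zero × fw q y ≡ 1F × fw q z ≡ 2F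
  go2 zero _ e _ = ⊥-elim (x≢y (bij-inj p (trans px (sym e))))
  go2 (suc _) zero _ e = ⊥-elim (x≢z (bij-inj p (trans px (sym e))))
  go2 (suc y₁) (suc z₁) ey ez = go3 n y₁ z₁ p px ey ez
    where
    go3 : ∀ n (y₁ z₁ : Fin n) (p : Bij _ (suc n)) → fw p x ≡ zero → fw p y ≡ suc y₁ → fw p z ≡ suc z₁ →
      ∃ λ k → Σ (Bij _ (3 + k)) λ q → fw q x ≡ zero × fw q y ≡ 1F × fw q z ≡ 2F
    go3 (suc n) y₁ z₁ p px ey ez with front y₁
    ... | q , qy = go4 (fw q z₁) refl
      where
      pq = bij-∘ p (bij-suc q)
      ex : fw pq x ≡ zero
      ex rewrite px = refl
      go4 : ∀ w → fw q z₁ ≡ w → ∃ λ k → Σ (Bij _ (3 + k)) λ q → fw q x ≡ zero × fw q y ≡ 1F × fw q z ≡ 2F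
      go4 zero e = ⊥-elim (y≢z (bij-inj p (trans ey (trans (cong suc (bij-inj q (trans qy (sym e)))) (sym ez)))))
      go4 (suc w) e = go5 n w q qy e
        where
        go5 : ∀ n (w : Fin n) (q : Bij _ (suc n)) → fw q y₁ ≡ zero → fw q z₁ ≡ suc w → ∃ λ k → Σ (Bij _ (3 + k)) λ q → fw q x ≡ zero × fw q y ≡ 1F × fw q z ≡ 2F
        go5 (suc n) w q qy e with front w
        ... | r , rw = n , bij-∘ (bij-∘ p (bij-suc q)) (bij-suc (bij-suc r)) , hx , hy , hz
          where
          hx : fw (bij-suc (bij-suc r)) (fw (bij-suc q) (fw p x)) ≡ zero
          hx rewrite px = refl
          hy : fw (bij-suc (bij-suc r)) (fw (bij-suc q) (fw p y)) ≡ 1F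
          hy rewrite ey | qy = refl
          hz : fw (bij-suc (bij-suc r)) (fw (bij-suc q) (fw p z)) ≡ 2F
          hz rewrite ez | e | rw = refl

relabel : ∀ {m n} (X : Dessin m) (p : Bij (s X) n) →
  X ≅ dessin n (λ x → map⊎ (λ c → c) (fw p) (τ X (map⊎ (λ c → c) (bw p) x))) (λ u → fw p (ρ X (bw p u)))
relabel X p = mk≅ (fw p) (bw p) (fb p) (bf p)
  (λ x → cong (λ v → map⊎ (λ c → c) (fw p) (τ X v)) (h x)) (λ u → cong (λ v → fw p (ρ X v)) (bf p u))
  where
  h : ∀ x → map⊎ (λ c → c) (bw p) (map⊎ (λ c → c) (fw p) x) ≡ x
  h (inj₁ c) = refl
  h (inj₂ u) = cong inj₂ (bf p u)

τ-inj : ∀ {m} {X : Dessin m} → Cubic X → ∀ {x y} → τ X x ≡ τ X y → x ≡ y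
τ-inj {X = X} c {x} {y} p = trans (sym (τ³ c x)) (trans (cong (λ v → τ X (τ X v)) p) (τ³ c y))

ρ-inj : ∀ {m} {X : Dessin m} → Cubic X → ∀ {x y} → ρ X x ≡ ρ X y → x ≡ y
ρ-inj {X = X} c {x} {y} p = trans (sym (ρ³ c x)) (trans (cong (λ v → ρ X (ρ X v)) p) (ρ³ c y))

H-uncover₀ : ∀ {m n} (t : Fin (2 + m) ⊎ Fin (3 + n) → Fin (2 + m) ⊎ Fin (3 + n)) (r : Fin (3 + n) → Fin (3 + n)) →
  Cubic (dessin (3 + n) t r) → t (inj₁ zero) ≡ inj₁ 1F → t (inj₁ 1F) ≡ inj₂ 2F → r 2F ≡ 1F → r 1F ≡ zero →
  ∃ λ Y → dessin (3 + n) t r ≅ H Y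
H-uncover₀ {m} {n} t r c t0 t1 r2 r1 = dessin n (λ x → unemb (t (emb x))) (λ u → lower u (r (3+ u))) , ≅-ext τ-ok rr
  where
  X = dessin (3 + n) t r
  t2 : t (inj₂ 2F) ≡ inj₁ zero
  t2 = trans (cong t (trans (sym t1) (cong t (sym t0)))) (τ³ c (inj₁ zero))
  r0 : r zero ≡ 2F
  r0 = trans (cong r (trans (sym r1) (cong r (sym r2)))) (ρ³ c 2F)
  lower : Fin n → Fin (3 + n) → Fin n
  lower u (3+ v) = v
  lower u zero = u
  lower u 1F = u
  lower u 2F = u
  re : ∀ x → emb (unemb (t (emb x))) ≡ t (emb x)
  re x with t (emb x) in eq
  ... | y with embView y
  ... | old z = cong emb (unemb-emb z)
  ... | f1 = ⊥-elim (emb≢f3 x (τ-inj {X = X} c (trans eq (sym t2))))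
  ... | f2 = ⊥-elim (emb≢f1 x (τ-inj {X = X} c (trans eq (sym t0))))
  ... | f3 = ⊥-elim (emb≢f2 x (τ-inj {X = X} c (trans eq (sym t1))))
  τ-ok : ∀ y → t y ≡ Hτ (λ x → unemb (t (emb x))) y
  τ-ok y with embView y
  ... | old x = sym (trans (Hτ-emb (dessin n (λ x → unemb (t (emb x))) (λ u → u)) x) (re x))
  ... | f1 = t0
  ... | f2 = t1
  ... | f3 = t2
  rr : ∀ u → r u ≡ Hρ {m} (λ u → lower u (r (3+ u))) u
  rr zero = r0
  rr 1F = r1
  rr 2F = r2
  rr (3+ u) = go (r (3+ u)) refl
    where
    go : ∀ w → r (3+ u) ≡ w → r (3+ u) ≡ 3+ (lower u (r (3+ u)))
    go zero e with ρ-inj {X = X} c (trans e (sym r1))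
    ... | ()
    go 1F e with ρ-inj {X = X} c (trans e (sym r2))
    ... | ()
    go 2F e with ρ-inj {X = X} c (trans e (sym r0))
    ... | ()
    go (3+ v) e = trans e (cong 3+ (sym (cong (lower u) e)))

-- A black vertex with two boundary edges and one inner edge always belongs to an H, because the
-- inner edge ends at a trivalent white vertex.
H-uncover : ∀ {m} (X : Dessin (2 + m)) → Cubic X → ∀ {u} → τ X (inj₁ zero) ≡ inj₁ 1F → τ X (inj₁ 1F) ≡ inj₂ u → ∃ λ Y → X ≅ H Y
H-uncover X c {u} t0 t1 with front3 (ρ X (ρ X u)) (ρ X u) u
  (λ e → ρ≢ c (ρ X u) e) (λ e → ρ≢ c u (trans (cong (ρ X) (sym e)) (ρ³ c u))) (ρ≢ c u)
... | k , p , p0 , p1 , p2 = proj₁ res , ≅-trans (relabel X p) (proj₂ res)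
  where
  b2 : bw p 2F ≡ u
  b2 = trans (cong (bw p) (sym p2)) (bf p u)
  b1 : bw p 1F ≡ ρ X u
  b1 = trans (cong (bw p) (sym p1)) (bf p _)
  res = H-uncover₀ _ _ (cubic-to (proj₁ (relabel X p)) c)
    (cong (map⊎ (λ c → c) (fw p)) t0) (trans (cong (map⊎ (λ c → c) (fw p)) t1) (cong inj₂ p2))
    (trans (cong (λ v → fw p (ρ X v)) b2) p1) (trans (cong (λ v → fw p (ρ X v)) b1) p0)

T-uncover : ∀ {m} (X : Dessin (3 + m)) → Cubic X → τ X (inj₁ zero) ≡ inj₁ 1F → τ X (inj₁ 1F) ≡ inj₁ 2F → ∃ λ Y → X ≅ T Y
T-uncover {m} X c t0 t1 = dessin (s X) (λ x → proj₁ (un x)) (ρ X) , ≅-ext τ-ok (λ _ → refl)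
  where
  t2 : τ X (inj₁ 2F) ≡ inj₁ zero
  t2 = trans (cong (τ X) (trans (sym t1) (cong (τ X) (sym t0)))) (τ³ c (inj₁ zero))
  un : ∀ (x : Fin m ⊎ Fin (s X)) → ∃ λ z → τ X (embT x) ≡ embT z
  un x with τ X (embT x) in eq
  ... | y with tView y
  ... | old z = z , refl
  ... | n1 = ⊥-elim (embT-old x 2F (τ-inj {X = X} c (trans eq (sym t2))))
  ... | n2 = ⊥-elim (embT-old x zero (τ-inj {X = X} c (trans eq (sym t0))))
  ... | n3 = ⊥-elim (embT-old x 1F (τ-inj {X = X} c (trans eq (sym t1))))
  τ-ok : ∀ y → τ X y ≡ Tτ (λ x → proj₁ (un x)) y
  τ-ok y with tView y
  ... | old x = trans (proj₂ (un x)) (sym (Tτ-emb (dessin (s X) (λ x → proj₁ (un x)) (ρ X)) x))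
  ... | n1 = t0
  ... | n2 = t1
  ... | n3 = t2

-- Discharging

∑F-mono : ∀ {n} {f g : Fin n → ℕ} → (∀ i → f i ≤ g i) → ∑F f ≤ ∑F g
∑F-mono {zero} h = z≤n
∑F-mono {suc n} h = ℕₚ.+-mono-≤ (h zero) (∑F-mono (λ i → h (suc i)))

∑F-const : ∀ n k → ∑F {n} (λ _ → k) ≡ n * k
∑F-const zero k = refl
∑F-const (suc n) k = cong (k +_) (∑F-const n k)

erase : ∀ {n} → Fin n → (Fin n → ℕ) → Fin n → ℕ
erase i f k with i Finₚ.≟ k
... | yes _ = 0
... | no _ = f k

erase-≢ : ∀ {n} {i k : Fin n} (f : Fin n → ℕ) → i ≢ k → erase i f k ≡ f k
erase-≢ {i = i} {k} f n with i Finₚ.≟ k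
... | yes p = ⊥-elim (n p)
... | no _ = refl

∑F-erase : ∀ {n} (i : Fin n) f → ∑F f ≡ f i + ∑F (erase i f)
∑F-erase {suc n} zero f = cong (f zero +_) (sum-cong-≗ {n} λ k → refl)
∑F-erase {suc n} (suc i) f = begin
  f zero + ∑F (λ k → f (suc k))                              ≡⟨ cong (f zero +_) (∑F-erase i (λ k → f (suc k))) ⟩
  f zero + (f (suc i) + ∑F (erase i (λ k → f (suc k))))      ≡⟨ lem (f zero) (f (suc i)) _ ⟩
  f (suc i) + (f zero + ∑F (erase i (λ k → f (suc k))))      ≡⟨ cong (λ v → f (suc i) + (f zero + v)) (sum-cong-≗ {n} er) ⟩
  f (suc i) + ∑F (erase (suc i) f)                           ∎
  where
  open ≡-Reasoning
  lem : ∀ a b c → a + (b + c) ≡ b + (a + c)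
  lem = solve-∀
  er : ∀ k → erase i (λ k → f (suc k)) k ≡ erase (suc i) f (suc k)
  er k with i Finₚ.≟ k
  ... | yes _ = refl
  ... | no _ = refl

∑F-≥1 : ∀ {n} (f : Fin n → ℕ) i → f i ≤ ∑F f
∑F-≥1 f i = subst (f i ≤_) (sym (∑F-erase i f)) (ℕₚ.m≤m+n _ _)

∑F-≥2 : ∀ {n} (f : Fin n → ℕ) {i j} → i ≢ j → f i + f j ≤ ∑F f
∑F-≥2 f {i} {j} i≢j = subst (f i + f j ≤_) (sym (∑F-erase i f))
  (ℕₚ.+-monoʳ-≤ (f i) (subst (_≤ ∑F (erase i f)) (erase-≢ f i≢j) (∑F-≥1 (erase i f) j)))

∑F-≥3 : ∀ {n} (f : Fin n → ℕ) {i j k} → i ≢ j → i ≢ k → j ≢ k → f i + (f j + f k) ≤ ∑F f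
∑F-≥3 f {i} {j} {k} i≢j i≢k j≢k = subst (f i + (f j + f k) ≤_) (sym (∑F-erase i f))
  (ℕₚ.+-monoʳ-≤ (f i) (subst (_≤ ∑F (erase i f)) (cong₂ _+_ (erase-≢ f i≢j) (erase-≢ f i≢k)) (∑F-≥2 (erase i f) j≢k)))

only : ∀ {N} → Fin N → ℕ → Fin N → ℕ
only l v c with l Finₚ.≟ c
... | yes _ = v
... | no _ = 0

only-≡ : ∀ {N} {l c : Fin N} v → l ≡ c → only l v c ≡ v
only-≡ {l = l} {c} v p with l Finₚ.≟ c
... | yes _ = refl
... | no n = ⊥-elim (n p)

∑F-only : ∀ {N} (l : Fin N) v → ∑F (only l v) ≡ v
∑F-only {suc N} zero v = trans (cong (v +_) (trans (sum-cong-≗ {N} (λ _ → refl)) (trans (∑F-const N 0) (ℕₚ.*-zeroʳ N)))) (ℕₚ.+-identityʳ v)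
∑F-only {suc N} (suc l) v = trans (sum-cong-≗ {N} er) (∑F-only l v)
  where
  er : ∀ k → only (suc l) v (suc k) ≡ only l v k
  er k with l Finₚ.≟ k
  ... | yes _ = refl
  ... | no _ = refl

class-weights : ∀ {n N w} {R : Fin n → Fin n → Set} (C : Classes R N) (g : Fin n → ℕ) →
  (∀ c → w ≤ ∑F (λ k → only (lab C k) (g k) c)) → N * w ≤ ∑F g
class-weights {n} {N} {w} C g h = begin
  N * w                                             ≡⟨ ∑F-const N w ⟨
  ∑F {N} (λ _ → w)                                  ≤⟨ ∑F-mono h ⟩
  ∑F (λ c → ∑F (λ k → only (lab C k) (g k) c))      ≡⟨ ∑-comm {N} {n} (λ c k → only (lab C k) (g k) c) ⟩
  ∑F (λ k → ∑F (λ c → only (lab C k) (g k) c))      ≡⟨ sum-cong-≗ {n} (λ k → ∑F-only (lab C k) (g k)) ⟩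
  ∑F g                                              ∎
  where open ℕₚ.≤-Reasoning

∑F-splitAt : ∀ m {n} (f : Fin m ⊎ Fin n → ℕ) → ∑F (λ i → f (splitAt m i)) ≡ ∑F (λ i → f (inj₁ i)) + ∑F (λ i → f (inj₂ i))
∑F-splitAt zero f = refl
∑F-splitAt (suc m) {n} f = trans (cong (f (inj₁ zero) +_) (trans (sum-cong-≗ {m + n} er) (∑F-splitAt m f′))) (sym (ℕₚ.+-assoc (f (inj₁ zero)) _ _))
  where
  f′ : Fin m ⊎ Fin n → ℕ
  f′ = λ x → f (map⊎ suc (λ u → u) x)
  er : ∀ i → f (splitAt (suc m) (suc i)) ≡ f′ (splitAt m i)
  er i = refl

module _ {m : ℕ} (X : Dessin m) where
  private
    Sp : Fin (m + s X) → Edge X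
    Sp = splitAt m
    Jn : Edge X → Fin (m + s X)
    Jn = Fin.join m (s X)
    SJ : ∀ x → Sp (Jn x) ≡ x
    SJ = Finₚ.splitAt-join m (s X)
    JS : ∀ i → Jn (Sp i) ≡ i
    JS = Finₚ.join-splitAt m (s X)

  edge-orbits : (f : Edge X → Edge X) → ∃ λ N → Classes (Graph f) N
  edge-orbits f with orbits-exist (λ i → Jn (f (Sp i)))
  ... | N , C = N , transferGraph-≅ Jn Sp (λ i → sym (SJ _)) SJ JS C

  flat-classes : ∀ {N} {f : Edge X → Edge X} → Classes (Graph f) N → Classes (Graph (λ i → Jn (f (Sp i)))) N
  flat-classes {f = f} = transferGraph-≅ Sp Jn (λ x → cong (λ v → Jn (f v)) (SJ x)) JS SJ

  edge-weights : ∀ {N w} {f : Edge X → Edge X} (C : Classes (Graph f) N) (g : Edge X → ℕ) →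
    (∀ x → w ≤ ∑F (λ k → only (lab C (Sp k)) (g (Sp k)) (lab C x))) → N * w ≤ ∑F (λ j → g (inj₁ j)) + ∑F (λ u → g (inj₂ u))
  edge-weights {w = w} {f} C g h = subst (_ ≤_) (∑F-splitAt m g)
    (class-weights (flat-classes C) (λ k → g (Sp k)) λ c →
      subst (λ v → w ≤ ∑F (λ k → only (lab C (Sp k)) (g (Sp k)) v)) (lab-rep C c) (h (rep C c)))

  ∑-τ : Cubic X → (g : Edge X → ℕ) → ∑F (λ i → g (Sp i)) ≡ ∑F (λ i → g (τ X (Sp i)))
  ∑-τ c g = trans (sum-permute (λ i → g (Sp i)) π) (sum-cong-≗ {m + s X} (λ i → cong g (SJ _)))
    where
    π = mk↔ₛ′ (λ i → Jn (τ X (Sp i))) (λ i → Jn (τ X (τ X (Sp i))))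
      (λ i → trans (cong (λ v → Jn (τ X v)) (SJ _)) (trans (cong Jn (τ³ c (Sp i))) (JS i)))
      (λ i → trans (cong (λ v → Jn (τ X (τ X v))) (SJ _)) (trans (cong Jn (τ³ c (Sp i))) (JS i)))

  Jn-≢ : ∀ {x y} → x ≢ y → Jn x ≢ Jn y
  Jn-≢ n p = n (trans (sym (SJ _)) (trans (cong Sp p) (SJ _)))

  module _ {N} {f : Edge X → Edge X} (C : Classes (Graph f) N) (g : Edge X → ℕ) (c : Fin N) where
    private
      W : Fin (m + s X) → ℕ
      W k = only (lab C (Sp k)) (g (Sp k)) c
      W≡ : ∀ {x} → lab C x ≡ c → W (Jn x) ≡ g x
      W≡ {x} p = trans (only-≡ _ (trans (cong (lab C) (SJ x)) p)) (cong g (SJ x))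

    class-≥1 : ∀ {x} → lab C x ≡ c → g x ≤ ∑F W
    class-≥1 {x} p = subst (_≤ ∑F W) (W≡ p) (∑F-≥1 W (Jn x))

    class-≥2 : ∀ {x y} → x ≢ y → lab C x ≡ c → lab C y ≡ c → g x + g y ≤ ∑F W
    class-≥2 {x} {y} n p q = subst (_≤ ∑F W) (cong₂ _+_ (W≡ p) (W≡ q)) (∑F-≥2 W (Jn-≢ n))

    class-≥3 : ∀ {x y z} → x ≢ y → x ≢ z → y ≢ z → lab C x ≡ c → lab C y ≡ c → lab C z ≡ c → g x + (g y + g z) ≤ ∑F W
    class-≥3 {x} {y} {z} n₁ n₂ n₃ p q r = subst (_≤ ∑F W) (cong₂ _+_ (W≡ p) (cong₂ _+_ (W≡ q) (W≡ r)))
      (∑F-≥3 W (Jn-≢ n₁) (Jn-≢ n₂) (Jn-≢ n₃))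

-- What is known of an arbitrary web while it is dismantled. In `euler` the numbers of vertices have
-- been eliminated from Euler's formula by counting three edges at each black and each internal
-- white vertex.
record Good {m} (X : Dessin m) : Set where
  field
    cubic : Cubic X
    kr    : Kr X
    conn  : ∀ x y → EqClosure (HubLink X) x y
    F     : ℕ
    faces : Classes (Graph (ψ X)) F
    euler : 2 * m + s X + 3 ≤ 3 * F

open Good public

good-≅ : ∀ {m} {X Y : Dessin m} → Conj X Y → Good X → Good Y
good-≅ {m} {X} {Y} C G = record { cubic = cubic-to C (cubic G) ; kr = kr-to C (kr G) ; conn = hub-to C (conn G)
  ; F = F G ; faces = ψ-classes-to C (faces G) ; euler = subst (λ v → 2 * m + v + 3 ≤ 3 * F G) s≡ (euler G) }
  where
  s≡ : s X ≡ s Y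
  s≡ = ℕₚ.≤-antisym
    (Finₚ.injective⇒≤ {f = f C} λ {a} {b} p → trans (sym (f-inv′ C a)) (trans (cong (g C) p) (f-inv′ C b)))
    (Finₚ.injective⇒≤ {f = g C} λ {a} {b} p → trans (sym (f-inv C a)) (trans (cong (f C) p) (f-inv C b)))

good-H⁻ : ∀ {m} {X : Dessin (2 + m)} → Good (H X) → Good X
good-H⁻ {m} {X} G with edge-orbits X (ψ X)
... | N , C = record { cubic = H-cubic⁻ X (cubic G) ; kr = H-kr⁻ X (kr G) ; conn = H-hub⁻ X (conn G)
  ; F = N ; faces = C ; euler = eu (classes-unique (faces G) (H-ψ-classes X C)) }
  where
  eu : F G ≡ suc N → 2 * (2 + m) + s X + 3 ≤ 3 * N
  eu e = ℕₚ.+-cancelˡ-≤ 3 _ _ (subst₂′ (lem (2 * (2 + m)) (s X)) (trans (cong (3 *_) e) (lem′ N)) (euler G))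
    where
    subst₂′ : ∀ {a a′ b b′} → a ≡ a′ → b ≡ b′ → a ≤ b → a′ ≤ b′
    subst₂′ refl refl p = p
    lem : ∀ a b → a + (3 + b) + 3 ≡ 3 + (a + b + 3)
    lem = solve-∀
    lem′ : ∀ n → 3 * suc n ≡ 3 + 3 * n
    lem′ = solve-∀

good-T⁻ : ∀ {m} {X : Dessin (suc m)} → Good (T X) → Good X
good-T⁻ {m} {X} G with edge-orbits X (ψ X)
... | N , C = record { cubic = T-cubic⁻ X (cubic G) ; kr = T-kr⁻ X (kr G) ; conn = T-hub⁻ X (conn G)
  ; F = N ; faces = C ; euler = eu (classes-unique (faces G) (T-ψ-classes X C)) }
  where
  eu : F G ≡ 2 + N → 2 * suc m + s X + 3 ≤ 3 * N
  eu e = ℕₚ.+-cancelˡ-≤ 6 _ _ (subst₂′ (lem m (s X)) (trans (cong (3 *_) e) (lem′ N)) (euler G))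
    where
    subst₂′ : ∀ {a a′ b b′} → a ≡ a′ → b ≡ b′ → a ≤ b → a′ ≤ b′
    subst₂′ refl refl p = p
    lem : ∀ a b → 2 * (3 + suc a) + b + 3 ≡ 6 + (2 * suc a + b + 3)
    lem = solve-∀
    lem′ : ∀ n → 3 * (2 + n) ≡ 6 + 3 * n
    lem′ = solve-∀

-- The step from j does not lead from the last edge back to edge 0. Codes are read from edge 0 on,
-- so a piece that is taken off must not straddle this place.
Linear : ∀ {m} → Fin m → Set
Linear j = toℕ (next j) ≡ suc (toℕ j)

linear⊎wrap : ∀ {m} (j : Fin m) → Linear j ⊎ (suc (toℕ j) ≡ m)
linear⊎wrap {suc m} j with view j
... | ‵fromℕ = inj₂ (cong suc (Finₚ.toℕ-fromℕ m))
... | ‵inject₁ i = inj₁ (cong suc (sym (Finₚ.toℕ-inject₁ i)))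

wrap-0 : ∀ {m} (j : Fin (suc m)) → suc (toℕ j) ≡ suc m → next j ≡ zero
wrap-0 {m} j p with view j
... | ‵fromℕ = refl
... | ‵inject₁ i = ⊥-elim (ℕₚ.<-irrefl (trans (sym (Finₚ.toℕ-inject₁ i)) (ℕₚ.suc-injective p)) (Finₚ.toℕ<n i))

linear? : ∀ {m} (j : Fin m) → Dec (Linear j)
linear? j = toℕ (next j) ℕ.≟ suc (toℕ j)

next-inj : ∀ {m} {a b : Fin m} → next a ≡ next b → a ≡ b
next-inj {a = a} {b} p = trans (sym (prev-next a)) (trans (cong prev p) (prev-next b))

prev-inj : ∀ {m} {a b : Fin m} → prev a ≡ prev b → a ≡ b
prev-inj {a = a} {b} p = trans (sym (next-prev a)) (trans (cong next p) (next-prev b))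

_≟E_ : ∀ {m n} (x y : Fin m ⊎ Fin n) → Dec (x ≡ y)
_≟E_ = Sumₚ.≡-dec Finₚ._≟_ Finₚ._≟_

module Charge {m} (X : Dessin m) (G : Good X) where

  -- Boundary edge j starts a gap towards j + 1 which is closed by a path through
  -- one (y-gap) or two (h-gap) black vertices.
  data Gap (j : Fin m) : Set where
    y-gap : τ X (inj₁ j) ≡ inj₁ (next j) → Gap j
    h-gap : ∀ u → τ X (inj₁ j) ≡ inj₂ u → τ X (inj₂ (ρ X u)) ≡ inj₁ (next j) → Gap j
    other : τ X (inj₁ j) ≢ inj₁ (next j) → (∀ u → τ X (inj₁ j) ≡ inj₂ u → τ X (inj₂ (ρ X u)) ≢ inj₁ (next j)) → Gap j

  gap : ∀ j → Gap j
  gap j = go (τ X (inj₁ j)) refl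
    where
    go : ∀ t → τ X (inj₁ j) ≡ t → Gap j
    go (inj₁ c) e with c Finₚ.≟ next j
    ... | yes refl = y-gap e
    ... | no n = other (λ p → n (Sumₚ.inj₁-injective (trans (sym e) p))) (λ u p → case-⊥ (trans (sym e) p))
      where
      case-⊥ : ∀ {u : Fin (s X)} {A : Set} → inj₁ {B = Fin (s X)} c ≡ inj₂ u → A
      case-⊥ ()
    go (inj₂ u) e with τ X (inj₂ (ρ X u)) ≟E inj₁ (next j)
    ... | yes p = h-gap u e p
    ... | no n = other (λ p → case-⊥ (trans (sym e) p)) (λ v p → subst (λ w → τ X (inj₂ (ρ X w)) ≢ inj₁ (next j)) (Sumₚ.inj₂-injective (trans (sym e) p)) n)
      where
      case-⊥ : ∀ {c : Fin m} {A : Set} → inj₂ u ≡ inj₁ c → A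
      case-⊥ ()

  weight : ∀ {j} → Gap j → ℕ
  weight (y-gap _) = 6
  weight (h-gap _ _ _) = 4
  weight (other _ _) = 3

  -- Every face is to receive 6. An inner edge gives 2; the boundary edge of a gap gives 6 if it is
  -- alone on the face, 4 if one inner edge helps, and 3 otherwise, for then the face has a second
  -- boundary edge or two inner ones.
  charge : Edge X → ℕ
  charge (inj₁ j) = weight (gap j)
  charge (inj₂ u) = 2

  3≤weight : ∀ {j} (g : Gap j) → 3 ≤ weight g
  3≤weight (y-gap _) = ℕₚ.m≤m+n 3 3
  3≤weight (h-gap _ _ _) = ℕₚ.m≤m+n 3 1
  3≤weight (other _ _) = ℕₚ.≤-refl

  ψ-inner : ∀ {x u} → ψ X x ≡ inj₂ u → Run X x 1 (ψ X x)
  ψ-inner {x} e = go (τ X x) refl e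
    where
    go : ∀ t → τ X x ≡ t → ∀ {u} → hubρ X (τ X x) ≡ inj₂ u → Run X x 1 (ψ X x)
    go (inj₁ c) p q with trans (sym q) (cong (hubρ X) p)
    ... | ()
    go (inj₂ v) p q = subst (Run X x 1) (sym (cong (hubρ X) p)) (there p here)

  no-fix : ∀ {x u} → x ≡ inj₂ u → ψ X x ≢ x
  no-fix {x} refl e with proj₁ (kr G x 1 ℕₚ.≤-refl (subst (Run X x 1) e (ψ-inner e)) λ { (suc j) _ (s≤s ()) })
  ... | s≤s ()

  no-fix² : ∀ {x u v} → x ≡ inj₂ u → ψ X x ≡ inj₂ v → ψ X (ψ X x) ≢ x
  no-fix² {x} refl p e with proj₁ (kr G x 2 (s≤s z≤n) (subst (Run X x 2) e (run-++ (ψ-inner p) (ψ-inner e))) λ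
     { (suc zero) _ _ r → no-fix refl (run-det (ψ-inner p) r) ; (suc (suc j)) _ (s≤s (s≤s ())) })
  ... | s≤s (s≤s ())

  private
    C = faces G
    lψ : ∀ x → lab C (ψ X x) ≡ lab C x
    lψ x = sym (sound C refl)

  W : Edge X → ℕ
  W x = ∑F (λ k → only (lab C (splitAt m k)) (charge (splitAt m k)) (lab C x))

  ge2 : ∀ {x y} → x ≢ y → lab C y ≡ lab C x → 6 ≤ charge x + charge y → 6 ≤ W x
  ge2 {x} n e h = ℕₚ.≤-trans h (class-≥2 X C charge (lab C x) n refl e)

  τ-of : ∀ {x c} → ψ X x ≡ inj₁ c → τ X x ≡ inj₁ (next c)
  τ-of {x} {c} e = go (τ X x) refl
    where
    go : ∀ t → τ X x ≡ t → τ X x ≡ inj₁ (next c)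
    go (inj₁ d) p = trans p (cong inj₁ (trans (sym (next-prev d)) (cong next (Sumₚ.inj₁-injective (trans (sym (cong (hubρ X) p)) e)))))
    go (inj₂ v) p with trans (sym (cong (hubρ X) p)) e
    ... | ()

  ψ-split : ∀ {x v} → ψ X x ≡ inj₂ v → ∃ λ u → τ X x ≡ inj₂ u × v ≡ ρ X u
  ψ-split {x} {v} e = go (τ X x) refl
    where
    go : ∀ t → τ X x ≡ t → ∃ λ u → τ X x ≡ inj₂ u × v ≡ ρ X u
    go (inj₁ d) p with trans (sym e) (cong (hubρ X) p)
    ... | ()
    go (inj₂ u) p = u , p , Sumₚ.inj₂-injective (trans (sym e) (cong (hubρ X) p))

  boundary-heavy : ∀ j → 6 ≤ W (inj₁ j)
  boundary-heavy j with gap j in gj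
  ... | y-gap e = subst (_≤ W (inj₁ j)) (cong weight gj) (class-≥1 X C charge (lab C (inj₁ j)) refl)
  ... | h-gap u e e′ = ge2 {inj₁ j} {ψ X (inj₁ j)} (λ p → ⊥-elim (dis (trans p (cong (hubρ X) e)))) (lψ _)
          (ℕₚ.≤-reflexive (sym (cong₂ _+_ (cong weight gj) (cong charge (cong (hubρ X) e)))))
    where
    dis : ∀ {c : Fin m} {v : Fin (s X)} → inj₁ c ≢ inj₂ v
    dis ()
  ... | other n₁ n₂ = go (ψ X (inj₁ j)) refl
    where
    ch : charge (inj₁ j) ≡ 3
    ch = cong weight gj
    go : ∀ y → ψ X (inj₁ j) ≡ y → 6 ≤ W (inj₁ j)
    go (inj₁ c) p = ge2 {inj₁ j} {inj₁ c} (λ { refl → n₁ (τ-of p) }) (trans (cong (lab C) (sym p)) (lψ _))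
      (subst (λ v → 6 ≤ v + charge (inj₁ c)) (sym ch) (ℕₚ.+-monoʳ-≤ 3 (3≤weight (gap c))))
    go (inj₂ v) p = go′ (ψ X (inj₂ v)) refl
      where
      p′ : ∃ λ u → τ X (inj₁ j) ≡ inj₂ u × v ≡ ρ X u
      p′ = ψ-split p
      lv : lab C (inj₂ v) ≡ lab C (inj₁ j)
      lv = trans (cong (lab C) (sym p)) (lψ _)
      go′ : ∀ y → ψ X (inj₂ v) ≡ y → 6 ≤ W (inj₁ j)
      go′ (inj₁ c) q = ge2 {inj₁ j} {inj₁ c}
        (λ { refl → n₂ _ (proj₁ (proj₂ p′)) (trans (cong (λ w → τ X (inj₂ w)) (sym (proj₂ (proj₂ p′)))) (τ-of q)) })
        (trans (cong (lab C) (sym q)) (trans (lψ _) lv))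
        (subst (λ v → 6 ≤ v + charge (inj₁ c)) (sym ch) (ℕₚ.+-monoʳ-≤ 3 (3≤weight (gap c))))
      go′ (inj₂ w) q = ℕₚ.≤-trans (ℕₚ.m≤m+n 6 1) (subst (λ z → z + 4 ≤ W (inj₁ j)) ch
        (class-≥3 X C charge (lab C (inj₁ j)) {inj₁ j} {inj₂ v} {inj₂ w} (λ ()) (λ ())
          (λ e → no-fix refl (trans q (sym e))) refl lv (trans (cong (lab C) (sym q)) (trans (lψ _) lv))))

  face-heavy : ∀ x → 6 ≤ W x
  face-heavy (inj₁ j) = boundary-heavy j
  face-heavy (inj₂ u) = go (ψ X (inj₂ u)) refl
    where
    via : ∀ c → lab C (inj₁ c) ≡ lab C (inj₂ u) → 6 ≤ W (inj₂ u)
    via c e = subst (λ l → 6 ≤ ∑F (λ k → only (lab C (splitAt m k)) (charge (splitAt m k)) l)) e (boundary-heavy c)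
    go : ∀ y → ψ X (inj₂ u) ≡ y → 6 ≤ W (inj₂ u)
    go (inj₁ c) p = via c (trans (cong (lab C) (sym p)) (lψ _))
    go (inj₂ v) p = go′ (ψ X (inj₂ v)) refl
      where
      lv : lab C (inj₂ v) ≡ lab C (inj₂ u)
      lv = trans (cong (lab C) (sym p)) (lψ _)
      go′ : ∀ y → ψ X (inj₂ v) ≡ y → 6 ≤ W (inj₂ u)
      go′ (inj₁ c) q = via c (trans (cong (lab C) (sym q)) (trans (lψ _) lv))
      go′ (inj₂ w) q = class-≥3 X C charge (lab C (inj₂ u)) {inj₂ u} {inj₂ v} {inj₂ w}
        (λ e → no-fix refl (trans p (sym e)))
        (λ e → no-fix² refl p (trans (cong (ψ X) p) (trans q (sym e))))
        (λ e → no-fix refl (trans q (sym e)))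
        refl lv (trans (cong (lab C) (sym q)) (trans (lψ _) lv))

  -- Six units per face against twice Euler's inequality; the charge 2 of an inner edge is chosen so
  -- that inner edges cancel.
  total : 4 * m + 6 ≤ ∑F (λ j → weight (gap j))
  total = ℕₚ.+-cancelʳ-≤ (s X * 2) _ _ (begin
    4 * m + 6 + s X * 2          ≡⟨ lem m (s X) ⟩
    2 * (2 * m + s X + 3)        ≤⟨ ℕₚ.*-monoʳ-≤ 2 (euler G) ⟩
    2 * (3 * F G)                ≡⟨ lem′ (F G) ⟩
    F G * 6                      ≤⟨ edge-weights X C charge face-heavy ⟩
    ∑F (λ j → weight (gap j)) + ∑F {s X} (λ _ → 2)  ≡⟨ cong (∑F (λ j → weight (gap j)) +_) (∑F-const (s X) 2) ⟩
    ∑F (λ j → weight (gap j)) + s X * 2 ∎)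
    where
    open ℕₚ.≤-Reasoning
    lem : ∀ m s → 4 * m + 6 + s * 2 ≡ 2 * (2 * m + s + 3)
    lem = solve-∀
    lem′ : ∀ n → 2 * (3 * n) ≡ n * 6
    lem′ = solve-∀

  -- A place where an H or a tripod on consecutive boundary edges can be taken off.
  Reducible : Fin m → Set
  Reducible a = Linear a × τ X (inj₁ a) ≡ inj₁ (next a) ×
    ((∃ λ u → τ X (inj₁ (next a)) ≡ inj₂ u) ⊎ (Linear (next a) × τ X (inj₁ (next a)) ≡ inj₁ (next (next a))))

  inner? : (x : Edge X) → Dec (∃ λ u → x ≡ inj₂ u)
  inner? (inj₁ c) = no λ ()
  inner? (inj₂ u) = yes (u , refl)

  reducible? : ∀ a → Dec (Reducible a)
  reducible? a = linear? a ×-dec (_ ≟E _) ×-dec (inner? _ ⊎-dec (linear? (next a) ×-dec (_ ≟E _)))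

  module _ (none : ∀ a → ¬ Reducible a) where
    private c = cubic G

    Tight : Fin m → Set
    Tight j = Linear j × τ X (inj₁ j) ≡ inj₁ (next j)

    tight? : ∀ j → Dec (Tight j)
    tight? j = linear? j ×-dec (_ ≟E _)

    h : Edge X → ℕ
    h (inj₁ j) with tight? j
    ... | yes _ = 1
    ... | no _ = 0
    h (inj₂ u) = 0

    -- The gap from the last edge to edge 0 counts only 3, since nothing may be taken off there.
    -- This loses at most 3, less than the surplus 6 in `total`.
    gw : Edge X → ℕ
    gw (inj₁ j) with linear? j
    ... | yes _ = weight (gap j)
    ... | no _ = 3
    gw (inj₂ u) = 4

    h-cases : ∀ x → h x ≡ 0 ⊎ (h x ≡ 1 × ∃ λ j → x ≡ inj₁ j × Tight j)
    h-cases (inj₁ j) with tight? j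
    ... | yes t = inj₂ (refl , j , refl , t)
    ... | no _ = inj₁ refl
    h-cases (inj₂ u) = inj₁ refl

    h-not : ∀ {j} → ¬ Tight j → h (inj₁ j) ≡ 0
    h-not {j} n with tight? j
    ... | yes t = ⊥-elim (n t)
    ... | no _ = refl

    g-not : ∀ {j c} → ¬ Tight j → τ X (inj₁ j) ≡ inj₁ c → gw (inj₁ j) ≡ 3
    g-not {j} n e with linear? j
    ... | no _ = refl
    ... | yes l with gap j
    ... | y-gap p = ⊥-elim (n (l , p))
    ... | h-gap u p _ with trans (sym e) p
    ... | ()
    g-not {j} n e | yes l | other _ _ = refl

    g-≤ : ∀ x → gw x ≤ 4 + 2 * h x
    g-≤ (inj₂ u) = ℕₚ.≤-refl
    g-≤ (inj₁ j) with tight? j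
    ... | yes t = g≤6
      where
      g≤6 : gw (inj₁ j) ≤ 6
      g≤6 with linear? j
      ... | no _ = ℕₚ.m≤m+n 3 3
      ... | yes _ with gap j
      ... | y-gap _ = ℕₚ.≤-refl
      ... | h-gap _ _ _ = ℕₚ.m≤m+n 4 2
      ... | other _ _ = ℕₚ.m≤m+n 3 3
    ... | no n with linear? j
    ... | no _ = ℕₚ.m≤m+n 3 1
    ... | yes l with gap j
    ... | y-gap p = ⊥-elim (n (l , p))
    ... | h-gap _ _ _ = ℕₚ.≤-refl
    ... | other _ _ = ℕₚ.m≤m+n 3 1

    tripod : ∀ {j} → Tight j → ∃ λ d → τ X (inj₁ (next j)) ≡ inj₁ d × τ X (inj₁ d) ≡ inj₁ j ×
      ¬ Tight (next j) × ¬ Tight d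
    tripod {j} (l , e) = go (τ X (inj₁ (next j))) refl
      where
      go : ∀ t → τ X (inj₁ (next j)) ≡ t → ∃ λ d → τ X (inj₁ (next j)) ≡ inj₁ d × τ X (inj₁ d) ≡ inj₁ j × ¬ Tight (next j) × ¬ Tight d
      go (inj₂ u) p = ⊥-elim (none j (l , e , inj₁ (u , p)))
      go (inj₁ d) p = d , p , q , (λ { (l′ , e′) → none j (l , e , inj₂ (l′ , e′)) }) , nd
        where
        q : τ X (inj₁ d) ≡ inj₁ j
        q = trans (cong (τ X) (trans (sym p) (cong (τ X) (sym e)))) (τ³ c (inj₁ j))
        nd : ¬ Tight d
        nd (l′ , e′) with trans (sym q) e′
        ... | refl = none d (l′ , e′ , inj₂ (l , e))

    light-sum : ∀ x {a b} → gw x ≡ 3 → a ≡ 1 → b ≡ 0 → gw x + (a + b) ≤ 4 + 2 * h x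
    light-sum x p refl refl rewrite p = ℕₚ.m≤m+n 4 _

    light-sum′ : ∀ x {a b} → gw x ≡ 3 → a ≡ 0 → b ≡ 1 → gw x + (a + b) ≤ 4 + 2 * h x
    light-sum′ x p refl refl rewrite p = ℕₚ.m≤m+n 4 _

    -- A second discharging, around black vertices. A tight edge may weigh 6, two more than the
    -- average 4, and draws one unit from each of the other two edges at its black vertex. With no
    -- reducible place these are boundary edges of weight 3 that are not tight themselves.
    pointwise : ∀ x → gw x + (h (τ X x) + h (τ X (τ X x))) ≤ 4 + 2 * h x
    pointwise x with h-cases x
    ... | inj₂ (hx , j , refl , t) with tripod t
    ... | d , p , q , n₁ , n₂ = subst₂ (trans (h-eq (proj₂ t)) (h-not n₁)) (trans (h-eq (trans (cong (τ X) (proj₂ t)) p)) (h-not n₂))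
      where
      h-eq : ∀ {x y} → x ≡ y → h x ≡ h y
      h-eq = cong h
      subst₂ : ∀ {a b} → a ≡ 0 → b ≡ 0 → gw (inj₁ j) + (a + b) ≤ 4 + 2 * h (inj₁ j)
      subst₂ refl refl = ℕₚ.≤-trans (ℕₚ.≤-reflexive (ℕₚ.+-identityʳ _)) (g-≤ (inj₁ j))
    pointwise x | inj₁ hx with h-cases (τ X x)
    ... | inj₂ (h1 , j , e , t) with tripod t
    ... | d , p , q , n₁ , n₂ = light-sum x
        (trans (cong gw (τ-inj {X = X} c {x} {inj₁ d} (trans e (sym q)))) (g-not n₂ q)) h1
        (trans (cong h (trans (cong (τ X) e) (proj₂ t))) (h-not n₁))
    pointwise x | inj₁ hx | inj₁ h1 with h-cases (τ X (τ X x))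
    ... | inj₁ h2 rewrite h1 | h2 = ℕₚ.≤-trans (ℕₚ.≤-reflexive (ℕₚ.+-identityʳ _)) (g-≤ x)
    ... | inj₂ (h2 , j , e , t) with tripod t
    ... | d , p , q , n₁ , n₂ = light-sum′ x (trans (cong gw xb) (g-not n₁ p)) h1 h2
      where
      xb : x ≡ inj₁ (next j)
      xb = trans (sym (τ³ c x)) (trans (cong (τ X) e) (proj₂ t))

    private
      Sp : Fin (m + s X) → Edge X
      Sp = splitAt m
      ΣE : (Edge X → ℕ) → ℕ
      ΣE k = ∑F (λ i → k (Sp i))

    light : ∑F (λ j → gw (inj₁ j)) ≤ 4 * m
    light = ℕₚ.+-cancelʳ-≤ (s X * 4) _ _ (ℕₚ.+-cancelʳ-≤ (ΣE h + ΣE h) _ _ (begin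
      ∑F (λ j → gw (inj₁ j)) + s X * 4 + (ΣE h + ΣE h)
        -- Summed over all edges, h, h after τ and h after two τ have the same total, so the units
        -- exchanged cancel.
        ≡⟨ cong₂ _+_ (trans (cong (∑F (λ j → gw (inj₁ j)) +_) (sym (∑F-const (s X) 4))) (sym (∑F-splitAt m gw)))
             (cong₂ _+_ (∑-τ X c h) (trans (∑-τ X c h) (∑-τ X c (λ x → h (τ X x))))) ⟩
      ΣE gw + (ΣE (λ x → h (τ X x)) + ΣE (λ x → h (τ X (τ X x))))
        ≡⟨ sym (trans (∑-distrib-+ {m + s X} _ _) (cong (ΣE gw +_) (∑-distrib-+ {m + s X} _ _))) ⟩
      ΣE (λ x → gw x + (h (τ X x) + h (τ X (τ X x))))  ≤⟨ ∑F-mono (λ i → pointwise (Sp i)) ⟩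
      ΣE (λ x → 4 + 2 * h x)  ≡⟨ ∑-distrib-+ {m + s X} _ _ ⟩
      ΣE (λ x → 4) + ΣE (λ x → 2 * h x)  ≡⟨ cong₂ _+_ (∑F-const (m + s X) 4) (trans (sum-cong-≗ {m + s X} (λ i → cong (h (Sp i) +_) (ℕₚ.+-identityʳ _))) (∑-distrib-+ {m + s X} _ _)) ⟩
      (m + s X) * 4 + (ΣE h + ΣE h)  ≡⟨ cong (_+ (ΣE h + ΣE h)) (lem m (s X)) ⟩
      4 * m + s X * 4 + (ΣE h + ΣE h) ∎))
      where
      open ℕₚ.≤-Reasoning
      lem : ∀ m s → (m + s) * 4 ≡ 4 * m + s * 4
      lem = solve-∀

  weight≤6 : ∀ {j} (k : Gap j) → weight k ≤ 6
  weight≤6 (y-gap _) = ℕₚ.≤-refl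
  weight≤6 (h-gap _ _ _) = ℕₚ.m≤m+n 4 2
  weight≤6 (other _ _) = ℕₚ.m≤m+n 3 3

reducible : ∀ {m} (X : Dessin (suc m)) (G : Good X) → ∃ λ a → Charge.Reducible X G a
reducible {m} X G with any? (Charge.reducible? X G)
... | yes r = r
... | no nr = ⊥-elim (ℕₚ.<-irrefl refl (begin-strict
    4 * suc m + 3                   <⟨ ℕₚ.+-monoʳ-< (4 * suc m) (ℕₚ.m≤m+n 4 2) ⟩
    4 * suc m + 6                   ≤⟨ total ⟩
    ∑F (λ j → weight (gap j))       ≤⟨ ∑F-mono one ⟩
    ∑F (λ j → gw none (inj₁ j) + only (fromℕ m) 3 j) ≡⟨ ∑-distrib-+ {suc m} (λ j → gw none (inj₁ j)) (only (fromℕ m) 3) ⟩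
    ∑F (λ j → gw none (inj₁ j)) + ∑F (only (fromℕ m) 3) ≡⟨ cong (∑F (λ j → gw none (inj₁ j)) +_) (∑F-only (fromℕ m) 3) ⟩
    ∑F (λ j → gw none (inj₁ j)) + 3  ≤⟨ ℕₚ.+-monoˡ-≤ 3 (light none) ⟩
    4 * suc m + 3                   ∎))
  where
  open Charge X G
  open ℕₚ.≤-Reasoning
  none : ∀ a → ¬ Reducible a
  none a r = nr (a , r)
  one : ∀ j → weight (gap j) ≤ gw none (inj₁ j) + only (fromℕ m) 3 j
  one j with linear? j
  ... | yes _ = ℕₚ.m≤m+n _ _
  ... | no n with linear⊎wrap j
  ... | inj₁ l = ⊥-elim (n l)
  ... | inj₂ e = ℕₚ.≤-trans (weight≤6 (gap j)) (ℕₚ.≤-reflexive (cong (3 +_) (sym (only-≡ 3 (sym (Finₚ.toℕ-injective (trans (ℕₚ.suc-injective e) (sym (Finₚ.toℕ-fromℕ m)))))))))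

-- Codes

-- The face between boundary edges a and a + 1 is closed by a path through j + 1 black vertices.
CG : ∀ {m} → Dessin m → Fin m → ℕ → Set
CG X a j = Arr X (inj₁ a) j (next a)

pb-next : ∀ {m} {X Y : Dessin m} (C : Conj X Y) a → pb C (next a) ≡ next (pb C a)
pb-next C a = trans (sym (next-prev _)) (cong next (trans (pb-prev C (next a)) (cong (pb C) (prev-next a))))

cg-to : ∀ {m} {X Y : Dessin m} (C : Conj X Y) {a j} → CG X a j → CG Y (pb C a) j
cg-to {Y = Y} C {a} {j} c = subst (Arr Y (inj₁ (pb C a)) j) (pb-next C a) (arr-to C c)

cg-≅ : ∀ {m} {X Y : Dessin m} → X ≅ Y → ∀ {a j} → CG X a j → CG Y a j
cg-≅ {Y = Y} I {a} {j} c = subst (λ v → CG Y v j) (proj₂ I a) (cg-to (proj₁ I) c)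

cg-det : ∀ {m} {X : Dessin m} {a j k} → CG X a j → CG X a k → j ≡ k
cg-det {X = X} p q = proj₁ (arr-det {X = X} p q)

linear : ∀ {m} {a : Fin m} → suc (toℕ a) < m → Linear a
linear {a = a} h with linear⊎wrap a
... | inj₁ l = l
... | inj₂ e = ⊥-elim (ℕₚ.<-irrefl e h)

linear-< : ∀ {m} {a : Fin m} → Linear a → suc (toℕ a) < m
linear-< {a = a} l = subst (_< _) l (Finₚ.toℕ<n (next a))

module _ {m} (X : Dessin (2 + m)) where

  cg-H-0 : CG (H X) zero 0
  cg-H-0 = inj₁ zero , here , refl

  cg-H : ∀ {a j} → a ≢ zero → a ≢ 1F → next a ≢ zero → CG X a j → CG (H X) a j
  cg-H {zero} n _ _ _ = ⊥-elim (n refl)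
  cg-H {1F} _ n _ _ = ⊥-elim (n refl)
  cg-H {suc (suc a)} {j} _ _ n c = go (next (suc (suc a))) refl c
    where
    go : ∀ d → next (suc (suc a)) ≡ d → Arr X (inj₁ (suc (suc a))) j d → Arr (H X) (inj₁ (suc (suc a))) j d
    go zero e = ⊥-elim (n e)
    go 1F e with next-inj {a = suc (suc a)} {b = zero} e
    ... | ()
    go (suc (suc d)) e c = arr-emb X c

  cg-H-before : ∀ {a j} → a ≢ zero → a ≢ 1F → next a ≡ zero → CG X a j → CG (H X) a (suc j)
  cg-H-before {zero} n _ _ _ = ⊥-elim (n refl)
  cg-H-before {1F} _ n _ _ = ⊥-elim (n refl)
  cg-H-before {suc (suc a)} {j} _ _ e c = subst (Arr (H X) (inj₁ (suc (suc a))) (suc j)) (sym e)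
    (arr-emb-0 X (subst (Arr X (inj₁ (suc (suc a))) j) e c))

  cg-H-after : ∀ {j} → next 1F ≢ zero → CG X 1F j → CG (H X) 1F (suc j)
  cg-H-after {j} n c = go (next 1F) refl c
    where
    go : ∀ d → next {2 + m} 1F ≡ d → Arr X (inj₁ 1F) j d → Arr (H X) (inj₁ 1F) (suc j) d
    go zero e = ⊥-elim (n e)
    go 1F e with next-inj {a = 1F} {b = zero} e
    ... | ()
    go (suc (suc d)) e c = arr-from-1 X (arr-emb X c)

iter-next-toℕ : ∀ {m} (a : Fin m) k → toℕ a + k < m → toℕ (iter next k a) ≡ toℕ a + k
iter-next-toℕ a zero h = sym (ℕₚ.+-identityʳ _)
iter-next-toℕ {m} a (suc k) h = trans (linear {a = iter next k a} (subst (λ v → suc v < m) (sym ih) h′)) (trans (cong suc ih) (sym (ℕₚ.+-suc _ k)))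
  where
  h′ : suc (toℕ a + k) < m
  h′ = subst (_< m) (ℕₚ.+-suc _ k) h
  ih = iter-next-toℕ a k (ℕₚ.<-trans (ℕₚ.n<1+n _) h′)

rotN : ∀ {m} → ℕ → Dessin m → Dessin m
rotN zero X = X
rotN (suc k) X = rot (rotN k X)

unrotN : ∀ {m} → ℕ → Dessin m → Dessin m
unrotN zero X = X
unrotN (suc k) X = unrot (unrotN k X)

rotN-conj : ∀ {m} k (X : Dessin m) → Σ (Conj X (rotN k X)) λ C → ∀ a → pb C a ≡ iter prev k a
rotN-conj zero X = conj-refl X , λ _ → refl
rotN-conj (suc k) X = conj-trans (proj₁ (rotN-conj k X)) (rot-conj (rotN k X)) , λ a → cong prev (proj₂ (rotN-conj k X) a)

iter-prev-toℕ : ∀ {m} (a : Fin (suc m)) → iter prev (toℕ a) a ≡ zero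
iter-prev-toℕ a = go (toℕ a) a refl
  where
  iter-comm : ∀ {m} k (a : Fin m) → iter prev (suc k) a ≡ iter prev k (prev a)
  iter-comm zero a = refl
  iter-comm (suc k) a = cong prev (iter-comm k a)
  go : ∀ {m} k (a : Fin (suc m)) → toℕ a ≡ k → iter prev k a ≡ zero
  go zero zero e = refl
  go (suc k) (suc a) e = trans (iter-comm k (suc a)) (go k (inject₁ a) (trans (Finₚ.toℕ-inject₁ a) (ℕₚ.suc-injective e)))

-- X arises from Y by gluing an H to the boundary edges a and a + 1.
record HStep {m} (X Y : Dessin m) (a : Fin m) : Set where
  field
    at     : CG X a 0
    else   : ∀ {b j} → b ≢ a → b ≢ next a → next b ≢ a → CG Y b j → CG X b j
    before : ∀ {b j} → b ≢ a → b ≢ next a → next b ≡ a → CG Y b j → CG X b (suc j)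
    after  : ∀ {j} → next (next a) ≢ a → CG Y (next a) j → CG X (next a) (suc j)
    closed : ∀ {j} → CG Y a j → 3 ≤ suc j

open HStep public

h-step : ∀ {m} (X : Dessin (2 + m)) → Closable X → HStep (H X) X zero
h-step X cl = record { at = cg-H-0 X ; else = cg-H X ; before = cg-H-before X ; after = cg-H-after X ; closed = λ {j} c → proj₁ (cl j c) }

h-step-conj : ∀ {m} {X Y X′ Y′ : Dessin m} {a} (C : Conj X X′) (D : Conj Y′ Y) → (∀ c → pb C (pb D c) ≡ c) →
  HStep X Y a → HStep X′ Y′ (pb C a)
h-step-conj {X = X} {Y} {X′} {Y′} {a} C D inv h = record
  { at = cg-to C (at h)
  ; else = λ {b} n₁ n₂ n₃ c → back (else h (λ e → n₁ (to-a e)) (λ e → n₂ (to-na e)) (λ e → n₃ (to-nb e)) (cg-to D c))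
  ; before = λ {b} n₁ n₂ e c → back (before h (λ e → n₁ (to-a e)) (λ e → n₂ (to-na e)) (trans (sym (pb-next D b)) (trans (cong (pb D) e) (inv′ a))) (cg-to D c))
  ; after = λ {j} n c → subst (λ v → CG X′ v (suc j)) (pb-next C a) (cg-to C (after h
      (λ e → n (trans (cong next (sym (pb-next C a))) (trans (sym (pb-next C (next a))) (cong (pb C) e))))
      (subst (λ v → CG Y v j) (trans (cong (pb D) (sym (pb-next C a))) (inv′ (next a))) (cg-to D c))))
  ; closed = λ {j} c → closed h (subst (λ v → CG Y v j) (inv′ a) (cg-to D c)) }
  where
  inv′ : ∀ c → pb D (pb C c) ≡ c
  inv′ c = trans (cong (pb D) (sym (trans (cong (pb C) (pb-inv D _)) refl)))
    (trans (cong (λ v → pb D (pb C v)) (pb-inv D c)) (trans (cong (λ v → pb D (pb C v)) (sym (pb-inv D c))) (trans (cong (pb D) (inv (pb⁻ D c))) (pb-inv D c))))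
  to-a : ∀ {b} → pb D b ≡ a → b ≡ pb C a
  to-a {b} e = trans (sym (inv b)) (cong (pb C) e)
  to-na : ∀ {b} → pb D b ≡ next a → b ≡ next (pb C a)
  to-na {b} e = trans (sym (inv b)) (trans (cong (pb C) e) (pb-next C a))
  to-nb : ∀ {b} → next (pb D b) ≡ a → next b ≡ pb C a
  to-nb {b} e = trans (sym (inv (next b))) (cong (pb C) (trans (pb-next D b) e))
  back : ∀ {b j} → CG X (pb D b) j → CG X′ b j
  back {b} {j} c = subst (λ v → CG X′ v j) (inv b) (cg-to C c)

-- The faces of a tripod on a … whose last leg crosses n strands.
record Pattern {m} (X : Dessin m) (a : Fin m) (n : ℕ) : Set where
  field
    first : CG X a 0
    mid   : ∀ k → k < n → CG X (iter next (suc k) a) 1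
    last  : CG X (iter next (suc n) a) 0

open Pattern public

pattern-to : ∀ {m} {X Y : Dessin m} (C : Conj X Y) {a n} → Pattern X a n → Pattern Y (pb C a) n
pattern-to {Y = Y} C {a} {n} P = record
  { first = cg-to C (first P)
  ; mid = λ k h → subst (λ v → CG Y v 1) (it (suc k)) (cg-to C (mid P k h))
  ; last = subst (λ v → CG Y v 0) (it (suc n)) (cg-to C (last P)) }
  where
  it : ∀ k → pb C (iter next k a) ≡ iter next k (pb C a)
  it zero = refl
  it (suc k) = trans (pb-next C _) (cong next (it k))

iter-suc : ∀ {A : Set} (f : A → A) k x → iter f (suc k) x ≡ iter f k (f x)
iter-suc f zero x = refl
iter-suc f (suc k) x = cong f (iter-suc f k x)

-- The face shut by the H passes at least three black vertices, the gaps of a pattern pass one or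
-- two, so the H is not glued across a gap of the pattern. If it ends where the pattern begins, or
-- begins where it ends, the pattern grows by one crossed strand; otherwise the pattern survives
-- unchanged.
module _ {m} {X Y : Dessin m} {a b : Fin m} {n : ℕ} (h : HStep X Y a) (l : Linear a) (P : Pattern Y b n) (bound : toℕ b + n + 3 ≤ m) where
  private
    pos : ∀ k → k ≤ 2 + n → toℕ (iter next k b) ≡ toℕ b + k
    pos k k≤ = iter-next-toℕ b k (ℕₚ.≤-trans (s≤s (ℕₚ.+-monoʳ-≤ (toℕ b) k≤)) (subst (_≤ m) (lem (toℕ b) n) bound))
      where
      lem : ∀ x y → x + y + 3 ≡ suc (x + (2 + y))
      lem = solve-∀

    inside : ∀ k → k ≤ suc n → iter next k b ≢ a
    inside zero _ e = small (closed h (subst (λ v → CG Y v 0) e (first P)))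
      where
      small : ¬ 3 ≤ 1
      small (s≤s ())
    inside (suc k) (s≤s le) e with ℕₚ.m≤n⇒m<n∨m≡n le
    ... | inj₁ lt = small (closed h (subst (λ v → CG Y v 1) e (mid P k lt)))
      where
      small : ¬ 3 ≤ 2
      small (s≤s (s≤s ()))
    ... | inj₂ refl = small (closed h (subst (λ v → CG Y v 0) e (last P)))
      where
      small : ¬ 3 ≤ 1
      small (s≤s ())

    keep : ∀ {k j} → 1 ≤ k → k ≤ n → CG Y (iter next k b) j → CG X (iter next k b) j
    keep {suc k} _ k≤n = else h (inside (suc k) (ℕₚ.m≤n⇒m≤1+n k≤n)) (λ e → inside k (ℕₚ.≤-trans (ℕₚ.n≤1+n k) (ℕₚ.m≤n⇒m≤1+n k≤n)) (next-inj e))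
      (inside (suc (suc k)) (s≤s k≤n))

    first-keep : b ≢ next a → CG X b 0
    first-keep nb = else h (inside 0 z≤n) nb (inside 1 (s≤s z≤n)) (first P)

    last-≢ : iter next (suc n) b ≢ next a
    last-≢ e = inside n (ℕₚ.n≤1+n n) (next-inj e)

  pattern-lift′ : iter next (2 + n) b ≢ a → ∃ λ c → ∃ λ k → Pattern X c k × toℕ c + k ≡ toℕ b + n
  pattern-lift′ e with b Finₚ.≟ next a
  ... | yes refl = a , suc n , record
      { first = at h
      ; mid = λ { zero _ → after h (inside 1 (s≤s z≤n)) (first P)
                ; (suc k) (s≤s lt) → subst (λ v → CG X v 1) (sym (iter-suc next (suc k) a)) (keep (s≤s z≤n) lt (mid P k lt)) }
      ; last = subst (λ v → CG X v 0) (sym (iter-suc next (suc n) a)) (else h (inside (suc n) ℕₚ.≤-refl) last-≢ e (last P)) }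
      , trans (ℕₚ.+-suc (toℕ a) n) (cong (_+ n) (sym l))
  ... | no nb = b , n , record
      { first = first-keep nb
      ; mid = λ k lt → keep (s≤s z≤n) lt (mid P k lt)
      ; last = else h (inside (suc n) ℕₚ.≤-refl) last-≢ e (last P) } , refl

  pattern-lift : ∃ λ c → ∃ λ k → Pattern X c k × toℕ c + k + 3 ≤ m
  pattern-lift with iter next (2 + n) b Finₚ.≟ a
  ... | no e = let (c , k , Q , eq) = pattern-lift′ e in c , k , Q , subst (λ v → v + 3 ≤ m) (sym eq) bound
  ... | yes e = b , suc n , record
      { first = first-keep nb
      ; mid = λ k lt → mid′ k (ℕₚ.m≤n⇒m<n∨m≡n (ℕₚ.≤-pred lt))
      ; last = subst (λ v → CG X v 0) (sym e) (at h) }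
      , subst (_≤ m) (trans (cong (λ v → suc (suc v)) a≡) (lem (toℕ b) n)) (linear-< l)
    where
    a≡ : toℕ a ≡ toℕ b + (2 + n)
    a≡ = trans (cong toℕ (sym e)) (pos (2 + n) ℕₚ.≤-refl)
    nb : b ≢ next a
    nb p = ℕₚ.m≢1+m+n (toℕ a) (trans a≡ (cong (_+ (2 + n)) (trans (cong toℕ p) l)))
    lem : ∀ x y → 2 + (x + (2 + y)) ≡ x + suc y + 3
    lem = solve-∀
    mid′ : ∀ k → k < n ⊎ k ≡ n → CG X (iter next (suc k) b) 1
    mid′ k (inj₁ lt) = keep (s≤s z≤n) lt (mid P k lt)
    mid′ k (inj₂ refl) = before h (inside (suc n) ℕₚ.≤-refl) last-≢ e (last P)

conj-s : ∀ {m} {X Y : Dessin m} → Conj X Y → s Y ≤ s X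
conj-s C = Finₚ.injective⇒≤ {f = g C} λ {a} {b} p → trans (sym (f-inv C a)) (trans (cong (f C) p) (f-inv C b))

-- Some H on the boundary comes off at a: rotating a to the front, X is H Y.
uncover-at : ∀ {m} (X : Dessin (2 + m)) → Good X → ∀ {a u} → Linear a → τ X (inj₁ a) ≡ inj₁ (next a) → τ X (inj₁ (next a)) ≡ inj₂ u →
  ∃ λ Y → Good Y × HStep X Y a × 3 + s Y ≤ s X
uncover-at {m} X G {a} {u} l e₁ e₂ = Y′ , good-≅ (conj-sym (proj₁ CY)) GY , subst (HStep X Y′) back (h-step-conj CX (proj₁ CY) inv (h-step (proj₁ un) (H-closable⁻ (proj₁ un) (kr GH)))) , ℕₚ.≤-trans (ℕₚ.+-monoʳ-≤ 3 sz₁) sz₂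
  where
  k = toℕ a
  X₀ = rotN k X
  C₀ = rotN-conj k X
  G₀ : Good X₀
  G₀ = good-≅ (proj₁ C₀) G
  pa : pb (proj₁ C₀) a ≡ zero
  pa = trans (proj₂ C₀ a) (iter-prev-toℕ a)
  pna : pb (proj₁ C₀) (next a) ≡ 1F
  pna = trans (pb-next (proj₁ C₀) a) (cong next pa)
  t0 : τ X₀ (inj₁ zero) ≡ inj₁ 1F
  t0 = trans (cong (λ v → τ X₀ (inj₁ v)) (sym pa)) (trans (f-τ (proj₁ C₀) (inj₁ a)) (trans (cong (to (proj₁ C₀)) e₁) (cong inj₁ pna)))
  t1 : τ X₀ (inj₁ 1F) ≡ inj₂ (f (proj₁ C₀) u)
  t1 = trans (cong (λ v → τ X₀ (inj₁ v)) (sym pna)) (trans (f-τ (proj₁ C₀) (inj₁ (next a))) (cong (to (proj₁ C₀)) e₂))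
  un = H-uncover X₀ (cubic G₀) t0 t1
  GH : Good (H (proj₁ un))
  GH = good-≅ (proj₁ (proj₂ un)) G₀
  GY = good-H⁻ GH
  Y′ : Dessin (2 + m)
  Y′ = unrotN k (proj₁ un)
  unC : ∀ {m} k (X : Dessin m) → Σ (Conj (unrotN k X) X) λ C → ∀ c → pb C c ≡ iter prev k c
  unC zero X = conj-refl X , λ _ → refl
  unC (suc k) X = conj-trans (conj-sym (unrot-conj (unrotN k X))) (proj₁ (unC k X)) , λ c → trans (proj₂ (unC k X) (prev c)) (sym (iter-suc prev k c))
  CY = unC k (proj₁ un)
  CX : Conj (H (proj₁ un)) X
  CX = conj-trans (conj-sym (proj₁ (proj₂ un))) (conj-sym (proj₁ C₀))
  h⁻ : ∀ c → pb⁻ (proj₁ (proj₂ un)) c ≡ c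
  h⁻ c = trans (cong (pb⁻ (proj₁ (proj₂ un))) (sym (proj₂ (proj₂ un) c))) (pb-inv′ (proj₁ (proj₂ un)) c)
  inv : ∀ c → pb CX (pb (proj₁ CY) c) ≡ c
  inv c = trans (cong (pb⁻ (proj₁ C₀)) (trans (h⁻ _) (trans (proj₂ CY c) (sym (proj₂ C₀ c))))) (pb-inv′ (proj₁ C₀) c)
  sz₁ : s Y′ ≤ s (proj₁ un)
  sz₁ = conj-s {X = proj₁ un} {Y = Y′} (conj-sym (proj₁ CY))
  sz₂ : s (H (proj₁ un)) ≤ s X
  sz₂ = conj-s {X = X} {Y = H (proj₁ un)} (conj-sym CX)
  back : pb CX zero ≡ a
  back = trans (cong (pb⁻ (proj₁ C₀)) (trans (h⁻ zero) (sym pa))) (pb-inv′ (proj₁ C₀) a)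

HasPattern : ∀ {m} → Dessin m → Set
HasPattern {m} X = ∃ λ a → ∃ λ n → Pattern X a n × toℕ a + n + 3 ≤ m

tripod-pattern : ∀ {m} (X : Dessin m) {a} → τ X (inj₁ a) ≡ inj₁ (next a) → Linear (next a) → Linear a →
  τ X (inj₁ (next a)) ≡ inj₁ (next (next a)) → HasPattern X
tripod-pattern {m} X {a} e l′ l e′ = a , 0 , record { first = inj₁ a , here , e ; mid = λ _ () ; last = inj₁ (next a) , here , e′ } ,
    subst (_≤ m) (trans (cong (2 +_) l) (lem (toℕ a))) (linear-< l′)
  where
  lem : ∀ x → 3 + x ≡ x + 0 + 3
  lem = solve-∀

-- Discharging finds a tripod, which is a pattern with n = 0, or an H. Taking off the H removes
-- three inner edges, and the pattern of the smaller web is carried back by `pattern-lift`.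
pattern-exists : ∀ fuel {m} (X : Dessin (suc m)) → Good X → s X < fuel → HasPattern X
pattern-step : ∀ fuel {m} (X : Dessin (suc m)) → Good X → s X ≤ fuel → ∀ a → Linear a → τ X (inj₁ a) ≡ inj₁ (next a) →
  ∀ {u} → τ X (inj₁ (next a)) ≡ inj₂ u → HasPattern X

pattern-exists (suc fuel) X G (s≤s le) = go (reducible X G)
  where
  go : (∃ λ a → Charge.Reducible X G a) → HasPattern X
  go (a , l , e , inj₂ (l′ , e′)) = tripod-pattern X e l′ l e′
  go (a , l , e , inj₁ (u , e′)) = pattern-step fuel X G le a l e e′

pattern-step fuel {zero} X G le zero () e e′
pattern-step fuel {suc m} X G le a l e e′ = go (uncover-at X G l e e′)
  where
  go : (∃ λ Y → Good Y × HStep X Y a × 3 + s Y ≤ s X) → HasPattern X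
  go (Y , GY , h , sz) = lift (pattern-exists fuel Y GY (ℕₚ.≤-trans (s≤s (ℕₚ.m≤n+m (s Y) 2)) (ℕₚ.≤-trans sz le)))
    where
    lift : HasPattern Y → HasPattern X
    lift (b , n , P , bd) = pattern-lift h l P bd

-- Stack entries record the gaps between consecutive boundary edges: just j is
-- a gap closed through j + 1 black vertices, nothing separates two components.
Stack : Set
Stack = List (Maybe ℕ)

-- The gaps from the second edge of a completed comb on: a `just 1` after each of the i crossed
-- strands preceding the last, a `just 0` before the last leg, then the gap g after it. The first
-- edge stays behind the pointer, since a later tripod must lie to the right of it.
stack : ℕ → Maybe ℕ → Stack → Stack
stack zero g E = just 0 ∷ g ∷ E
stack (suc i) g E = just 1 ∷ stack i g E

-- The face that is shut must pass an odd number of black vertices; that it passes more than one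
-- comes from `np-act`.
hop? : Maybe ℕ → Bool
hop? nothing = true
hop? (just j) = odd (suc j)

-- `UW n E` codes a web made of n tripods with a pointer on its boundary; E lists the gaps from the
-- pointer on, and `drop` advances the pointer for good. In `Act n i g E` one more tripod is under
-- construction: the pointer is at its last leg, which has crossed i strands, and g is the gap after
-- that leg. A fresh tripod is a component of its own, so its gap is open.
data UW : ℕ → Stack → Set
data Act : ℕ → ℕ → Maybe ℕ → Stack → Set

data UW where
  nil  : UW 0 []
  drop : ∀ {n g E} → UW n (g ∷ E) → UW n E
  done : ∀ {n i g E E′} → Act n i g E → E′ ≡ stack i g E → UW (suc n) E′

data Act where
  trip : ∀ {n E} → UW n E → Act n 0 nothing E
  hop  : ∀ {n i g h E} → Act n i g (h ∷ E) → hop? g ≡ true → Act n (suc i) (Maybe.map suc h) E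

M : ℕ → ℕ
M zero = 0
M (suc n) = 3+ (M n)

empty : Dessin 0
empty = dessin 0 (λ { (inj₁ ()) ; (inj₂ ()) }) (λ ())

webU : ∀ {n E} → UW n E → Dessin (M n)
webA : ∀ {n i g E} → Act n i g E → Dessin (3+ (M n))

webU nil = empty
webU (drop d) = rot (webU d)
webU (done {i = i} α _) = unrotN (suc i) (webA α)
webA (trip d) = rot (rot (T (webU d)))
webA (hop α _) = rot (H (webA α))

closes : Maybe ℕ → ℕ
closes nothing = 1
closes (just _) = 0

-- A component is counted at the moment when the open gap after it is dropped; components that still
-- meet the stack are not counted yet.
κU : ∀ {n E} → UW n E → ℕ
κA : ∀ {n i g E} → Act n i g E → ℕ
κU nil = 0
κU (drop {g = g} d) = closes g + κU d
κU (done α _) = κA α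
κA (trip d) = κU d
κA (hop α _) = κA α

noth : Stack → ℕ
noth [] = 0
noth (g ∷ E) = closes g + noth E

-- Exact data for the webs built by codes. The capped map has 1 + m + w + b vertices and 2 m + s
-- edges, so `feuler` and `fsize` together are Euler's formula.
record Fine {m} (X : Dessin m) : Set where
  field
    fcubic : Cubic X
    fkr    : Kr X
    fconn  : ∀ x y → EqClosure (HubLink X) x y
    w b F  : ℕ
    cw     : Classes (Graph (ρ X)) w
    cb     : Classes (Graph (τ X)) b
    cf     : Classes (Graph (ψ X)) F
    feuler : w + F ≡ 2 * b + 1
    fsize  : 3 * b ≡ m + s X

open Fine public

fine-conj : ∀ {m} {X Y : Dessin m} → Conj X Y → Fine X → Fine Y
fine-conj {m} C f = record { fcubic = cubic-to C (fcubic f) ; fkr = kr-to C (fkr f) ; fconn = hub-to C (fconn f)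
  ; w = w f ; b = b f ; F = F f ; cw = ρ-classes-to C (cw f) ; cb = τ-classes-to C (cb f) ; cf = ψ-classes-to C (cf f)
  ; feuler = feuler f ; fsize = trans (fsize f) (cong (m +_) (ℕₚ.≤-antisym (conj-s (conj-sym C)) (conj-s C))) }

fine-H : ∀ {m} {X : Dessin (2 + m)} → Closable X → Fine X → Fine (H X)
fine-H {X = X} cl f = record { fcubic = H-cubic X (fcubic f) ; fkr = H-kr X cl (fkr f) ; fconn = H-hub X (fconn f)
  ; w = _ ; b = _ ; F = _ ; cw = H-ρ-classes X (cw f) ; cb = H-τ-classes X (cb f) ; cf = H-ψ-classes X (cf f)
  ; feuler = trans (lem (w f) (F f)) (trans (cong (2 +_) (feuler f)) (lem′ (b f)))
  ; fsize = trans (lem″ (b f)) (trans (cong (3 +_) (fsize f)) (lem‴ (2 + _) (s X))) }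
  where
  lem″ : ∀ b → 3 * suc b ≡ 3 + 3 * b
  lem″ = solve-∀
  lem‴ : ∀ m s → 3 + (m + s) ≡ m + (3 + s)
  lem‴ = solve-∀
  lem : ∀ a c → suc a + suc c ≡ 2 + (a + c)
  lem = solve-∀
  lem′ : ∀ c → 2 + (2 * c + 1) ≡ 2 * suc c + 1
  lem′ = solve-∀

fine-T : ∀ {m} {X : Dessin (suc m)} → Fine X → Fine (T X)
fine-T {X = X} f = record { fcubic = T-cubic X (fcubic f) ; fkr = T-kr X (fkr f) ; fconn = T-hub X (fconn f)
  ; w = _ ; b = _ ; F = _ ; cw = cw f ; cb = T-τ-classes X (cb f) ; cf = T-ψ-classes X (cf f)
  ; feuler = trans (lem (w f) (F f)) (trans (cong (2 +_) (feuler f)) (lem′ (b f)))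
  ; fsize = trans (lem″ (b f)) (cong (3 +_) (fsize f)) }
  where
  lem″ : ∀ b → 3 * suc b ≡ 3 + 3 * b
  lem″ = solve-∀
  lem : ∀ a c → a + (2 + c) ≡ 2 + (a + c)
  lem = solve-∀
  lem′ : ∀ c → 2 + (2 * c + 1) ≡ 2 * suc c + 1
  lem′ = solve-∀

fine-T0 : Fine (T empty)
fine-T0 = record
  { fcubic = T-cubic empty record { τ³ = λ { (inj₁ ()) ; (inj₂ ()) } ; τ≢ = λ { (inj₁ ()) ; (inj₂ ()) } ; ρ³ = λ () ; ρ≢ = λ () }
  ; fkr = T-kr empty λ { (inj₁ ()) ; (inj₂ ()) }
  ; fconn = λ x y → E-sym (to0 x) ◅◅ to0 y
  ; w = 0 ; b = 1 ; F = 3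
  ; cw = record { lab = λ u → u ; rep = λ () ; sound = λ {} ; complete = λ {} ; lab-rep = λ () }
  ; cb = T-τ-classes empty record { lab = λ { (inj₁ ()) ; (inj₂ ()) } ; rep = λ () ; sound = λ { {inj₁ ()} ; {inj₂ ()} } ; complete = λ { {inj₁ ()} ; {inj₂ ()} } ; lab-rep = λ () }
  ; cf = record { lab = lb ; rep = inj₁ ; sound = λ {x} → snd {x} ; complete = λ {x} {y} → cmp {x} {y} ; lab-rep = λ _ → refl }
  ; feuler = refl ; fsize = refl }
  where
  to0 : ∀ y → EqClosure (HubLink (T empty)) (inj₁ zero) y
  to0 (inj₁ zero) = ε
  to0 (inj₁ 1F) = Eq.return (hτ (inj₁ zero))
  to0 (inj₁ 2F) = Eq.return (hτ (inj₁ zero)) ◅◅ Eq.return (hτ (inj₁ 1F))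
  lb : Fin 3 ⊎ Fin 0 → Fin 3
  lb (inj₁ c) = c
  snd : ∀ {x y} → ψ (T empty) x ≡ y → lb x ≡ lb y
  snd {inj₁ zero} refl = refl
  snd {inj₁ 1F} refl = refl
  snd {inj₁ 2F} refl = refl
  cmp : ∀ {x y} → lb x ≡ lb y → EqClosure (Graph (ψ (T empty))) x y
  cmp {inj₁ c} {inj₁ d} refl = ε

-- What the stack says about the web built by a code

Entry : ∀ {m} → Dessin m → ℕ → Maybe ℕ → Set
Entry X p nothing = ⊤
Entry X p (just j) = ∃ λ a → toℕ a ≡ p × CG X a j

Matches : ∀ {m} → Dessin m → ℕ → Stack → Set
Matches X p [] = ⊤
Matches X p (g ∷ E) = Entry X p g × Matches X (suc p) E

-- Gaps are read backwards from the last boundary edge: they lie just behind the pointer, nearest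
-- first.
Back : ∀ {m} → Dessin m → ℕ → List ℕ → Set
Back X q [] = ⊤
Back {m} X q (v ∷ vs) = (∀ a → suc (toℕ a + q) ≡ m → CG X a v) × Back X (suc q) vs

-- A normal form for component labels: from b on, the label rises by one at each open gap, so
-- different blocks of the stack lie in different components.
Blocks : ∀ {m} → (Fin m → ℕ) → ℕ → ℕ → Stack → Set
Blocks L p b [] = ⊤
Blocks L p b (g ∷ E) = (∀ a → toℕ a ≡ p → L a ≡ b) × Blocks L (suc p) (closes g + b) E

labels : ∀ {m N} {X : Dessin m} → Classes (Link X) N → Fin m → ℕ
labels C a = toℕ (lab C (inj₁ a))

matches-map : ∀ {m m′} {X : Dessin m} {Y : Dessin m′} p p′ E →
  (∀ k → k < length E → ∀ a {j} → toℕ a ≡ p + k → CG X a j → ∃ λ a′ → toℕ a′ ≡ p′ + k × CG Y a′ j) →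
  Matches X p E → Matches Y p′ E
matches-map p p′ [] h _ = tt
matches-map {X = X} {Y} p p′ (g ∷ E) h (e , es) = entry g e , matches-map (suc p) (suc p′) E
  (λ k lt a q c → let (a′ , q′ , c′) = h (suc k) (s≤s lt) a (trans q (sym (ℕₚ.+-suc p k))) c in a′ , trans q′ (ℕₚ.+-suc p′ k) , c′) es
  where
  entry : ∀ g → Entry X p g → Entry Y p′ g
  entry nothing _ = tt
  entry (just j) (a , q , c) = let (a′ , q′ , c′) = h 0 (s≤s z≤n) a (trans q (sym (ℕₚ.+-identityʳ p))) c in a′ , trans q′ (ℕₚ.+-identityʳ p′) , c′

blocks-map : ∀ {m m′} {L : Fin m → ℕ} {L′ : Fin m′ → ℕ} (φ : ℕ → ℕ) p p′ b E → (∀ c → b ≤ c → φ (suc c) ≡ suc (φ c)) →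
  (∀ k → k < length E → ∀ a′ → toℕ a′ ≡ p′ + k → ∃ λ a → toℕ a ≡ p + k × (b ≤ L a → L′ a′ ≡ φ (L a))) →
  Blocks L p b E → Blocks L′ p′ (φ b) E
blocks-map φ p p′ b [] hφ h _ = tt
blocks-map {L = L} {L′} φ p p′ b (g ∷ E) hφ h (e , es) =
  (λ a′ q′ → let (a , q , l) = h 0 (s≤s z≤n) a′ (trans q′ (sym (ℕₚ.+-identityʳ p′))) ; ea = e a (trans q (ℕₚ.+-identityʳ p)) in trans (l (ℕₚ.≤-reflexive (sym ea))) (cong φ ea)) ,
  subst (λ v → Blocks L′ (suc p′) v E) (φg g) (blocks-map φ (suc p) (suc p′) (closes g + b) E (λ c le → hφ c (ℕₚ.≤-trans (ℕₚ.m≤n+m b _) le))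
    (λ k lt a′ q′ → let (a , q , l) = h (suc k) (s≤s lt) a′ (trans q′ (sym (ℕₚ.+-suc p′ k))) in a , trans q (ℕₚ.+-suc p k) , λ le → l (ℕₚ.≤-trans (ℕₚ.m≤n+m b _) le)) es)
  where
  φg : ∀ g → φ (closes g + b) ≡ closes g + φ b
  φg nothing = hφ b ℕₚ.≤-refl
  φg (just _) = refl

-- `backL` puts the r edges behind the pointer into the component at the pointer. By `count` every
-- component is either finished or ends at an open gap of the stack.
record St {m} (X : Dessin m) (L : Stack) (vs : List ℕ) (r k : ℕ) : Set where
  field
    mat   : Matches X 0 L
    back  : Back X 0 vs
    N     : ℕ
    cls   : Classes (Link X) N
    blk   : Blocks (labels cls) 0 0 L
    backL : ∀ a → m ≤ toℕ a + r → labels cls a ≡ 0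
    count : N ≡ k + noth L

open St public

toℕ-prev : ∀ {m} (a : Fin (suc m)) {p} → toℕ a ≡ suc p → toℕ (prev a) ≡ p
toℕ-prev (suc a) e = trans (Finₚ.toℕ-inject₁ a) (ℕₚ.suc-injective e)

toℕ-last : ∀ {m} (a : Fin (suc m)) → toℕ a ≡ m → next a ≡ zero
toℕ-last a e = wrap-0 a (cong suc e)

back-rot : ∀ {m} {X : Dessin (suc m)} q vs → Back X q vs → Back (rot X) (suc q) vs
back-rot q [] _ = tt
back-rot {m} {X} q (v ∷ vs) (e , es) = (λ a eq → subst (λ c → CG (rot X) c v) (prev-next a)
  (cg-to (rot-conj X) (e (next a) (trans (cong (λ z → suc (z + q)) (lin a eq)) (trans (cong suc (sym (ℕₚ.+-suc (toℕ a) q))) eq))))) , back-rot (suc q) vs es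
  where
  lin : ∀ a → suc (toℕ a + suc q) ≡ suc m → toℕ (next a) ≡ suc (toℕ a)
  lin a eq = linear (subst (suc (toℕ a) <_) eq (s≤s (subst (toℕ a <_) (sym (ℕₚ.+-suc (toℕ a) q)) (s≤s (ℕₚ.m≤m+n (toℕ a) q)))))

back-unrot : ∀ {m} {X : Dessin (suc m)} q vs → suc q + length vs ≤ suc m → Back X (suc q) vs → Back (unrot X) q vs
back-unrot q [] h _ = tt
back-unrot {m} {X} q (v ∷ vs) h (e , es) = hd , back-unrot (suc q) vs (subst (_≤ suc m) (cong suc (ℕₚ.+-suc q (length vs))) h) es
  where
  q< : suc q < suc m
  q< = ℕₚ.≤-trans (s≤s (ℕₚ.+-monoʳ-≤ 1 (ℕₚ.≤-trans (ℕₚ.m≤m+n q (length vs)) ℕₚ.≤-refl))) (subst (_≤ suc m) (cong suc (ℕₚ.+-suc q (length vs))) h)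
  hd : ∀ a → suc (toℕ a + q) ≡ suc m → CG (unrot X) a v
  hd zero eq = ⊥-elim (ℕₚ.<-irrefl eq q<)
  hd (suc a) eq = subst (λ c → CG (unrot X) c v) (next-prev (suc a))
    (cg-to (unrot-conj X) (e (inject₁ a) (trans (cong (λ z → suc (z + suc q)) (Finₚ.toℕ-inject₁ a)) (trans (cong suc (ℕₚ.+-suc (toℕ a) q)) eq))))

-- A boundary edge of the top block moves behind the pointer.
st-rot : ∀ {m} {X : Dessin (suc m)} {v L vs r k} → suc (length L) ≤ suc m → St X (just v ∷ L) vs r k → St (rot X) L (v ∷ vs) (suc r) k
st-rot {m} {X} {v} {L} {vs} {r} size S = record
  { mat = matches-map 1 0 L (λ k lt a e c → prev a , toℕ-prev a e , cg-to (rot-conj X) c) (proj₂ (mat S))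
  ; back = wrapg , back-rot 0 vs (back S)
  ; N = N S ; cls = link-classes-to (rot-conj X) (cls S)
  ; blk = blocks-map (λ c → c) 1 0 0 L (λ _ _ → refl) (λ k lt a e → next a , trans (linear {a = a} (s≤s (subst (_< m) (sym e) (ℕₚ.<-≤-trans lt (ℕₚ.≤-pred size))))) (cong suc e) , λ _ → refl) (proj₂ (blk S))
  ; backL = bl
  ; count = count S }
  where
  wrapg : ∀ a → suc (toℕ a + 0) ≡ suc m → CG (rot X) a v
  wrapg a e with mat S
  ... | (z , z0 , c) , _ = subst (λ d → CG (rot X) d v) (trans (cong prev z≡) (prev-next a)) (cg-to (rot-conj X) c)
    where
    z≡ : z ≡ next a
    z≡ = trans (Finₚ.toℕ-injective z0) (sym (toℕ-last a (trans (sym (ℕₚ.+-identityʳ _)) (ℕₚ.suc-injective e))))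
  bl : ∀ a → suc m ≤ toℕ a + suc r → labels (cls S) (next a) ≡ 0
  bl a le with linear⊎wrap a
  ... | inj₁ l = backL S (next a) (ℕₚ.≤-trans le (ℕₚ.≤-reflexive (trans (ℕₚ.+-suc _ r) (cong (_+ r) (sym l)))))
  ... | inj₂ e = proj₁ (blk S) (next a) (cong toℕ (wrap-0 a e))

st-unrot : ∀ {m} {X : Dessin (suc m)} {v L vs r k} → length L < m → 1 + length vs ≤ suc m → r < suc m →
  St X L (v ∷ vs) (suc r) k → St (unrot X) (just v ∷ L) vs r k
st-unrot {m} {X} {v} {L} {vs} {r} size size′ r< S = record
  { mat = (zero , refl , first0) , matches-map 0 1 L (λ k lt a e c → next a , trans (linear (s≤s (subst (_< m) (sym e) (ℕₚ.<-trans lt size)))) (cong suc e) , cg-to (unrot-conj X) c) (mat S)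
  ; back = back-unrot 0 vs size′ (proj₂ (back S))
  ; N = N S ; cls = link-classes-to (unrot-conj X) (cls S)
  ; blk = (λ { zero _ → backL S (prev zero) (lastle) }) , blocks-map (λ c → c) 0 1 0 L (λ _ _ → refl) (λ { k lt a e → prev a , toℕ-prev a e , λ _ → refl }) (blk S)
  ; backL = bl
  ; count = count S }
  where
  lastle : suc m ≤ toℕ (fromℕ m) + suc r
  lastle = subst (λ v → suc m ≤ v + suc r) (sym (Finₚ.toℕ-fromℕ m)) (subst (suc m ≤_) (sym (ℕₚ.+-suc m r)) (s≤s (ℕₚ.m≤m+n m r)))
  first0 : CG (unrot X) zero v
  first0 = subst (λ c → CG (unrot X) c v) (next-prev zero) (cg-to (unrot-conj X) (proj₁ (back S) (prev zero) (cong suc (trans (ℕₚ.+-identityʳ _) (Finₚ.toℕ-fromℕ m)))))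
  bl : ∀ a → suc m ≤ toℕ a + r → labels (cls S) (prev a) ≡ 0
  bl zero le = ⊥-elim (ℕₚ.<-irrefl refl (ℕₚ.≤-trans r< le))
  bl (suc a) le = backL S (inject₁ a) (subst (suc m ≤_) (trans (sym (ℕₚ.+-suc (toℕ a) r)) (cong (_+ suc r) (sym (Finₚ.toℕ-inject₁ a)))) le)

forget : ∀ {m} {X : Dessin m} {L vs r k} → St X L vs r k → St X L [] 0 k
forget {m} S = record { mat = mat S ; back = tt ; N = N S ; cls = cls S ; blk = blk S ; count = count S
  ; backL = λ a le → ⊥-elim (ℕₚ.<-irrefl refl (ℕₚ.<-≤-trans (Finₚ.toℕ<n a) (ℕₚ.≤-trans le (ℕₚ.≤-reflexive (ℕₚ.+-identityʳ _))))) }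

-- When a component is finished, its label 0 moves to the end and all others step down, so the
-- remaining blocks are again numbered from 0.
cycle-labels : ∀ {A : Set} {R : A → A → Set} {N} → Classes R N → Classes R N
cycle-labels C = record { lab = λ x → prev (lab C x) ; rep = λ i → rep C (next i) ; sound = λ r → cong prev (sound C r)
  ; complete = λ e → complete C (prev-inj e) ; lab-rep = λ i → trans (cong prev (lab-rep C (next i))) (prev-next i) }

toℕ-prev-pred : ∀ {n} (i : Fin n) → 1 ≤ toℕ i → toℕ (prev i) ≡ ℕ.pred (toℕ i)
toℕ-prev-pred (suc i) _ = Finₚ.toℕ-inject₁ i

pred-suc : ∀ b c → 1 ≤ b → b ≤ c → ℕ.pred (suc c) ≡ suc (ℕ.pred c)
pred-suc b (suc c) _ _ = refl
pred-suc (suc b) zero _ ()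

st-drop : ∀ {m} {X : Dessin (suc m)} {g L k} → suc (length L) ≤ suc m → St X (g ∷ L) [] 0 k → St (rot X) L [] 0 (closes g + k)
st-drop {g = just v} size S = forget (st-rot size S)
st-drop {m} {X} {nothing} {L} {k} size S = record
  { mat = matches-map 1 0 L (λ k lt a e c → prev a , toℕ-prev a e , cg-to (rot-conj X) c) (proj₂ (mat S))
  ; back = tt
  ; N = N S ; cls = cycle-labels (link-classes-to (rot-conj X) (cls S))
  ; blk = blocks-map ℕ.pred 1 0 1 L (λ c le → pred-suc 1 c ℕₚ.≤-refl le) (λ k lt a e → next a ,
      trans (linear {a = a} (s≤s (subst (_< m) (sym e) (ℕₚ.<-≤-trans lt (ℕₚ.≤-pred size))))) (cong suc e) , λ le → toℕ-prev-pred _ le) (proj₂ (blk S))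
  ; backL = λ a le → ⊥-elim (ℕₚ.<-irrefl refl (ℕₚ.<-≤-trans (Finₚ.toℕ<n a) (ℕₚ.≤-trans le (ℕₚ.≤-reflexive (ℕₚ.+-identityʳ _)))))
  ; count = trans (count S) (ℕₚ.+-suc k (noth L)) }

st-T : ∀ {m} {X : Dessin m} {L k} → L ≡ [] ⊎ length L < m → St X L [] 0 k → St (T X) (just 0 ∷ just 0 ∷ nothing ∷ L) [] 0 k
st-T {m} {X} {L} {k} size S = record
  { mat = (zero , refl , inj₁ zero , here , refl) , (1F , refl , inj₁ 1F , here , refl) , tt ,
      matches-map 0 3 L (λ k lt a e c → 3+ a , cong 3+ e , subst (Arr (T X) (inj₁ (3+ a)) _) (sym (nx a k lt e)) (arr-embT X c)) (mat S)
  ; back = tt ; N = suc (N S) ; cls = proj₁ D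
  ; blk = (λ { zero _ → cong toℕ (proj₁ (proj₂ D)) }) , (λ { 1F _ → cong toℕ (proj₁ (proj₂ (proj₂ D))) }) , (λ { 2F _ → cong toℕ (proj₁ (proj₂ (proj₂ (proj₂ D)))) }) ,
      blocks-map suc 0 3 0 L (λ _ _ → refl) (λ { k lt (3+ a) e → a , ℕₚ.suc-injective (ℕₚ.suc-injective (ℕₚ.suc-injective e)) , λ _ → cong toℕ (proj₂ (proj₂ (proj₂ (proj₂ D))) a) }) (blk S)
  ; backL = λ a le → ⊥-elim (ℕₚ.<-irrefl refl (ℕₚ.<-≤-trans (Finₚ.toℕ<n a) (ℕₚ.≤-trans le (ℕₚ.≤-reflexive (ℕₚ.+-identityʳ _)))))
  ; count = trans (cong suc (count S)) (sym (ℕₚ.+-suc k (noth L))) }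
  where
  D = T-link-classes X (cls S)
  lt′ : L ≡ [] ⊎ length L < m → ∀ k → k < length L → suc k < m
  lt′ (inj₁ refl) k ()
  lt′ (inj₂ h) k lt = ℕₚ.<-≤-trans (s≤s lt) h
  nx : ∀ a k → k < length L → toℕ a ≡ k → next (3+ a) ≡ 3+ (next a)
  nx a k lt e = Finₚ.toℕ-injective (trans (linear {a = 3+ a} (s≤s (s≤s (s≤s l)))) (sym (cong 3+ (linear l))))
    where
    l : suc (toℕ a) < m
    l = subst (λ v → suc v < m) (sym e) (lt′ size k lt)

collapse-toℕ : ∀ {n} {i j : Fin (suc n)} (d : i ≢ j) → toℕ i ≡ 0 → toℕ j ≡ 1 → ∀ k → toℕ (collapse d k) ≡ ℕ.pred (toℕ k)
collapse-toℕ {i = zero} {suc zero} d _ _ zero = refl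
collapse-toℕ {i = zero} {suc zero} d _ _ (suc k) = refl

closes-map : ∀ h → closes (Maybe.map suc h) ≡ closes h
closes-map nothing = refl
closes-map (just _) = refl

module _ {m} {X : Dessin (2 + m)} where

  big : ∀ {a : Fin (2 + m)} {p} → toℕ a ≡ 2 + p → a ≢ zero × a ≢ 1F
  big e = (λ p → n0 (trans (sym (cong toℕ p)) e)) , (λ p → n1′ (trans (sym (cong toℕ p)) e))
    where
    n0 : ∀ {p} → 0 ≢ 2 + p
    n0 ()
    n1′ : ∀ {p} → 1 ≢ 2 + p
    n1′ ()

  linear-≢ : ∀ {a : Fin (2 + m)} → suc (toℕ a) < 2 + m → next a ≢ zero
  linear-≢ {a} h e with trans (sym (cong toℕ e)) (linear h)
  ... | ()

  back-H : ∀ q vs → 1 ≤ q → q + length vs ≤ m → Back X q vs → Back (H X) q vs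
  back-H q [] _ _ _ = tt
  back-H q (v ∷ vs) 1≤q size (e , es) = hd , back-H (suc q) vs (s≤s z≤n) (subst (_≤ m) (ℕₚ.+-suc q (length vs)) size) es
    where
    hd : ∀ a → suc (toℕ a + q) ≡ 2 + m → CG (H X) a v
    hd a eq = cg-H X (λ { refl → small 0 z≤n eq }) (λ { refl → small 1 ℕₚ.≤-refl eq }) (linear-≢ lin) (e a eq)
      where
      small : ∀ t → t ≤ 1 → suc (t + q) ≢ 2 + m
      small t t≤ p = ℕₚ.<-irrefl p (s≤s (s≤s (ℕₚ.≤-trans (ℕₚ.+-monoˡ-≤ q t≤) (ℕₚ.≤-trans (ℕₚ.+-monoʳ-≤ 1 ℕₚ.≤-refl) (subst (_≤ m) (ℕₚ.+-comm q 1) (ℕₚ.≤-trans (ℕₚ.+-monoʳ-≤ q (s≤s z≤n)) size))))))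
      lin : suc (toℕ a) < 2 + m
      lin = subst (suc (toℕ a) <_) eq (s≤s (subst (_≤ toℕ a + q) (ℕₚ.+-comm (toℕ a) 1) (ℕₚ.+-monoʳ-≤ (toℕ a) 1≤q)))

  -- Across a closed gap the labels stay. Across an open gap the components 0 and 1 merge and
  -- `collapse` lowers the later labels by one.
  st-H : ∀ {g h L v vs r k} → 2 + length L + suc (length vs) ≤ 2 + m → Closable X → St X (g ∷ h ∷ L) (v ∷ vs) r k →
    St (H X) (just 0 ∷ Maybe.map suc h ∷ L) (suc v ∷ vs) r k
  st-H {g} {h} {L} {v} {vs} {r} {k} size cl S = record
    { mat = (zero , refl , cg-H-0 X) , ent h (proj₁ (proj₂ (mat S))) , matches-map 2 2 L (λ k lt a e c →
        a , e , cg-H X (proj₁ (big e)) (proj₂ (big e)) (linear-≢ (subst (λ z → suc z < 2 + m) (sym e) (s≤s (s≤s (ℕₚ.≤-trans (s≤s lt) L<m))))) c) (proj₂ (proj₂ (mat S)))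
    ; back = wrapg , back-H 1 vs ℕₚ.≤-refl (ℕₚ.≤-pred (ℕₚ.≤-pred (ℕₚ.≤-trans (s≤s (s≤s (ℕₚ.m≤n+m _ (length L)))) size))) (proj₂ (back S))
    ; N = proj₁ lk ; cls = proj₁ (proj₂ lk) ; blk = proj₁ (proj₂ (proj₂ lk)) ; backL = proj₁ (proj₂ (proj₂ (proj₂ lk)))
    ; count = proj₂ (proj₂ (proj₂ (proj₂ lk))) }
    where
    L<m : suc (length L) ≤ m
    L<m = ℕₚ.≤-pred (ℕₚ.≤-pred (ℕₚ.≤-trans (ℕₚ.≤-reflexive (cong (2 +_) (ℕₚ.+-comm 1 (length L)))) (ℕₚ.≤-trans (s≤s (s≤s (ℕₚ.+-monoʳ-≤ (length L) (s≤s z≤n)))) size)))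
    1≤m : 1 ≤ m
    1≤m = ℕₚ.≤-trans (s≤s z≤n) L<m
    ent : ∀ h → Entry X 1 h → Entry (H X) 1 (Maybe.map suc h)
    ent nothing _ = tt
    ent (just j) (1F , _ , c) = 1F , refl , cg-H-after X (linear-≢ {1F} (s≤s (s≤s 1≤m))) c
    wrapg : ∀ a → suc (toℕ a + 0) ≡ 2 + m → CG (H X) a (suc v)
    wrapg a e = cg-H-before X (λ { refl → z1 e }) (λ { refl → z2 e }) (wrap-0 a (trans (cong suc (sym (ℕₚ.+-identityʳ _))) e)) (proj₁ (back S) a e)
      where
      z1 : 1 ≢ 2 + m
      z1 ()
      z2 : 2 ≢ 2 + m
      z2 p = ℕₚ.<-irrefl p (s≤s (s≤s 1≤m))
    lk : ∃ λ N′ → Σ (Classes (Link (H X)) N′) λ C′ → Blocks (labels C′) 0 0 (just 0 ∷ Maybe.map suc h ∷ L) ×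
      (∀ a → 2 + m ≤ toℕ a + r → labels C′ a ≡ 0) × N′ ≡ k + noth (just 0 ∷ Maybe.map suc h ∷ L)
    lk = relink g (N S) (cls S) (blk S) (backL S) (count S)
      where
      relink : ∀ g N (C : Classes (Link X) N) → Blocks (labels C) 0 0 (g ∷ h ∷ L) → (∀ a → 2 + m ≤ toℕ a + r → labels C a ≡ 0) →
        N ≡ k + noth (g ∷ h ∷ L) → ∃ λ N′ → Σ (Classes (Link (H X)) N′) λ C′ → Blocks (labels C′) 0 0 (just 0 ∷ Maybe.map suc h ∷ L) ×
        (∀ a → 2 + m ≤ toℕ a + r → labels C′ a ≡ 0) × N′ ≡ k + noth (just 0 ∷ Maybe.map suc h ∷ L)
      relink (just _) N C (e0 , e1 , es) bl ct = N , proj₁ D ,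
        ((λ a p → trans (D≡ a) (e0 a p)) , (λ a p → trans (D≡ a) (e1 a p)) , subst (λ z → Blocks (labels (proj₁ D)) 2 z L) (sym (mapcl h))
          (blocks-map (λ c → c) 2 2 _ L (λ _ _ → refl) (λ _ _ a p → a , p , λ _ → D≡ a) es)) ,
        (λ a le → trans (D≡ a) (bl a le)) , trans ct (cong (λ z → k + (z + noth L)) (sym (closes-map h)))
        where
        D = H-link-same X C (Finₚ.toℕ-injective (trans (e0 zero refl) (sym (e1 1F refl))))
        D≡ : ∀ a → labels (proj₁ D) a ≡ labels C a
        D≡ a = cong toℕ (proj₂ D a)
        mapcl : ∀ h → closes (Maybe.map suc h) + 0 ≡ closes h + 0
        mapcl h = cong (_+ 0) (closes-map h)
      relink nothing N C (e0 , e1 , es) bl ct = merged N C e0 e1 es bl (trans ct (ℕₚ.+-suc k _))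
        where
        merged : ∀ N (C : Classes (Link X) N) → (∀ a → toℕ a ≡ 0 → labels C a ≡ 0) → (∀ a → toℕ a ≡ 1 → labels C a ≡ 1) →
          Blocks (labels C) 2 (closes h + 1) L → (∀ a → 2 + m ≤ toℕ a + r → labels C a ≡ 0) → N ≡ suc (k + noth (h ∷ L)) →
          ∃ λ N′ → Σ (Classes (Link (H X)) N′) λ C′ → Blocks (labels C′) 0 0 (just 0 ∷ Maybe.map suc h ∷ L) ×
          (∀ a → 2 + m ≤ toℕ a + r → labels C′ a ≡ 0) × N′ ≡ k + noth (just 0 ∷ Maybe.map suc h ∷ L)
        merged _ C e0 e1 es bl refl = _ , proj₁ D ,
          ((λ a p → trans (D≡ a) (cong ℕ.pred (e0 a p))) , (λ a p → trans (D≡ a) (cong ℕ.pred (e1 a p))) ,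
            subst (λ z → Blocks (labels (proj₁ D)) 2 z L) (pc h)
              (blocks-map ℕ.pred 2 2 (closes h + 1) L (λ c le → pred-suc 1 c ℕₚ.≤-refl (ℕₚ.≤-trans (ℕₚ.m≤n+m 1 (closes h)) le)) (λ _ _ a p → a , p , λ _ → D≡ a) es)) ,
          (λ a le → trans (D≡ a) (cong ℕ.pred (bl a le))) , cong (λ z → k + (z + noth L)) (sym (closes-map h))
          where
          n : lab C (inj₁ zero) ≢ lab C (inj₁ 1F)
          n e with trans (sym (e0 zero refl)) (trans (cong toℕ e) (e1 1F refl))
          ... | ()
          D = H-link-merge X C n
          D≡ : ∀ a → labels (proj₁ D) a ≡ ℕ.pred (labels C a)
          D≡ a = trans (cong toℕ (proj₂ D a)) (collapse-toℕ n (e0 zero refl) (e1 1F refl) _)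
          pc : ∀ h → ℕ.pred (closes h + 1) ≡ closes (Maybe.map suc h) + 0
          pc nothing = refl
          pc (just _) = refl

-- A face word just 1 … just 1, just 0: with a preceding just 0 it would be a
-- pattern to the right of the last inserted one.
Chain : Stack → Set
Chain [] = ⊥
Chain (just 0 ∷ E) = ⊤
Chain (just 1 ∷ E) = Chain E
Chain (_ ∷ E) = ⊥

NoPattern : Stack → Set
NoPattern [] = ⊤
NoPattern (g ∷ E) = (g ≡ just 0 → ¬ Chain E) × NoPattern E

-- A hop raises the gap h after the crossed strand by one. A chain starting there would have to
-- start with `just 1`, hence h was `just 0`, and followed by a chain it was forbidden before the
-- hop.
np-act : ∀ {n i g E} → Act n i g E → NoPattern (g ∷ E) × ¬ Chain (g ∷ E)
np-uw : ∀ {n E} → UW n E → NoPattern E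

np-uw nil = tt
np-uw (drop d) = proj₂ (np-uw d)
np-uw (done {i = i} {g} {E} α refl) = go i
  where
  go : ∀ i → NoPattern (stack i g E)
  go zero = (λ _ → proj₂ (np-act α)) , proj₁ (np-act α)
  go (suc i) = (λ ()) , go i

np-act (trip d) = ((λ ()) , np-uw d) , λ ()
np-act (hop {h = nothing} α _) = ((λ ()) , proj₂ (proj₂ (proj₁ (np-act α)))) , λ ()
np-act (hop {h = just zero} α _) with np-act α
... | (_ , n , np) , _ = ((λ ()) , np) , n refl
np-act (hop {h = just (suc j)} α _) = ((λ ()) , proj₂ (proj₂ (proj₁ (np-act α)))) , λ ()

ones : ℕ → List ℕ
ones zero = 0 ∷ []
ones (suc i) = 1 ∷ ones i

length-ones : ∀ i → length (ones i) ≡ suc i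
length-ones zero = refl
length-ones (suc i) = cong suc (length-ones i)

length-stack : ∀ i g E → length (stack i g E) ≡ i + (2 + length E)
length-stack zero g E = refl
length-stack (suc i) g E = cong suc (length-stack i g E)

push : ℕ → Stack → Stack
push zero L = L
push (suc i) L = push i (just 1 ∷ L)

push-stack : ∀ i g E → push i (just 0 ∷ g ∷ E) ≡ stack i g E
push-stack i g E = go i (just 0 ∷ g ∷ E) i refl
  where
  push-∷ : ∀ i L → push i (just 1 ∷ L) ≡ just 1 ∷ push i L
  push-∷ zero L = refl
  push-∷ (suc i) L = push-∷ i (just 1 ∷ L)
  go : ∀ i L i′ → i ≡ i′ → push i (just 0 ∷ g ∷ E) ≡ stack i′ g E
  go zero L .zero refl = refl
  go (suc i) L .(suc i) refl = trans (push-∷ i _) (cong (just 1 ∷_) (go i L i refl))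

unrotN-suc : ∀ {m} k (X : Dessin m) → unrotN (suc k) X ≡ unrotN k (unrot X)
unrotN-suc zero X = refl
unrotN-suc (suc k) X = cong unrot (unrotN-suc k X)

unrotN-conj : ∀ {m} k (X : Dessin m) → Conj X (unrotN k X)
unrotN-conj zero X = conj-refl X
unrotN-conj (suc k) X = conj-trans (unrotN-conj k X) (unrot-conj (unrotN k X))

unroll : ∀ {m} i {X : Dessin (suc m)} {L k} → i + length L ≤ m → St X L (ones i) (suc i) k → St (unrotN i X) (push i L) (0 ∷ []) 1 k
unroll zero size S = S
unroll {m} (suc i) {X} {L} {k} size S = subst (λ Y → St Y (push i (just 1 ∷ L)) (0 ∷ []) 1 k) (sym (unrotN-suc i X))
  (unroll i (subst (_≤ m) (sym (ℕₚ.+-suc i (length L))) size)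
    (st-unrot (ℕₚ.≤-trans (s≤s (ℕₚ.m≤n+m _ i)) size) (s≤s (subst (_≤ m) (sym (length-ones i)) (ℕₚ.≤-trans (ℕₚ.m≤m+n (suc i) _) size)))
      (s≤s (ℕₚ.≤-trans (ℕₚ.m≤m+n (suc i) _) size)) S))

record AInv {n i g E} (α : Act n i g E) : Set where
  field
    fine  : Fine (webA α)
    st    : St (webA α) (g ∷ E) (0 ∷ ones i) (2 + i) (κA α)
    size  : i + (3 + length E) ≤ 3 + M n

record UInv {n E} (d : UW n E) : Set where
  field
    ufine : ∀ {k} → n ≡ suc k → Fine (webU d)
    ust   : St (webU d) E [] 0 (κU d)
    usize : E ≡ [] ⊎ length E < M n

open AInv public
open UInv public

uw-0 : ∀ {E} → UW 0 E → E ≡ []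
uw-0 nil = refl
uw-0 (drop d) with uw-0 d
... | ()

webU-0 : ∀ {E} (d : UW 0 E) → webU d ≡ empty
webU-0 nil = refl
webU-0 (drop d) with uw-0 d
... | ()

-- Across an open gap the two edges lie in different components, so no walk joins them. Across a
-- closed gap oddness is given by `hop?`, and a gap past a single black vertex would begin a chain.
closable : ∀ {n i g h E} (α : Act n i g (h ∷ E)) → hop? g ≡ true → St (webA α) (g ∷ h ∷ E) (0 ∷ ones i) (2 + i) (κA α) → Closable (webA α)
closable {g = nothing} α _ S j c with trans (sym (proj₁ (blk S) zero refl)) (trans (cong toℕ (soundE (cls S) (arr-link c))) (proj₁ (proj₂ (blk S)) 1F refl))
... | ()
closable {g = just j₀} α e S j c with mat S
... | (zero , refl , c₀) , _ with cg-det {X = webA α} c c₀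
... | refl = three j e (proj₂ (np-act α)) , e
  where
  three : ∀ j → odd (suc j) ≡ true → ¬ Chain (just j ∷ _) → 3 ≤ suc j
  three zero e n = ⊥-elim (n tt)
  three (suc (suc j)) e n = s≤s (s≤s (s≤s z≤n))

done-st : ∀ {n i g E} (α : Act n i g E) → AInv α → St (unrotN (suc i) (webA α)) (stack i g E) (0 ∷ []) 1 (κA α)
done-st {n} {i} {g} {E} α I = subst (λ L → St (unrotN (suc i) (webA α)) L (0 ∷ []) 1 (κA α)) (push-stack i g E)
      (subst (λ Y → St Y (push i (just 0 ∷ g ∷ E)) (0 ∷ []) 1 (κA α)) (sym (unrotN-suc i (webA α)))
        (unroll i sz (st-unrot sz₁ sz₂ sz₃ (st I))))
  where
  sz : i + (2 + length E) ≤ 2 + M n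
  sz = ℕₚ.≤-pred (subst (_≤ 3 + M n) (ℕₚ.+-suc i _) (size I))
  sz₁ : suc (length E) < 2 + M n
  sz₁ = ℕₚ.≤-trans (ℕₚ.m≤n+m _ i) sz
  sz₃ : suc i < 3 + M n
  sz₃ = s≤s (ℕₚ.≤-trans (ℕₚ.≤-reflexive (ℕₚ.+-comm 1 i)) (ℕₚ.≤-trans (ℕₚ.+-monoʳ-≤ i (s≤s z≤n)) sz))
  sz₂ : suc (length (ones i)) ≤ 3 + M n
  sz₂ = subst (λ v → suc v ≤ 3 + M n) (sym (length-ones i)) sz₃

abstract
  ainv : ∀ {n i g E} (α : Act n i g E) → AInv α
  uinv : ∀ {n E} (d : UW n E) → UInv d

  uinv nil = record { ufine = λ () ; usize = inj₁ refl
    ; ust = record { mat = tt ; back = tt ; N = 0 ; blk = tt ; backL = λ () ; count = refl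
       ; cls = record { lab = λ { (inj₁ ()) ; (inj₂ ()) } ; rep = λ () ; sound = λ { {inj₁ ()} ; {inj₂ ()} } ; complete = λ { {inj₁ ()} ; {inj₂ ()} } ; lab-rep = λ () } } }
  uinv (drop {zero} d) with uw-0 d
  ... | ()
  uinv (drop {suc n} {g} {E} d) = record
    { ufine = λ e → fine-conj (rot-conj (webU d)) (ufine (uinv d) e)
    ; ust = st-drop (ℕₚ.<⇒≤ (sz (usize (uinv d)))) (ust (uinv d))
    ; usize = inj₂ (ℕₚ.<-trans (ℕₚ.n<1+n _) (sz (usize (uinv d)))) }
    where
    sz : g ∷ E ≡ [] ⊎ suc (length E) < M (suc n) → suc (length E) < M (suc n)
    sz (inj₂ h) = h
  uinv (done {n} {i} {g} {E} α refl) = record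
    { ufine = λ _ → fine-conj (unrotN-conj (suc i) (webA α)) (fine (ainv α))
    ; ust = forget (done-st α (ainv α))
    ; usize = inj₂ (subst (_< 3 + M n) (sym (length-stack i g E)) (ℕₚ.≤-trans (ℕₚ.≤-reflexive (sym (ℕₚ.+-suc i _))) (size (ainv α)))) }

  ainv (trip {n} {E} d) = record
    { fine = fine-conj (conj-trans (rot-conj (T (webU d))) (rot-conj (rot (T (webU d))))) (fT d)
    ; st = st-rot {vs = 0 ∷ []} (ℕₚ.<⇒≤ (sz₀ 2 ℕₚ.≤-refl)) (st-rot {vs = []} (sz₀ 2 ℕₚ.≤-refl) (st-T (usize U) (ust U)))
    ; size = s≤s (s≤s (s≤s (lenE (usize U)))) }
    where
    U : UInv d
    U = uinv d
    lenE : E ≡ [] ⊎ length E < M n → length E ≤ M n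
    lenE (inj₁ refl) = z≤n
    lenE (inj₂ h) = ℕₚ.<⇒≤ h
    sz₀ : ∀ t → t ≤ 2 → t + suc (length E) ≤ 3 + M n
    sz₀ t h = ℕₚ.≤-trans (ℕₚ.+-mono-≤ h (s≤s (lenE (usize U)))) ℕₚ.≤-refl
    fT : ∀ {n E} (d : UW n E) → Fine (T (webU d))
    fT {zero} d rewrite webU-0 d = fine-T0
    fT {suc n} d = fine-T (ufine (uinv d) refl)
  ainv (hop {n} {i} {g} {h} {E} α e) = record
    { fine = fine-conj (rot-conj (H (webA α))) (fine-H cl (fine I))
    ; st = st-rot {vs = 1 ∷ ones i} sz₁ (st-H sz₂ cl (st I))
    ; size = subst (_≤ 3 + M n) (ℕₚ.+-suc i (3 + length E)) (size I) }
    where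
    I : AInv α
    I = ainv α
    cl : Closable (webA α)
    cl = closable α e (st I)
    sz₂ : 2 + length E + suc (length (ones i)) ≤ 3 + M n
    sz₂ = subst (_≤ 3 + M n) (trans (lem i (length E)) (cong (λ v → 2 + length E + suc v) (sym (length-ones i)))) (size I)
      where
      lem : ∀ i l → i + (3 + suc l) ≡ 2 + l + suc (suc i)
      lem = solve-∀
    sz₁ : suc (suc (length E)) ≤ 3 + M n
    sz₁ = ℕₚ.≤-trans (ℕₚ.m≤m+n _ _) sz₂

-- A stack never stops inside a component, so two stacks of equal length agree at their last entry.
EndsOpen : Stack → Set
EndsOpen [] = ⊤
EndsOpen (g ∷ []) = g ≡ nothing
EndsOpen (g ∷ h ∷ E) = EndsOpen (h ∷ E)

ends-tail : ∀ {g} E → EndsOpen (g ∷ E) → EndsOpen E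
ends-tail [] _ = tt
ends-tail (h ∷ E) e = e

ends-act : ∀ {n i g E} → Act n i g E → EndsOpen (g ∷ E)
ends-uw : ∀ {n E} → UW n E → EndsOpen E
ends-uw nil = tt
ends-uw (drop {E = E} d) = ends-tail E (ends-uw d)
ends-uw (done {i = i} α refl) = go i (ends-act α)
  where
  go : ∀ i {g E} → EndsOpen (g ∷ E) → EndsOpen (stack i g E)
  go zero e = e
  go (suc zero) e = e
  go (suc (suc i)) e = go (suc i) e
ends-act (trip {E = []} d) = refl
ends-act (trip {E = _ ∷ _} d) = ends-uw d
ends-act (hop {h = h} {E = []} α _) with ends-act α
... | refl = refl
ends-act (hop {E = _ ∷ _} α _) = ends-act α

-- Uniqueness of the code

-- The stack can be read off from the web: the length of a closed gap is an invariant, and a gap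
-- closed for one code cannot be open for the other, because it links two edges whose labels differ
-- there.
stacks-agree : ∀ {m} {X Y : Dessin m} {N N′} (I : X ≅ Y) (C : Classes (Link X) N) (D : Classes (Link Y) N′) p b b′ L L′ →
  length L ≡ length L′ → p + length L ≤ m → Matches X p L → Matches Y p L′ → Blocks (labels C) p b L → Blocks (labels D) p b′ L′ →
  EndsOpen L → EndsOpen L′ → L ≡ L′
stacks-agree I C D p b b′ [] [] _ _ _ _ _ _ _ _ = refl
stacks-agree {m} {X} {Y} I C D p b b′ (g ∷ L) (g′ ∷ L′) len size (e , es) (e′ , es′) (l , ls) (l′ , ls′) o o′ =
  cong₂ _∷_ (heads g g′ L L′ e e′ l l′ ls ls′ o o′ (ℕₚ.suc-injective len) size)
    (stacks-agree I C D (suc p) _ _ L L′ (ℕₚ.suc-injective len) (subst (_≤ m) (ℕₚ.+-suc p _) size) es es′ ls ls′ (ends-tail L o) (ends-tail L′ o′))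
  where
  absurd : ∀ {Y : Dessin m} {N} (D : Classes (Link Y) N) {b j h} L → p + suc (suc (length L)) ≤ m → (∃ λ a → toℕ a ≡ p × CG Y a j) → (∀ a → toℕ a ≡ p → labels D a ≡ b) →
    Blocks (labels D) (suc p) (suc b) (h ∷ L) → ⊥
  absurd D {b} L size (a , q , c) l (l₂ , _) = ℕₚ.<-irrefl
    (trans (sym (l a q)) (trans (cong toℕ (soundE D (arr-link c))) (l₂ (next a) (trans (linear lin) (cong suc q))))) (ℕₚ.n<1+n b)
    where
    lin : suc (toℕ a) < m
    lin = ℕₚ.≤-trans (s≤s (s≤s (ℕₚ.≤-reflexive q))) (ℕₚ.≤-trans (ℕₚ.≤-trans (ℕₚ.≤-reflexive (ℕₚ.+-comm 2 p)) (ℕₚ.+-monoʳ-≤ p (s≤s (s≤s z≤n)))) size)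
  heads : ∀ g g′ L L′ → Entry X p g → Entry Y p g′ → (∀ a → toℕ a ≡ p → labels C a ≡ b) → (∀ a → toℕ a ≡ p → labels D a ≡ b′) →
    Blocks (labels C) (suc p) (closes g + b) L → Blocks (labels D) (suc p) (closes g′ + b′) L′ → EndsOpen (g ∷ L) → EndsOpen (g′ ∷ L′) →
    length L ≡ length L′ → p + suc (length L) ≤ m → g ≡ g′
  heads nothing nothing _ _ _ _ _ _ _ _ _ _ _ _ = refl
  heads (just j) (just j′) _ _ (a , q , c) (a′ , q′ , c′) _ _ _ _ _ _ _ _ with Finₚ.toℕ-injective (trans q (sym q′))
  ... | refl = cong just (cg-det {X = Y} (cg-≅ I c) c′)
  heads (just j) nothing [] _ _ _ _ _ _ _ () _ _ _
  heads (just j) nothing (h ∷ L) (h′ ∷ L′) (a , q , c) _ l l′ ls ls′ _ _ len size = ⊥-elim (absurd D L′ (subst (λ v → p + suc v ≤ m) len size) (a , q , cg-≅ I c) l′ ls′)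
  heads nothing (just j) _ [] _ _ _ _ _ _ _ () _ _
  heads nothing (just j) (h ∷ L) (h′ ∷ L′) _ (a , q , c) l l′ ls ls′ _ _ len size = ⊥-elim (absurd C L size (a , q , cg-≅ (≅-sym I) c) l ls)

tail-≡ : ∀ {A : Set} {x y : A} {xs ys : List A} → x ∷ xs ≡ y ∷ ys → xs ≡ ys
tail-≡ refl = refl

uip : ∀ {A : Set} {x y : A} (p q : x ≡ y) → p ≡ q
uip refl refl = refl

stack-inj : ∀ i i′ {g g′ E E′} → stack i g E ≡ stack i′ g′ E′ → i ≡ i′ × E ≡ E′
stack-inj zero zero refl = refl , refl
stack-inj (suc i) (suc i′) {g} {g′} {E} {E′} e with stack-inj i i′ {g} {g′} {E} {E′} (tail-≡ e)
... | refl , eq = refl , eq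

chain-stack : ∀ i g E → Chain (stack i g E)
chain-stack zero g E = tt
chain-stack (suc i) g E = chain-stack i g E

unrotN-cancel : ∀ {m} k {X Y : Dessin m} → unrotN k X ≅ unrotN k Y → X ≅ Y
unrotN-cancel zero I = I
unrotN-cancel (suc k) I = unrotN-cancel k (unrot-cancel I)

CodeU : ℕ → Set
CodeU n = Σ Stack (UW n)

size-≤ : ∀ {n} {E : Stack} → E ≡ [] ⊎ length E < M n → length E ≤ M n
size-≤ (inj₁ refl) = z≤n
size-≤ (inj₂ h) = ℕₚ.<⇒≤ h

agree : ∀ {n E E′} (d : UW n E) (d′ : UW n E′) → webU d ≅ webU d′ → length E ≡ length E′ → E ≡ E′
agree {E = E} {E′} d d′ I len = stacks-agree I (cls (ust (uinv d))) (cls (ust (uinv d′))) 0 0 0 E E′ len (size-≤ (usize (uinv d)))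
  (mat (ust (uinv d))) (mat (ust (uinv d′))) (blk (ust (uinv d))) (blk (ust (uinv d′))) (ends-uw d) (ends-uw d′)

no-chain-before : ∀ {m} {X : Dessin (suc m)} {Y g L k} (S : St X (g ∷ L) [] 0 k) → rot X ≅ Y → CG Y (fromℕ m) 0 → 1 ≤ m →
  1 ≤ length L → NoPattern (g ∷ L) → ¬ Chain L
no-chain-before {zero} S I c ()
no-chain-before {suc m} {X} {Y} {g} {h ∷ L} S I c _ _ np ch = go g (mat S) (blk S) np
  where
  c₀ : CG X zero 0
  c₀ = subst (λ v → CG X v 0) (next-prev zero) (cg-to (conj-sym (rot-conj X)) (cg-≅ (≅-sym I) c))
  go : ∀ g → Matches X 0 (g ∷ h ∷ L) → Blocks (labels (cls S)) 0 0 (g ∷ h ∷ L) → NoPattern (g ∷ h ∷ L) → ⊥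
  go (just j) ((zero , _ , c) , _) _ (np , _) with cg-det {X = X} c c₀
  ... | refl = np refl ch
  go nothing _ (b₀ , b₁ , _) _ with trans (sym (b₀ zero refl)) (trans (cong toℕ (soundE (cls S) (arr-link c₀))) (b₁ 1F refl))
  ... | ()

done-back : ∀ {n i g E} (α : Act n i g E) → CG (unrotN (suc i) (webA α)) (fromℕ (2 + M n)) 0
done-back {n} α = proj₁ (back (done-st α (ainv α))) (fromℕ (2 + M n)) (cong suc (trans (ℕₚ.+-identityʳ _) (Finₚ.toℕ-fromℕ (2 + M n))))

-- The last inserted tripod cannot be mistaken for an earlier one.
done≢drop : ∀ {n i g g₁ E E₁} (α : Act n i g E) (d : UW (suc n) (g₁ ∷ E₁)) → E₁ ≡ stack i g E → ¬ rot (webU d) ≅ unrotN (suc i) (webA α)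
done≢drop {n} {i} {g} {g₁} {E} α d refl I = no-chain-before (ust (uinv d)) I (done-back α) (s≤s z≤n)
  (subst (1 ≤_) (sym (length-stack i g E)) (ℕₚ.≤-trans (s≤s z≤n) (ℕₚ.m≤n+m _ i))) (np-uw d) (chain-stack i g E)

-- The stacks agree, and they reveal the last step: a completed tripod contradicts a drop by
-- `done≢drop`, and the number of its hops is the number of leading `just 1`. Each step can be
-- cancelled from the isomorphism.
unique-U : ∀ {n E E′} (d : UW n E) (d′ : UW n E′) → webU d ≅ webU d′ → length E ≡ length E′ → _≡_ {A = CodeU n} (E , d) (E′ , d′)
unique-A : ∀ {n i g g′ E E′} (α : Act n i g E) (α′ : Act n i g′ E′) → webA α ≅ webA α′ → length E ≡ length E′ →
  _≡_ {A = Σ (Maybe ℕ) λ g → Σ Stack (Act n i g)} (g , E , α) (g′ , E′ , α′)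

unique-U nil nil I len = refl
unique-U {zero} (drop d) _ I len with uw-0 d
... | ()
unique-U {zero} nil (drop d) I len with uw-0 d
... | ()
unique-U (drop d) (drop d′) I len with unique-U d d′ (rot-cancel I) (cong suc len)
... | refl = refl
unique-U (drop d) (done α refl) I len = ⊥-elim (done≢drop α d (agree (drop d) (done α refl) I len) I)
unique-U (done α refl) (drop d) I len = ⊥-elim (done≢drop α d (agree (drop d) (done α refl) (≅-sym I) (sym len)) (≅-sym I))
unique-U (done {i = i} {g} {E} α refl) (done {i = i′} {g′} {E′} α′ refl) I len with stack-inj i i′ {g} {g′} (agree (done α refl) (done α′ refl) I len)
... | refl , refl with unique-A α α′ (unrotN-cancel (suc i) I) refl
... | refl = refl

unique-A (trip d) (trip d′) I len with unique-U d d′ (T-cancel (rot-cancel (rot-cancel I))) len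
... | refl = refl
unique-A (hop α e) (hop α′ e′) I len with unique-A α α′ (H-cancel (rot-cancel I)) (cong suc len)
... | refl = cong (λ p → _ , _ , hop α p) (uip e e′)

-- Existence of the code

iter-+ : ∀ {A : Set} (f : A → A) a b x → iter f (a + b) x ≡ iter f a (iter f b x)
iter-+ f zero b x = refl
iter-+ f (suc a) b x = cong f (iter-+ f a b x)

iter-prev-next : ∀ {m} k (c : Fin m) → iter prev k (iter next k c) ≡ c
iter-prev-next zero c = refl
iter-prev-next (suc k) c = trans (iter-suc prev k _) (trans (cong (iter prev k) (prev-next _)) (iter-prev-next k c))

iter-next-zero : ∀ {m} (z : Fin (suc m)) k → toℕ z + k ≡ m → iter next (suc k) z ≡ zero
iter-next-zero {m} z k e = toℕ-last (iter next k z) (trans (iter-next-toℕ z k (s≤s (ℕₚ.≤-reflexive e))) e)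

iter-next-wrap : ∀ {m} (z : Fin m) k r → toℕ z + k ≡ m + r → r < m → toℕ (iter next k z) ≡ r
iter-next-wrap {suc m} z k r e r<m = trans (cong toℕ (trans (cong (λ v → iter next v z) k≡) (trans (iter-+ next r (suc l) z) (cong (iter next r) (iter-next-zero z l l≡)))))
  (iter-next-toℕ zero r r<m)
  where
  l = m ℕ.∸ toℕ z
  l≡ : toℕ z + l ≡ m
  l≡ = ℕₚ.m+[n∸m]≡n (ℕₚ.≤-pred (Finₚ.toℕ<n z))
  k≡ : k ≡ r + suc l
  k≡ = ℕₚ.+-cancelˡ-≡ (toℕ z) k (r + suc l) (trans e (trans (cong (λ v → suc v + r) (sym l≡)) (lem (toℕ z) l r)))
    where
    lem : ∀ z l r → suc (z + l) + r ≡ z + (r + suc l)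
    lem = solve-∀

rotN-conj⁻ : ∀ {m} k (X : Dessin m) c → pb⁻ (proj₁ (rotN-conj k X)) c ≡ iter next k c
rotN-conj⁻ k X c = trans (cong (pb⁻ K₀) (sym (trans (proj₂ (rotN-conj k X) (iter next k c)) (iter-prev-next k c)))) (pb-inv′ K₀ _)
  where K₀ = proj₁ (rotN-conj k X)

rotN-suc : ∀ {m} k (X : Dessin m) → rotN (suc k) X ≡ rotN k (rot X)
rotN-suc zero X = refl
rotN-suc (suc k) X = cong rot (rotN-suc k X)

rotN-+ : ∀ {m} a b (X : Dessin m) → rotN (a + b) X ≡ rotN a (rotN b X)
rotN-+ zero b X = refl
rotN-+ (suc a) b X = cong rot (rotN-+ a b X)

rotN-cong : ∀ {m} k {X Y : Dessin m} → X ≅ Y → rotN k X ≅ rotN k Y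
rotN-cong zero I = I
rotN-cong (suc k) I = rot-cong (rotN-cong k I)

≅-≡ : ∀ {m} {X Y : Dessin m} → X ≡ Y → X ≅ Y
≅-≡ {X = X} refl = ≅-refl X

rotN-unrotN : ∀ {m} k (X : Dessin m) → rotN k (unrotN k X) ≅ X
rotN-unrotN zero X = ≅-refl X
rotN-unrotN (suc k) X = ≅-trans (≅-≡ (rotN-suc k _)) (≅-trans (rotN-cong k (≅-sym (rot-unrot (unrotN k X)))) (rotN-unrotN k X))

rotN-full : ∀ {m} (X : Dessin m) → X ≅ rotN m X
rotN-full {m} X = proj₁ (rotN-conj m X) , λ c → trans (proj₂ (rotN-conj m X) c)
  (trans (cong (iter prev m) (sym (Finₚ.toℕ-injective (iter-next-wrap c m (toℕ c) (ℕₚ.+-comm (toℕ c) m) (Finₚ.toℕ<n c))))) (iter-prev-next m c))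

NoPatternIn : ∀ {m} → Dessin m → ℕ → Set
NoPatternIn X t = ∀ b n → Pattern X b n → toℕ b + n + 3 ≤ t → ⊥

pattern-≅ : ∀ {m} {X Y : Dessin m} → X ≅ Y → ∀ {a n} → Pattern X a n → Pattern Y a n
pattern-≅ {Y = Y} I {a} {n} P = subst (λ v → Pattern Y v n) (proj₂ I a) (pattern-to (proj₁ I) P)

nopattern-≅ : ∀ {m} {X Y : Dessin m} {t} → X ≅ Y → NoPatternIn X t → NoPatternIn Y t
nopattern-≅ I h b n P = h b n (pattern-≅ (≅-sym I) P)

back-≅ : ∀ {m} {X Y : Dessin m} → X ≅ Y → ∀ q vs → Back X q vs → Back Y q vs
back-≅ I q [] _ = tt
back-≅ I q (v ∷ vs) (e , es) = (λ a eq → cg-≅ I (e a eq)) , back-≅ I (suc q) vs es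

cg-T : ∀ {m} (X : Dessin m) {a j} → suc (toℕ a) < m → CG X a j → CG (T X) (3+ a) j
cg-T X {a} {j} lt c = subst (Arr (T X) (inj₁ (3+ a)) j) (sym (Finₚ.toℕ-injective (trans (linear {a = 3+ a} (s≤s (s≤s (s≤s lt)))) (sym (cong 3+ (linear lt)))))) (arr-embT X c)

iter-next-3+ : ∀ {m} (b : Fin m) k → toℕ b + k < m → iter next k (3+ b) ≡ 3+ (iter next k b)
iter-next-3+ b k lt = Finₚ.toℕ-injective (trans (iter-next-toℕ (3+ b) k (s≤s (s≤s (s≤s lt)))) (sym (cong 3+ (iter-next-toℕ b k lt))))

pattern-T : ∀ {m} (X : Dessin m) {b n} → toℕ b + n + 3 ≤ m → Pattern X b n → Pattern (T X) (3+ b) n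
pattern-T {m} X {b} {n} bd P = record
  { first = cg-T X (subst (λ v → suc v < m) (ℕₚ.+-identityʳ _) (lt′ 0 z≤n)) (first P)
  ; mid = λ k k<n → cg-at (suc k) (ℕₚ.m≤n⇒m≤1+n k<n) (mid P k k<n)
  ; last = cg-at (suc n) ℕₚ.≤-refl (last P) }
  where
  lt′ : ∀ k → k ≤ suc n → suc (toℕ b + k) < m
  lt′ k k≤ = ℕₚ.≤-trans (s≤s (s≤s (ℕₚ.+-monoʳ-≤ (toℕ b) k≤))) (subst (_≤ m) (lem (toℕ b) n) bd)
    where
    lem : ∀ x y → x + y + 3 ≡ suc (suc (x + suc y))
    lem = solve-∀
  cg-at : ∀ k → k ≤ suc n → ∀ {j} → CG X (iter next k b) j → CG (T X) (iter next k (3+ b)) j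
  cg-at k k≤ {j} c = subst (λ v → CG (T X) v j) (sym (iter-next-3+ b k (ℕₚ.<⇒≤ (lt′ k k≤))))
    (cg-T X (subst (λ v → suc v < m) (sym (iter-next-toℕ b k (ℕₚ.<⇒≤ (lt′ k k≤)))) (lt′ k k≤)) c)

matches-stack : ∀ {m} {X : Dessin m} p i {g E} → Matches X p (stack i g E) →
  (∀ k → k < i → ∃ λ a → toℕ a ≡ p + k × CG X a 1) × ∃ λ a → toℕ a ≡ p + i × CG X a 0
matches-stack p zero ((a , q , c) , _) = (λ k ()) , a , trans q (sym (ℕₚ.+-identityʳ p)) , c
matches-stack p (suc i) ((a , q , c) , es) with matches-stack (suc p) i es
... | ms , (a′ , q′ , c′) = (λ { zero _ → a , trans q (sym (ℕₚ.+-identityʳ p)) , c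
    ; (suc k) (s≤s lt) → let (a , q , c) = ms k lt in a , trans q (sym (ℕₚ.+-suc p k)) , c }) , a′ , trans q′ (sym (ℕₚ.+-suc p i)) , c′

done-pattern : ∀ {n i g E} (α : Act n i g E) → Pattern (unrot (unrotN (suc i) (webA α))) zero i
done-pattern {n} {i} {g} {E} α = record
  { first = subst (λ v → CG (unrot D) v 0) (next-prev zero) (cg-to (unrot-conj D) (done-back α))
  ; mid = λ k k<i → atk k 1 (ℕₚ.<⇒≤ k<i) (proj₁ ms k k<i)
  ; last = atk i 0 ℕₚ.≤-refl (proj₂ ms) }
  where
  D = unrotN (suc i) (webA α)
  ms = matches-stack 0 i (mat (done-st α (ainv α)))
  atk : ∀ k j → k ≤ i → (∃ λ a → toℕ a ≡ k × CG D a j) → CG (unrot D) (iter next (suc k) zero) j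
  atk k j k≤ (a , q , c) = subst (λ v → CG (unrot D) (next v) j) (Finₚ.toℕ-injective (trans q (sym (iter-next-toℕ zero k k<)))) (cg-to (unrot-conj D) c)
    where
    k< : k < 3 + M n
    k< = ℕₚ.≤-<-trans k≤ (ℕₚ.≤-trans (ℕₚ.≤-reflexive (ℕₚ.+-comm 1 i)) (ℕₚ.≤-trans (ℕₚ.+-monoʳ-≤ i (s≤s z≤n)) (size (ainv α))))

-- Takes back r drops. The last step to be taken back is a drop each time, because a completed
-- tripod would show a pattern in the region that is assumed to be free of patterns.
climb : ∀ {k} r {Y : Dessin (M k)} {E} (d : UW k E) → rotN r Y ≅ webU d → NoPatternIn Y (r + length E) → r + length E ≤ M k →
  ∃ λ E₁ → Σ (UW k E₁) λ d₁ → length E₁ ≡ r + length E × Y ≅ webU d₁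
climb zero d I np sz = _ , d , refl , I
climb (suc r) nil I np ()
climb {k} (suc r) {Y} {E} (drop {g = g} d) I np sz with climb r d (rot-cancel I) (subst (NoPatternIn Y) (sym (ℕₚ.+-suc r (length E))) np) (subst (_≤ M k) (sym (ℕₚ.+-suc r (length E))) sz)
... | E₁ , d₁ , len , J = E₁ , d₁ , trans len (ℕₚ.+-suc r (length E)) , J
climb {suc n} (suc r) {Y} (done {i = i} {g} {E} α refl) I np sz = ⊥-elim (np (iter next r zero) i P bd)
  where
  Q : Pattern (rotN r Y) zero i
  Q = pattern-≅ (≅-trans (unrot-cong (≅-sym I)) (≅-sym (unrot-rot (rotN r Y)))) (done-pattern α)
  P : Pattern Y (iter next r zero) i
  P = subst (λ v → Pattern Y v i) (rotN-conj⁻ r Y zero) (pattern-to (conj-sym (proj₁ (rotN-conj r Y))) Q)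
  bd : toℕ (iter next r zero) + i + 3 ≤ suc r + length (stack i g E)
  bd = subst (λ v → v + i + 3 ≤ suc r + length (stack i g E)) (sym (iter-next-toℕ zero r (ℕₚ.<-≤-trans (s≤s (ℕₚ.m≤m+n r _)) sz)))
    (subst (λ v → r + i + 3 ≤ suc r + v) (sym (length-stack i g E)) (ℕₚ.≤-trans (ℕₚ.m≤m+n _ (length E)) (ℕₚ.≤-reflexive (lem r i (length E)))))
    where
    lem : ∀ r i e → r + i + 3 + e ≡ suc r + (i + (2 + e))
    lem = solve-∀

-- Taking an H off the boundary keeps the remaining faces of the comb it belongs to.
module _ {m} {X : Dessin (3 + m)} (cu : Cubic X) where
  private
    inj₁≢inj₂ : ∀ {A B : Set} {a : A} {b : B} → inj₁ {B = B} a ≢ inj₂ b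
    inj₁≢inj₂ ()

    emb-inj₁ : ∀ {n} (x : Fin (3 + m) ⊎ Fin n) {c} → emb x ≡ inj₁ c → x ≡ inj₁ c
    emb-inj₁ (inj₁ (suc (suc d))) refl = refl

    two : ∀ {a : Fin (3 + m)} q → suc (toℕ a + q) ≡ 3 + m → q ≤ m → ∃ λ d → a ≡ suc (suc d)
    two {zero} q e h = ⊥-elim (ℕₚ.<-irrefl (ℕₚ.suc-injective e) (s≤s (ℕₚ.m≤n⇒m≤1+n h)))
    two {1F} q e h = ⊥-elim (ℕₚ.<-irrefl (ℕₚ.suc-injective (ℕₚ.suc-injective e)) (s≤s h))
    two {suc (suc d)} q e h = d , refl

    cg₀ : ∀ {d c} → τ (H X) (inj₁ (suc (suc d))) ≡ inj₁ c → τ X (inj₁ (suc (suc d))) ≡ inj₁ c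
    cg₀ {d} e = emb-inj₁ (τ X (inj₁ (suc (suc d)))) e

  back-H⁻-first : ∀ a → suc (toℕ a + 0) ≡ 3 + m → CG (H X) a 1 → τ X (inj₁ a) ≡ inj₁ zero
  back-H⁻-first a eq (y , there {u = u} p here , q) with two 0 eq z≤n
  ... | d , refl = go u refl
    where
    nx : next (suc (suc d)) ≡ zero
    nx = wrap-0 (suc (suc d)) (trans (cong suc (sym (ℕₚ.+-identityʳ _))) eq)
    u≡ : inj₂ (Hρ {1 + m} (ρ X) u) ≡ inj₂ 2F
    u≡ = τ-inj {X = H X} (H-cubic X cu) (trans q (cong inj₁ nx))
    go : ∀ v → v ≡ u → τ X (inj₁ (suc (suc d))) ≡ inj₁ zero
    go zero refl = emb-inj {x = τ X (inj₁ (suc (suc d)))} {inj₁ zero} p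
    go 1F refl with Sumₚ.inj₂-injective u≡
    ... | ()
    go 2F refl with Sumₚ.inj₂-injective u≡
    ... | ()
    go (3+ v) refl with Sumₚ.inj₂-injective u≡
    ... | ()

  back-H⁻ : (∀ a → suc (toℕ a) ≡ 3 + m → τ X (inj₁ a) ≡ inj₁ zero) → ∀ q i → 1 ≤ q → q + i ≤ m →
    (∀ c → toℕ c + q ≡ 3 + m → ∃ λ u → τ (H X) (inj₁ c) ≡ inj₂ u) → Back (H X) q (ones i) → Back X q (ones i)
  back-H⁻ lst q zero 1≤q sz inner (e , _) = (λ a eq → go a eq (e a eq)) , tt
    where
    go : ∀ a → suc (toℕ a + q) ≡ 3 + m → CG (H X) a 0 → CG X a 0
    go a eq (y , here , p) with two q eq (subst (_≤ m) (ℕₚ.+-identityʳ q) sz)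
    ... | d , refl = inj₁ (suc (suc d)) , here , cg₀ p
  back-H⁻ lst q (suc i) 1≤q sz inner (e , es) = (λ a eq → go a eq (e a eq)) ,
    back-H⁻ lst (suc q) i (s≤s z≤n) (subst (_≤ m) (ℕₚ.+-suc q i) sz) (λ c eq → fst c (e c (trans (sym (ℕₚ.+-suc _ q)) eq))) es
    where
    fst : ∀ c → CG (H X) c 1 → ∃ λ u → τ (H X) (inj₁ c) ≡ inj₂ u
    fst c (y , there p r , _) = _ , p
    q≤ : q ≤ m
    q≤ = ℕₚ.≤-trans (ℕₚ.m≤m+n q (suc i)) sz
    go : ∀ a → suc (toℕ a + q) ≡ 3 + m → CG (H X) a 1 → CG X a 1
    go a eq (y , there {u = u} p here , p′) with two q eq q≤
    ... | d , refl = cases (τ X (inj₁ (suc (suc d)))) refl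
      where
      a′ : Fin (3 + m)
      a′ = suc (suc d)
      nx : toℕ (next a′) ≡ suc (toℕ a′)
      nx = linear (subst (suc (toℕ a′) <_) eq (s≤s (subst (_≤ toℕ a′ + q) (ℕₚ.+-comm (toℕ a′) 1) (ℕₚ.+-monoʳ-≤ (toℕ a′) 1≤q))))
      cases : ∀ t → τ X (inj₁ a′) ≡ t → CG X a′ 1
      cases (inj₂ w) et with trans (sym (cong emb et)) p
      ... | refl = inj₂ (ρ X w) , there et here , emb-inj₁ (τ X (inj₂ (ρ X w))) p′
      cases (inj₁ (suc (suc t))) et = ⊥-elim (inj₁≢inj₂ (trans (sym (cong emb et)) p))
      cases (inj₁ zero) et with trans (sym (cong emb et)) p
      ... | refl with trans (cong toℕ (Sumₚ.inj₁-injective p′)) nx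
      ... | ()
      cases (inj₁ 1F) et with trans (sym (cong emb et)) p
      ... | refl = ⊥-elim (inj₁≢inj₂ (trans (sym bk) (proj₂ (inner (next a′) (trans (cong (_+ q) nx) eq)))))
        where
        ℓ : Fin (3 + m)
        ℓ = fromℕ (2 + m)
        τ0 : τ X (inj₁ zero) ≡ inj₁ (next a′)
        τ0 = emb-inj₁ (τ X (inj₁ zero)) p′
        τℓ : τ X (inj₁ ℓ) ≡ inj₁ zero
        τℓ = lst ℓ (cong suc (Finₚ.toℕ-fromℕ (2 + m)))
        τc : τ X (inj₁ (next a′)) ≡ inj₁ ℓ
        τc = trans (cong (τ X) (trans (sym τ0) (cong (τ X) (sym τℓ)))) (τ³ cu (inj₁ ℓ))
        bigc : ∀ c → toℕ c ≡ suc (toℕ a′) → τ X (inj₁ c) ≡ inj₁ ℓ → τ (H X) (inj₁ c) ≡ inj₁ ℓ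
        bigc (suc (suc c)) _ e = cong emb e
        bk : τ (H X) (inj₁ (next a′)) ≡ inj₁ ℓ
        bk = bigc (next a′) nx τc

Coded : ∀ {m} → Dessin m → Set
Coded {m} X = ∃ λ k → Σ (m ≡ M k) λ e → Σ (UW k []) λ d → subst Dessin e X ≅ webU d

CodedA : ∀ {m} → Dessin (3+ m) → ℕ → ℕ → Set
CodedA {m} Z i t = ∃ λ k → Σ (m ≡ M k) λ e → ∃ λ g → ∃ λ E → Σ (Act k i g E) λ α →
  suc (length E) ≡ t × subst (λ v → Dessin (3+ v)) e Z ≅ webA α

cg-0 : ∀ {m} {X : Dessin m} {a} → CG X a 0 → τ X (inj₁ a) ≡ inj₁ (next a)
cg-0 (y , here , p) = p

module Behind {m} (Z : Dessin (3+ m)) where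
  V W : Dessin (3+ m)
  V = unrot Z
  W = unrot V

  cg-V : ∀ {j} → CG Z (prev zero) j → CG V zero j
  cg-V {j} c = subst (λ v → CG V v j) (next-prev zero) (cg-to (unrot-conj Z) c)

  cg-V′ : ∀ {j} → CG Z (prev (prev zero)) j → CG V (prev zero) j
  cg-V′ {j} c = subst (λ v → CG V v j) (next-prev (prev zero)) (cg-to (unrot-conj Z) c)

  cg-W : ∀ {j} → CG V (prev zero) j → CG W zero j
  cg-W {j} c = subst (λ v → CG W v j) (next-prev zero) (cg-to (unrot-conj V) c)

  cg-W′ : ∀ {j} → CG V zero j → CG W 1F j
  cg-W′ c = cg-to (unrot-conj V) c

  idx₀ : suc (toℕ {3 + m} (prev zero) + 0) ≡ 3 + m
  idx₀ = cong suc (trans (ℕₚ.+-identityʳ _) (Finₚ.toℕ-fromℕ (2 + m)))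

  idx₁ : suc (toℕ {3 + m} (prev (prev zero)) + 1) ≡ 3 + m
  idx₁ = cong suc (trans (ℕₚ.+-comm _ 1) (cong suc (trans (Finₚ.toℕ-inject₁ (fromℕ (1 + m))) (Finₚ.toℕ-fromℕ (1 + m)))))

-- With no strand left to uncross, the two gaps behind the pointer expose a tripod. The rest has a
-- code in which everything is dropped, and `climb` moves its pointer back to the place where the
-- tripod stood.
peel-tripod : ∀ {m} → (∀ r (Y : Dessin m) → Good (T Y) → Coded (rotN r Y)) → (Z : Dessin (3+ m)) → Good Z →
  Back Z 0 (0 ∷ 0 ∷ []) → ∀ t → 1 ≤ t → t + 2 ≤ 3+ m → NoPatternIn (unrot Z) (suc t) → CodedA Z 0 t
peel-tripod {m} code Z G (e₀ , e₁ , _) (suc t) _ sz np = finish {t≤m = t≤m} (code t Y GT) np-Y I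
  where
  open Behind Z
  GW : Good W
  GW = good-≅ (unrot-conj V) (good-≅ (unrot-conj Z) G)
  unc : ∃ λ Y → W ≅ T Y
  unc = T-uncover W (cubic GW) (cg-0 {X = W} (cg-W (cg-V′ (e₁ _ idx₁)))) (cg-0 {X = W} (cg-W′ (cg-V (e₀ _ idx₀))))
  Y = proj₁ unc
  I = proj₂ unc
  GT : Good (T Y)
  GT = good-≅ (proj₁ I) GW
  t≤m : t ≤ m
  t≤m = ℕₚ.≤-pred (ℕₚ.≤-pred (ℕₚ.≤-pred (subst (_≤ 3+ m) (ℕₚ.+-comm (suc t) 2) sz)))
  np-Y : NoPatternIn Y t
  np-Y c n P bd = np (prev (3+ c)) n (pattern-≅ (≅-sym (rot-unrot V)) (pattern-to (rot-conj W) (pattern-≅ (≅-sym I) (pattern-T Y (ℕₚ.≤-trans bd t≤m) P))))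
    (subst (λ v → v + n + 3 ≤ 2 + t) (sym (Finₚ.toℕ-inject₁ (suc (suc c)))) (s≤s (s≤s bd)))
  finish : ∀ {m} {Z : Dessin (3+ m)} {Y : Dessin m} {t} {t≤m : t ≤ m} → Coded (rotN t Y) → NoPatternIn Y t → unrot (unrot Z) ≅ T Y → CodedA Z 0 (suc t)
  finish {Z = Z} {Y} {t} {t≤m} (k , refl , d , J) np I = fin (climb t d J (subst (NoPatternIn Y) (sym (ℕₚ.+-identityʳ t)) np) (subst (_≤ M k) (sym (ℕₚ.+-identityʳ t)) t≤m))
    where
    fin : (∃ λ E₁ → Σ (UW k E₁) λ d₁ → length E₁ ≡ t + 0 × Y ≅ webU d₁) → CodedA Z 0 (suc t)
    fin (E₁ , d₁ , len , K) = k , refl , nothing , E₁ , trip d₁ , cong suc (trans len (ℕₚ.+-identityʳ t)) ,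
      ≅-trans (rot-unrot Z) (rot-cong (≅-trans (rot-unrot (unrot Z)) (rot-cong (≅-trans I (T-cong K)))))

-- If edge 1 were followed by a boundary edge d, then d and the inner edge on the gap behind edge 0
-- would both precede edge 0 around its black vertex.
comb-inner : ∀ {m} {X : Dessin (3+ m)} → Cubic X → τ X (inj₁ zero) ≡ inj₁ 1F → CG X (prev zero) 1 → ∃ λ u → τ X (inj₁ 1F) ≡ inj₂ u
comb-inner {X = X} cu τ0 (y , there {u = u} p here , q) = go (τ X (inj₁ 1F)) refl
  where
  go : ∀ x → τ X (inj₁ 1F) ≡ x → ∃ λ u → τ X (inj₁ 1F) ≡ inj₂ u
  go (inj₂ u) e = u , e
  go (inj₁ d) e = ⊥-elim (absurd (τ-inj {X = X} cu {inj₁ d} {inj₂ (ρ X u)} (trans τd (sym (trans q (cong inj₁ (next-prev zero)))))))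
    where
    τd : τ X (inj₁ d) ≡ inj₁ zero
    τd = trans (cong (τ X) (trans (sym e) (cong (τ X) (sym τ0)))) (τ³ cu (inj₁ zero))
    absurd : ∀ {v : Fin (s X)} → inj₁ d ≢ inj₂ v
    absurd ()

no-wrap : ∀ {m} (c : Fin (suc m)) k → toℕ c + suc k < suc m → iter next (suc k) c ≢ zero
no-wrap c k lt e with trans (sym (iter-next-toℕ c (suc k) lt)) (cong toℕ e)
... | p with trans (sym (ℕₚ.+-suc (toℕ c) k)) p
... | ()

-- A pattern of the smaller web would reappear when the H is glued back, possibly longer to the
-- left; as `pattern-lift′` keeps its right end fixed, it would stay inside the region.
np-H⁻ : ∀ {m t} {X : Dessin (2 + m)} → Closable X → t ≤ 2 + m → NoPatternIn (H X) t → NoPatternIn X t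
np-H⁻ {m} {t} {X} cl t≤ np c n P bd = go (pattern-lift′ (h-step X cl) refl P (ℕₚ.≤-trans bd t≤) (no-wrap c (suc n) (subst (_≤ 2 + m) (lem (toℕ c) n) (ℕₚ.≤-trans bd t≤))))
  where
  lem : ∀ x y → x + y + 3 ≡ suc (x + (2 + y))
  lem = solve-∀
  go : (∃ λ c′ → ∃ λ k → Pattern (H X) c′ k × toℕ c′ + k ≡ toℕ c + n) → ⊥
  go (c′ , n′ , Q , eq) = np c′ n′ Q (subst (λ v → v + 3 ≤ t) (sym eq) bd)

-- Moving the pointer back by one edge can only add patterns that start at this edge. Their second
-- gap would pass at most two black vertices, but it is the gap shut by the H, which if closed
-- passes at least three.
np-unrot : ∀ {m t} {X : Dessin (2 + m)} → Closable X → NoPatternIn X t → NoPatternIn (unrot X) (suc t)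
np-unrot {m} {t} {X} cl np (suc c) n P bd = np (inject₁ c) n (pattern-to (conj-sym (unrot-conj X)) P)
    (subst (λ v → v + n + 3 ≤ t) (sym (Finₚ.toℕ-inject₁ c)) (ℕₚ.≤-pred bd))
np-unrot {m} {t} {X} cl np zero n P bd = start n P
  where
  small : ∀ {j} → j ≤ 1 → ¬ CG (unrot X) 1F j
  small {j} h c with ℕₚ.≤-trans (proj₁ (cl j (cg-to (conj-sym (unrot-conj X)) c))) (s≤s h)
  ... | s≤s (s≤s ())
  start : ∀ n → Pattern (unrot X) zero n → ⊥
  start zero P = small z≤n (last P)
  start (suc n) P = small ℕₚ.≤-refl (mid P 0 (s≤s z≤n))

peel-H : ∀ {m i} (Z : Dessin (3+ m)) → Good Z → Back Z 0 (0 ∷ ones (suc i)) → ∀ t → t + (3 + i) ≤ 3+ m → 1 ≤ t → NoPatternIn (unrot Z) (suc t) →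
  ∃ λ Z₁ → unrot Z ≅ H Z₁ × Good Z₁ × Closable Z₁ × Back Z₁ 0 (0 ∷ ones i) × NoPatternIn (unrot Z₁) (2 + t)
peel-H {m} {i} Z G (e₀ , e₁ , es) t sz 1≤t np = Z₁ , I , G₁ , cl , bk , np₁
  where
  open Behind Z
  GV : Good V
  GV = good-≅ (unrot-conj Z) G
  τ0 : τ V (inj₁ zero) ≡ inj₁ 1F
  τ0 = cg-0 {X = V} (cg-V (e₀ _ idx₀))
  cV : CG V (prev zero) 1
  cV = cg-V′ (e₁ _ idx₁)
  inner1 : ∃ λ u → τ V (inj₁ 1F) ≡ inj₂ u
  inner1 = comb-inner (cubic GV) τ0 cV
  unc = H-uncover V (cubic GV) τ0 (proj₂ inner1)
  Z₁ : Dessin (3+ m)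
  Z₁ = proj₁ unc
  I : V ≅ H Z₁
  I = proj₂ unc
  GH : Good (H Z₁)
  GH = good-≅ (proj₁ I) GV
  G₁ : Good Z₁
  G₁ = good-H⁻ GH
  cl : Closable Z₁
  cl = H-closable⁻ Z₁ (kr GH)
  i<m : suc i ≤ m
  i<m = ℕₚ.≤-pred (ℕₚ.≤-pred (ℕₚ.≤-pred (ℕₚ.≤-trans (ℕₚ.≤-trans (ℕₚ.≤-reflexive (sym (ℕₚ.+-suc 3 i))) (ℕₚ.+-monoˡ-≤ (3 + i) 1≤t)) sz)))
  backH : Back (H Z₁) 0 (ones (suc i))
  backH = back-≅ I 0 (ones (suc i)) (back-unrot 0 (ones (suc i)) (s≤s (subst (_≤ 2 + m) (sym (length-ones (suc i))) (s≤s (ℕₚ.m≤n⇒m≤1+n i<m)))) (e₁ , es))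
  lst : ∀ a → suc (toℕ a) ≡ 3 + m → τ Z₁ (inj₁ a) ≡ inj₁ zero
  lst a e = back-H⁻-first (cubic G₁) a e′ (proj₁ backH a e′)
    where
    e′ : suc (toℕ a + 0) ≡ 3 + m
    e′ = trans (cong suc (ℕₚ.+-identityʳ _)) e
  bk : Back Z₁ 0 (0 ∷ ones i)
  bk = (λ a e → inj₁ a , here , trans (lst a (trans (cong suc (sym (ℕₚ.+-identityʳ _))) e)) (cong inj₁ (sym (wrap-0 a (trans (cong suc (sym (ℕₚ.+-identityʳ _))) e))))) ,
    back-H⁻ (cubic G₁) lst 1 i ℕₚ.≤-refl i<m (λ c e → fst c (proj₁ backH c (trans (cong suc (ℕₚ.+-identityʳ _)) (trans (ℕₚ.+-comm 1 _) e)))) (proj₂ backH)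
    where
    fst : ∀ c → CG (H Z₁) c 1 → ∃ λ u → τ (H Z₁) (inj₁ c) ≡ inj₂ u
    fst c (y , there p r , _) = _ , p
  t≤ : suc t ≤ 3 + m
  t≤ = ℕₚ.≤-trans (ℕₚ.≤-reflexive (ℕₚ.+-comm 1 t)) (ℕₚ.≤-trans (ℕₚ.+-monoʳ-≤ t (s≤s z≤n)) sz)
  np₁ : NoPatternIn (unrot Z₁) (2 + t)
  np₁ = np-unrot cl (np-H⁻ cl t≤ (nopattern-≅ I np))

hop-ok : ∀ {m g h E} {Z : Dessin (2 + m)} → Closable Z → Matches Z 0 (g ∷ h ∷ E) → hop? g ≡ true
hop-ok {g = nothing} cl _ = refl
hop-ok {g = just j} cl ((zero , _ , c) , _) = proj₂ (cl j c)

matches-≅ : ∀ {m} {X Y : Dessin m} → X ≅ Y → ∀ p L → Matches X p L → Matches Y p L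
matches-≅ I p L = matches-map p p L (λ k _ a e c → a , e , cg-≅ I c)

hop-≅ : ∀ {m} {Z Z₁ A₁ : Dessin (2 + m)} → unrot Z ≅ H Z₁ → Z₁ ≅ A₁ → Z ≅ rot (H A₁)
hop-≅ {Z = Z} I J = ≅-trans (rot-unrot Z) (rot-cong (≅-trans I (H-cong J)))

act-hop : ∀ {m i t} {Z Z₁ : Dessin (3+ m)} → unrot Z ≅ H Z₁ → Closable Z₁ → CodedA Z₁ i (suc (suc t)) → CodedA Z (suc i) (suc t)
act-hop I cl (k , refl , g , h ∷ E , α , e , J) = k , refl , Maybe.map suc h , E ,
  hop α (hop-ok cl (matches-≅ (≅-sym J) 0 (g ∷ h ∷ E) (mat (st (ainv α))))) , ℕₚ.suc-injective e , hop-≅ I J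

peel : ∀ i {m} → (∀ r (Y : Dessin m) → Good (T Y) → Coded (rotN r Y)) → (Z : Dessin (3+ m)) → Good Z →
  Back Z 0 (0 ∷ ones i) → ∀ t → 1 ≤ t → t + (2 + i) ≤ 3+ m → NoPatternIn (unrot Z) (suc t) → CodedA Z i t
peel zero code Z G bk t 1≤t sz np = peel-tripod code Z G bk t 1≤t sz np
peel (suc i) {m} code Z G bk (suc t) 1≤t sz np = go (peel-H Z G bk (suc t) sz 1≤t np)
  where
  go : (∃ λ Z₁ → unrot Z ≅ H Z₁ × Good Z₁ × Closable Z₁ × Back Z₁ 0 (0 ∷ ones i) × NoPatternIn (unrot Z₁) (3 + t)) → CodedA Z (suc i) (suc t)
  go (Z₁ , I , G₁ , cl , bk₁ , np₁) = act-hop I cl (peel i code Z₁ G₁ bk₁ (suc (suc t)) (s≤s z≤n) (subst (_≤ 3+ m) (ℕₚ.+-suc (suc t) (2 + i)) sz) np₁)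

drop-all : ∀ {n E} (d : UW n E) → Σ (UW n []) λ d′ → webU d′ ≡ rotN (length E) (webU d)
drop-all {E = []} d = d , refl
drop-all {E = g ∷ E} d with drop-all (drop d)
... | d′ , e = d′ , trans e (sym (rotN-suc (length E) (webU d)))

-- K steps forward, i back and t + i forward make one full turn of the boundary.
unwind : ∀ {m K i t u} {X A₁ : Dessin m} → rotN K X ≅ A₁ → t + K ≡ m → u ≡ t + i → X ≅ rotN u (unrotN i A₁)
unwind {m} {K} {i} {t} {X = X} {A₁} J eq refl = ≅-trans p₁ (≅-trans p₂ (≅-trans p₃ p₄))
  where
  p₁ : X ≅ rotN m X
  p₁ = rotN-full X
  p₂ : rotN m X ≅ rotN t (rotN K X)
  p₂ = ≅-≡ (trans (cong (λ v → rotN v X) (sym eq)) (rotN-+ t K X))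
  p₃ : rotN t (rotN K X) ≅ rotN t (rotN i (unrotN i A₁))
  p₃ = rotN-cong t (≅-trans J (≅-sym (rotN-unrotN i A₁)))
  p₄ : rotN t (rotN i (unrotN i A₁)) ≅ rotN (t + i) (unrotN i A₁)
  p₄ = ≅-≡ (sym (rotN-+ t i (unrotN i A₁)))

coded-done : ∀ {m i t K} (X : Dessin (3+ m)) → CodedA (rotN K X) i t → t + K ≡ 3+ m → Coded X
coded-done {i = i} {t} {K} X (k , refl , g , E , α , refl , J) eq = suc k , refl , proj₁ D ,
  ≅-trans (unwind {K = K} {t = suc (length E)} J eq (trans (length-stack i g E) (lem (length E) i))) (≅-≡ (sym (proj₂ D)))
  where
  D : Σ (UW (suc k) []) λ d′ → webU d′ ≡ rotN (length (stack i g E)) (webU (done {E = E} α refl))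
  D = drop-all (done α refl)
  lem : ∀ e i → i + (2 + e) ≡ suc e + suc i
  lem = solve-∀

cg0? : ∀ {m} (X : Dessin m) a → Dec (CG X a 0)
cg0? X a = map′ (λ e → inj₁ a , here , e) (cg-0 {X = X}) (τ X (inj₁ a) ≟E inj₁ (next a))

cg1? : ∀ {m} (X : Dessin m) a → Dec (CG X a 1)
cg1? X a = go (τ X (inj₁ a)) refl
  where
  go : ∀ x → τ X (inj₁ a) ≡ x → Dec (CG X a 1)
  go (inj₁ c) e = no λ { (y , there p r , q) → absurd (trans (sym e) p) }
    where
    absurd : ∀ {u : Fin (s X)} → inj₁ c ≢ inj₂ u
    absurd ()
  go (inj₂ u) e = map′ (λ p → inj₂ (ρ X u) , there e here , p) from-cg (τ X (inj₂ (ρ X u)) ≟E inj₁ (next a))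
    where
    from-cg : CG X a 1 → τ X (inj₂ (ρ X u)) ≡ inj₁ (next a)
    from-cg (y , there p here , q) with Sumₚ.inj₂-injective (trans (sym e) p)
    ... | refl = q

pattern? : ∀ {m} (X : Dessin m) a n → Dec (Pattern X a n)
pattern? X a n = map′ (λ { (p , q , r) → record { first = p ; mid = λ k lt → q lt ; last = r } })
  (λ P → first P , (λ {k} lt → mid P k lt) , last P)
  (cg0? X a ×-dec (ℕₚ.allUpTo? (λ k → cg1? X (iter next (suc k) a)) n ×-dec cg0? X (iter next (suc n) a)))

PatternAt : ∀ {m} → Dessin m → Fin m → Set
PatternAt {m} X a = ∃ λ n → n < m × (Pattern X a n × toℕ a + n + 3 ≤ m)

patternAt? : ∀ {m} (X : Dessin m) a → Dec (PatternAt X a)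
patternAt? {m} X a = ℕₚ.anyUpTo? (λ n → pattern? X a n ×-dec (toℕ a + n + 3 ℕ.≤? m)) m

n<bound : ∀ {a n m} → a + n + 3 ≤ m → n < m
n<bound {a} {n} {m} h = ℕₚ.≤-trans (ℕₚ.≤-trans (s≤s (ℕₚ.m≤n+m n a)) (ℕₚ.≤-trans (ℕₚ.≤-reflexive (ℕₚ.+-comm 1 (a + n))) (ℕₚ.+-monoʳ-≤ (a + n) (s≤s z≤n)))) h

Rightmost : ∀ {m} → Dessin m → Fin m → Set
Rightmost X a = PatternAt X a × (∀ b → toℕ a < toℕ b → ¬ PatternAt X b)

rightmost : ∀ {m} (X : Dessin m) fuel a → m ≤ toℕ a + fuel → PatternAt X a → ∃ (Rightmost X)
rightmost {m} X zero a h P = ⊥-elim (ℕₚ.<-irrefl refl (ℕₚ.<-≤-trans (Finₚ.toℕ<n a) (subst (m ≤_) (ℕₚ.+-identityʳ _) h)))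
rightmost {m} X (suc fuel) a h P with any? (λ b → (toℕ a ℕ.<? toℕ b) ×-dec patternAt? X b)
... | yes (b , lt , Q) = rightmost X fuel b (ℕₚ.≤-trans h (ℕₚ.≤-trans (ℕₚ.≤-reflexive (ℕₚ.+-suc _ fuel)) (ℕₚ.+-monoˡ-≤ fuel lt))) Q
... | no none = a , P , λ b lt Q → none (b , lt , Q)

-- K steps bring the pointer to the last leg of the pattern, and t edges remain from there on. That
-- the pattern is the rightmost one is the absence of patterns that `peel` asks for.
module AtPattern {m} (X : Dessin (3+ m)) {a : Fin (3+ m)} {n} (P : Pattern X a n) (bd : toℕ a + n + 3 ≤ 3+ m) (right : ∀ b → toℕ a < toℕ b → ¬ PatternAt X b) where
  K₁ K : ℕ
  K₁ = toℕ a + suc n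
  K = suc K₁
  t : ℕ
  t = 3+ m ℕ.∸ K

  K+1≤ : suc K ≤ 3+ m
  K+1≤ = subst (_≤ 3+ m) (lem (toℕ a) n) bd
    where
    lem : ∀ x y → x + y + 3 ≡ suc (suc (x + suc y))
    lem = solve-∀

  t+K : t + K ≡ 3+ m
  t+K = ℕₚ.m∸n+n≡m (ℕₚ.<⇒≤ K+1≤)

  1≤t : 1 ≤ t
  1≤t = ℕₚ.m<n⇒0<n∸m K+1≤

  size-ok : t + (2 + n) ≤ 3+ m
  size-ok = ℕₚ.≤-trans (ℕₚ.+-monoʳ-≤ t (s≤s (ℕₚ.m≤n+m (suc n) (toℕ a)))) (ℕₚ.≤-reflexive t+K)

  pos : ∀ z q r → suc (toℕ z + q) ≡ 3+ m → q + r ≡ suc n → iter next K z ≡ iter next r a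
  pos z q r e e′ = Finₚ.toℕ-injective (trans (iter-next-wrap z K (toℕ a + r) eq lt) (sym (iter-next-toℕ a r lt)))
    where
    lt : toℕ a + r < 3+ m
    lt = ℕₚ.≤-trans (s≤s (ℕₚ.+-monoʳ-≤ (toℕ a) (ℕₚ.≤-trans (ℕₚ.m≤n+m r q) (ℕₚ.≤-reflexive e′)))) (ℕₚ.<⇒≤ K+1≤)
    eq : toℕ z + K ≡ 3+ m + (toℕ a + r)
    eq = trans (cong (λ v → toℕ z + suc (toℕ a + v)) (sym e′)) (trans (lem (toℕ z) (toℕ a) q r) (cong (_+ (toℕ a + r)) e))
      where
      lem : ∀ z a q r → z + suc (a + (q + r)) ≡ suc (z + q) + (a + r)
      lem = solve-∀

  entry : ∀ {v} z q r → suc (toℕ z + q) ≡ 3+ m → q + r ≡ suc n → CG X (iter next r a) v → CG (rotN K X) z v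
  entry {v} z q r e e′ c = subst (λ y → CG (rotN K X) y v) (trans (proj₂ (rotN-conj K X) _) (iter-prev-next K z))
    (cg-to (proj₁ (rotN-conj K X)) (subst (λ y → CG X y v) (sym (pos z q r e e′)) c))

  behind-ones : ∀ r q → q + r ≡ suc n → 1 ≤ q → Back (rotN K X) q (ones r)
  behind-ones zero q e _ = (λ z eq → entry z q 0 eq e (first P)) , tt
  behind-ones (suc r) q e 1≤q = (λ z eq → entry z q (suc r) eq e (mid P r (ℕₚ.≤-pred (ℕₚ.≤-trans (ℕₚ.+-monoˡ-≤ (suc r) 1≤q) (ℕₚ.≤-reflexive e))))) ,
    behind-ones r (suc q) (trans (sym (ℕₚ.+-suc q r)) e) (s≤s z≤n)

  behind : Back (rotN K X) 0 (0 ∷ ones n)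
  behind = (λ z eq → entry z 0 (suc n) eq refl (last P)) , behind-ones n 1 refl ℕₚ.≤-refl

  np : NoPatternIn (unrot (rotN K X)) (suc t)
  np c k Q h = right b₀ (subst (toℕ a <_) (sym b≡) (ℕₚ.<-≤-trans (ℕₚ.m<m+n (toℕ a) (s≤s z≤n)) (ℕₚ.m≤n+m K₁ (toℕ c))))
    (k , n<bound h′ , subst (λ v → Pattern X v k) (rotN-conj⁻ K₁ X c) (pattern-to (conj-sym (proj₁ (rotN-conj K₁ X))) (pattern-≅ (≅-sym (unrot-rot (rotN K₁ X))) Q)) , h′)
    where
    b₀ = iter next K₁ c
    h₀ : toℕ c + K₁ + k + 3 ≤ 3+ m
    h₀ = ℕₚ.≤-trans (ℕₚ.≤-reflexive (lem (toℕ c) K₁ k)) (ℕₚ.≤-trans (ℕₚ.+-monoˡ-≤ K₁ h) (ℕₚ.≤-reflexive (trans (sym (ℕₚ.+-suc t K₁)) t+K)))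
      where
      lem : ∀ x y z → x + y + z + 3 ≡ x + z + 3 + y
      lem = solve-∀
    b≡ : toℕ b₀ ≡ toℕ c + K₁
    b≡ = iter-next-toℕ c K₁ (ℕₚ.≤-trans (ℕₚ.≤-trans (s≤s (ℕₚ.m≤m+n _ k)) (ℕₚ.≤-trans (ℕₚ.≤-reflexive (ℕₚ.+-comm 1 _)) (ℕₚ.+-monoʳ-≤ (toℕ c + K₁ + k) (s≤s z≤n)))) h₀)
    h′ : toℕ b₀ + k + 3 ≤ 3+ m
    h′ = subst (λ v → v + k + 3 ≤ 3+ m) (sym b≡) h₀

  result : (∀ r (Y : Dessin m) → Good (T Y) → Coded (rotN r Y)) → Good X → Coded X
  result code G = coded-done X (peel n code (rotN K X) (good-≅ (proj₁ (rotN-conj K X)) G) behind t 1≤t size-ok np) t+K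

-- The recursion is on the number of boundary edges: undoing a hop keeps it, removing a tripod
-- lowers it by three.
coded : ∀ fuel {m} (X : Dessin (suc m)) → m < fuel → Good X → Coded X
coded-T : ∀ fuel {m} → m ≤ fuel → ∀ r (Y : Dessin m) → Good (T Y) → Coded (rotN r Y)
coded-big : ∀ fuel m (X : Dessin (suc m)) → m ≤ fuel → Good X → ∀ {a n} → Pattern X a n → toℕ a + n + 3 ≤ suc m →
  (∀ b → toℕ a < toℕ b → ¬ PatternAt X b) → Coded X

coded-T fuel {zero} h r Y G = 0 , refl , nil , mk≅ (λ u → ⊥-elim (no-inner u)) (λ ()) (λ ()) (λ u → ⊥-elim (no-inner u)) (λ { (inj₁ ()) ; (inj₂ u) → ⊥-elim (no-inner u) }) (λ u → ⊥-elim (no-inner u))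
  where
  no-inner : ¬ Fin (s (rotN r Y))
  no-inner u = T-hub-0 Y (conn G) (g (proj₁ (rotN-conj r Y)) u)
coded-T (suc fuel) {suc m} h r Y G = coded (suc fuel) (rotN r Y) h (good-≅ (proj₁ (rotN-conj r Y)) (good-T⁻ G))

coded (suc fuel) {m} X (s≤s h) G = go (pattern-exists (suc (s X)) X G ℕₚ.≤-refl)
  where
  go : HasPattern X → Coded X
  go (a , n , P , bd) = go′ (rightmost X (suc m) a (ℕₚ.m≤n+m (suc m) (toℕ a)) (n , n<bound bd , P , bd))
    where
    go′ : ∃ (Rightmost X) → Coded X
    go′ (a , (n , _ , P , bd) , right) = coded-big fuel m X h G P bd right

coded-big fuel zero X h G {a} {n} P bd right = ⊥-elim (ℕₚ.<-irrefl refl (ℕₚ.≤-trans (s≤s (s≤s z≤n)) (ℕₚ.≤-trans (ℕₚ.m≤n+m 3 (toℕ a + n)) bd)))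
coded-big fuel (suc zero) X h G {a} {n} P bd right = ⊥-elim (ℕₚ.<-irrefl refl (ℕₚ.≤-trans (ℕₚ.m≤n+m 3 (toℕ a + n)) bd))
coded-big (suc (suc fuel)) (suc (suc m)) X h G P bd right = AtPattern.result X P bd right (coded-T (suc fuel) (ℕₚ.m≤n⇒m≤1+n (ℕₚ.≤-pred (ℕₚ.≤-pred h)))) G
coded-big (suc zero) (suc (suc m)) X (s≤s ()) G P bd right

-- Capped maps as dessins

classes-⊎ : ∀ {A B : Set} {f : A → A} {g : B → B} {M N} → Classes (Graph f) M → Classes (Graph g) N → Classes (Graph (map⊎ f g)) (M + N)
classes-⊎ {A} {B} {f} {g} {M} {N} C D = record
  { lab = L
  ; rep = λ i → map⊎ (rep C) (rep D) (splitAt M i)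
  ; sound = λ { {inj₁ x} refl → cong (_↑ˡ N) (sound C refl) ; {inj₂ x} refl → cong (M ↑ʳ_) (sound D refl) }
  ; complete = λ {x} {y} → cmp x y
  ; lab-rep = lr }
  where
  L : A ⊎ B → Fin (M + N)
  L (inj₁ a) = lab C a ↑ˡ N
  L (inj₂ b) = M ↑ʳ lab D b
  G = Graph (map⊎ f g)
  l : ∀ {x y} → EqClosure (Graph f) x y → EqClosure G (inj₁ x) (inj₁ y)
  l = E-bind inj₁ (λ e → Eq.return (cong inj₁ e))
  r : ∀ {x y} → EqClosure (Graph g) x y → EqClosure G (inj₂ x) (inj₂ y)
  r = E-bind inj₂ (λ e → Eq.return (cong inj₂ e))
  cmp : ∀ x y → L x ≡ L y → EqClosure G x y
  cmp (inj₁ a) (inj₁ b) e = l (complete C (Finₚ.↑ˡ-injective N _ _ e))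
  cmp (inj₂ a) (inj₂ b) e = r (complete D (Finₚ.↑ʳ-injective M _ _ e))
  cmp (inj₁ a) (inj₂ b) e with trans (sym (Finₚ.splitAt-↑ˡ M (lab C a) N)) (trans (cong (splitAt M) e) (Finₚ.splitAt-↑ʳ M N (lab D b)))
  ... | ()
  cmp (inj₂ a) (inj₁ b) e with trans (sym (Finₚ.splitAt-↑ʳ M N (lab D a))) (trans (cong (splitAt M) e) (Finₚ.splitAt-↑ˡ M (lab C b) N))
  ... | ()
  lr : ∀ i → L (map⊎ (rep C) (rep D) (splitAt M i)) ≡ i
  lr i with splitAt M i in eq
  ... | inj₁ j = trans (cong (_↑ˡ N) (lab-rep C j)) (Finₚ.splitAt⁻¹-↑ˡ eq)
  ... | inj₂ j = trans (cong (M ↑ʳ_) (lab-rep D j)) (Finₚ.splitAt⁻¹-↑ʳ eq)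

classes-swap : ∀ {A : Set} {n} (h : A → Fin n) (h⁻ : Fin n → A) → (∀ i → h (h⁻ i) ≡ i) → (∀ x → h⁻ (h x) ≡ x) → Classes (Graph (swap {A = A} {B = A})) n
classes-swap {A} h h⁻ hh⁻ h⁻h = record { lab = λ x → h (un x) ; rep = λ i → inj₁ (h⁻ i) ; sound = λ { {inj₁ x} refl → refl ; {inj₂ x} refl → refl }
  ; complete = λ {x} {y} e → E-sym (home x) ◅◅ (E-≡ (cong inj₁ (trans (sym (h⁻h (un x))) (trans (cong h⁻ e) (h⁻h (un y))))) ◅◅ home y) ; lab-rep = hh⁻ }
  where
  un : A ⊎ A → A
  un (inj₁ x) = x
  un (inj₂ x) = x
  home : ∀ x → EqClosure (Graph swap) (inj₁ (un x)) x
  home (inj₁ x) = ε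
  home (inj₂ x) = step (inj₁ x)

classes-prev : ∀ m → Classes (Graph (prev {suc m})) 1
classes-prev m = record { lab = λ _ → zero ; rep = λ _ → zero ; sound = λ _ → refl ; complete = λ {x} {y} _ → to0 x ◅◅ E-sym (to0 y) ; lab-rep = λ { zero → refl } }
  where
  it : ∀ k (x : Fin (suc m)) → EqClosure (Graph prev) x (iter prev k x)
  it zero x = ε
  it (suc k) x = it k x ◅◅ step _
  to0 : ∀ x → EqClosure (Graph prev) x zero
  to0 x = it (toℕ x) x ◅◅ E-≡ (iter-prev-toℕ x)

-- The darts of the capped map of a web.
data Dart (m : ℕ) (E : Set) : Set where
  hubD bndD : Fin m → Dart m E
  whte blck   : E → Dart m E

module _ {m} (X : Dessin m) where

  αD : Dart m (Edge X) → Dart m (Edge X)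
  αD (hubD i) = bndD i
  αD (bndD i) = hubD i
  αD (whte x) = blck x
  αD (blck x) = whte x

  σD : Dart m (Edge X) → Dart m (Edge X)
  σD (hubD i) = hubD (prev i)
  σD (bndD i) = whte (inj₁ i)
  σD (whte (inj₁ i)) = bndD i
  σD (whte (inj₂ u)) = whte (inj₂ (ρ X u))
  σD (blck x) = blck (τ X x)

  colD : Dart m (Edge X) → Color
  colD (blck x) = black
  colD _ = white

  φD : Dart m (Edge X) → Dart m (Edge X)
  φD d = σD (αD d)

  αD-classes : Classes (Graph αD) (m + (m + s X))
  αD-classes = transferGraph-≅ r e com er re
      (classes-⊎ (classes-swap {A = Fin m} (λ i → i) (λ i → i) (λ _ → refl) (λ _ → refl))
                 (classes-swap (Fin.join m (s X)) (splitAt m) (Finₚ.join-splitAt m (s X)) (Finₚ.splitAt-join m (s X))))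
    where
    S = (Fin m ⊎ Fin m) ⊎ (Edge X ⊎ Edge X)
    r : Dart m (Edge X) → S
    r (hubD i) = inj₁ (inj₁ i)
    r (bndD i) = inj₁ (inj₂ i)
    r (whte x) = inj₂ (inj₁ x)
    r (blck x) = inj₂ (inj₂ x)
    e : S → Dart m (Edge X)
    e (inj₁ (inj₁ i)) = hubD i
    e (inj₁ (inj₂ i)) = bndD i
    e (inj₂ (inj₁ x)) = whte x
    e (inj₂ (inj₂ x)) = blck x
    com : ∀ x → αD (e x) ≡ e (map⊎ swap swap x)
    com (inj₁ (inj₁ i)) = refl
    com (inj₁ (inj₂ i)) = refl
    com (inj₂ (inj₁ x)) = refl
    com (inj₂ (inj₂ x)) = refl
    er : ∀ y → e (r y) ≡ y
    er (hubD i) = refl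
    er (bndD i) = refl
    er (whte x) = refl
    er (blck x) = refl
    re : ∀ y → r (e y) ≡ y
    re (inj₁ (inj₁ i)) = refl
    re (inj₁ (inj₂ i)) = refl
    re (inj₂ (inj₁ x)) = refl
    re (inj₂ (inj₂ x)) = refl

  σD-classes : ∀ {m′ w b} → m ≡ suc m′ → Classes (Graph (ρ X)) w → Classes (Graph (τ X)) b → Classes (Graph σD) ((1 + m) + (w + b))
  σD-classes {m′} refl cw cb = transferGraph-≅ r e com er re
      (classes-⊎ (classes-⊎ (classes-prev m′) (classes-swap {A = Fin m} (λ i → i) (λ i → i) (λ _ → refl) (λ _ → refl))) (classes-⊎ cw cb))
    where
    S = (Fin m ⊎ (Fin m ⊎ Fin m)) ⊎ (Fin (s X) ⊎ Edge X)
    r : Dart m (Edge X) → S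
    r (hubD i) = inj₁ (inj₁ i)
    r (bndD i) = inj₁ (inj₂ (inj₁ i))
    r (whte (inj₁ i)) = inj₁ (inj₂ (inj₂ i))
    r (whte (inj₂ u)) = inj₂ (inj₁ u)
    r (blck x) = inj₂ (inj₂ x)
    e : S → Dart m (Edge X)
    e (inj₁ (inj₁ i)) = hubD i
    e (inj₁ (inj₂ (inj₁ i))) = bndD i
    e (inj₁ (inj₂ (inj₂ i))) = whte (inj₁ i)
    e (inj₂ (inj₁ u)) = whte (inj₂ u)
    e (inj₂ (inj₂ x)) = blck x
    com : ∀ x → σD (e x) ≡ e (map⊎ (map⊎ prev swap) (map⊎ (ρ X) (τ X)) x)
    com (inj₁ (inj₁ i)) = refl
    com (inj₁ (inj₂ (inj₁ i))) = refl
    com (inj₁ (inj₂ (inj₂ i))) = refl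
    com (inj₂ (inj₁ u)) = refl
    com (inj₂ (inj₂ x)) = refl
    er : ∀ y → e (r y) ≡ y
    er (hubD i) = refl
    er (bndD i) = refl
    er (whte (inj₁ i)) = refl
    er (whte (inj₂ u)) = refl
    er (blck x) = refl
    re : ∀ y → r (e y) ≡ y
    re (inj₁ (inj₁ i)) = refl
    re (inj₁ (inj₂ (inj₁ i))) = refl
    re (inj₁ (inj₂ (inj₂ i))) = refl
    re (inj₂ (inj₁ u)) = refl
    re (inj₂ (inj₂ x)) = refl

  -- The `whte` darts meet every face of the capped map, and the first return of φ to them is ψ.
  φD-classes : ∀ {F} → Classes (Graph (ψ X)) F → Classes (Graph φD) F
  φD-classes = transferGraph r whte (λ ()) (λ _ → refl) oldnew ir (λ _ → refl) (λ ())
    where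
    r : Dart m (Edge X) → Edge X ⊎ Fin 0
    r (hubD i) = inj₁ (inj₁ i)
    r (bndD i) = inj₁ (inj₁ (prev i))
    r (whte x) = inj₁ x
    r (blck x) = inj₁ (hubρ X x)
    oldnew : ∀ y → (∃ λ x → y ≡ whte x) ⊎ (r (φD y) ≡ r y)
    oldnew (hubD i) = inj₂ refl
    oldnew (bndD i) = inj₂ refl
    oldnew (whte x) = inj₁ (x , refl)
    oldnew (blck (inj₁ i)) = inj₂ refl
    oldnew (blck (inj₂ u)) = inj₂ refl
    ir : ∀ y → EqClosure (Graph φD) ([ whte , (λ ()) ]′ (r y)) y
    ir (hubD i) = E-sym (step (hubD i))
    ir (bndD i) = E-sym (step (bndD i) ◅◅ step (hubD (prev i)))
    ir (whte x) = ε
    ir (blck (inj₁ i)) = E-sym (step (blck (inj₁ i)) ◅◅ (step (bndD i) ◅◅ step (hubD (prev i))))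
    ir (blck (inj₂ u)) = E-sym (step (blck (inj₂ u)))

-- W is, up to naming of darts, the capped map of the dessin X.
record Pres {m} (W : RawWeb m) (X : Dessin m) : Set where
  open RawWeb W
  field
    P     : Dart m (Edge X) → Fin (m + k)
    Q     : Fin (m + k) → Dart m (Edge X)
    PQ    : ∀ x → P (Q x) ≡ x
    QP    : ∀ d → Q (P d) ≡ d
    P-hub : ∀ i → P (hubD i) ≡ hub W i
    P-α   : ∀ d → α (P d) ≡ P (αD X d)
    P-σ   : ∀ d → σ (P d) ≡ P (σD X d)
    P-col : ∀ d → (∀ i → d ≢ hubD i) → col (P d) ≡ colD X d

  P-φ : ∀ d → φ W (P d) ≡ P (φD X d)
  P-φ d = trans (cong σ (P-α d)) (P-σ (αD X d))

  P-inj : ∀ {c d} → P c ≡ P d → c ≡ d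
  P-inj {c} {d} e = trans (sym (QP c)) (trans (cong Q e) (QP d))

  nonhub : ∀ {d} → (∀ i → d ≢ hubD i) → NonHub W (P d)
  nonhub n i e = n i (P-inj (trans e (sym (P-hub i))))

  nonhub⁻ : ∀ {d} → NonHub W (P d) → ∀ i → d ≢ hubD i
  nonhub⁻ n i refl = n i (P-hub i)

open Pres public

num-classes : ∀ {d N} {R : Fin d → Fin d → Set} → Classes R N → NumClasses (λ _ → ⊤) R N
num-classes C = record { rep = rep C ; rep-in = λ _ → tt ; cover = λ x _ → lab C x , complete C (lab-rep C (lab C x))
  ; distinct = λ i j e → trans (sym (lab-rep C i)) (trans (soundE C e) (lab-rep C j)) }

classes-num : ∀ {d N} {R : Fin d → Fin d → Set} → NumClasses (λ _ → ⊤) R N → Classes R N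
classes-num {R = R} C = record { lab = λ x → proj₁ (NC.cover x tt) ; rep = NC.rep
  ; sound = λ {x} {y} r → NC.distinct _ _ (proj₂ (NC.cover x tt) ◅◅ (Eq.return r ◅◅ E-sym (proj₂ (NC.cover y tt))))
  ; complete = λ {x} {y} e → E-sym (proj₂ (NC.cover x tt)) ◅◅ (E-≡ (cong NC.rep e) ◅◅ proj₂ (NC.cover y tt))
  ; lab-rep = λ i → NC.distinct _ _ (proj₂ (NC.cover (NC.rep i) tt)) }
  where module NC = NumClasses C

module _ {m} {W : RawWeb m} {X : Dessin m} (p : Pres W X) where
  open RawWeb W

  α-classes : Classes (Graph α) (m + (m + s X))
  α-classes = transferGraph-≅ (Q p) (P p) (P-α p) (PQ p) (QP p) (αD-classes X)

  σ-classes : ∀ {m′ w b} → m ≡ suc m′ → Classes (Graph (ρ X)) w → Classes (Graph (τ X)) b → Classes (Graph σ) ((1 + m) + (w + b))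
  σ-classes e cw cb = transferGraph-≅ (Q p) (P p) (P-σ p) (PQ p) (QP p) (σD-classes X e cw cb)

  φ-classes : ∀ {F} → Classes (Graph (ψ X)) F → Classes (Graph (φ W)) F
  φ-classes cf = transferGraph-≅ (Q p) (P p) (P-φ p) (PQ p) (QP p) (φD-classes X cf)

  φ-run : ∀ {x n y} → Run X x n y → iter (φ W) (n + n) (P p (whte x)) ≡ P p (whte y)
  φ-run here = refl
  φ-run {x} {suc n} (there {u = u} e r) = trans (cong (λ v → iter (φ W) v (P p (whte x))) (cong suc (ℕₚ.+-suc n n)))
    (trans (iter-suc (φ W) (suc (n + n)) _) (trans (iter-suc (φ W) (n + n) _) (trans (cong (iter (φ W) (n + n)) two) (φ-run r))))
    where
    two : φ W (φ W (P p (whte x))) ≡ P p (whte (inj₂ (ρ X u)))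
    two = trans (cong (φ W) (trans (P-φ p (whte x)) (cong (λ v → P p (blck v)) e))) (P-φ p (blck (inj₂ u)))

module _ {m} {W : RawWeb m} {X : Dessin m} (p : Pres W X) where
  open RawWeb W

  bnd-P : ∀ i → bnd W i ≡ P p (bndD i)
  bnd-P i = trans (cong α (sym (P-hub p i))) (P-α p (hubD i))

  σbnd-P : ∀ i → σ (bnd W i) ≡ P p (whte (inj₁ i))
  σbnd-P i = trans (cong σ (bnd-P i)) (P-σ p (bndD i))

  private
    Rel : Fin (m + k) → Fin (m + k) → Set
    Rel x y = (σ x ≡ y) ⊎ (α x ≡ y)
    σ~ : ∀ d → EqClosure Rel (P p d) (P p (σD X d))
    σ~ d = Eq.return (inj₁ (P-σ p d))
    α~ : ∀ d → EqClosure Rel (P p d) (P p (αD X d))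
    α~ d = Eq.return (inj₂ (P-α p d))

    hub~ : ∀ c → EqClosure Rel (P p (hubD c)) (P p (whte (inj₁ c)))
    hub~ c = α~ (hubD c) ◅◅ σ~ (bndD c)

    link~ : ∀ {x y} → HubLink X x y → EqClosure Rel (P p (whte x)) (P p (whte y))
    link~ (hτ x) = α~ (whte x) ◅◅ (σ~ (blck x) ◅◅ α~ (blck (τ X x)))
    link~ (hρ (inj₁ c)) = E-sym (hub~ c) ◅◅ (σ~ (hubD c) ◅◅ hub~ (prev c))
    link~ (hρ (inj₂ u)) = σ~ (whte (inj₂ u))

  pres-connected : ∀ {m′} → m ≡ suc m′ → (∀ x y → EqClosure (HubLink X) x y) → Connected W
  pres-connected refl conn = num-classes record { lab = λ _ → zero ; rep = λ _ → P p (hubD zero) ; sound = λ _ → refl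
    ; complete = λ {x} {y} _ → E-sym (all x) ◅◅ all y ; lab-rep = λ { zero → refl } }
    where
    whts : ∀ x → EqClosure Rel (P p (hubD zero)) (P p (whte x))
    whts x = hub~ zero ◅◅ E-bind (λ x → P p (whte x)) link~ (conn (inj₁ zero) x)
    darts : ∀ d → EqClosure Rel (P p (hubD zero)) (P p d)
    darts (hubD i) = whts (inj₁ i) ◅◅ E-sym (hub~ i)
    darts (bndD i) = whts (inj₁ i) ◅◅ σ~ (whte (inj₁ i))
    darts (whte x) = whts x
    darts (blck x) = whts x ◅◅ α~ (whte x)
    all : ∀ x → EqClosure Rel (P p (hubD zero)) x
    all x = darts (Q p x) ◅◅ E-≡ (PQ p x)

  pres-spherical : ∀ {m′} → m ≡ suc m′ → Fine X → Spherical W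
  pres-spherical e fi = _ , _ , _ , num-classes (σ-classes p e (cw fi) (cb fi)) , num-classes (α-classes p) , num-classes (φ-classes p (cf fi)) ,
    eul (w fi) (b fi) (F fi) (feuler fi) (fsize fi)
    where
    eul : ∀ w b F → w + F ≡ 2 * b + 1 → 3 * b ≡ m + s X → (1 + m) + (w + b) + F ≡ 2 + (m + (m + s X))
    eul w b F e₁ e₂ = trans (lem₁ m w b F) (trans (cong (λ v → 1 + m + b + v) e₁) (trans (lem₂ m b) (cong (λ v → 2 + (m + v)) e₂)))
      where
      lem₁ : ∀ m w b F → (1 + m) + (w + b) + F ≡ 1 + m + b + (w + F)
      lem₁ = solve-∀
      lem₂ : ∀ m b → 1 + m + b + (2 * b + 1) ≡ 2 + (m + 3 * b)
      lem₂ = solve-∀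

  pres-isWeb : (∀ x → σ (σ⁻ x) ≡ x) → (∀ x → σ⁻ (σ x) ≡ x) → Cubic X → (m + k ≡ 0) ⊎ (Connected W × Spherical W) → IsWeb W
  pres-isWeb σσ⁻ σ⁻σ cu pl = record
    { α-invol = λ x → via (λ x → α (α x) ≡ x) (λ d → trans (cong α (P-α p d)) (trans (P-α p _) (cong (P p) (αα d)))) x
    ; α-nofix = λ x → via (λ x → α x ≢ x) (λ d e → αn d (P-inj p (trans (sym (P-α p d)) e))) x
    ; σ-inv₁ = σσ⁻ ; σ-inv₂ = σ⁻σ
    ; hub-rot = λ i → trans (cong σ (sym (P-hub p i))) (trans (P-σ p (hubD i)) (P-hub p (prev i)))
    ; bnd-nonhub = λ i → subst (NonHub W) (sym (bnd-P i)) (nonhub p (λ j ()))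
    ; bnd-deg = λ i → trans (cong σ (σbnd-P i)) (trans (P-σ p _) (sym (bnd-P i)))
    ; bnd-sep = λ i j e → sep (P-inj p (trans (sym (σbnd-P i)) (trans e (bnd-P j))))
    ; int-deg = λ x → via (λ x → NonHub W x → (∀ i → x ≢ bnd W i) → (∀ i → x ≢ σ (bnd W i)) → (σ x ≢ x) × (σ (σ (σ x)) ≡ x)) deg x
    ; col-vertex = λ x → via (λ x → NonHub W x → col (σ x) ≡ col x) (λ d n → trans (cong col (P-σ p d)) (trans (P-col p _ (σnh d (nonhub⁻ p n))) (trans (cv d) (sym (P-col p d (nonhub⁻ p n)))))) x
    ; col-edge = λ x → via (λ x → NonHub W x → NonHub W (α x) → col (α x) ≢ col x)
        (λ d n n′ e → ce d (nonhub⁻ p n) (nonhub⁻ p (subst (NonHub W) (P-α p d) n′))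
          (trans (sym (P-col p _ (nonhub⁻ p (subst (NonHub W) (P-α p d) n′)))) (trans (cong col (sym (P-α p d))) (trans e (P-col p d (nonhub⁻ p n)))))) x
    ; planar = pl }
    where
    via : (A : Fin (m + k) → Set) → (∀ d → A (P p d)) → ∀ x → A x
    via A h x = subst A (PQ p x) (h (Q p x))
    αα : ∀ d → αD X (αD X d) ≡ d
    αα (hubD i) = refl
    αα (bndD i) = refl
    αα (whte x) = refl
    αα (blck x) = refl
    αn : ∀ d → αD X d ≢ d
    αn (hubD i) ()
    αn (bndD i) ()
    αn (whte x) ()
    αn (blck x) ()
    sep : ∀ {i j} → whte {m} {Edge X} i ≢ bndD j
    sep ()
    σnh : ∀ d → (∀ i → d ≢ hubD i) → ∀ i → σD X d ≢ hubD i
    σnh (hubD i) n = ⊥-elim (n i refl)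
    σnh (bndD i) n j ()
    σnh (whte (inj₁ i)) n j ()
    σnh (whte (inj₂ u)) n j ()
    σnh (blck x) n j ()
    cv : ∀ d → colD X (σD X d) ≡ colD X d
    cv (hubD i) = refl
    cv (bndD i) = refl
    cv (whte (inj₁ i)) = refl
    cv (whte (inj₂ u)) = refl
    cv (blck x) = refl
    ce : ∀ d → (∀ i → d ≢ hubD i) → (∀ i → αD X d ≢ hubD i) → colD X (αD X d) ≢ colD X d
    ce (hubD i) n n′ e = n i refl
    ce (bndD i) n n′ e = n′ i refl
    ce (whte x) n n′ ()
    ce (blck x) n n′ ()
    σ³ : ∀ d → σ (σ (σ (P p d))) ≡ P p (σD X (σD X (σD X d)))
    σ³ d = trans (cong (λ v → σ (σ v)) (P-σ p d)) (trans (cong σ (P-σ p _)) (P-σ p _))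
    deg : ∀ d → NonHub W (P p d) → (∀ i → P p d ≢ bnd W i) → (∀ i → P p d ≢ σ (bnd W i)) → (σ (P p d) ≢ P p d) × (σ (σ (σ (P p d))) ≡ P p d)
    deg (hubD i) n _ _ = ⊥-elim (n i (P-hub p i))
    deg (bndD i) _ n _ = ⊥-elim (n i (sym (bnd-P i)))
    deg (whte (inj₁ i)) _ _ n = ⊥-elim (n i (sym (σbnd-P i)))
    deg (whte (inj₂ u)) _ _ _ = (λ e → ρ≢ cu u (whtinj (P-inj p (trans (sym (P-σ p _)) e)))) , trans (σ³ _) (cong (λ v → P p (whte (inj₂ v))) (ρ³ cu u))
      where
      whtinj : ∀ {a b : Fin (s X)} → whte {m} {Edge X} (inj₂ a) ≡ whte (inj₂ b) → a ≡ b
      whtinj refl = refl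
    deg (blck x) _ _ _ = (λ e → τ≢ cu x (blkinj (P-inj p (trans (sym (P-σ p _)) e)))) , trans (σ³ _) (cong (λ v → P p (blck v)) (τ³ cu x))
      where
      blkinj : ∀ {a b : Edge X} → blck {m} a ≡ blck b → a ≡ b
      blkinj refl = refl

  components : ∀ {N} → Classes (Link X) N → NumComponents W N
  components C = record
    { rep = λ i → P p (whte (rep C i))
    ; rep-in = λ i → nonhub p (λ j ())
    ; cover = λ x n → subst (λ x → NonHub W x → ∃ λ i → EqClosure R (P p (whte (rep C i))) x) (PQ p x) (λ n → cov (Q p x) n) n
    ; distinct = λ i j e → trans (sym (lab-rep C i)) (trans (trans (cong (λ d → lab C (un d)) (sym (QP p (whte (rep C i))))) (trans (E-const (λ x → lab C (un (Q p x))) inv e) (cong (λ d → lab C (un d)) (QP p (whte (rep C j)))))) (lab-rep C j)) }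
    where
    R : Fin (m + k) → Fin (m + k) → Set
    R x y = NonHub W x × NonHub W y × ((σ x ≡ y) ⊎ (α x ≡ y))
    un : Dart m (Edge X) → Edge X
    un (hubD i) = inj₁ i
    un (bndD i) = inj₁ i
    un (whte x) = x
    un (blck x) = x
    nw : ∀ {x} → NonHub W (P p (whte x))
    nw = nonhub p (λ j ())
    nb : ∀ {x} → NonHub W (P p (blck x))
    nb = nonhub p (λ j ())
    nβ : ∀ {i} → NonHub W (P p (bndD i))
    nβ = nonhub p (λ j ())
    wb : ∀ x → EqClosure R (P p (whte x)) (P p (blck x))
    wb x = Eq.return (nw , nb , inj₂ (P-α p (whte x)))
    lk : ∀ {x y} → Link X x y → EqClosure R (P p (whte x)) (P p (whte y))
    lk (lτ x) = wb x ◅◅ (Eq.return (nb , nb , inj₁ (P-σ p (blck x))) ◅◅ E-sym (wb (τ X x)))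
    lk (lρ u) = Eq.return (nw , nw , inj₁ (P-σ p (whte (inj₂ u))))
    fromrep : ∀ x → EqClosure R (P p (whte (rep C (lab C x)))) (P p (whte x))
    fromrep x = E-bind (λ x → P p (whte x)) lk (complete C (lab-rep C (lab C x)))
    cov : ∀ d → NonHub W (P p d) → ∃ λ i → EqClosure R (P p (whte (rep C i))) (P p d)
    cov (hubD i) n = ⊥-elim (n i (P-hub p i))
    cov (bndD i) n = lab C (inj₁ i) , (fromrep (inj₁ i) ◅◅ Eq.return (nw , nβ , inj₁ (P-σ p (whte (inj₁ i)))))
    cov (whte x) n = lab C x , fromrep x
    cov (blck x) n = lab C x , (fromrep x ◅◅ wb x)
    invD : ∀ d → NonHub W (P p d) → (lab C (un (σD X d)) ≡ lab C (un d)) × (NonHub W (P p (αD X d)) → lab C (un (αD X d)) ≡ lab C (un d))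
    invD (hubD i) n = ⊥-elim (n i (P-hub p i))
    invD (bndD i) n = refl , λ n′ → ⊥-elim (n′ i (P-hub p i))
    invD (whte (inj₁ i)) n = refl , λ _ → refl
    invD (whte (inj₂ u)) n = sym (sound C (lρ u)) , λ _ → refl
    invD (blck x) n = sym (sound C (lτ x)) , λ _ → refl
    inv : ∀ {x y} → R x y → lab C (un (Q p x)) ≡ lab C (un (Q p y))
    inv {x} {y} (n , n′ , st) = subst (λ v → NonHub W v → NonHub W y → (σ v ≡ y) ⊎ (α v ≡ y) → lab C (un (Q p x)) ≡ lab C (un (Q p y))) (PQ p x) (go (Q p x)) n n′ st
      where
      go : ∀ d → NonHub W (P p d) → NonHub W y → (σ (P p d) ≡ y) ⊎ (α (P p d) ≡ y) → lab C (un d) ≡ lab C (un (Q p y))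
      go d n n′ (inj₁ refl) = trans (sym (proj₁ (invD d n))) (cong (λ v → lab C (un v)) (sym (trans (cong (Q p) (P-σ p d)) (QP p _))))
      go d n n′ (inj₂ refl) = trans (sym (proj₂ (invD d n) (subst (NonHub W) (P-α p d) n′))) (cong (λ v → lab C (un v)) (sym (trans (cong (Q p) (P-α p d)) (QP p _))))

odd-double : ∀ n → odd (n + n) ≡ false
odd-double zero = refl
odd-double (suc n) = trans (cong (λ v → not (odd v)) (ℕₚ.+-suc n n)) (trans (not-involutive (odd (n + n))) (odd-double n))

even⊎odd : ∀ n → (∃ λ k → n ≡ k + k) ⊎ (∃ λ k → n ≡ suc (k + k))
even⊎odd zero = inj₁ (0 , refl)
even⊎odd (suc n) with even⊎odd n
... | inj₁ (k , e) = inj₂ (k , cong suc e)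
... | inj₂ (k , e) = inj₁ (suc k , cong suc (trans e (sym (ℕₚ.+-suc k k))))

¬4∣2odd : ∀ n → odd n ≡ true → ¬ (4 ∣ (n + n))
¬4∣2odd n o (divides q e) with trans (sym o) (trans (cong odd n≡) (odd-double q))
  where
  n≡ : n ≡ q + q
  n≡ = ℕₚ.*-cancelˡ-≡ n (q + q) 2 (trans (lem₁ n) (trans e (lem₂ q)))
    where
    lem₁ : ∀ n → 2 * n ≡ n + n
    lem₁ = solve-∀
    lem₂ : ∀ q → q * 4 ≡ 2 * (q + q)
    lem₂ = solve-∀
... | ()

2odd : ∀ n → ¬ (4 ∣ (n + n)) → odd n ≡ true
2odd n h with even⊎odd n
... | inj₁ (q , refl) = ⊥-elim (h (divides q (lem q)))
  where
  lem : ∀ q → q + q + (q + q) ≡ q * 4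
  lem = solve-∀
... | inj₂ (q , refl) = cong not (odd-double q)

module _ {m} {W : RawWeb m} {X : Dessin m} (p : Pres W X) where
  open RawWeb W

  φ-inj : IsWeb W → ∀ {x y} → φ W x ≡ φ W y → x ≡ y
  φ-inj iw {x} {y} e = trans (sym (α-invol x)) (trans (cong α (trans (sym (σ-inv₂ _)) (trans (cong σ⁻ e) (σ-inv₂ _)))) (α-invol y))
    where open IsWeb iw

  -- If the walk reached the boundary at c, three steps of φ from its last `whte` dart would pass a
  -- `blck` and a `bndD` dart and end at the hub.
  internal-run : ∀ {x} → InternalFace W (P p (whte x)) → ∀ n → ∃ λ y → Run X x n y
  internal-run {x} int zero = x , here
  internal-run {x} int (suc n) with internal-run int n
  ... | y , r = go (τ X y) refl
    where
    go : ∀ t → τ X y ≡ t → ∃ λ y → Run X x (suc n) y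
    go (inj₂ u) e = _ , run-snoc r e
    go (inj₁ c) e = ⊥-elim (int (3 + (n + n)) (prev c) (trans (cong (λ v → φ W (φ W (φ W v))) (φ-run p r))
      (trans (cong (λ v → φ W (φ W v)) (trans (P-φ p (whte y)) (cong (λ v → P p (blck v)) e))) (trans (cong (φ W) (P-φ p (blck (inj₁ c)))) (trans (P-φ p (bndD c)) (P-hub p (prev c)))))))

  odd-run : ∀ {x n y} → Run X x n y → iter (φ W) (suc (n + n)) (P p (whte x)) ≡ P p (blck (τ X y))
  odd-run {y = y} r = trans (cong (φ W) (φ-run p r)) (P-φ p (whte y))

  private
    whte≢blck : ∀ {x y : Edge X} → whte {m} x ≢ blck y
    whte≢blck ()
    whtinj : ∀ {a b : Edge X} → whte {m} a ≡ whte b → a ≡ b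
    whtinj refl = refl

  pres-kr : IsWeb W → Kr X → IsKreweras W
  pres-kr iw kr = record
    { bnd-white = λ i → trans (cong col (bnd-P p i)) (P-col p (bndD i) (λ j ()))
    ; faces = λ x ℓ int per → subst (λ x → InternalFace W x → Period (φ W) x ℓ → (6 ≤ ℓ) × ¬ (4 ∣ ℓ)) (PQ p x) (go (Q p x) ℓ) int per }
    where
    main : ∀ x ℓ → InternalFace W (P p (whte x)) → Period (φ W) (P p (whte x)) ℓ → (6 ≤ ℓ) × ¬ (4 ∣ ℓ)
    main x ℓ int (1≤ , ret , min) with even⊎odd ℓ
    ... | inj₂ (n , refl) with internal-run int n
    ... | y , r = ⊥-elim (whte≢blck (P-inj p (trans (sym ret) (odd-run r))))
    main x ℓ int (1≤ , ret , min) | inj₁ (n , refl) with internal-run int n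
    ... | y , r with whtinj (P-inj p (trans (sym ret) (φ-run p r)))
    ... | refl with kr x n (pos n 1≤) r (λ j 1≤j j<n r′ → min (j + j) (ℕₚ.≤-trans 1≤j (ℕₚ.m≤m+n j j)) (ℕₚ.+-mono-< j<n j<n) (φ-run p r′))
      where
      pos : ∀ n → 1 ≤ n + n → 1 ≤ n
      pos (suc n) _ = s≤s z≤n
    ... | 3≤n , o = ℕₚ.+-mono-≤ 3≤n 3≤n , ¬4∣2odd n o
    shift : ∀ {x ℓ} → Period (φ W) x ℓ → Period (φ W) (φ W x) ℓ
    shift {x} {ℓ} (1≤ , ret , min) = 1≤ , trans (sym (iter-suc (φ W) ℓ x)) (cong (φ W) ret) ,
      λ j a c e → min j a c (φ-inj iw (trans (iter-suc (φ W) j x) e))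
    int-shift : ∀ {x} → InternalFace W x → InternalFace W (φ W x)
    int-shift {x} int j i e = int (suc j) i (trans (iter-suc (φ W) j x) e)
    go : ∀ d ℓ → InternalFace W (P p d) → Period (φ W) (P p d) ℓ → (6 ≤ ℓ) × ¬ (4 ∣ ℓ)
    go (hubD i) ℓ int per = ⊥-elim (int 0 i (P-hub p i))
    go (bndD i) ℓ int per = ⊥-elim (int 1 (prev i) (trans (P-φ p (bndD i)) (P-hub p (prev i))))
    go (whte x) ℓ int per = main x ℓ int per
    go (blck (inj₁ i)) ℓ int per = ⊥-elim (int 2 (prev i) (trans (cong (φ W) (P-φ p (blck (inj₁ i)))) (trans (P-φ p (bndD i)) (P-hub p (prev i)))))
    go (blck (inj₂ u)) ℓ int per = main (inj₂ (ρ X u)) ℓ (subst (InternalFace W) e (int-shift int)) (subst (λ x → Period (φ W) x ℓ) e (shift per))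
      where e = P-φ p (blck (inj₂ u))

  run-forever : ∀ {x ℓ} → 1 ≤ ℓ → Run X x ℓ x → ∀ n → ∃ λ y → Run X x n y
  run-forever {x} {ℓ} 1≤ℓ r n = run-prefix n (ℕₚ.≤-trans (ℕₚ.≤-reflexive (sym (ℕₚ.*-identityʳ n))) (ℕₚ.*-monoʳ-≤ n 1≤ℓ)) (rep* n)
    where
    rep* : ∀ n → Run X x (n * ℓ) x
    rep* zero = here
    rep* (suc n) = run-++ r (rep* n)

  kr-pres : IsKreweras W → Kr X
  kr-pres kw x ℓ 1≤ℓ r min = half (proj₁ res) , 2odd ℓ (proj₂ res)
    where
    int : InternalFace W (P p (whte x))
    int j i e with even⊎odd j
    ... | inj₁ (n , refl) = nonhub p {whte _} (λ _ ()) i (trans (sym (φ-run p (proj₂ (run-forever 1≤ℓ r n)))) e)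
    ... | inj₂ (n , refl) = nonhub p {blck _} (λ _ ()) i (trans (sym (odd-run (proj₂ (run-forever 1≤ℓ r n)))) e)
    small : ∀ j → 1 ≤ j → j < ℓ + ℓ → iter (φ W) j (P p (whte x)) ≢ P p (whte x)
    small j 1≤j j<ℓ e with even⊎odd j
    ... | inj₂ (n , refl) = whte≢blck (P-inj p (trans (sym e) (odd-run (proj₂ (run-forever 1≤ℓ r n)))))
    ... | inj₁ (n , refl) with run-forever 1≤ℓ r n
    ... | y , r′ with whtinj (P-inj p (trans (sym e) (φ-run p r′)))
    ... | refl = min n (pos n 1≤j) (lt n j<ℓ) r′
      where
      pos : ∀ n → 1 ≤ n + n → 1 ≤ n
      pos (suc n) _ = s≤s z≤n
      lt : ∀ n → n + n < ℓ + ℓ → n < ℓ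
      lt n h with n ℕ.<? ℓ
      ... | yes q = q
      ... | no q = ⊥-elim (ℕₚ.<-irrefl refl (ℕₚ.<-≤-trans h (ℕₚ.+-mono-≤ (ℕₚ.≮⇒≥ q) (ℕₚ.≮⇒≥ q))))
    res : (6 ≤ ℓ + ℓ) × ¬ (4 ∣ (ℓ + ℓ))
    res = IsKreweras.faces kw (P p (whte x)) (ℓ + ℓ) int (ℕₚ.≤-trans 1≤ℓ (ℕₚ.m≤m+n ℓ ℓ) , φ-run p r , small)
    half : 6 ≤ ℓ + ℓ → 3 ≤ ℓ
    half h with 3 ℕ.≤? ℓ
    ... | yes q = q
    ... | no q = ⊥-elim (ℕₚ.<-irrefl refl (ℕₚ.≤-trans h (ℕₚ.≤-trans (ℕₚ.+-mono-≤ (ℕₚ.≤-pred (ℕₚ.≰⇒> q)) (ℕₚ.≤-pred (ℕₚ.≰⇒> q))) (ℕₚ.m≤m+n 4 1))))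

module _ {m} {W W′ : RawWeb m} {X X′ : Dessin m} (p : Pres W X) (p′ : Pres W′ X′) where
  private
    module RW = RawWeb W
    module RW′ = RawWeb W′

  iso-of-≅ : X ≅ X′ → Iso W W′
  iso-of-≅ I = record
    { f = λ x → P p′ (md Fu (Q p x)) ; g = λ y → P p (md Gu (Q p′ y))
    ; gf = λ x → trans (cong (λ d → P p (md Gu d)) (QP p′ _)) (trans (cong (P p) (md-inv Gu Fu GF (Q p x))) (PQ p x))
    ; fg = λ x → trans (cong (λ d → P p′ (md Fu d)) (QP p _)) (trans (cong (P p′) (md-inv Fu Gu FG (Q p′ x))) (PQ p′ x))
    ; f-hub = λ i → trans (cong (λ d → P p′ (md Fu d)) (trans (cong (Q p) (sym (P-hub p i))) (QP p _))) (P-hub p′ i)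
    ; f-α = λ x → trans (cong (λ d → P p′ (md Fu d)) (Qα p x)) (trans (cong (P p′) (mα (Q p x))) (sym (P-α p′ _)))
    ; f-σ = λ x → trans (cong (λ d → P p′ (md Fu d)) (Qσ x)) (trans (cong (P p′) (mσ (Q p x))) (sym (P-σ p′ _)))
    ; f-col = λ x n → trans (P-col p′ _ (mnh (Q p x) (nonhub⁻ p (subst (NonHub W) (sym (PQ p x)) n))))
        (trans (mcol (Q p x)) (trans (sym (P-col p _ (nonhub⁻ p (subst (NonHub W) (sym (PQ p x)) n)))) (cong RW.col (PQ p x)))) }
    where
    open ≅-lemmas I renaming (F to Fu; G to Gu)
    md : ∀ {a b : ℕ} → (Fin a → Fin b) → Dart m (Fin m ⊎ Fin a) → Dart m (Fin m ⊎ Fin b)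
    md f (hubD i) = hubD i
    md f (bndD i) = bndD i
    md f (whte x) = whte (map⊎ (λ c → c) f x)
    md f (blck x) = blck (map⊎ (λ c → c) f x)
    mp-inv : ∀ {a b : ℕ} (f : Fin a → Fin b) (g : Fin b → Fin a) → (∀ u → f (g u) ≡ u) → ∀ (x : Fin m ⊎ Fin b) → map⊎ (λ c → c) f (map⊎ (λ c → c) g x) ≡ x
    mp-inv f g h (inj₁ c) = refl
    mp-inv f g h (inj₂ u) = cong inj₂ (h u)
    md-inv : ∀ {a b : ℕ} (f : Fin a → Fin b) (g : Fin b → Fin a) → (∀ u → f (g u) ≡ u) → ∀ d → md f (md g d) ≡ d
    md-inv f g h (hubD i) = refl
    md-inv f g h (bndD i) = refl
    md-inv f g h (whte x) = cong whte (mp-inv f g h x)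
    md-inv f g h (blck x) = cong blck (mp-inv f g h x)
    Qα : (p : Pres W X) → ∀ x → Q p (RW.α x) ≡ αD X (Q p x)
    Qα p x = trans (cong (λ v → Q p (RW.α v)) (sym (PQ p x))) (trans (cong (Q p) (P-α p _)) (QP p _))
    Qσ : ∀ x → Q p (RW.σ x) ≡ σD X (Q p x)
    Qσ x = trans (cong (λ v → Q p (RW.σ v)) (sym (PQ p x))) (trans (cong (Q p) (P-σ p _)) (QP p _))
    mα : ∀ d → md Fu (αD X d) ≡ αD X′ (md Fu d)
    mα (hubD i) = refl
    mα (bndD i) = refl
    mα (whte x) = refl
    mα (blck x) = refl
    mσ : ∀ d → md Fu (σD X d) ≡ σD X′ (md Fu d)
    mσ (hubD i) = refl
    mσ (bndD i) = refl
    mσ (whte (inj₁ i)) = refl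
    mσ (whte (inj₂ u)) = cong (λ v → whte (inj₂ v)) (sym (Fρ u))
    mσ (blck x) = cong blck (sym (Fτ x))
    mcol : ∀ d → colD X′ (md Fu d) ≡ colD X d
    mcol (hubD i) = refl
    mcol (bndD i) = refl
    mcol (whte x) = refl
    mcol (blck x) = refl
    mnh : ∀ d → (∀ i → d ≢ hubD i) → ∀ i → md Fu d ≢ hubD i
    mnh (hubD i) n = ⊥-elim (n i refl)
    mnh (bndD i) n j ()
    mnh (whte x) n j ()
    mnh (blck x) n j ()

  module FromIso (I : Iso W W′) where
    open Iso I renaming (f to fI; g to gI)

    h : Dart m (Edge X) → Dart m (Edge X′)
    h d = Q p′ (fI (P p d))

    Ph : ∀ d → P p′ (h d) ≡ fI (P p d)
    Ph d = PQ p′ _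

    h-α : ∀ d → h (αD X d) ≡ αD X′ (h d)
    h-α d = P-inj p′ (trans (Ph _) (trans (cong fI (sym (P-α p d))) (trans (f-α _) (trans (cong RW′.α (sym (Ph d))) (P-α p′ _)))))

    h-σ : ∀ d → h (σD X d) ≡ σD X′ (h d)
    h-σ d = P-inj p′ (trans (Ph _) (trans (cong fI (sym (P-σ p d))) (trans (f-σ _) (trans (cong RW′.σ (sym (Ph d))) (P-σ p′ _)))))

    h-inj : ∀ {c d} → h c ≡ h d → c ≡ d
    h-inj {c} {d} e = P-inj p (trans (sym (gf _)) (trans (cong gI (trans (sym (Ph c)) (trans (cong (P p′) e) (Ph d)))) (gf _)))

    h-hub : ∀ i → h (hubD i) ≡ hubD i
    h-hub i = P-inj p′ (trans (Ph _) (trans (cong fI (P-hub p i)) (trans (f-hub i) (sym (P-hub p′ i)))))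

    h-bnd : ∀ i → h (bndD i) ≡ bndD i
    h-bnd i = trans (h-α (hubD i)) (cong (αD X′) (h-hub i))

    h-wht : ∀ i → h (whte (inj₁ i)) ≡ whte (inj₁ i)
    h-wht i = trans (h-σ (bndD i)) (cong (σD X′) (h-bnd i))

    inner : ∀ u → ∃ λ v → h (whte (inj₂ u)) ≡ whte (inj₂ v)
    inner u = go (h (whte (inj₂ u))) refl
      where
      nh : NonHub W (P p (whte (inj₂ u)))
      nh = nonhub p (λ j ())
      go : ∀ d → h (whte (inj₂ u)) ≡ d → ∃ λ v → d ≡ whte (inj₂ v)
      go (hubD i) e with h-inj (trans e (sym (h-hub i)))
      ... | ()
      go (bndD i) e with h-inj (trans e (sym (h-bnd i)))
      ... | ()
      go (whte (inj₁ i)) e with h-inj (trans e (sym (h-wht i)))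
      ... | ()
      go (whte (inj₂ v)) e = v , refl
      go (blck x) e with trans (sym (P-col p′ (blck x) (λ j ()))) (trans (cong RW′.col (trans (sym (cong (P p′) e)) (Ph _))) (trans (f-col _ nh) (P-col p (whte (inj₂ u)) (λ j ()))))
      ... | ()

  iso-sym : Iso W W′ → Iso W′ W
  iso-sym I = record { f = gI ; g = fI ; gf = fg ; fg = gf
    ; f-hub = λ i → trans (cong gI (sym (f-hub i))) (gf _)
    ; f-α = λ x → trans (cong (λ v → gI (RW′.α v)) (sym (fg x))) (trans (cong gI (sym (f-α _))) (gf _))
    ; f-σ = λ x → trans (cong (λ v → gI (RW′.σ v)) (sym (fg x))) (trans (cong gI (sym (f-σ _))) (gf _))
    ; f-col = λ x n → trans (sym (f-col (gI x) (λ i e → n i (trans (sym (fg x)) (trans (cong fI e) (f-hub i)))))) (cong RW′.col (fg x)) }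
    where open Iso I renaming (f to fI; g to gI)

≅-of-iso : ∀ {m} {W W′ : RawWeb m} {X X′ : Dessin m} (p : Pres W X) (p′ : Pres W′ X′) → Iso W W′ → X ≅ X′
≅-of-iso {m} {W} {W′} {X} {X′} p p′ I = mk≅ fu gu fg′ gf′ tt′ rr
  where
  module H₁ = FromIso p p′ I
  module H₂ = FromIso p′ p (iso-sym p p′ I)
  fu : Fin (s X) → Fin (s X′)
  fu u = proj₁ (H₁.inner u)
  gu : Fin (s X′) → Fin (s X)
  gu u = proj₁ (H₂.inner u)
  h₂₁ : ∀ d → H₂.h (H₁.h d) ≡ d
  h₂₁ d = trans (cong (λ v → Q p (Iso.g I v)) (H₁.Ph d)) (trans (cong (Q p) (Iso.gf I _)) (QP p d))
  h₁₂ : ∀ d → H₁.h (H₂.h d) ≡ d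
  h₁₂ d = trans (cong (λ v → Q p′ (Iso.f I v)) (H₂.Ph d)) (trans (cong (Q p′) (Iso.fg I _)) (QP p′ d))
  winj : ∀ {n} {a b : Fin n} → whte {m} {Fin m ⊎ Fin n} (inj₂ a) ≡ whte (inj₂ b) → a ≡ b
  winj refl = refl
  binj : ∀ {n} {a b : Fin m ⊎ Fin n} → blck {m} {Fin m ⊎ Fin n} a ≡ blck b → a ≡ b
  binj refl = refl
  fg′ : ∀ u → fu (gu u) ≡ u
  fg′ u = winj (trans (sym (proj₂ (H₁.inner (gu u)))) (trans (cong H₁.h (sym (proj₂ (H₂.inner u)))) (h₁₂ _)))
  gf′ : ∀ u → gu (fu u) ≡ u
  gf′ u = winj (trans (sym (proj₂ (H₂.inner (fu u)))) (trans (cong H₂.h (sym (proj₂ (H₁.inner u)))) (h₂₁ _)))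
  hw : ∀ x → H₁.h (whte x) ≡ whte (map⊎ (λ c → c) fu x)
  hw (inj₁ i) = H₁.h-wht i
  hw (inj₂ u) = proj₂ (H₁.inner u)
  hb : ∀ x → H₁.h (blck x) ≡ blck (map⊎ (λ c → c) fu x)
  hb x = trans (H₁.h-α (whte x)) (cong (αD X′) (hw x))
  tt′ : ∀ x → τ X′ (map⊎ (λ c → c) fu x) ≡ map⊎ (λ c → c) fu (τ X x)
  tt′ x = binj (trans (cong (σD X′) (sym (hb x))) (trans (sym (H₁.h-σ (blck x))) (hb (τ X x))))
  rr : ∀ u → ρ X′ (fu u) ≡ fu (ρ X u)
  rr u = winj (trans (cong (σD X′) (sym (hw (inj₂ u)))) (trans (sym (H₁.h-σ (whte (inj₂ u)))) (hw (inj₂ (ρ X u)))))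

-- From dessins to capped maps

module _ {m} (X : Dessin m) where
  private
    n k₁ k₂ : ℕ
    n = m + s X
    k₂ = n + n
    k₁ = m + k₂

  enc : Dart m (Edge X) → Fin (m + (m + ((m + s X) + (m + s X))))
  enc (hubD i) = i ↑ˡ k₁
  enc (bndD i) = m ↑ʳ (i ↑ˡ k₂)
  enc (whte x) = m ↑ʳ (m ↑ʳ (Fin.join m (s X) x ↑ˡ n))
  enc (blck x) = m ↑ʳ (m ↑ʳ (n ↑ʳ Fin.join m (s X) x))

  private
    dec₂ : Fin n ⊎ Fin n → Dart m (Edge X)
    dec₂ = [ (λ i → whte (splitAt m i)) , (λ i → blck (splitAt m i)) ]′
    dec₁ : Fin m ⊎ Fin k₂ → Dart m (Edge X)
    dec₁ = [ bndD , (λ i → dec₂ (splitAt n i)) ]′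
    dec₀ : Fin m ⊎ Fin k₁ → Dart m (Edge X)
    dec₀ = [ hubD , (λ i → dec₁ (splitAt m i)) ]′

  dec : Fin (m + (m + ((m + s X) + (m + s X)))) → Dart m (Edge X)
  dec i = dec₀ (splitAt m i)

  dec-enc : ∀ d → dec (enc d) ≡ d
  dec-enc (hubD i) rewrite Finₚ.splitAt-↑ˡ m i k₁ = refl
  dec-enc (bndD i) rewrite Finₚ.splitAt-↑ʳ m k₁ (i ↑ˡ k₂) | Finₚ.splitAt-↑ˡ m i k₂ = refl
  dec-enc (whte x) rewrite Finₚ.splitAt-↑ʳ m k₁ (m ↑ʳ (Fin.join m (s X) x ↑ˡ n)) | Finₚ.splitAt-↑ʳ m k₂ (Fin.join m (s X) x ↑ˡ n)
    | Finₚ.splitAt-↑ˡ n (Fin.join m (s X) x) n | Finₚ.splitAt-join m (s X) x = refl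
  dec-enc (blck x) rewrite Finₚ.splitAt-↑ʳ m k₁ (m ↑ʳ (n ↑ʳ Fin.join m (s X) x)) | Finₚ.splitAt-↑ʳ m k₂ (n ↑ʳ Fin.join m (s X) x)
    | Finₚ.splitAt-↑ʳ n n (Fin.join m (s X) x) | Finₚ.splitAt-join m (s X) x = refl

  enc-dec : ∀ i → enc (dec i) ≡ i
  enc-dec i with splitAt m i in e₀
  ... | inj₁ j = Finₚ.splitAt⁻¹-↑ˡ e₀
  ... | inj₂ j with splitAt m j in e₁
  ... | inj₁ l = trans (cong (m ↑ʳ_) (Finₚ.splitAt⁻¹-↑ˡ e₁)) (Finₚ.splitAt⁻¹-↑ʳ e₀)
  ... | inj₂ l with splitAt n l in e₂
  ... | inj₁ q = trans (cong (λ v → m ↑ʳ (m ↑ʳ v)) (trans (cong (_↑ˡ n) (Finₚ.join-splitAt m (s X) q)) (Finₚ.splitAt⁻¹-↑ˡ e₂))) (trans (cong (m ↑ʳ_) (Finₚ.splitAt⁻¹-↑ʳ e₁)) (Finₚ.splitAt⁻¹-↑ʳ e₀))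
  ... | inj₂ q = trans (cong (λ v → m ↑ʳ (m ↑ʳ v)) (trans (cong (n ↑ʳ_) (Finₚ.join-splitAt m (s X) q)) (Finₚ.splitAt⁻¹-↑ʳ e₂))) (trans (cong (m ↑ʳ_) (Finₚ.splitAt⁻¹-↑ʳ e₁)) (Finₚ.splitAt⁻¹-↑ʳ e₀))

  σ⁻D : Dart m (Edge X) → Dart m (Edge X)
  σ⁻D (hubD i) = hubD (next i)
  σ⁻D (bndD i) = whte (inj₁ i)
  σ⁻D (whte (inj₁ i)) = bndD i
  σ⁻D (whte (inj₂ u)) = whte (inj₂ (ρ X (ρ X u)))
  σ⁻D (blck x) = blck (τ X (τ X x))

  raw : RawWeb m
  raw = record { k = m + ((m + s X) + (m + s X)) ; α = λ i → enc (αD X (dec i)) ; σ = λ i → enc (σD X (dec i))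
    ; σ⁻ = λ i → enc (σ⁻D (dec i)) ; col = λ i → colD X (dec i) }

  raw-pres : Pres raw X
  raw-pres = record { P = enc ; Q = dec ; PQ = enc-dec ; QP = dec-enc ; P-hub = λ i → refl
    ; P-α = λ d → cong (λ v → enc (αD X v)) (dec-enc d) ; P-σ = λ d → cong (λ v → enc (σD X v)) (dec-enc d)
    ; P-col = λ d _ → cong (colD X) (dec-enc d) }

  raw-isWeb : Cubic X → (m + (m + ((m + s X) + (m + s X))) ≡ 0) ⊎ (Connected raw × Spherical raw) → IsWeb raw
  raw-isWeb cu = pres-isWeb raw-pres (λ i → trans (cong (λ v → enc (σD X v)) (dec-enc (σ⁻D (dec i)))) (trans (cong enc (σσ⁻ (dec i))) (enc-dec i)))
      (λ i → trans (cong (λ v → enc (σ⁻D v)) (dec-enc (σD X (dec i)))) (trans (cong enc (σ⁻σ (dec i))) (enc-dec i))) cu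
    where
    σσ⁻ : ∀ d → σD X (σ⁻D d) ≡ d
    σσ⁻ (hubD i) = cong hubD (prev-next i)
    σσ⁻ (bndD i) = refl
    σσ⁻ (whte (inj₁ i)) = refl
    σσ⁻ (whte (inj₂ u)) = cong (λ v → whte (inj₂ v)) (ρ³ cu u)
    σσ⁻ (blck x) = cong blck (τ³ cu x)
    σ⁻σ : ∀ d → σ⁻D (σD X d) ≡ d
    σ⁻σ (hubD i) = cong hubD (next-prev i)
    σ⁻σ (bndD i) = refl
    σ⁻σ (whte (inj₁ i)) = refl
    σ⁻σ (whte (inj₂ u)) = cong (λ v → whte (inj₂ v)) (ρ³ cu u)
    σ⁻σ (blck x) = cong blck (τ³ cu x)

kweb : ∀ {m} (X : Dessin (suc m)) → Fine X → ∀ {N} → Classes (Link X) N → KWeb (suc m)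
kweb X fi {N} C = record { web = raw X ; isWeb = iw ; isKr = pres-kr (raw-pres X) iw (fkr fi) ; κ = N ; κ-ok = components (raw-pres X) C }
  where
  iw : IsWeb (raw X)
  iw = raw-isWeb X (fcubic fi) (inj₂ (pres-connected (raw-pres X) refl (fconn fi) , pres-spherical (raw-pres X) refl fi))

-- From capped maps to dessins

record Enum {n} (A : Fin n → Set) : Set where
  field
    card    : ℕ
    elem    : Fin card → Fin n
    elem-in : ∀ u → A (elem u)
    elem-inj : ∀ {u v} → elem u ≡ elem v → u ≡ v
    index   : ∀ x → A x → ∃ λ u → elem u ≡ x

enum : ∀ {n} {A : Fin n → Set} → (∀ x → Dec (A x)) → Enum A
enum {zero} d = record { card = 0 ; elem = λ () ; elem-in = λ () ; elem-inj = λ { {()} } ; index = λ () }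
enum {suc n} {A} d with enum (λ x → d (suc x)) | d zero
... | E | yes a = record { card = suc card ; elem = λ { zero → zero ; (suc u) → suc (elem u) }
    ; elem-in = λ { zero → a ; (suc u) → elem-in u }
    ; elem-inj = λ { {zero} {zero} _ → refl ; {suc u} {suc v} e → cong suc (elem-inj (Finₚ.suc-injective e)) }
    ; index = λ { zero _ → zero , refl ; (suc x) h → suc (proj₁ (index x h)) , cong suc (proj₂ (index x h)) } }
  where open Enum E
... | E | no na = record { card = card ; elem = λ u → suc (elem u) ; elem-in = elem-in
    ; elem-inj = λ e → elem-inj (Finₚ.suc-injective e)
    ; index = λ { zero h → ⊥-elim (na h) ; (suc x) h → proj₁ (index x h) , cong suc (proj₂ (index x h)) } }
  where open Enum E

-- An edge of the dessin is named by its black dart: `cᵢ` is the black dart of the edge at boundary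
-- vertex i, and the other black darts off the hub are enumerated as inner edges.
module Decode {m} (W : RawWeb m) (iw : IsWeb W) (kw : IsKreweras W) where
  open RawWeb W
  open IsWeb iw
  open IsKreweras kw

  α-inj : ∀ {x y} → α x ≡ α y → x ≡ y
  α-inj e = trans (sym (α-invol _)) (trans (cong α e) (α-invol _))

  σ-inj : ∀ {x y} → σ x ≡ σ y → x ≡ y
  σ-inj e = trans (sym (σ-inv₂ _)) (trans (cong σ⁻ e) (σ-inv₂ _))

  hub-inj : ∀ {i j} → hub W i ≡ hub W j → i ≡ j
  hub-inj e = Finₚ.↑ˡ-injective k _ _ e

  hubcase : ∀ x → (∃ λ i → x ≡ hub W i) ⊎ NonHub W x
  hubcase x with splitAt m x in e
  ... | inj₁ i = inj₁ (i , sym (Finₚ.splitAt⁻¹-↑ˡ e))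
  ... | inj₂ j = inj₂ λ { i refl → absurd (trans (sym e) (Finₚ.splitAt-↑ˡ m i k)) }
    where
    absurd : ∀ {i} → inj₂ j ≢ inj₁ {A = Fin m} i
    absurd ()

  σ-nh : ∀ {x} → NonHub W x → NonHub W (σ x)
  σ-nh n j e = n (next j) (σ-inj (trans e (trans (cong (hub W) (sym (prev-next j))) (sym (hub-rot (next j))))))

  α-nh : ∀ {x} → (∀ i → x ≢ bnd W i) → NonHub W (α x)
  α-nh n j e = n j (trans (sym (α-invol _)) (cong α e))

  black⊎white : ∀ x → (col x ≡ black) ⊎ (col x ≡ white)
  black⊎white x with col x
  ... | black = inj₁ refl
  ... | white = inj₂ refl

  b≢w : black ≢ white
  b≢w ()

  other : ∀ {x y} → col x ≢ col y → col y ≡ white → col x ≡ black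
  other {x} n e with black⊎white x
  ... | inj₁ b = b
  ... | inj₂ w = ⊥-elim (n (trans w (sym e)))

  other′ : ∀ {x y} → col x ≢ col y → col y ≡ black → col x ≡ white
  other′ {x} n e with black⊎white x
  ... | inj₂ b = b
  ... | inj₁ w = ⊥-elim (n (trans w (sym e)))

  sᵢ cᵢ : Fin m → Fin (m + k)
  sᵢ i = σ (bnd W i)
  cᵢ i = α (sᵢ i)

  s-nh : ∀ i → NonHub W (sᵢ i)
  s-nh i = σ-nh (bnd-nonhub i)

  s-white : ∀ i → col (sᵢ i) ≡ white
  s-white i = trans (col-vertex _ (bnd-nonhub i)) (bnd-white i)

  c-nh : ∀ i → NonHub W (cᵢ i)
  c-nh i = α-nh (λ j e → bnd-sep i j e)

  c-black : ∀ i → col (cᵢ i) ≡ black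
  c-black i = other (col-edge _ (s-nh i) (c-nh i)) (s-white i)

  bnd-inj : ∀ {i j} → bnd W i ≡ bnd W j → i ≡ j
  bnd-inj e = hub-inj (α-inj e)

  c-inj : ∀ {i j} → cᵢ i ≡ cᵢ j → i ≡ j
  c-inj e = bnd-inj (σ-inj (α-inj e))

  Inner : Fin (m + k) → Set
  Inner x = NonHub W x × col x ≡ black × (∀ i → x ≢ cᵢ i)

  inner? : ∀ x → Dec (Inner x)
  inner? x with hubcase x
  ... | inj₁ (i , e) = no λ { (n , _) → n i e }
  ... | inj₂ n with black⊎white x
  ... | inj₂ w = no λ { (_ , b , _) → b≢w (trans (sym b) w) }
  ... | inj₁ b with all? (λ i → ¬? (x Finₚ.≟ cᵢ i))
  ... | yes h = yes (n , b , h)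
  ... | no h = no λ { (_ , _ , h′) → h h′ }

  private
    En = enum inner?
  open Enum En

  E° : Set
  E° = Fin m ⊎ Fin card

  cd : E° → Fin (m + k)
  cd (inj₁ i) = cᵢ i
  cd (inj₂ u) = elem u

  cd-nh : ∀ x → NonHub W (cd x)
  cd-nh (inj₁ i) = c-nh i
  cd-nh (inj₂ u) = proj₁ (elem-in u)

  cd-black : ∀ x → col (cd x) ≡ black
  cd-black (inj₁ i) = c-black i
  cd-black (inj₂ u) = proj₁ (proj₂ (elem-in u))

  cd-inj : ∀ {x y} → cd x ≡ cd y → x ≡ y
  cd-inj {inj₁ i} {inj₁ j} e = cong inj₁ (c-inj e)
  cd-inj {inj₁ i} {inj₂ u} e = ⊥-elim (proj₂ (proj₂ (elem-in u)) i (sym e))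
  cd-inj {inj₂ u} {inj₁ i} e = ⊥-elim (proj₂ (proj₂ (elem-in u)) i e)
  cd-inj {inj₂ u} {inj₂ v} e = cong inj₂ (elem-inj e)

  edge : ∀ x → NonHub W x → col x ≡ black → ∃ λ e → cd e ≡ x
  edge x n b with any? (λ i → x Finₚ.≟ cᵢ i)
  ... | yes (i , e) = inj₁ i , sym e
  ... | no h = inj₂ (proj₁ (index x inn)) , proj₂ (index x inn)
    where
    inn : Inner x
    inn = n , b , λ i e → h (i , e)

  t° : E° → E°
  t° x = proj₁ (edge (σ (cd x)) (σ-nh (cd-nh x)) (trans (col-vertex _ (cd-nh x)) (cd-black x)))

  t°-cd : ∀ x → cd (t° x) ≡ σ (cd x)
  t°-cd x = proj₂ (edge (σ (cd x)) (σ-nh (cd-nh x)) (trans (col-vertex _ (cd-nh x)) (cd-black x)))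

  cd≢bnd : ∀ x i → cd x ≢ bnd W i
  cd≢bnd x i e = b≢w (trans (sym (cd-black x)) (trans (cong col e) (bnd-white i)))

  α-cd-nh : ∀ x → NonHub W (α (cd x))
  α-cd-nh x = α-nh (cd≢bnd x)

  α-cd-white : ∀ x → col (α (cd x)) ≡ white
  α-cd-white x = other′ (col-edge _ (cd-nh x) (α-cd-nh x)) (cd-black x)

  module _ (u : Fin card) where
    ws : Fin (m + k)
    ws = σ (α (elem u))
    ws≢bnd : ∀ i → ws ≢ bnd W i
    ws≢bnd i e = proj₂ (proj₂ (elem-in u)) i (trans (sym (α-invol _)) (cong α (σ-inj (trans e (sym (bnd-deg i))))))
    ws≢s : ∀ i → ws ≢ sᵢ i
    ws≢s i e = proj₁ (elem-in u) i (trans (sym (α-invol _)) (trans (cong α (σ-inj e)) (α-invol _)))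
    ws-nh : NonHub W ws
    ws-nh = σ-nh (α-cd-nh (inj₂ u))
    next-inner : Inner (α ws)
    next-inner = α-nh ws≢bnd , other (col-edge ws ws-nh (α-nh ws≢bnd)) (trans (col-vertex _ (α-cd-nh (inj₂ u))) (α-cd-white (inj₂ u))) , λ i e → ws≢s i (α-inj e)

  r° : Fin card → Fin card
  r° u = proj₁ (index _ (next-inner u))

  r°-elem : ∀ u → elem (r° u) ≡ α (σ (α (elem u)))
  r°-elem u = proj₂ (index _ (next-inner u))

  X° : Dessin m
  X° = dessin card t° r°

  p° : Dart m E° → Fin (m + k)
  p° (hubD i) = hub W i
  p° (bndD i) = bnd W i
  p° (whte x) = α (cd x)
  p° (blck x) = cd x

  α-bnd : ∀ i → α (bnd W i) ≡ hub W i
  α-bnd i = α-invol _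

  surj : ∀ x → ∃ λ d → p° d ≡ x
  surj x with hubcase x
  ... | inj₁ (i , e) = hubD i , sym e
  ... | inj₂ n with black⊎white x
  ... | inj₁ b = blck (proj₁ (edge x n b)) , proj₂ (edge x n b)
  ... | inj₂ w with hubcase (α x)
  ... | inj₁ (i , e) = bndD i , trans (cong α (sym e)) (α-invol x)
  ... | inj₂ n′ = whte (proj₁ ed) , trans (cong α (proj₂ ed)) (α-invol x)
    where
    ed = edge (α x) n′ (other (col-edge x n n′) w)

  inj : ∀ c d → p° c ≡ p° d → c ≡ d
  inj (hubD i) (hubD j) e = cong hubD (hub-inj e)
  inj (hubD i) (bndD j) e = ⊥-elim (bnd-nonhub j i (sym e))
  inj (hubD i) (whte x) e = ⊥-elim (α-cd-nh x i (sym e))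
  inj (hubD i) (blck x) e = ⊥-elim (cd-nh x i (sym e))
  inj (bndD i) (hubD j) e = ⊥-elim (bnd-nonhub i j e)
  inj (bndD i) (bndD j) e = cong bndD (bnd-inj e)
  inj (bndD i) (whte x) e = ⊥-elim (cd-nh x i (α-inj (sym e)))
  inj (bndD i) (blck x) e = ⊥-elim (cd≢bnd x i (sym e))
  inj (whte x) (hubD j) e = ⊥-elim (α-cd-nh x j e)
  inj (whte x) (bndD j) e = ⊥-elim (cd-nh x j (α-inj e))
  inj (whte x) (whte y) e = cong whte (cd-inj (α-inj e))
  inj (whte x) (blck y) e = ⊥-elim (b≢w (trans (sym (cd-black y)) (trans (cong col (sym e)) (α-cd-white x))))
  inj (blck x) (hubD j) e = ⊥-elim (cd-nh x j e)
  inj (blck x) (bndD j) e = ⊥-elim (cd≢bnd x j e)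
  inj (blck x) (whte y) e = ⊥-elim (b≢w (trans (sym (cd-black x)) (trans (cong col e) (α-cd-white y))))
  inj (blck x) (blck y) e = cong blck (cd-inj e)

  pres : Pres W X°
  pres = record { P = p° ; Q = λ x → proj₁ (surj x) ; PQ = λ x → proj₂ (surj x) ; QP = λ d → inj _ d (proj₂ (surj (p° d)))
    ; P-hub = λ _ → refl ; P-α = pα ; P-σ = pσ ; P-col = pcol }
    where
    pα : ∀ d → α (p° d) ≡ p° (αD X° d)
    pα (hubD i) = refl
    pα (bndD i) = α-bnd i
    pα (whte x) = α-invol _
    pα (blck x) = refl
    pσ : ∀ d → σ (p° d) ≡ p° (σD X° d)
    pσ (hubD i) = hub-rot i
    pσ (bndD i) = sym (α-invol _)
    pσ (whte (inj₁ i)) = trans (cong σ (α-invol _)) (bnd-deg i)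
    pσ (whte (inj₂ u)) = sym (trans (cong α (r°-elem u)) (α-invol _))
    pσ (blck x) = sym (t°-cd x)
    pcol : ∀ d → (∀ i → d ≢ hubD i) → col (p° d) ≡ colD X° d
    pcol (hubD i) n = ⊥-elim (n i refl)
    pcol (bndD i) n = bnd-white i
    pcol (whte x) n = α-cd-white x
    pcol (blck x) n = cd-black x

  deg-cd : ∀ x → (σ (cd x) ≢ cd x) × (σ (σ (σ (cd x))) ≡ cd x)
  deg-cd x = int-deg (cd x) (cd-nh x) (cd≢bnd x) (λ i e → b≢w (trans (sym (cd-black x)) (trans (cong col e) (s-white i))))

  deg-α : ∀ u → (σ (α (elem u)) ≢ α (elem u)) × (σ (σ (σ (α (elem u)))) ≡ α (elem u))
  deg-α u = int-deg _ (α-cd-nh (inj₂ u)) (λ i e → proj₁ (elem-in u) i (α-inj e)) (λ i e → proj₂ (proj₂ (elem-in u)) i (trans (sym (α-invol _)) (cong α e)))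

  cubic° : Cubic X°
  cubic° = record
    { τ³ = λ x → cd-inj (trans (t°-cd (t° (t° x))) (trans (cong σ (t°-cd (t° x))) (trans (cong (λ v → σ (σ v)) (t°-cd x)) (proj₂ (deg-cd x)))))
    ; τ≢ = λ x e → proj₁ (deg-cd x) (trans (sym (t°-cd x)) (cong cd e))
    ; ρ³ = λ u → elem-inj (α-inj (trans (αr (r° (r° u))) (trans (cong σ (αr (r° u))) (trans (cong (λ v → σ (σ v)) (αr u)) (proj₂ (deg-α u))))))
    ; ρ≢ = λ u e → proj₁ (deg-α u) (trans (sym (αr u)) (cong (λ v → α (elem v)) e)) }
    where
    αr : ∀ u → α (elem (r° u)) ≡ σ (α (elem u))
    αr u = trans (cong α (r°-elem u)) (α-invol _)

three-distinct : ∀ {n N} {f : Fin n → Fin n} (C : Classes (Graph f) N) → (∀ x → x ≢ f x) → (∀ x → x ≢ f (f x)) → N * 3 ≤ n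
three-distinct {n} {N} {f} K n₁ n₂ = subst (N * 3 ≤_) (trans (∑F-const n 1) (ℕₚ.*-identityʳ n)) (class-weights K (λ _ → 1) h)
  where
  h : ∀ c → 3 ≤ ∑F (λ k → only (lab K k) 1 c)
  h c = subst (_≤ ∑F wt) (cong₂ _+_ (one x refl) (cong₂ _+_ (one (f x) lx) (one (f (f x)) (trans (sym (sound K refl)) lx))))
    (∑F-≥3 wt (n₁ x) (n₂ x) (n₁ (f x)))
    where
    wt : Fin n → ℕ
    wt k = only (lab K k) 1 c
    x = rep K c
    lx : lab K (f x) ≡ lab K x
    lx = sym (sound K refl)
    one : ∀ y → lab K y ≡ lab K x → wt y ≡ 1
    one y e = only-≡ 1 (trans e (lab-rep K c))

three-each : ∀ {n N} {f : Fin n → Fin n} (C : Classes (Graph f) N) → (∀ x → f x ≢ x) → (∀ x → f (f (f x)) ≡ x) → N * 3 ≤ n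
three-each {f = f} K n₁ n₃ = three-distinct K (λ x e → n₁ x (sym e)) (λ x e → n₁ x (trans (cong f e) (n₃ x)))

module _ {m′} {W : RawWeb (suc m′)} (kw : IsKreweras W) {X° : Dessin (suc m′)} (pres : Pres W X°) (cubic° : Cubic X°) where
  private
    m : ℕ
    m = suc m′
  open RawWeb W

  conn-decode : Connected W → ∀ x y → EqClosure (HubLink X°) x y
  conn-decode cn x y = E-≡ (cong un (sym (QP pres (whte x)))) ◅◅ (E-bind (λ z → un (Q pres z)) stp (all (P pres (whte x)) (P pres (whte y))) ◅◅ E-≡ (cong un (QP pres (whte y))))
    where
    module NC = NumClasses cn
    all : ∀ a b → EqClosure (λ x y → (σ x ≡ y) ⊎ (α x ≡ y)) a b
    all a b with NC.cover a tt | NC.cover b tt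
    ... | zero , p | zero , q = E-sym p ◅◅ q
    un : Dart m (Edge X°) → Edge X°
    un (hubD i) = inj₁ i
    un (bndD i) = inj₁ i
    un (whte x) = x
    un (blck x) = x
    sD : ∀ d → EqClosure (HubLink X°) (un d) (un (σD X° d))
    sD (hubD i) = Eq.return (hρ (inj₁ i))
    sD (bndD i) = ε
    sD (whte (inj₁ i)) = ε
    sD (whte (inj₂ u)) = Eq.return (hρ (inj₂ u))
    sD (blck x) = Eq.return (hτ x)
    aD : ∀ d → un (αD X° d) ≡ un d
    aD (hubD i) = refl
    aD (bndD i) = refl
    aD (whte x) = refl
    aD (blck x) = refl
    stp : ∀ {a b} → (σ a ≡ b) ⊎ (α a ≡ b) → EqClosure (HubLink X°) (un (Q pres a)) (un (Q pres b))
    stp {a} (inj₁ refl) = sD (Q pres a) ◅◅ E-≡ (cong un (sym (trans (cong (λ v → Q pres (σ v)) (sym (PQ pres a))) (trans (cong (Q pres) (P-σ pres (Q pres a))) (QP pres (σD X° (Q pres a)))))))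
    stp {a} (inj₂ refl) = E-≡ (sym (trans (cong un (trans (cong (λ v → Q pres (α v)) (sym (PQ pres a))) (trans (cong (Q pres) (P-α pres (Q pres a))) (QP pres (αD X° (Q pres a)))))) (aD (Q pres a))))

  -- The orbits of ρ and τ have at least three elements each. Inserted into Euler's formula, with 1
  -- + m + w + b vertices and 2 m + s edges, this is the inequality in `Good`.
  good-decode : IsWeb W → Good X°
  good-decode iw = go (IsWeb.planar iw)
    where
    wO = orbits-exist (ρ X°)
    bO = edge-orbits X° (τ X°)
    fO = edge-orbits X° (ψ X°)
    3w≤ : proj₁ wO * 3 ≤ s X°
    3w≤ = three-each (proj₂ wO) (ρ≢ cubic°) (ρ³ cubic°)
    3b≤ : proj₁ bO * 3 ≤ m + s X°
    3b≤ = three-each (flat-classes X° (proj₂ bO)) (λ i e → τ≢ cubic° (splitAt m i) (trans (sym (SJ _)) (cong (splitAt m) e)))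
      (λ i → trans (cong (λ v → J (τ X° v)) (SJ _)) (trans (cong (λ v → J (τ X° (τ X° v))) (SJ _)) (trans (cong J (τ³ cubic° (splitAt m i))) (Finₚ.join-splitAt m (s X°) i))))
      where
      J = Fin.join m (s X°)
      SJ : ∀ x → splitAt m (J x) ≡ x
      SJ = Finₚ.splitAt-join m (s X°)
    go : (m + k ≡ 0) ⊎ (Connected W × Spherical W) → Good X°
    go (inj₂ (cn , V , E , F , nV , nE , nF , eul)) = record { cubic = cubic° ; kr = kr-pres pres kw ; conn = conn-decode cn ; F = proj₁ fO ; faces = proj₂ fO
      ; euler = fin (proj₁ wO) (proj₁ bO) (proj₁ fO) 3w≤ 3b≤
         (subst₂′ (cong₂ _+_ (classes-unique (classes-num nV) (σ-classes pres refl (proj₂ wO) (proj₂ bO))) (classes-unique (classes-num nF) (φ-classes pres (proj₂ fO))))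
            (cong (2 +_) (classes-unique (classes-num nE) (α-classes pres))) eul) }
      where
      subst₂′ : ∀ {a a′ b b′ : ℕ} → a ≡ a′ → b ≡ b′ → a ≡ b → a′ ≡ b′
      subst₂′ refl refl e = e
      fin : ∀ w b F → w * 3 ≤ s X° → b * 3 ≤ m + s X° → (1 + m) + (w + b) + F ≡ 2 + (m + (m + s X°)) → 2 * m + s X° + 3 ≤ 3 * F
      fin w b F h₁ h₂ e = ℕₚ.+-cancelˡ-≤ (s X° + (m + s X°)) _ _ (begin
        s X° + (m + s X°) + (2 * m + s X° + 3)    ≡⟨ lem₁ m (s X°) ⟩
        3 * (1 + m + s X°)                         ≡⟨ cong (3 *_) (ℕₚ.+-cancelˡ-≡ (1 + m) _ _ (trans (lem₂ m (s X°)) (trans (sym e) (ℕₚ.+-assoc (1 + m) (w + b) F)))) ⟩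
        3 * (w + b + F)                            ≡⟨ lem₃ w b F ⟩
        w * 3 + b * 3 + 3 * F                      ≤⟨ ℕₚ.+-monoˡ-≤ (3 * F) (ℕₚ.+-mono-≤ h₁ h₂) ⟩
        s X° + (m + s X°) + 3 * F                  ∎)
        where
        open ℕₚ.≤-Reasoning
        lem₁ : ∀ m s → s + (m + s) + (2 * m + s + 3) ≡ 3 * (1 + m + s)
        lem₁ = solve-∀
        lem₂ : ∀ m s → 1 + m + (1 + m + s) ≡ 2 + (m + (m + s))
        lem₂ = solve-∀
        lem₃ : ∀ w b F → 3 * (w + b + F) ≡ w * 3 + b * 3 + 3 * F
        lem₃ = solve-∀

decode : ∀ {m} (W : RawWeb (suc m)) → IsWeb W → IsKreweras W → ∃ λ X → Pres W X × Good X
decode W iw kw = X° , pres , good-decode kw pres cubic° iw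
  where open Decode W iw kw

-- Counting codes by boundary colours

AnyAct : ℕ → Set
AnyAct n = ∃ λ i → ∃ λ g → ∃ λ E → Act n i g E

drops : ∀ {n E} → UW n E → List (CodeU n)
drops {E = []} d = (_ , d) ∷ []
drops {E = g ∷ E} d = (_ , d) ∷ drops (drop d)

hops : ∀ {n i g E} → Act n i g E → List (AnyAct n)
hopsIf : ∀ {n i g h E} → Act n i g (h ∷ E) → ∀ b → hop? g ≡ b → List (AnyAct n)
hops {E = []} α = (_ , _ , _ , α) ∷ []
hops {g = g} {E = h ∷ E} α = (_ , _ , _ , α) ∷ hopsIf α (hop? g) refl
hopsIf α true e = hops (hop α e)
hopsIf α false e = []

-- Finite lists suffice: each drop and each hop uses up one stack entry, and only a new tripod
-- raises n.
ucodes : ∀ n → List (CodeU n)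
acts : ∀ n → List (AnyAct n)
ucodes zero = (_ , nil) ∷ []
ucodes (suc n) = concatMap (λ { (i , g , E , α) → drops (done α refl) }) (acts n)
acts n = concatMap (λ { (E , d) → hops (trip d) }) (ucodes n)

drops-head : ∀ {n E} (d : UW n E) → (E , d) ∈ drops d
drops-head {E = []} d = here refl
drops-head {E = g ∷ E} d = here refl

drops-closed : ∀ {n E₀ g E} (d₀ : UW n E₀) (d : UW n (g ∷ E)) → (g ∷ E , d) ∈ drops d₀ → (E , drop d) ∈ drops d₀
drops-closed {E₀ = []} d₀ d (here ())
drops-closed {E₀ = _ ∷ _} d₀ .d₀ (here refl) = there (drops-head (drop d₀))
drops-closed {E₀ = _ ∷ _} d₀ d (there p) = there (drops-closed (drop d₀) d p)

hops-head : ∀ {n i g E} (α : Act n i g E) → (i , g , E , α) ∈ hops α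
hops-head {E = []} α = here refl
hops-head {E = h ∷ E} α = here refl

hops-closed : ∀ {n i₀ g₀ E₀ i g h E} (α₀ : Act n i₀ g₀ E₀) (α : Act n i g (h ∷ E)) (e : hop? g ≡ true) → (i , g , h ∷ E , α) ∈ hops α₀ →
  (suc i , Maybe.map suc h , E , hop α e) ∈ hops α₀
hopsIf-closed : ∀ {n i₀ g₀ h₀ E₀ i g h E} (α₀ : Act n i₀ g₀ (h₀ ∷ E₀)) b (e₀ : hop? g₀ ≡ b) (α : Act n i g (h ∷ E)) (e : hop? g ≡ true) → (i , g , h ∷ E , α) ∈ hopsIf α₀ b e₀ →
  (suc i , Maybe.map suc h , E , hop α e) ∈ hopsIf α₀ b e₀
hopsIf-head : ∀ {n i g h E} (α : Act n i g (h ∷ E)) (e : hop? g ≡ true) b (e₀ : hop? g ≡ b) → (suc i , Maybe.map suc h , E , hop α e) ∈ hopsIf α b e₀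
hopsIf-head {g = g} α e true e₀ with uip e e₀
... | refl = hops-head (hop α e)
hopsIf-head {g = g} α e false e₀ with trans (sym e) e₀
... | ()
hops-closed {E₀ = []} α₀ α e (here ())
hops-closed {g₀ = g₀} {E₀ = _ ∷ _} α₀ .α₀ e (here refl) = there (hopsIf-head α₀ e (hop? g₀) refl)
hops-closed {g₀ = g₀} {E₀ = _ ∷ _} α₀ α e (there p) = there (hopsIf-closed α₀ (hop? g₀) refl α e p)
hopsIf-closed α₀ true e₀ α e p = hops-closed (hop α₀ e₀) α e p

∈-concatMap : ∀ {A B : Set} (f : A → List B) {xs x y} → x ∈ xs → y ∈ f x → y ∈ concatMap f xs
∈-concatMap f {x ∷ xs} (here refl) q = Memₚ.∈-++⁺ˡ q
∈-concatMap f {x ∷ xs} (there p) q = Memₚ.∈-++⁺ʳ (f x) (∈-concatMap f p q)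

∈-concatMap⁻ : ∀ {A B : Set} (f : A → List B) xs {y} → y ∈ concatMap f xs → ∃ λ x → x ∈ xs × y ∈ f x
∈-concatMap⁻ f (x ∷ xs) p with Memₚ.∈-++⁻ (f x) p
... | inj₁ q = x , here refl , q
... | inj₂ q with ∈-concatMap⁻ f xs q
... | x′ , a , b = x′ , there a , b

ucodes-complete : ∀ {n E} (d : UW n E) → (E , d) ∈ ucodes n
acts-complete : ∀ {n i g E} (α : Act n i g E) → (i , g , E , α) ∈ acts n
ucodes-complete nil = here refl
ucodes-complete {zero} (drop d) with uw-0 d
... | ()
ucodes-complete {suc n} (drop d) with ∈-concatMap⁻ _ (acts n) (ucodes-complete d)
... | (i , g , E , α) , a , b = ∈-concatMap _ a (drops-closed (done α refl) d b)
ucodes-complete (done α refl) = ∈-concatMap _ (acts-complete α) (drops-head (done α refl))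
acts-complete {n} (trip d) = ∈-concatMap _ (ucodes-complete d) (hops-head (trip d))
acts-complete {n} (hop α e) with ∈-concatMap⁻ _ (ucodes n) (acts-complete α)
... | (E , d) , a , b = ∈-concatMap _ a (hops-closed (trip d) α e b)

ΣL : {A : Set} → List A → (A → ℕ) → ℕ
ΣL [] f = 0
ΣL (x ∷ xs) f = f x + ΣL xs f

ΣL-++ : {A : Set} (xs ys : List A) (f : A → ℕ) → ΣL (xs ++ ys) f ≡ ΣL xs f + ΣL ys f
ΣL-++ [] ys f = refl
ΣL-++ (x ∷ xs) ys f = trans (cong (f x +_) (ΣL-++ xs ys f)) (sym (ℕₚ.+-assoc (f x) _ _))

ΣL-concatMap : {A B : Set} (g : A → List B) (xs : List A) (f : B → ℕ) → ΣL (concatMap g xs) f ≡ ΣL xs (λ x → ΣL (g x) f)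
ΣL-concatMap g [] f = refl
ΣL-concatMap g (x ∷ xs) f = trans (ΣL-++ (g x) _ f) (cong (ΣL (g x) f +_) (ΣL-concatMap g xs f))

ΣL-cong : {A : Set} (xs : List A) {f g : A → ℕ} → (∀ x → f x ≡ g x) → ΣL xs f ≡ ΣL xs g
ΣL-cong [] h = refl
ΣL-cong (x ∷ xs) h = cong₂ _+_ (h x) (ΣL-cong xs h)

ΣL-+ : {A : Set} (xs : List A) (f g : A → ℕ) → ΣL xs (λ x → f x + g x) ≡ ΣL xs f + ΣL xs g
ΣL-+ [] f g = refl
ΣL-+ (x ∷ xs) f g = trans (cong (f x + g x +_) (ΣL-+ xs f g)) (lem (f x) (g x) (ΣL xs f) (ΣL xs g))
  where
  lem : ∀ a b c d → a + b + (c + d) ≡ a + c + (b + d)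
  lem = solve-∀

ΣL-* : {A : Set} (xs : List A) (f : A → ℕ) (c : ℕ) → ΣL xs (λ x → c * f x) ≡ c * ΣL xs f
ΣL-* [] f c = sym (ℕₚ.*-zeroʳ c)
ΣL-* (x ∷ xs) f c = trans (cong (c * f x +_) (ΣL-* xs f c)) (sym (ℕₚ.*-distribˡ-+ c (f x) _))

ΣL-0 : {A : Set} (xs : List A) {f : A → ℕ} → (∀ x → f x ≡ 0) → ΣL xs f ≡ 0
ΣL-0 [] h = refl
ΣL-0 (x ∷ xs) h = cong₂ _+_ (h x) (ΣL-0 xs h)

-- A colour for every stack element, and a mark demanding that the gap after it is open.
Marked : Set
Marked = List (Bool × Bool)

-- A closed gap through an even number of black vertices joins strands of equal colour.
fits : ℕ → Bool → Bool → ℕ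
fits j x y = if (odd j xor (x xor y)) then 1 else 0

cmp : Stack → Marked → ℕ
cmp [] [] = 1
cmp [] (_ ∷ _) = 0
cmp (_ ∷ _) [] = 0
cmp (nothing ∷ E) (_ ∷ e) = cmp E e
cmp (just j ∷ E) ((x , true) ∷ e) = 0
cmp (just j ∷ E) ((x , false) ∷ []) = 0
cmp (just j ∷ E) ((x , false) ∷ (y , μ) ∷ e) = fits j x y * cmp E ((y , μ) ∷ e)

plain : Bool → Bool × Bool
plain x = x , false

fits-both : ∀ j y → fits j true y + fits j false y ≡ 1
fits-both j y with odd j | y
... | true | true = refl
... | true | false = refl
... | false | true = refl
... | false | false = refl

-- The sum over the colour of the front strand. A closed gap admits exactly one colour; an open gap
-- admits both, while dropping it contributes w, and v times the word with the gap marked as open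
-- makes up the difference.
cmp-extend : ∀ w v → w + v ≡ 2 → ∀ g E e z → EndsOpen (g ∷ E) →
  w ^ closes g * cmp E e + v * cmp (g ∷ E) ((z , true) ∷ e) ≡ cmp (g ∷ E) (plain true ∷ e) + cmp (g ∷ E) (plain false ∷ e)
cmp-extend w v h nothing E e z o = trans (cong (λ x → x * cmp E e + v * cmp E e) (ℕₚ.*-identityʳ w)) (trans (sym (ℕₚ.*-distribʳ-+ (cmp E e) w v)) (trans (cong (_* cmp E e) h) (cong (cmp E e +_) (ℕₚ.+-identityʳ _))))
cmp-extend w v h (just j) [] e z ()
cmp-extend w v h (just j) (g ∷ E) [] z o = trans (cong (λ x → x + v * 0) (ℕₚ.*-zeroʳ 1)) (ℕₚ.*-zeroʳ v)
cmp-extend w v h (just j) (g ∷ E) ((y , μ) ∷ e) z o = trans (cong₂ _+_ (ℕₚ.*-identityˡ _) (ℕₚ.*-zeroʳ v)) (trans (ℕₚ.+-identityʳ c)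
  (trans (sym (ℕₚ.*-identityˡ c)) (trans (cong (_* c) (sym (fits-both j y))) (ℕₚ.*-distribʳ-+ c (fits j true y) (fits j false y)))))
  where
  c = cmp (g ∷ E) ((y , μ) ∷ e)

-- A finished component weighs w, whereas summing over colours produces 2; v is the difference. The
-- two cases used are w = 2, which counts all webs with their weights, and w = 0, which keeps only
-- codes without a finished component.
module Sums (w v : ℕ) (w+v : w + v ≡ 2) where

  term : ∀ {n} → Marked → CodeU n → ℕ
  term e (E , d) = w ^ κU d * cmp E e

  S : ℕ → Marked → ℕ
  S n e = ΣL (ucodes n) (term e)

  drops-sum : ∀ {n E} (d : UW n E) e z → ΣL (drops d) (term e) + v * ΣL (drops d) (term ((z , true) ∷ e)) ≡
    w ^ κU d * cmp E e + (ΣL (drops d) (term (plain true ∷ e)) + ΣL (drops d) (term (plain false ∷ e)))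
  drops-sum {E = []} d e z = trans (cong₂ _+_ (ℕₚ.+-identityʳ _) (trans (cong (v *_) (trans (ℕₚ.+-identityʳ _) z0)) (ℕₚ.*-zeroʳ v))) (cong (w ^ κU d * cmp [] e +_) (sym (cong₂ _+_ (trans (ℕₚ.+-identityʳ _) z0) (trans (ℕₚ.+-identityʳ _) z0))))
    where
    z0 : w ^ κU d * 0 ≡ 0
    z0 = ℕₚ.*-zeroʳ (w ^ κU d)
  drops-sum {E = g ∷ E} d e z = begin
    (W * c₀ + T₀) + v * (W * cz + Tz)                      ≡⟨ lem₁ W c₀ T₀ v cz Tz ⟩
    W * c₀ + W * (v * cz) + (T₀ + v * Tz)                  ≡⟨ cong (W * c₀ + W * (v * cz) +_) (drops-sum (drop d) e z) ⟩
    W * c₀ + W * (v * cz) + (w ^ (closes g + κU d) * cmp E e + (Tt + Tf)) ≡⟨ cong (λ x → W * c₀ + W * (v * cz) + (x * cmp E e + (Tt + Tf))) (ℕₚ.^-distribˡ-+-* w (closes g) (κU d)) ⟩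
    W * c₀ + W * (v * cz) + (w ^ closes g * W * cmp E e + (Tt + Tf)) ≡⟨ lem₂ W c₀ (v * cz) (w ^ closes g) (cmp E e) Tt Tf ⟩
    W * c₀ + (W * (w ^ closes g * cmp E e + v * cz) + (Tt + Tf)) ≡⟨ cong (λ x → W * c₀ + (W * x + (Tt + Tf))) (cmp-extend w v w+v g E e z (ends-uw d)) ⟩
    W * c₀ + (W * (ct + cf′) + (Tt + Tf))                   ≡⟨ lem₃ W c₀ ct cf′ Tt Tf ⟩
    W * c₀ + ((W * ct + Tt) + (W * cf′ + Tf))               ∎
    where
    open ≡-Reasoning
    W = w ^ κU d
    c₀ = cmp (g ∷ E) e
    cz = cmp (g ∷ E) ((z , true) ∷ e)
    ct = cmp (g ∷ E) (plain true ∷ e)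
    cf′ = cmp (g ∷ E) (plain false ∷ e)
    T₀ = ΣL (drops (drop d)) (term e)
    Tz = ΣL (drops (drop d)) (term ((z , true) ∷ e))
    Tt = ΣL (drops (drop d)) (term (plain true ∷ e))
    Tf = ΣL (drops (drop d)) (term (plain false ∷ e))
    lem₁ : ∀ W c T v z Z → W * c + T + v * (W * z + Z) ≡ W * c + W * (v * z) + (T + v * Z)
    lem₁ = solve-∀
    lem₂ : ∀ W c z p q a b → W * c + W * z + (p * W * q + (a + b)) ≡ W * c + (W * (p * q + z) + (a + b))
    lem₂ = solve-∀
    lem₃ : ∀ W c x y a b → W * c + (W * (x + y) + (a + b)) ≡ W * c + ((W * x + a) + (W * y + b))
    lem₃ = solve-∀

  actTerm : ∀ {n} → Marked → AnyAct n → ℕ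
  actTerm e (i , g , E , α) = w ^ κA α * cmp (stack i g E) e

  Bₛ : ℕ → Marked → ℕ
  Bₛ n e = ΣL (acts n) (actTerm e)

  S-suc : ∀ n e z → S (suc n) e + v * S (suc n) ((z , true) ∷ e) ≡ Bₛ n e + (S (suc n) (plain true ∷ e) + S (suc n) (plain false ∷ e))
  S-suc n e z = begin
    S (suc n) e + v * S (suc n) ((z , true) ∷ e)  ≡⟨ cong₂ (λ a b → a + v * b) (flat e) (flat ((z , true) ∷ e)) ⟩
    ΣL (acts n) (dr e) + v * ΣL (acts n) (dr ((z , true) ∷ e))  ≡⟨ cong (ΣL (acts n) (dr e) +_) (sym (ΣL-* (acts n) _ v)) ⟩
    ΣL (acts n) (dr e) + ΣL (acts n) (λ a → v * dr ((z , true) ∷ e) a)  ≡⟨ sym (ΣL-+ (acts n) _ _) ⟩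
    ΣL (acts n) (λ a → dr e a + v * dr ((z , true) ∷ e) a)  ≡⟨ ΣL-cong (acts n) (λ { (i , g , E , α) → drops-sum (done {i = i} {E = E} α refl) e z }) ⟩
    ΣL (acts n) (λ a → actTerm e a + (dr (plain true ∷ e) a + dr (plain false ∷ e) a))  ≡⟨ trans (ΣL-+ (acts n) _ _) (cong (Bₛ n e +_) (ΣL-+ (acts n) _ _)) ⟩
    Bₛ n e + (ΣL (acts n) (dr (plain true ∷ e)) + ΣL (acts n) (dr (plain false ∷ e)))  ≡⟨ cong (Bₛ n e +_) (sym (cong₂ _+_ (flat (plain true ∷ e)) (flat (plain false ∷ e)))) ⟩
    Bₛ n e + (S (suc n) (plain true ∷ e) + S (suc n) (plain false ∷ e)) ∎
    where
    open ≡-Reasoning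
    dr : Marked → AnyAct n → ℕ
    dr e (i , g , E , α) = ΣL (drops (done α refl)) (term e)
    flat : ∀ e → S (suc n) e ≡ ΣL (acts n) (dr e)
    flat e = trans (ΣL-concatMap _ (acts n) (term e)) (ΣL-cong (acts n) (λ { (i , g , E , α) → refl }))

opt : {A : Set} → (A → ℕ) → Maybe A → ℕ
opt h nothing = 0
opt h (just x) = h x

opt-map : {A B : Set} (h : B → ℕ) (k : A → B) (x : Maybe A) → opt h (Maybe.map k x) ≡ opt (λ a → h (k a)) x
opt-map h k nothing = refl
opt-map h k (just x) = refl

opt-cong : {A : Set} {h k : A → ℕ} → (∀ a → h a ≡ k a) → ∀ x → opt h x ≡ opt k x
opt-cong p nothing = refl
opt-cong p (just x) = p x

-- A strand of colour x crosses a run of x's up to the first other colour; the mark there is inherited.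
cross : Bool → Marked → Maybe Marked
cross x [] = nothing
cross x ((y , μ) ∷ e) = if x xor y then just ((x , μ) ∷ e) else (if μ then nothing else Maybe.map (plain x ∷_) (cross x e))

reduct : Marked → Maybe Marked
reduct [] = nothing
reduct ((x , true) ∷ e) = nothing
reduct ((x , false) ∷ e) = Maybe.map (Data.List.drop 1) (cross x e)

flip : Marked → Marked
flip [] = []
flip ((x , μ) ∷ e) = (not x , μ) ∷ e

run : ℕ → Bool → Marked → Marked
run zero x e = e
run (suc i) x e = plain x ∷ run i x e

run-shift : ∀ i x e → run i x (plain x ∷ e) ≡ plain x ∷ run i x e
run-shift zero x e = refl
run-shift (suc i) x e = cong (plain x ∷_) (run-shift i x e)

-- Gaps `just 1` demand equal colours, so a run of equal letters and the gaps along it can be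
-- removed together.
stack-run : ∀ i k g E x e → cmp (stack (i + k) g E) (run i x (plain x ∷ e)) ≡ cmp (stack k g E) (plain x ∷ e)
stack-run zero k g E x e = refl
stack-run (suc i) k g E x e = trans (one x) (stack-run i k g E x e)
  where
  one : ∀ x → cmp (just 1 ∷ stack (i + k) g E) (plain x ∷ run i x (plain x ∷ e)) ≡ cmp (stack (i + k) g E) (run i x (plain x ∷ e))
  one x = trans (cong (λ z → cmp (just 1 ∷ stack (i + k) g E) (plain x ∷ z)) (run-shift i x e)) (trans (two x) (sym (cong (cmp (stack (i + k) g E)) (run-shift i x e))))
    where
    two : ∀ x → fits 1 x x * cmp (stack (i + k) g E) (plain x ∷ run i x e) ≡ cmp (stack (i + k) g E) (plain x ∷ run i x e)
    two true = ℕₚ.+-identityʳ _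
    two false = ℕₚ.+-identityʳ _

stack-[] : ∀ k g E → cmp (stack k g E) [] ≡ 0
stack-[] zero g E = refl
stack-[] (suc k) g E = refl

stack-mark : ∀ k g E x e → cmp (stack k g E) ((x , true) ∷ e) ≡ 0
stack-mark zero g E x e = refl
stack-mark (suc k) g E x e = refl

stack-single : ∀ k g E x → cmp (stack k g E) (plain x ∷ []) ≡ 0
stack-single zero g E x = refl
stack-single (suc k) g E x = refl

stack-blocked : ∀ k g E x e → cmp (stack k g E) (plain x ∷ (x , true) ∷ e) ≡ 0
stack-blocked zero g E true e = refl
stack-blocked zero g E false e = refl
stack-blocked (suc k) g E x e = trans (cong (fits 1 x x *_) (stack-mark k g E x e)) (ℕₚ.*-zeroʳ (fits 1 x x))

stack-short : ∀ k g E x μ e → cmp (stack (suc k) g E) (plain x ∷ (not x , μ) ∷ e) ≡ 0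
stack-short k g E true μ e = refl
stack-short k g E false μ e = refl

fits-suc : ∀ j x y → fits (suc j) (not x) y ≡ fits j x y
fits-suc j x y with odd j | x | y
... | true | true | true = refl
... | true | true | false = refl
... | true | false | true = refl
... | true | false | false = refl
... | false | true | true = refl
... | false | true | false = refl
... | false | false | true = refl
... | false | false | false = refl

-- One more black vertex on a gap has the same effect on compatibility as changing the colour at one
-- end; an open gap ignores both.
cmp-flip : ∀ h E e → cmp (Maybe.map suc h ∷ E) (flip e) ≡ cmp (h ∷ E) e
cmp-flip nothing E [] = refl
cmp-flip nothing E (_ ∷ e) = refl
cmp-flip (just j) E [] = refl
cmp-flip (just j) E ((x , true) ∷ e) = refl
cmp-flip (just j) E ((x , false) ∷ []) = refl
cmp-flip (just j) E ((x , false) ∷ (y , μ) ∷ e) = cong (_* cmp E ((y , μ) ∷ e)) (fits-suc j x y)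

cross-head : ∀ x e → cross x e ≡ nothing ⊎ ∃ λ μ → ∃ λ e′ → cross x e ≡ just ((x , μ) ∷ e′)
cross-head x [] = inj₁ refl
cross-head x ((y , μ) ∷ e) with x xor y | μ
... | true | μ = inj₂ (μ , e , refl)
... | false | true = inj₁ refl
... | false | false with cross x e
... | nothing = inj₁ refl
... | just e′ = inj₂ (false , e′ , refl)

-- The rest of the run, seen by the strand that has crossed one element of it.
crossed : ∀ x e g h E → hop? g ≡ true → opt (λ e′ → cmp (g ∷ h ∷ E) (flip e′)) (cross x (plain x ∷ e)) ≡ opt (λ e′ → cmp (Maybe.map suc h ∷ E) (flip e′)) (cross x e)
crossed x e g h E q = trans (cong (opt _) (stay x)) (trans (opt-map _ (plain x ∷_) (cross x e)) (go (cross x e) (cross-head x e)))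
  where
  stay : ∀ x → cross x (plain x ∷ e) ≡ Maybe.map (plain x ∷_) (cross x e)
  stay true = refl
  stay false = refl
  go : ∀ c → (c ≡ nothing ⊎ ∃ λ μ → ∃ λ e′ → c ≡ just ((x , μ) ∷ e′)) → opt (λ e′ → cmp (g ∷ h ∷ E) (plain (not x) ∷ e′)) c ≡ opt (λ e′ → cmp (Maybe.map suc h ∷ E) (flip e′)) c
  go _ (inj₁ refl) = refl
  go _ (inj₂ (μ , e′ , refl)) = trans (via g q) (sym (cmp-flip h E ((x , μ) ∷ e′)))
    where
    one : ∀ j x → odd (suc j) ≡ true → fits j (not x) x ≡ 1
    one j x q with odd j
    one j true q | false = refl
    one j false q | false = refl
    via : ∀ g → hop? g ≡ true → cmp (g ∷ h ∷ E) (plain (not x) ∷ (x , μ) ∷ e′) ≡ cmp (h ∷ E) ((x , μ) ∷ e′)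
    via nothing q = refl
    via (just j) q = trans (cong (_* cmp (h ∷ E) ((x , μ) ∷ e′)) (one j x q)) (ℕₚ.*-identityˡ _)

blocked : ∀ x e g h E → hop? g ≡ false → opt (λ e′ → cmp (g ∷ h ∷ E) (flip e′)) (cross x (plain x ∷ e)) ≡ 0
blocked x e g h E q = trans (cong (opt _) (stay x)) (trans (opt-map _ (plain x ∷_) (cross x e)) (go (cross x e) (cross-head x e)))
  where
  stay : ∀ x → cross x (plain x ∷ e) ≡ Maybe.map (plain x ∷_) (cross x e)
  stay true = refl
  stay false = refl
  go : ∀ c → (c ≡ nothing ⊎ ∃ λ μ → ∃ λ e′ → c ≡ just ((x , μ) ∷ e′)) → opt (λ e′ → cmp (g ∷ h ∷ E) (plain (not x) ∷ e′)) c ≡ 0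
  go _ (inj₁ refl) = refl
  go _ (inj₂ (μ , e′ , refl)) = via g q
    where
    one : ∀ j x → odd (suc j) ≡ false → fits j (not x) x ≡ 0
    one j x q with odd j
    one j true q | true = refl
    one j false q | true = refl
    via : ∀ g → hop? g ≡ false → cmp (g ∷ h ∷ E) (plain (not x) ∷ (x , μ) ∷ e′) ≡ 0
    via (just j) q = cong (_* cmp (h ∷ E) ((x , μ) ∷ e′)) (one j x q)

ended : ∀ x e g → opt (λ e′ → cmp (g ∷ []) (flip e′)) (cross x (plain x ∷ e)) ≡ 0
ended x e g = trans (cong (opt _) (stay x)) (trans (opt-map _ (plain x ∷_) (cross x e)) (go (cross x e) (cross-head x e)))
  where
  stay : ∀ x → cross x (plain x ∷ e) ≡ Maybe.map (plain x ∷_) (cross x e)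
  stay true = refl
  stay false = refl
  go : ∀ c → (c ≡ nothing ⊎ ∃ λ μ → ∃ λ e′ → c ≡ just ((x , μ) ∷ e′)) → opt (λ e′ → cmp (g ∷ []) (plain (not x) ∷ e′)) c ≡ 0
  go _ (inj₁ refl) = refl
  go _ (inj₂ (μ , e′ , refl)) = via g
    where
    via : ∀ g → cmp (g ∷ []) (plain (not x) ∷ (x , μ) ∷ e′) ≡ 0
    via nothing = refl
    via (just j) = ℕₚ.*-zeroʳ (fits j (not x) x)

module Combs (w v : ℕ) (w+v : w + v ≡ 2) where
  open Sums w v w+v

  hops-zero : ∀ {n i g E} (α : Act n i g E) e → (∀ k g E → cmp (stack (i + k) g E) e ≡ 0) → ΣL (hops α) (actTerm e) ≡ 0
  hopsIf-zero : ∀ {n i g h E} (α : Act n i g (h ∷ E)) b (q : hop? g ≡ b) e → (∀ k g E → cmp (stack (suc i + k) g E) e ≡ 0) → ΣL (hopsIf α b q) (actTerm e) ≡ 0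
  own-zero : ∀ {n i g E} (α : Act n i g E) e → (∀ k g E → cmp (stack (i + k) g E) e ≡ 0) → actTerm e (i , g , E , α) ≡ 0
  own-zero {i = i} {g} {E} α e z = trans (cong (w ^ κA α *_) (subst (λ j → cmp (stack j g E) e ≡ 0) (ℕₚ.+-identityʳ i) (z 0 g E))) (ℕₚ.*-zeroʳ (w ^ κA α))
  hops-zero {E = []} α e z = trans (ℕₚ.+-identityʳ _) (own-zero α e z)
  hops-zero {i = i} {g} {E = h ∷ E} α e z = cong₂ _+_ (own-zero α e z) (hopsIf-zero α (hop? g) refl e (λ k g E → subst (λ j → cmp (stack j g E) e ≡ 0) (ℕₚ.+-suc i k) (z (suc k) g E)))
  hopsIf-zero α true q e z = hops-zero (hop α q) e z
  hopsIf-zero α false q e z = refl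

  hop-over : ∀ {n i g E} (α : Act n i g E) x e →
    (∀ {h E} (β : Act n (suc i) (Maybe.map suc h) E) → ΣL (hops β) (actTerm (run (suc i) x (plain x ∷ e))) ≡ w ^ κA β * opt (λ e′ → cmp (Maybe.map suc h ∷ E) (flip e′)) (cross x e)) →
    ΣL (hops α) (actTerm (run i x (plain x ∷ plain x ∷ e))) ≡ w ^ κA α * opt (λ e′ → cmp (g ∷ E) (flip e′)) (cross x (plain x ∷ e))
  hop-over {n} {i} {g} {E} α x e IH = go E α
    where
    z0 : ∀ E x → cmp (stack 0 g E) (plain x ∷ plain x ∷ e) ≡ 0
    z0 E true = refl
    z0 E false = refl
    own0 : ∀ {E} (α : Act n i g E) → actTerm (run i x (plain x ∷ plain x ∷ e)) (i , g , E , α) ≡ 0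
    own0 {E} α = trans (cong (w ^ κA α *_) (trans (cong (λ j → cmp (stack j g E) (run i x (plain x ∷ plain x ∷ e))) (sym (ℕₚ.+-identityʳ i))) (trans (stack-run i 0 g E x (plain x ∷ e)) (z0 E x)))) (ℕₚ.*-zeroʳ (w ^ κA α))
    over : ∀ {h E} (α : Act n i g (h ∷ E)) b (q : hop? g ≡ b) → ΣL (hopsIf α b q) (actTerm (run i x (plain x ∷ plain x ∷ e))) ≡
      w ^ κA α * opt (λ e′ → cmp (g ∷ h ∷ E) (flip e′)) (cross x (plain x ∷ e))
    over {h} {E} α true q = trans (cong (λ z → ΣL (hops (hop α q)) (actTerm z)) (run-shift i x (plain x ∷ e))) (trans (IH {h} (hop α q)) (cong (w ^ κA α *_) (sym (crossed x e g h E q))))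
    over {h} {E} α false q = sym (trans (cong (w ^ κA α *_) (blocked x e g h E q)) (ℕₚ.*-zeroʳ (w ^ κA α)))
    go : ∀ E (α : Act n i g E) → ΣL (hops α) (actTerm (run i x (plain x ∷ plain x ∷ e))) ≡ w ^ κA α * opt (λ e′ → cmp (g ∷ E) (flip e′)) (cross x (plain x ∷ e))
    go [] α = trans (cong (_+ 0) (own0 α)) (sym (trans (cong (w ^ κA α *_) (ended x e g)) (ℕₚ.*-zeroʳ (w ^ κA α))))
    go (h ∷ E) α = trans (cong (_+ ΣL (hopsIf α (hop? g) refl) (actTerm (run i x (plain x ∷ plain x ∷ e)))) (own0 α)) (over α (hop? g) refl)

  hop-none : ∀ {n i g E} (α : Act n i g E) x e → (∀ k g E → cmp (stack k g E) (plain x ∷ e) ≡ 0) → ΣL (hops α) (actTerm (run i x (plain x ∷ e))) ≡ w ^ κA α * 0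
  hop-none {i = i} α x e z = trans (hops-zero α _ (λ k g E → trans (stack-run i k g E x e) (z k g E))) (sym (ℕₚ.*-zeroʳ (w ^ κA α)))

  hop-last : ∀ {n i g E} (α : Act n i g E) x μ e → ΣL (hops α) (actTerm (run i x (plain x ∷ (not x , μ) ∷ e))) ≡ w ^ κA α * cmp (g ∷ E) ((not x , μ) ∷ e)
  hop-last {n} {i} {g} {E} α x μ e = go E α
    where
    own : ∀ {E} → cmp (stack i g E) (run i x (plain x ∷ (not x , μ) ∷ e)) ≡ cmp (g ∷ E) ((not x , μ) ∷ e)
    own {E} = trans (cong (λ j → cmp (stack j g E) (run i x (plain x ∷ (not x , μ) ∷ e))) (sym (ℕₚ.+-identityʳ i))) (trans (stack-run i 0 g E x ((not x , μ) ∷ e)) (tf x))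
      where
      tf : ∀ x → cmp (stack 0 g E) (plain x ∷ (not x , μ) ∷ e) ≡ cmp (g ∷ E) ((not x , μ) ∷ e)
      tf true = ℕₚ.*-identityˡ _
      tf false = ℕₚ.*-identityˡ _
    go : ∀ E (α : Act n i g E) → ΣL (hops α) (actTerm (run i x (plain x ∷ (not x , μ) ∷ e))) ≡ w ^ κA α * cmp (g ∷ E) ((not x , μ) ∷ e)
    go [] α = trans (ℕₚ.+-identityʳ _) (cong (w ^ κA α *_) own)
    go (h ∷ E) α = trans (cong₂ _+_ (cong (w ^ κA α *_) own) (hopsIf-zero α (hop? g) refl _ (λ k g E → trans (cong (λ j → cmp (stack j g E) (run i x (plain x ∷ (not x , μ) ∷ e))) (sym (ℕₚ.+-suc i k)))
      (trans (stack-run i (suc k) g E x _) (stack-short k g E x μ e))))) (ℕₚ.+-identityʳ _)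

  -- The word determines the number of hops: after them the last leg is the first strand whose
  -- colour is not x, and every other number contributes 0. Undoing the hops exchanges this leg with
  -- the strands of colour x that it has crossed.
  hops-sum : ∀ {n i g E} (α : Act n i g E) x e → ΣL (hops α) (actTerm (run i x (plain x ∷ e))) ≡ w ^ κA α * opt (λ e′ → cmp (g ∷ E) (flip e′)) (cross x e)
  hops-sum α x [] = hop-none α x [] (λ k g E → stack-single k g E x)
  hops-sum α true ((true , true) ∷ e) = hop-none α true _ (λ k g E → stack-blocked k g E true e)
  hops-sum α false ((false , true) ∷ e) = hop-none α false _ (λ k g E → stack-blocked k g E false e)
  hops-sum α true ((true , false) ∷ e) = hop-over α true e (λ β → hops-sum β true e)
  hops-sum α false ((false , false) ∷ e) = hop-over α false e (λ β → hops-sum β false e)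
  hops-sum α true ((false , μ) ∷ e) = hop-last α true μ e
  hops-sum α false ((true , μ) ∷ e) = hop-last α false μ e

  trips : ∀ {n} → CodeU n → List (AnyAct n)
  trips (E , d) = hops (trip d)

  -- Undoing a completed tripod deletes two letters from the word: its second leg, of colour x, and
  -- its last leg, of the other colour. The first leg is not part of the stack.
  Bₛ-peel : ∀ n e → Bₛ n e ≡ opt (S n) (reduct e)
  Bₛ-peel n e = trans (trans (ΣL-concatMap _ (ucodes n) (actTerm e)) (ΣL-cong (ucodes n) (λ { (E , d) → refl }))) (byHead e)
    where
    byHead : ∀ e → ΣL (ucodes n) (λ u → ΣL (trips u) (actTerm e)) ≡ opt (S n) (reduct e)
    byHead [] = ΣL-0 (ucodes n) (λ { (E , d) → hops-zero (trip d) [] stack-[] })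
    byHead ((x , true) ∷ e) = ΣL-0 (ucodes n) (λ { (E , d) → hops-zero (trip d) _ (λ k g E → stack-mark k g E x e) })
    byHead ((x , false) ∷ e) = trans (ΣL-cong (ucodes n) {g = λ u → opt (λ e′ → term (Data.List.drop 1 e′) u) (cross x e)} (λ { (E , d) → trans (hops-sum (trip d) x e) (inner E d) })) (outer (cross x e))
      where
      inner : ∀ E (d : UW n E) → w ^ κU d * opt (λ e′ → cmp (nothing ∷ E) (flip e′)) (cross x e) ≡ opt (λ e′ → term (Data.List.drop 1 e′) (E , d)) (cross x e)
      inner E d = go (cross x e) (cross-head x e)
        where
        go : ∀ c → (c ≡ nothing ⊎ ∃ λ μ → ∃ λ e′ → c ≡ just ((x , μ) ∷ e′)) → w ^ κU d * opt (λ e′ → cmp (nothing ∷ E) (flip e′)) c ≡ opt (λ e′ → term (Data.List.drop 1 e′) (E , d)) c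
        go _ (inj₁ refl) = ℕₚ.*-zeroʳ (w ^ κU d)
        go _ (inj₂ (μ , e′ , refl)) = refl
      outer : ∀ c → ΣL (ucodes n) (λ u → opt (λ e′ → term (Data.List.drop 1 e′) u) c) ≡ opt (S n) (Maybe.map (Data.List.drop 1) c)
      outer nothing = ΣL-0 (ucodes n) (λ _ → refl)
      outer (just e′) = ΣL-cong (ucodes n) (λ _ → refl)

open PowerSeries

module ℕS = Series ℕₚ.+-*-commutativeSemiring
open ℕS using () renaming (_⊛_ to _∗_; tail to shift)

-- Dependence on the number of letters of each colour

crossB : Bool → List Bool → Maybe (List Bool)
crossB x [] = nothing
crossB x (y ∷ e) = if x xor y then just (x ∷ e) else Maybe.map (x ∷_) (crossB x e)

peelB : List Bool → Maybe (List Bool)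
peelB [] = nothing
peelB (x ∷ e) = Maybe.map (Data.List.drop 1) (crossB x e)

plains : List Bool → Marked
plains = map plain

#t #f : List Bool → ℕ
#t [] = 0
#t (true ∷ e) = suc (#t e)
#t (false ∷ e) = #t e
#f [] = 0
#f (true ∷ e) = #f e
#f (false ∷ e) = suc (#f e)

-- The counts depend on e through the numbers of its two colours only.
record Family (v : ℕ) (γ : ℕ → ℕ) (q : List Bool → ℕ → ℕ) : Set where
  field
    q-one  : q [] 0 ≡ 1
    q-long : ∀ n x e → M n ≤ length (x ∷ e) → q (x ∷ e) n ≡ 0
    q-suc  : ∀ n e → q e (suc n) + v * (shift γ ∗ q e) n ≡ opt (λ e′ → q e′ n) (peelB e) + (q (true ∷ e) (suc n) + q (false ∷ e) (suc n))

record Table (v : ℕ) (γ : ℕ → ℕ) (a : ℕ → ℕ → ℕ → ℕ) : Set where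
  field
    a-one  : a 0 0 0 ≡ 1
    a-long : ∀ n i j → 1 ≤ i + j → M n ≤ i + j → a i j n ≡ 0
    a-sucˡ : ∀ n i → a i 0 (suc n) + v * (shift γ ∗ a i 0) n ≡ a (suc i) 0 (suc n) + a i 1 (suc n)
    a-sucʳ : ∀ n j → a 0 j (suc n) + v * (shift γ ∗ a 0 j) n ≡ a 1 j (suc n) + a 0 (suc j) (suc n)
    a-suc  : ∀ n i j → a (suc i) (suc j) (suc n) + v * (shift γ ∗ a (suc i) (suc j)) n ≡ a i j n + (a (2 + i) (suc j) (suc n) + a (suc i) (2 + j) (suc n))

data CrossSpec (x : Bool) (e : List Bool) : Set where
  runs-on : crossB x e ≡ nothing → #t (not x ∷ e) ≡ #t (not x ∷ []) + #t e → (x ≡ true → #f e ≡ 0) → (x ≡ false → #t e ≡ 0) → CrossSpec x e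
  crosses : ∀ e′ → crossB x e ≡ just (x ∷ e′) → #t (x ∷ e) ≡ suc (#t e′) → #f (x ∷ e) ≡ suc (#f e′) → CrossSpec x e

crossB-spec : ∀ x e → CrossSpec x e
crossB-spec true [] = runs-on refl refl (λ _ → refl) (λ ())
crossB-spec false [] = runs-on refl refl (λ ()) (λ _ → refl)
crossB-spec true (false ∷ e) = crosses e refl refl refl
crossB-spec false (true ∷ e) = crosses e refl refl refl
crossB-spec true (true ∷ e) with crossB-spec true e
... | runs-on p _ z z′ = runs-on (cong (Maybe.map (true ∷_)) p) refl z (λ ())
... | crosses e′ p t f = crosses (true ∷ e′) (cong (Maybe.map (true ∷_)) p) (cong suc t) f
crossB-spec false (false ∷ e) with crossB-spec false e
... | runs-on p _ z z′ = runs-on (cong (Maybe.map (false ∷_)) p) refl (λ ()) z′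
... | crosses e′ p t f = crosses (false ∷ e′) (cong (Maybe.map (false ∷_)) p) t (cong suc f)

-- Peeling fails for a word of one colour and otherwise removes one letter of each colour. This is
-- why only the numbers of letters matter.
data PeelSpec (e : List Bool) : Set where
  monochrome : peelB e ≡ nothing → #t e ≡ 0 ⊎ #f e ≡ 0 → PeelSpec e
  peels : ∀ e′ → peelB e ≡ just e′ → #t e ≡ suc (#t e′) → #f e ≡ suc (#f e′) → PeelSpec e

peelB-spec : ∀ e → PeelSpec e
peelB-spec [] = monochrome refl (inj₁ refl)
peelB-spec (true ∷ e) with crossB-spec true e
... | runs-on p _ z z′ = monochrome (cong (Maybe.map (Data.List.drop 1)) p) (inj₂ (z refl))
... | crosses e′ p t f = peels e′ (cong (Maybe.map (Data.List.drop 1)) p) t f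
peelB-spec (false ∷ e) with crossB-spec false e
... | runs-on p _ z z′ = monochrome (cong (Maybe.map (Data.List.drop 1)) p) (inj₁ (z′ refl))
... | crosses e′ p t f = peels e′ (cong (Maybe.map (Data.List.drop 1)) p) t f

length-#  : ∀ e → length e ≡ #t e + #f e
length-# [] = refl
length-# (true ∷ e) = cong suc (length-# e)
length-# (false ∷ e) = trans (cong suc (length-# e)) (sym (ℕₚ.+-suc (#t e) (#f e)))

0≢suc : ∀ {n} → 0 ≢ suc n
0≢suc ()

module Content {v γ q} (A : Family v γ q) where
  open Family A

  -- The recursion leads to longer words and to smaller n. Nonempty words of length at least `M n`
  -- count 0, and L bounds how much longer a word must get to reach this length, so the recursion
  -- ends. `PeelSpec` keeps the contents equal.
  content : ∀ N n → n ≤ N → ∀ L e e′ → M n ≤ L + length e → #t e ≡ #t e′ → #f e ≡ #f e′ → q e n ≡ q e′ n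
  zero-long : ∀ n e e′ → M n ≤ length e → length e ≡ length e′ → q e n ≡ q e′ n
  zero-long n [] [] h eq = refl
  zero-long n (x ∷ e) (y ∷ e′) h eq = trans (q-long n x e h) (sym (q-long n y e′ (subst (M n ≤_) eq h)))
  len : ∀ e e′ → #t e ≡ #t e′ → #f e ≡ #f e′ → length e ≡ length e′
  len e e′ p r = trans (length-# e) (trans (cong₂ _+_ p r) (sym (length-# e′)))
  content N zero le L e e′ h p r = zero-long 0 e e′ z≤n (len e e′ p r)
  content N (suc n) le zero e e′ h p r = zero-long (suc n) e e′ h (len e e′ p r)
  content (suc N) (suc n) (s≤s le) (suc L) e e′ h p r = ℕₚ.+-cancelʳ-≡ (v * (shift γ ∗ q e) n) _ _ (begin
    q e (suc n) + v * (shift γ ∗ q e) n  ≡⟨ q-suc n e ⟩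
    opt (λ z → q z n) (peelB e) + (q (true ∷ e) (suc n) + q (false ∷ e) (suc n))  ≡⟨ cong₂ _+_ (peeled (peelB-spec e) (peelB-spec e′))
      (cong₂ _+_ (content (suc N) (suc n) (s≤s le) L (true ∷ e) (true ∷ e′) h′ (cong suc p) r) (content (suc N) (suc n) (s≤s le) L (false ∷ e) (false ∷ e′) h′ p (cong suc r))) ⟩
    opt (λ z → q z n) (peelB e′) + (q (true ∷ e′) (suc n) + q (false ∷ e′) (suc n))  ≡⟨ sym (q-suc n e′) ⟩
    q e′ (suc n) + v * (shift γ ∗ q e′) n  ≡⟨ cong (λ z → q e′ (suc n) + v * z) (sym (ℕS.⊛-agree {f = shift γ} {g = q e} (suc n) (λ _ _ → refl) (λ k lt → content N k (ℕₚ.≤-trans (ℕₚ.≤-pred lt) le) (M k) e e′ (ℕₚ.m≤m+n (M k) _) p r) n ℕₚ.≤-refl)) ⟩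
    q e′ (suc n) + v * (shift γ ∗ q e) n ∎)
    where
    open ≡-Reasoning
    h′ : M (suc n) ≤ L + suc (length e)
    h′ = subst (M (suc n) ≤_) (sym (ℕₚ.+-suc L (length e))) h
    peeled : PeelSpec e → PeelSpec e′ → opt (λ z → q z n) (peelB e) ≡ opt (λ z → q z n) (peelB e′)
    peeled (monochrome a _) (monochrome b _) = trans (cong (opt _) a) (cong (opt _) (sym b))
    peeled (monochrome _ (inj₁ z)) (peels _ _ t f) = ⊥-elim (0≢suc (trans (sym z) (trans p t)))
    peeled (monochrome _ (inj₂ z)) (peels _ _ t f) = ⊥-elim (0≢suc (trans (sym z) (trans r f)))
    peeled (peels _ _ t f) (monochrome _ (inj₁ z)) = ⊥-elim (0≢suc (trans (sym z) (trans (sym p) t)))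
    peeled (peels _ _ t f) (monochrome _ (inj₂ z)) = ⊥-elim (0≢suc (trans (sym z) (trans (sym r) f)))
    peeled (peels u a t f) (peels u′ b t′ f′) = trans (cong (opt _) a) (trans
      (content N n le (M n) u u′ (ℕₚ.m≤m+n (M n) _) (ℕₚ.suc-injective (trans (sym t) (trans p t′))) (ℕₚ.suc-injective (trans (sym f) (trans r f′)))) (cong (opt _) (sym b)))

  word : ℕ → ℕ → List Bool
  word zero j = replicate j false
  word (suc i) j = true ∷ word i j

  #t-word : ∀ i j → #t (word i j) ≡ i
  #t-word zero zero = refl
  #t-word zero (suc j) = #t-word zero j
  #t-word (suc i) j = cong suc (#t-word i j)

  #f-word : ∀ i j → #f (word i j) ≡ j
  #f-word zero zero = refl
  #f-word zero (suc j) = cong suc (#f-word zero j)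
  #f-word (suc i) j = #f-word i j

  q-word : ∀ n e {i j} → #t e ≡ i → #f e ≡ j → q e n ≡ q (word i j) n
  q-word n e refl refl = content n n ℕₚ.≤-refl (M n) e _ (ℕₚ.m≤m+n (M n) _) (sym (#t-word (#t e) (#f e))) (sym (#f-word (#t e) (#f e)))

  table : Table v γ (λ i j → q (word i j))
  table = record
    { a-one = q-one
    ; a-long = λ { n i j h h′ → long n (word i j) (trans (length-# (word i j)) (cong₂ _+_ (#t-word i j) (#f-word i j))) h h′ }
    ; a-sucˡ = λ n i → trans (q-suc n (word i 0)) (trans (cong (_+ (q (true ∷ word i 0) (suc n) + q (false ∷ word i 0) (suc n))) (mono n (word i 0) (inj₂ (#f-word i 0)))) (added n i 0))
    ; a-sucʳ = λ n j → trans (q-suc n (word 0 j)) (trans (cong (_+ (q (true ∷ word 0 j) (suc n) + q (false ∷ word 0 j) (suc n))) (mono n (word 0 j) (inj₁ (#t-word 0 j)))) (added n 0 j))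
    ; a-suc = λ n i j → trans (q-suc n (word (suc i) (suc j))) (cong₂ _+_ (inner n i j) (added n (suc i) (suc j))) }
    where
    long : ∀ n e {l} → length e ≡ l → 1 ≤ l → M n ≤ l → q e n ≡ 0
    long n [] refl ()
    long n (x ∷ e) refl h h′ = q-long n x e h′
    added : ∀ n i j → q (true ∷ word i j) (suc n) + q (false ∷ word i j) (suc n) ≡ q (word (suc i) j) (suc n) + q (word i (suc j)) (suc n)
    added n i j = cong (q (word (suc i) j) (suc n) +_) (q-word (suc n) (false ∷ word i j) (#t-word i j) (cong suc (#f-word i j)))
    mono : ∀ n e → #t e ≡ 0 ⊎ #f e ≡ 0 → opt (λ z → q z n) (peelB e) ≡ 0
    mono n e z with peelB-spec e
    ... | monochrome p _ = cong (opt (λ z → q z n)) p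
    mono n e (inj₁ z) | peels _ _ t f = ⊥-elim (0≢suc (trans (sym z) t))
    mono n e (inj₂ z) | peels _ _ t f = ⊥-elim (0≢suc (trans (sym z) f))
    inner : ∀ n i j → opt (λ z → q z n) (peelB (word (suc i) (suc j))) ≡ q (word i j) n
    inner n i j with peelB-spec (word (suc i) (suc j))
    ... | monochrome _ (inj₁ z) = ⊥-elim (0≢suc (trans (sym z) (#t-word (suc i) (suc j))))
    ... | monochrome _ (inj₂ z) = ⊥-elim (0≢suc (trans (sym z) (#f-word (suc i) (suc j))))
    ... | peels e p t f = trans (cong (opt (λ z → q z n)) p) (q-word n e (ℕₚ.suc-injective (trans (sym t) (#t-word (suc i) (suc j)))) (ℕₚ.suc-injective (trans (sym f) (#f-word (suc i) (suc j)))))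

cmp-length : ∀ E e → length E ≢ length e → cmp E e ≡ 0
cmp-length [] [] h = ⊥-elim (h refl)
cmp-length [] (_ ∷ _) h = refl
cmp-length (nothing ∷ E) [] h = refl
cmp-length (just _ ∷ E) [] h = refl
cmp-length (nothing ∷ E) (_ ∷ e) h = cmp-length E e (λ q → h (cong suc q))
cmp-length (just j ∷ E) ((x , true) ∷ e) h = refl
cmp-length (just j ∷ E) ((x , false) ∷ []) h = refl
cmp-length (just j ∷ E) ((x , false) ∷ (y , μ) ∷ e) h = trans (cong (fits j x y *_) (cmp-length E ((y , μ) ∷ e) (λ q → h (cong suc q)))) (ℕₚ.*-zeroʳ (fits j x y))

cross-plains : ∀ x e → cross x (plains e) ≡ Maybe.map plains (crossB x e)
cross-plains x [] = refl
cross-plains x (y ∷ e) with x xor y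
... | true = refl
... | false = trans (cong (Maybe.map (plain x ∷_)) (cross-plains x e)) (lem (crossB x e))
  where
  lem : ∀ c → Maybe.map (plain x ∷_) (Maybe.map plains c) ≡ Maybe.map plains (Maybe.map (x ∷_) c)
  lem nothing = refl
  lem (just _) = refl

peel-plains : ∀ e → reduct (plains e) ≡ Maybe.map plains (peelB e)
peel-plains [] = refl
peel-plains (x ∷ e) = trans (cong (Maybe.map (Data.List.drop 1)) (cross-plains x e)) (lem (crossB x e))
  where
  lem : ∀ c → Maybe.map (Data.List.drop 1) (Maybe.map plains c) ≡ Maybe.map plains (Maybe.map (Data.List.drop 1) c)
  lem nothing = refl
  lem (just []) = refl
  lem (just (_ ∷ _)) = refl

module Count (w v : ℕ) (w+v : w + v ≡ 2) where
  open Sums w v w+v public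
  open Combs w v w+v public

  S-long : ∀ n x e → M n ≤ length (x ∷ e) → S n (x ∷ e) ≡ 0
  S-long n x e h = ΣL-0 (ucodes n) (λ { (E , d) → trans (cong (w ^ κU d *_) (cmp-length E (x ∷ e) (λ q → short E (usize (uinv d)) q))) (ℕₚ.*-zeroʳ (w ^ κU d)) })
    where
    short : ∀ E → E ≡ [] ⊎ length E < M n → length E ≢ length (x ∷ e)
    short .[] (inj₁ refl) ()
    short E (inj₂ l) q = ℕₚ.<-irrefl q (ℕₚ.<-≤-trans l h)

  S-step : ∀ n e z → S (suc n) e + v * S (suc n) ((z , true) ∷ e) ≡ opt (S n) (reduct e) + (S (suc n) (plain true ∷ e) + S (suc n) (plain false ∷ e))
  S-step n e z = trans (S-suc n e z) (cong (_+ (S (suc n) (plain true ∷ e) + S (suc n) (plain false ∷ e))) (Bₛ-peel n e))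

  peel-S : ∀ n e → opt (S n) (reduct (plains e)) ≡ opt (λ e′ → S n (plains e′)) (peelB e)
  peel-S n e = trans (cong (opt (S n)) (peel-plains e)) (opt-map (S n) plains (peelB e))

module Tot = Count 2 0 refl

all-family : ∀ γ → Family 0 γ (λ e n → Tot.S n (plains e))
all-family γ = record
  { q-one = refl
  ; q-long = λ n x e h → Tot.S-long n (plain x) (plains e) (subst (M n ≤_) (cong suc (sym (Listₚ.length-map plain e))) h)
  ; q-suc = λ n e → trans (Tot.S-step n (plains e) true) (cong (_+ (Tot.S (suc n) (plains (true ∷ e)) + Tot.S (suc n) (plains (false ∷ e)))) (Tot.peel-S n e)) }

module One = Count 0 2 refl

-- Splitting connected pieces at an open gap

hat : Marked → Marked
hat [] = []
hat ((x , μ) ∷ []) = (x , true) ∷ []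
hat (a ∷ b ∷ e) = a ∷ hat (b ∷ e)

hat-length : ∀ f → length (hat f) ≡ length f
hat-length [] = refl
hat-length (_ ∷ []) = refl
hat-length (_ ∷ b ∷ f) = cong suc (hat-length (b ∷ f))

hatted : Marked → Maybe Marked → Maybe Marked
hatted e = Maybe.map (λ f → hat f ++ e)

cross-hat : ∀ x a f e → cross x (hat (a ∷ f) ++ e) ≡ hatted e (cross x (a ∷ f))
cross-hat true (true , true) [] e = refl
cross-hat true (true , false) [] e = refl
cross-hat true (false , μ) [] e = refl
cross-hat false (false , true) [] e = refl
cross-hat false (false , false) [] e = refl
cross-hat false (true , μ) [] e = refl
cross-hat x (y , μ) (b ∷ f) e with x xor y | μ
... | true | μ = refl
... | false | true = refl
... | false | false = trans (cong (Maybe.map (plain x ∷_)) (cross-hat x b f e)) (go (cross x (b ∷ f)) (cross-head x (b ∷ f)))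
  where
  go : ∀ c → (c ≡ nothing ⊎ ∃ λ μ → ∃ λ e′ → c ≡ just ((x , μ) ∷ e′)) → Maybe.map (plain x ∷_) (hatted e c) ≡ hatted e (Maybe.map (plain x ∷_) c)
  go _ (inj₁ refl) = refl
  go _ (inj₂ (μ , e′ , refl)) = refl

peel-hat : ∀ a f e → reduct (hat (a ∷ f) ++ e) ≡ hatted e (reduct (a ∷ f))
peel-hat (x , true) [] e = refl
peel-hat (x , false) [] e = refl
peel-hat (x , true) (b ∷ f) e = refl
peel-hat (x , false) (b ∷ f) e = trans (cong (Maybe.map (Data.List.drop 1)) (cross-hat x b f e)) (go (cross x (b ∷ f)) (cross-head x (b ∷ f)))
  where
  go : ∀ c → (c ≡ nothing ⊎ ∃ λ μ → ∃ λ e′ → c ≡ just ((x , μ) ∷ e′)) → Maybe.map (Data.List.drop 1) (hatted e c) ≡ hatted e (Maybe.map (Data.List.drop 1) c)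
  go _ (inj₁ refl) = refl
  go _ (inj₂ (μ , [] , refl)) = refl
  go _ (inj₂ (μ , _ ∷ _ , refl)) = refl

∗-vanish : ∀ f g n → (∀ j k → j + k ≡ n → f j * g k ≡ 0) → (f ∗ g) n ≡ 0
∗-vanish f g zero h = h 0 0 refl
∗-vanish f g (suc n) h = cong₂ _+_ (h 0 (suc n) refl) (∗-vanish (shift f) g n (λ j k e → h (suc j) k (cong suc e)))

-- The constant term of g is 0, so the top coefficient of f is irrelevant.
∗-cong-below : ∀ {f f′} g n → g 0 ≡ 0 → (∀ k → k < n → f k ≡ f′ k) → (f ∗ g) n ≡ (f′ ∗ g) n
∗-cong-below {f} {f′} g zero z h = trans (cong (f 0 *_) z) (trans (ℕₚ.*-zeroʳ (f 0)) (sym (trans (cong (f′ 0 *_) z) (ℕₚ.*-zeroʳ (f′ 0)))))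
∗-cong-below {f} {f′} g (suc n) z h = trans (ℕS.⊛-right f g n) (trans (cong₂ _+_ (both z) (ℕS.⊛-agree {g = shift g} (suc n) h (λ _ _ → refl) n ℕₚ.≤-refl)) (sym (ℕS.⊛-right f′ g n)))
  where
  both : g 0 ≡ 0 → f (suc n) * g 0 ≡ f′ (suc n) * g 0
  both z = trans (cong (f (suc n) *_) z) (trans (ℕₚ.*-zeroʳ (f (suc n))) (sym (trans (cong (f′ (suc n) *_) z) (ℕₚ.*-zeroʳ (f′ (suc n))))))

∗-linear : ∀ {a b c d e : ℕ → ℕ} v g n → (∀ k → a k + v * b k ≡ c k + (d k + e k)) → (a ∗ g) n + v * (b ∗ g) n ≡ (c ∗ g) n + ((d ∗ g) n + (e ∗ g) n)
∗-linear {a} {b} {c} {d} {e} v g n h = begin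
  (a ∗ g) n + v * (b ∗ g) n  ≡⟨ cong ((a ∗ g) n +_) (sym (ℕS.⊛-scale v b g n)) ⟩
  (a ∗ g) n + ((λ k → v * b k) ∗ g) n  ≡⟨ sym (ℕS.⊛-distribʳ g a (λ k → v * b k) n) ⟩
  ((λ k → a k + v * b k) ∗ g) n  ≡⟨ ℕS.⊛-cong {g = g} h (λ _ → refl) n ⟩
  ((λ k → c k + (d k + e k)) ∗ g) n  ≡⟨ trans (ℕS.⊛-distribʳ g c (λ k → d k + e k) n) (cong ((c ∗ g) n +_) (ℕS.⊛-distribʳ g d e n)) ⟩
  (c ∗ g) n + ((d ∗ g) n + (e ∗ g) n) ∎
  where open ≡-Reasoning

module _ where
  open One

  counts : Marked → ℕ → ℕ
  counts e n = S n e

  -- With n positive, an empty stack means that a last open gap has been dropped, hence a finished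
  -- component, of weight 0.
  S-nil : ∀ n → S (suc n) [] ≡ 0
  S-nil n = ΣL-0 (ucodes (suc n)) (λ { (E , d) → go d })
    where
    no-stack : ∀ i {g E} → [] ≢ stack i g E
    no-stack zero ()
    no-stack (suc i) ()
    dropped : ∀ {g} (d : UW (suc n) (g ∷ [])) → g ≡ nothing → 0 ^ (closes g + κU d) * 1 ≡ 0
    dropped d refl = refl
    go : ∀ {E} (d : UW (suc n) E) → 0 ^ κU d * cmp E [] ≡ 0
    go {nothing ∷ E} d = ℕₚ.*-zeroʳ (0 ^ κU d)
    go {just _ ∷ E} d = ℕₚ.*-zeroʳ (0 ^ κU d)
    go {[]} (drop {g = g} d) = dropped d (ends-uw d)
    go {[]} (done {i = i} α e) = ⊥-elim (no-stack i e)

  counts-nil : ∀ n → counts [] n ≡ ℕS.1ₛ n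
  counts-nil zero = refl
  counts-nil (suc n) = S-nil n

  counts-0 : ∀ e → 1 ≤ length e → counts e 0 ≡ 0
  counts-0 (_ ∷ _) _ = refl

  counts-long : ∀ n e → 1 ≤ length e → M n ≤ length e → counts e n ≡ 0
  counts-long n (x ∷ e) _ h = S-long n x e h

  M-+ : ∀ j k → M (j + k) ≡ M j + M k
  M-+ zero k = refl
  M-+ (suc j) k = cong (3 +_) (M-+ j k)

  -- Both sides obey the recursion `S-step`. Its marked term is treated by the claim itself: the
  -- mark splits off one letter, the rest splits at the hat, and associativity of the product
  -- regroups the three factors.
  splitting-step : ∀ n L a f e → 1 ≤ length e → M (suc n) ≤ suc L + (length (a ∷ f) + length e) →
    (∀ f e → 1 ≤ length e → M (suc n) ≤ L + (length f + length e) → counts (hat f ++ e) (suc n) ≡ (counts f ∗ counts e) (suc n)) →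
    (∀ k → k ≤ n → ∀ f e → 1 ≤ length e → counts (hat f ++ e) k ≡ (counts f ∗ counts e) k) →
    counts (hat (a ∷ f) ++ e) (suc n) ≡ (counts (a ∷ f) ∗ counts e) (suc n)
  splitting-step n L a f e 1≤ h inner outer = ℕₚ.+-cancelʳ-≡ (2 * counts ((true , true) ∷ ê) (suc n)) _ _ (begin
    counts ê (suc n) + 2 * counts ((true , true) ∷ ê) (suc n)  ≡⟨ S-step n ê true ⟩
    opt (S n) (reduct ê) + (counts (plain true ∷ ê) (suc n) + counts (plain false ∷ ê) (suc n))  ≡⟨ cong₂ _+_ peeled (cong₂ _+_ (longer true) (longer false)) ⟩
    ((λ k → opt (S k) (reduct f⁺)) ∗ ce) n + ((shift (counts (plain true ∷ f⁺)) ∗ ce) n + (shift (counts (plain false ∷ f⁺)) ∗ ce) n)  ≡⟨ sym (∗-linear 2 ce n (λ k → S-step k f⁺ true)) ⟩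
    (shift (counts f⁺) ∗ ce) n + 2 * (shift (counts ((true , true) ∷ f⁺)) ∗ ce) n  ≡⟨ cong (λ z → (shift (counts f⁺) ∗ ce) n + 2 * z) (sym marked) ⟩
    (shift (counts f⁺) ∗ ce) n + 2 * counts ((true , true) ∷ ê) (suc n) ∎)
    where
    open ≡-Reasoning
    f⁺ ê : Marked
    f⁺ = a ∷ f
    ê = hat f⁺ ++ e
    ce : ℕ → ℕ
    ce = counts e
    1≤ê : 1 ≤ length ê
    1≤ê = subst (1 ≤_) (sym (Listₚ.length-++ (hat f⁺))) (ℕₚ.≤-trans 1≤ (ℕₚ.m≤n+m _ _))
    h′ : M (suc n) ≤ L + suc (suc (length f) + length e)
    h′ = subst (M (suc n) ≤_) (sym (ℕₚ.+-suc L _)) h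
    longer : ∀ x → counts (plain x ∷ ê) (suc n) ≡ (shift (counts (plain x ∷ f⁺)) ∗ ce) n
    longer x = inner (plain x ∷ f⁺) e 1≤ h′
    peeled : opt (S n) (reduct ê) ≡ ((λ k → opt (S k) (reduct f⁺)) ∗ ce) n
    peeled = trans (cong (opt (S n)) (peel-hat a f e)) (go (reduct f⁺))
      where
      go : ∀ c → opt (S n) (hatted e c) ≡ ((λ k → opt (S k) c) ∗ ce) n
      go nothing = sym (ℕS.⊛-zeroˡ ce n)
      go (just f′) = outer n ℕₚ.≤-refl f′ e 1≤
    one : Marked
    one = plain true ∷ []
    marked : counts ((true , true) ∷ ê) (suc n) ≡ (shift (counts ((true , true) ∷ f⁺)) ∗ ce) n
    marked = begin
      counts ((true , true) ∷ ê) (suc n)  ≡⟨ inner one ê 1≤ê (subst (λ z → M (suc n) ≤ L + suc z) (sym (trans (Listₚ.length-++ (hat f⁺)) (cong (_+ length e) (hat-length f⁺)))) h′) ⟩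
      (shift (counts one) ∗ counts ê) n  ≡⟨ ℕS.⊛-agree {f = shift (counts one)} (suc n) (λ _ _ → refl) (λ k lt → outer k (ℕₚ.≤-pred lt) f⁺ e 1≤) n ℕₚ.≤-refl ⟩
      (shift (counts one) ∗ (counts f⁺ ∗ ce)) n  ≡⟨ sym (ℕS.⊛-assoc (shift (counts one)) (counts f⁺) ce n) ⟩
      ((shift (counts one) ∗ counts f⁺) ∗ ce) n  ≡⟨ ∗-cong-below ce n (counts-0 e 1≤) (λ k lt → sym (outer (suc k) lt one f⁺ (s≤s z≤n))) ⟩
      (shift (counts ((true , true) ∷ f⁺)) ∗ ce) n ∎

  -- Splitting the web at the open gap marked by the hat.
  splitting : ∀ N n → n ≤ N → ∀ L f e → 1 ≤ length e → M n ≤ L + (length f + length e) → counts (hat f ++ e) n ≡ (counts f ∗ counts e) n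
  splitting N n le L [] e 1≤ h = sym (trans (ℕS.⊛-cong {f = counts []} {g = counts e} counts-nil (λ _ → refl) n) (ℕS.⊛-identityˡ (counts e) n))
  splitting N zero le L (a ∷ f) e 1≤ h = counts-0 (hat (a ∷ f) ++ e) (subst (1 ≤_) (sym (Listₚ.length-++ (hat (a ∷ f)))) (ℕₚ.≤-trans 1≤ (ℕₚ.m≤n+m _ _)))
  -- With at least `M (suc n)` letters in all, one of the two words is too long for its share of
  -- tripods in every product.
  splitting N (suc n) le zero (a ∷ f) e 1≤ h = trans
    (counts-long (suc n) (hat (a ∷ f) ++ e) (subst (1 ≤_) (sym len) (s≤s z≤n)) (subst (M (suc n) ≤_) (sym len) h))
    (sym (∗-vanish (counts (a ∷ f)) (counts e) (suc n) parts))
    where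
    len : length (hat (a ∷ f) ++ e) ≡ length (a ∷ f) + length e
    len = trans (Listₚ.length-++ (hat (a ∷ f))) (cong (_+ length e) (hat-length (a ∷ f)))
    parts : ∀ j k → j + k ≡ suc n → counts (a ∷ f) j * counts e k ≡ 0
    parts j k q with ℕₚ.≤-total (M j) (length (a ∷ f))
    ... | inj₁ l = cong (_* counts e k) (S-long j a f l)
    ... | inj₂ l = trans (cong (counts (a ∷ f) j *_) (counts-long k e 1≤ (ℕₚ.+-cancelˡ-≤ (M j) _ _
        (ℕₚ.≤-trans (ℕₚ.≤-reflexive (trans (sym (M-+ j k)) (cong M q))) (ℕₚ.≤-trans h (ℕₚ.+-monoˡ-≤ (length e) l)))))) (ℕₚ.*-zeroʳ (counts (a ∷ f) j))
  splitting (suc N) (suc n) (s≤s le) (suc L) (a ∷ f) e 1≤ h = splitting-step n L a f e 1≤ h (splitting (suc N) (suc n) (s≤s le) L)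
    (λ k l f e q → splitting N k (ℕₚ.≤-trans l le) (M k) f e q (ℕₚ.m≤m+n (M k) _))

  -- One strand remains, followed by an open gap, and no component is finished; dropping that strand
  -- completes a connected web.
  connected : ℕ → ℕ
  connected n = S n (plain true ∷ [])

  mark-last : ∀ n → S n ((true , true) ∷ []) ≡ connected n
  mark-last n = ΣL-cong (ucodes n) (λ { (E , d) → cong (0 ^ κU d *_) (go E) })
    where
    go : ∀ E → cmp E ((true , true) ∷ []) ≡ cmp E (plain true ∷ [])
    go [] = refl
    go (nothing ∷ E) = refl
    go (just _ ∷ E) = refl

  marked-first : ∀ n e → S (suc n) ((true , true) ∷ e) ≡ (shift connected ∗ counts e) n
  marked-first n [] = trans (mark-last (suc n)) (sym (trans (ℕS.⊛-cong {f = shift connected} {g = counts []} (λ _ → refl) counts-nil n)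
    (trans (ℕS.⊛-comm (shift connected) ℕS.1ₛ n) (ℕS.⊛-identityˡ (shift connected) n))))
  marked-first n (x ∷ e) = splitting (suc n) (suc n) ℕₚ.≤-refl (M (suc n)) (plain true ∷ []) (x ∷ e) (s≤s z≤n) (ℕₚ.m≤m+n (M (suc n)) _)

one-family : Family 2 connected (λ e n → One.S n (plains e))
one-family = record
  { q-one = refl
  ; q-long = λ n x e h → One.S-long n (plain x) (plains e) (subst (M n ≤_) (cong suc (sym (Listₚ.length-map plain e))) h)
  ; q-suc = λ n e → trans (cong (λ z → One.S (suc n) (plains e) + 2 * z) (sym (marked-first n (plains e)))) (trans (One.S-step n (plains e) true)
      (cong (_+ (One.S (suc n) (plains (true ∷ e)) + One.S (suc n) (plains (false ∷ e)))) (One.peel-S n e))) }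

-- The kernel equation of the counts

third : ℕ → Maybe ℕ
third 0 = just 0
third 1 = nothing
third 2 = nothing
third (suc (suc (suc m))) = Maybe.map suc (third m)

third-M : ∀ e {n} → third e ≡ just n → e ≡ M n
third-M 0 refl = refl
third-M (suc (suc (suc e))) {n} p = go (third e) refl p
  where
  go : ∀ c → third e ≡ c → Maybe.map suc c ≡ just n → 3 + e ≡ M n
  go (just n) q refl = cong (3 +_) (third-M e q)

-- The series f (t³).
th : (ℕ → ℕ) → ℕ → ℕ
th f L = opt f (third L)

th-3 : ∀ f L → th f (3 + L) ≡ th (shift f) L
th-3 f L = opt-map f suc (third L)

th-∗ : ∀ g f L → (th g ∗ th f) L ≡ th (g ∗ f) L
th-∗ g f 0 = refl
th-∗ g f 1 = trans (ℕₚ.+-identityʳ (g 0 * 0)) (ℕₚ.*-zeroʳ (g 0))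
th-∗ g f 2 = trans (ℕₚ.+-identityʳ (g 0 * 0)) (ℕₚ.*-zeroʳ (g 0))
th-∗ g f (suc (suc (suc L))) = trans (cong (g 0 * th f (3 + L) +_) (trans (ℕS.⊛-cong {g = th f} (th-3 g) (λ _ → refl) L) (th-∗ (shift g) f L))) (go (third L))
  where
  go : ∀ c → g 0 * opt f (Maybe.map suc c) + opt (shift g ∗ f) c ≡ opt (g ∗ f) (Maybe.map suc c)
  go nothing = trans (ℕₚ.+-identityʳ _) (ℕₚ.*-zeroʳ (g 0))
  go (just n) = refl

th-shift : ∀ g f d L → (∀ e → e < d → th f e ≡ 0) → (th g ∗ (λ l → th f (d + l))) L ≡ th (g ∗ f) (d + L)
th-shift g f zero L h = th-∗ g f L
th-shift g f (suc d) L h = begin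
  (th g ∗ (λ l → th f (suc d + l))) L  ≡⟨ ℕS.⊛-cong {f = th g} (λ _ → refl) (λ l → cong (th f) (sym (ℕₚ.+-suc d l))) L ⟩
  (th g ∗ (λ l → th f (d + suc l))) L  ≡⟨ cong (_+ (th g ∗ (λ l → th f (d + suc l))) L) (sym (trans (cong (th g (suc L) *_) z) (ℕₚ.*-zeroʳ (th g (suc L))))) ⟩
  th g (suc L) * th f (d + 0) + (th g ∗ (λ l → th f (d + suc l))) L  ≡⟨ sym (ℕS.⊛-right (th g) (λ l → th f (d + l)) L) ⟩
  (th g ∗ (λ l → th f (d + l))) (suc L)  ≡⟨ th-shift g f d (suc L) (λ e lt → h e (ℕₚ.<-trans lt ℕₚ.≤-refl)) ⟩
  th (g ∗ f) (d + suc L)  ≡⟨ cong (th (g ∗ f)) (ℕₚ.+-suc d L) ⟩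
  th (g ∗ f) (suc d + L) ∎
  where
  open ≡-Reasoning
  z : th f (d + 0) ≡ 0
  z = h (d + 0) (s≤s (ℕₚ.≤-reflexive (ℕₚ.+-identityʳ d)))

ℕB : Semi
ℕB = ℕₚ.+-*-commutativeSemiring

ℕ-cancels : Cancels ℕB
ℕ-cancels x y z = ℕₚ.+-cancelʳ-≡ z x y

module ℕT = Tower ℕB

unit : (ℕ → ℕ) → ℕ → ℕ
unit γ zero = 0
unit γ (suc n) = γ (suc n)

-- The coefficient k of the kernel: 1 for the count of all webs, and 1 + 2 γ, with γ stripped of its
-- constant term, when finished components weigh 0.
weight : ℕ → (ℕ → ℕ) → ℕ → ℕ
weight v γ zero = 1
weight v γ (suc n) = v * γ (suc n)

-- `a i j n` becomes the coefficient of t^L x^i y^j with L = 3 n - i - j. Then L is the number of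
-- steps of a Kreweras walk ending at (i, j): a peeled pair is the step (1, 1), a letter removed in
-- front is a step (-1, 0) or (0, -1), and each of them raises L by one.
module TableKernel {v γ a} (A : Table v γ a) where
  open Table A
  open ℕT using (Carrier; t; x; y; at-x0; at-y0; R₁; R₂; R₃; module R₂; module S₁; module S₂; module S₃)
  module R = CommutativeSemiring R₃

  ω : ℕ → ℕ
  ω = weight v (th (unit γ))

  k q : Carrier
  k L = S₂.const (S₁.const (ω L))
  q L i j = th (a i j) (i + j + L)

  k-x : ℕT.XFree k
  k-x n i j = refl

  k-y : ℕT.YFree k
  k-y n zero j = refl
  k-y n (suc i) j = refl

  private
    k-coef : ∀ (ω : ℕ → ℕ) (f : Carrier) L i j → S₃._⊛_ (λ L → S₂.const (S₁.const (ω L))) f L i j ≡ (ω ∗ (λ l → f l i j)) L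
    one : ∀ c (g : ℕ → ℕ → ℕ) i j → S₂._⊛_ (S₂.const (S₁.const c)) g i j ≡ c * g i j
    one c g i j = trans (S₂.const-⊛ (S₁.const c) g i j) (S₁.const-⊛ c (g i) j)
    k-coef ω f zero i j = one (ω 0) (f 0) i j
    k-coef ω f (suc L) i j = cong₂ _+_ (one (ω 0) (f (suc L)) i j) (k-coef (shift ω) f L i j)

    thin : ∀ i j e → e < i + j → th (a i j) e ≡ 0
    thin i j e lt = go (third e) refl
      where
      go : ∀ c → third e ≡ c → opt (a i j) c ≡ 0
      go nothing p = refl
      go (just n) p = a-long n i j (ℕₚ.≤-trans (s≤s z≤n) lt) (ℕₚ.≤-trans (ℕₚ.≤-reflexive (sym (third-M e p))) (ℕₚ.<⇒≤ lt))

    kq : ∀ L i j → R._*_ k q (suc L) i j ≡ th (a i j) (suc (i + j + L)) + v * th (unit γ ∗ a i j) (suc (i + j + L))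
    kq L i j = begin
      R._*_ k q (suc L) i j  ≡⟨ k-coef ω q (suc L) i j ⟩
      1 * qij (suc L) + ((λ m → v * th (unit γ) (suc m)) ∗ qij) L  ≡⟨ cong₂ _+_ (ℕₚ.*-identityˡ (qij (suc L))) (ℕS.⊛-scale v (shift (th (unit γ))) qij L) ⟩
      qij (suc L) + v * (th (unit γ) ∗ qij) (suc L)  ≡⟨ cong (λ z → qij (suc L) + v * z) (th-shift (unit γ) (a i j) (i + j) (suc L) (thin i j)) ⟩
      th (a i j) (i + j + suc L) + v * th (unit γ ∗ a i j) (i + j + suc L)  ≡⟨ cong (λ s → th (a i j) s + v * th (unit γ ∗ a i j) s) (ℕₚ.+-suc (i + j) L) ⟩
      th (a i j) (suc (i + j + L)) + v * th (unit γ ∗ a i j) (suc (i + j + L)) ∎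
      where
      open ≡-Reasoning
      qij : ℕ → ℕ
      qij l = q l i j

    diag : ℕ → ℕ → ℕ → ℕ
    diag L zero j = 0
    diag L (suc i) zero = 0
    diag L (suc i) (suc j) = q L i j

    diag-none : ∀ L i j → third (suc (i + j + L)) ≡ nothing → diag L i j ≡ 0
    diag-none L zero j p = refl
    diag-none L (suc i) zero p = refl
    diag-none L (suc i) (suc j) p = go (third (i + j + L)) (trans (cong (λ z → third (2 + z)) (sym (cong (_+ L) (ℕₚ.+-suc i j)))) p)
      where
      go : ∀ c → Maybe.map suc c ≡ nothing → opt (a i j) c ≡ 0
      go nothing _ = refl

    diag-some : ∀ L i j n → third (suc (i + j + L)) ≡ just (suc n) → a i j (suc n) + v * (shift γ ∗ a i j) n ≡ diag L i j + (a (suc i) j (suc n) + a i (suc j) (suc n))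
    diag-some L zero j n p = a-sucʳ n j
    diag-some L (suc i) zero n p = a-sucˡ n (suc i)
    diag-some L (suc i) (suc j) n p = trans (a-suc n i j) (cong (_+ (a (2 + i) (suc j) (suc n) + a (suc i) (2 + j) (suc n)))
        (go (third (i + j + L)) (trans (cong (λ z → third (2 + z)) (sym (cong (_+ L) (ℕₚ.+-suc i j)))) p)))
      where
      go : ∀ c → Maybe.map suc c ≡ just (suc n) → a i j n ≡ opt (a i j) c
      go (just n) refl = refl

    kq-suc : ∀ L i j → R._*_ k q (suc L) i j ≡ diag L i j + (q L (suc i) j + q L i (suc j))
    kq-suc L i j = trans (kq L i j) (trans (go (third (suc (i + j + L))) refl) (cong (λ z → diag L i j + (q L (suc i) j + th (a i (suc j)) z)) (cong (_+ L) (sym (ℕₚ.+-suc i j)))))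
      where
      go : ∀ c → third (suc (i + j + L)) ≡ c → opt (a i j) c + v * opt (unit γ ∗ a i j) c ≡ diag L i j + (opt (a (suc i) j) (third (suc (i + j + L))) + opt (a i (suc j)) (third (suc (i + j + L))))
      go c p = trans (go′ c p) (cong (λ c → diag L i j + (opt (a (suc i) j) c + opt (a i (suc j)) c)) (sym p))
        where
        go′ : ∀ c → third (suc (i + j + L)) ≡ c → opt (a i j) c + v * opt (unit γ ∗ a i j) c ≡ diag L i j + (opt (a (suc i) j) c + opt (a i (suc j)) c)
        go′ nothing p = trans (ℕₚ.*-zeroʳ v) (sym (trans (ℕₚ.+-identityʳ _) (diag-none L i j p)))
        go′ (just zero) p with third-M (suc (i + j + L)) p
        ... | ()
        go′ (just (suc n)) p = diag-some L i j n p

    kq-zero : ∀ i j → R._*_ k q 0 i j ≡ R.1# 0 i j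
    kq-zero i j = trans (k-coef ω q 0 i j) (trans (ℕₚ.*-identityˡ _) (go i j))
      where
      go : ∀ i j → q 0 i j ≡ R.1# 0 i j
      go zero zero = a-one
      go zero (suc j) = thick (suc j) (cong suc (ℕₚ.+-identityʳ j)) (s≤s z≤n)
        where
        thick : ∀ j {s} → s ≡ j → 1 ≤ j → th (a 0 j) s ≡ 0
        thick j {s} e h = go′ (third s) refl
          where
          go′ : ∀ c → third s ≡ c → opt (a 0 j) c ≡ 0
          go′ nothing _ = refl
          go′ (just n) p = a-long n 0 j h (ℕₚ.≤-reflexive (trans (sym (third-M s p)) e))
      go (suc i) j = go′ (third (suc i + j + 0)) refl
        where
        go′ : ∀ c → third (suc i + j + 0) ≡ c → opt (a (suc i) j) c ≡ 0
        go′ nothing _ = refl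
        go′ (just n) p = a-long n (suc i) j (s≤s z≤n) (ℕₚ.≤-reflexive (trans (sym (third-M (suc i + j + 0) p)) (ℕₚ.+-identityʳ _)))

    open R using () renaming (_*_ to _·_; _+_ to _⊞_; _≈_ to _≈₃_)

    xy-cong : ∀ n f g → (∀ i j → f n i j ≡ g n i j) → ∀ i j → (x · (y · f)) n i j ≡ (x · (y · g)) n i j
    xy-cong n f g h zero j = trans (ℕT.x-0 (y · f) n j) (sym (ℕT.x-0 (y · g) n j))
    xy-cong n f g h (suc i) zero = trans (ℕT.x-suc (y · f) n i 0) (trans (trans (ℕT.y-0 f n i) (sym (ℕT.y-0 g n i))) (sym (ℕT.x-suc (y · g) n i 0)))
    xy-cong n f g h (suc i) (suc j) = trans (ℕT.x-suc (y · f) n i (suc j)) (trans (trans (ℕT.y-suc f n i j) (trans (h i j) (sym (ℕT.y-suc g n i j)))) (sym (ℕT.x-suc (y · g) n i (suc j))))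

    xy-zero : ∀ n f → (∀ i j → f n i j ≡ 0) → ∀ i j → (x · (y · f)) n i j ≡ 0
    xy-zero n f h i j = trans (xy-cong n f R.0# h i j) (R.trans (R.*-congˡ (R.zeroʳ y)) (R.zeroʳ x) n i j)

    xy-diag : ∀ L i j → (x · (y · q)) L i j ≡ diag L i j
    xy-diag L zero j = ℕT.x-0 (y · q) L j
    xy-diag L (suc i) zero = trans (ℕT.x-suc (y · q) L i 0) (ℕT.y-0 q L i)
    xy-diag L (suc i) (suc j) = trans (ℕT.x-suc (y · q) L i (suc j)) (ℕT.y-suc q L i j)

    -- Multiplying by x y makes room for the steps (-1, 0) and (0, -1). They must not leave the
    -- quadrant, which is corrected by the values of q on the two axes.
    sides : ∀ L i j → (x · (y · (k · q))) (suc L) i j + (y · at-x0 q ⊞ x · at-y0 q) L i j ≡ (x · q ⊞ (y · q ⊞ x · (y · (x · (y · q))))) L i j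
    sides L zero j = cong₂ _+_ (ℕT.x-0 (y · (k · q)) (suc L) j) (trans (cong₂ _+_ (trans (ℕT.y-at (at-x0 q) L 0 j) (sym (ℕT.y-at q L 0 j))) (ℕT.x-0 (at-y0 q) L j))
      (sym (cong₂ _+_ (ℕT.x-0 q L j) (cong ((y · q) L 0 j +_) (ℕT.x-0 (y · (x · (y · q))) L j))))) 
    sides L (suc i) zero = trans (cong₂ _+_ (trans (ℕT.x-suc (y · (k · q)) (suc L) i 0) (ℕT.y-0 (k · q) (suc L) i)) (cong₂ _+_ (ℕT.y-0 (at-x0 q) L (suc i)) (ℕT.x-suc (at-y0 q) L i 0)))
      (sym (trans (cong₂ _+_ (ℕT.x-suc q L i 0) (cong₂ _+_ (ℕT.y-0 q L (suc i)) (trans (ℕT.x-suc (y · (x · (y · q))) L i 0) (ℕT.y-0 (x · (y · q)) L i)))) (ℕₚ.+-identityʳ _)))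
    sides L (suc i) (suc j) = trans (cong₂ _+_ (trans (ℕT.x-suc (y · (k · q)) (suc L) i (suc j)) (trans (ℕT.y-suc (k · q) (suc L) i j) (kq-suc L i j)))
        (cong₂ _+_ (ℕT.y-suc (at-x0 q) L (suc i) j) (ℕT.x-suc (at-y0 q) L i (suc j))))
      (trans (lem (diag L i j) (q L (suc i) j) (q L i (suc j)))
      (sym (cong₂ _+_ (ℕT.x-suc q L i (suc j)) (cong₂ _+_ (ℕT.y-suc q L (suc i) j) (trans (ℕT.x-suc (y · (x · (y · q))) L i (suc j)) (trans (ℕT.y-suc (x · (y · q)) L i j) (xy-diag L i j)))))))
      where
      lem : ∀ d e f → d + (e + f) + 0 ≡ f + (e + d)
      lem = solve-∀

    points : x · (y · (k · q)) ⊞ t · (y · at-x0 q ⊞ x · at-y0 q) ≈₃ x · (y · R.1#) ⊞ t · (x · q ⊞ (y · q ⊞ x · (y · (x · (y · q)))))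
    points zero i j = cong₂ _+_ (xy-cong 0 (k · q) R.1# kq-zero i j) (trans (ℕT.t-0 (y · at-x0 q ⊞ x · at-y0 q) i j) (sym (ℕT.t-0 (x · q ⊞ (y · q ⊞ x · (y · (x · (y · q))))) i j)))
    points (suc L) i j = trans (cong ((x · (y · (k · q))) (suc L) i j +_) (ℕT.t-suc (y · at-x0 q ⊞ x · at-y0 q) L i j)) (trans (sides L i j)
      (sym (cong₂ _+_ (xy-zero (suc L) R.1# (λ _ _ → refl) i j) (ℕT.t-suc (x · q ⊞ (y · q ⊞ x · (y · (x · (y · q))))) L i j))))

  private module W = Kernel ℕB ℕ-cancels

  table-invariant : let c = ℕT.at-xy0 q ; a = at-y0 q in k · (x · a) ⊞ (t · c ⊞ t · c) ≈₃ x ⊞ (t · a ⊞ t · a) ⊞ t · t · (x · x · (a · a))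
  table-invariant = W.invariant k q (λ { zero zero → refl ; zero (suc j) → refl ; (suc i) j → refl }) k-x k-y
    (kernel-form R₃ t x y k q (at-y0 q) (at-x0 q) points)

-- Solving the quadratic equation over the integers

ℤB : Semi
ℤB = ℤₚ.+-*-commutativeSemiring

ℤ-cancels : Cancels ℤB
ℤ-cancels i j l = ∙-cancelʳ (CommutativeRing.+-group ℤₚ.+-*-commutativeRing) l i j

module ℤT = Tower ℤB

_∘ₕ_ : ∀ {R R′ R″} → Hom R′ R″ → Hom R R′ → Hom R R″
_∘ₕ_ {R″ = R″} h k = record { ⟦_⟧ = λ x → ⟦ h ⟧ (⟦ k ⟧ x) ; hcong = λ e → hcong h (hcong k e) ; h+ = λ x y → trans′ (hcong h (h+ k x y)) (h+ h _ _)
  ; h* = λ x y → trans′ (hcong h (h* k x y)) (h* h _ _) ; h0 = trans′ (hcong h (h0 k)) (h0 h) ; h1 = trans′ (hcong h (h1 k)) (h1 h) }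
  where open CommutativeSemiring R″ using () renaming (trans to trans′)

pos-hom : Hom ℕB ℤB
pos-hom = record { ⟦_⟧ = λ n → ℤ.+ n ; hcong = cong (λ n → ℤ.+ n) ; h+ = ℤₚ.pos-+ ; h* = ℤₚ.pos-* ; h0 = refl ; h1 = refl }

ℕ[t] : Semi
ℕ[t] = ℕS.psSemiring

th-hom : Hom ℕ[t] ℕ[t]
th-hom = record { ⟦_⟧ = th ; hcong = λ e L → opt-cong e (third L) ; h+ = λ f g L → add f g (third L) ; h* = λ f g L → sym (th-∗ f g L)
  ; h0 = λ L → zer (third L) ; h1 = one }
  where
  add : ∀ f g c → opt (λ n → f n + g n) c ≡ opt f c + opt g c
  add f g nothing = refl
  add f g (just n) = refl
  zer : ∀ c → opt (λ _ → 0) c ≡ 0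
  zer nothing = refl
  zer (just n) = refl
  one : ∀ L → th ℕS.1ₛ L ≡ ℕS.1ₛ L
  one 0 = refl
  one 1 = refl
  one 2 = refl
  one (suc (suc (suc L))) = trans (th-3 ℕS.1ₛ L) (zer (third L))

th-X : ∀ L → th ℕS.X L ≡ (ℕS.X ∗ (ℕS.X ∗ ℕS.X)) L
th-X 0 = refl
th-X 1 = refl
th-X 2 = refl
th-X (suc (suc (suc L))) = trans (trans (th-3 ℕS.X L) (h1 th-hom L)) (sym (trans (ℕS.X-⊛ (ℕS.X ∗ ℕS.X) (2 + L)) (ℕS.X-⊛ ℕS.X (suc L))))

third-of-M : ∀ n → third (M n) ≡ just n
third-of-M zero = refl
third-of-M (suc n) = cong (Maybe.map suc) (third-of-M n)

embed : Hom ℕ[t] ℕT.R₃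
embed = map-hom (const-hom ℕT.R₁ ∘ₕ const-hom ℕB)

cast : Hom ℕT.R₃ ℤT.R₃
cast = map-hom (map-hom (map-hom pos-hom))

-- f (z) ↦ f (t³)
Θ : Hom ℕ[t] ℤT.R₃
Θ = cast ∘ₕ (embed ∘ₕ th-hom)

Θ-injective : ∀ {f g} → ⟦ Θ ⟧ f ℤT.≈ ⟦ Θ ⟧ g → ∀ n → f n ≡ g n
Θ-injective {f} {g} e n = trans (sym (cong (opt f) (third-of-M n))) (trans (ℤₚ.+-injective (e (M n) 0 0)) (cong (opt g) (third-of-M n)))

module _ where
  open ℤT using (Carrier; t; x; XFree; at-x0; R₃; module R₁; module R₂; module S₂; module S₃; module XF)
  open ℤT using () renaming (_*_ to _·_; _+_ to _⊞_; _≈_ to _≈₃_; 1# to 𝟙; 0# to 𝟘)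
  private
    module Z = CommutativeSemiring R₃
    module U = Uniqueness ℤB ℤ-cancels

  cast-t : ⟦ cast ⟧ ℕT.t ≈₃ t
  cast-t zero i j = refl
  cast-t (suc zero) zero zero = refl
  cast-t (suc zero) zero (suc j) = refl
  cast-t (suc zero) (suc i) j = refl
  cast-t (suc (suc L)) i j = refl

  cast-x : ⟦ cast ⟧ ℕT.x ≈₃ x
  cast-x zero zero j = refl
  cast-x zero (suc zero) zero = refl
  cast-x zero (suc zero) (suc j) = refl
  cast-x zero (suc (suc i)) j = refl
  cast-x (suc L) i j = refl

  embed-X : ⟦ embed ⟧ ℕS.X ℕT.≈ ℕT.t
  embed-X zero zero zero = refl
  embed-X zero zero (suc j) = refl
  embed-X zero (suc i) j = refl
  embed-X (suc zero) zero zero = refl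
  embed-X (suc zero) zero (suc j) = refl
  embed-X (suc zero) (suc i) j = refl
  embed-X (suc (suc L)) zero zero = refl
  embed-X (suc (suc L)) zero (suc j) = refl
  embed-X (suc (suc L)) (suc i) j = refl

  Θ-X : ∀ f → ⟦ Θ ⟧ (ℕS.X ∗ f) ≈₃ t · (t · (t · ⟦ Θ ⟧ f))
  Θ-X f = Z.trans (h* Θ ℕS.X f) (Z.trans (Z.*-congʳ Θ-t) (Z.trans (Z.*-assoc t (t · t) (⟦ Θ ⟧ f)) (Z.*-congˡ (Z.*-assoc t t (⟦ Θ ⟧ f)))))
    where
    ct : ⟦ cast ∘ₕ embed ⟧ ℕS.X ≈₃ t
    ct = Z.trans (hcong cast embed-X) cast-t
    Θ-t : ⟦ Θ ⟧ ℕS.X ≈₃ t · (t · t)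
    Θ-t = Z.trans (hcong (cast ∘ₕ embed) {th ℕS.X} {ℕS.X ∗ (ℕS.X ∗ ℕS.X)} th-X) (Z.trans (h* (cast ∘ₕ embed) ℕS.X (ℕS.X ∗ ℕS.X)) (Z.*-cong ct (Z.trans (h* (cast ∘ₕ embed) ℕS.X ℕS.X) (Z.*-cong ct ct))))

  Θ-xfree : ∀ f → XFree (⟦ Θ ⟧ f)
  Θ-xfree f n i j = refl

  minus : Carrier
  minus = S₃.const (S₂.const (λ { zero → ℤ.-[1+ 0 ] ; (suc j) → ℤ.+ 0 }))

  minus-xfree : XFree minus
  minus-xfree zero i j = refl
  minus-xfree (suc L) i j = refl

  minus-one : minus ⊞ 𝟙 ≈₃ 𝟘
  minus-one zero zero zero = refl
  minus-one zero zero (suc j) = refl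
  minus-one zero (suc i) j = refl
  minus-one (suc L) i j = refl

  minus-cancel : ∀ z → z ⊞ minus · z ≈₃ 𝟘
  minus-cancel z = Z.trans (Z.+-comm z (minus · z)) (Z.trans (Z.+-congˡ {minus · z} (Z.sym (Z.*-identityˡ z))) (Z.trans (Z.sym (Z.distribʳ z minus 𝟙)) (Z.trans (Z.*-congʳ minus-one) (Z.zeroˡ z))))

  -- p (1 − v) + p v = p
  restore : ∀ p v → p · (𝟙 ⊞ minus · v) ⊞ p · v ≈₃ p
  restore p v = Z.trans (Z.sym (Z.distribˡ p (𝟙 ⊞ minus · v) v)) (Z.trans (Z.*-congˡ (Z.trans (Z.+-assoc 𝟙 (minus · v) v) (Z.trans (Z.+-congˡ {𝟙} (Z.trans (Z.+-comm (minus · v) v) (minus-cancel v))) (Z.+-identityʳ 𝟙)))) (Z.*-identityʳ p))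

  double cube : (ℕ → ℕ) → ℕ → ℕ
  double f n = f n + f n
  cube f = f ∗ (f ∗ f)

  Θ-double : ∀ f → ⟦ Θ ⟧ (double f) ≈₃ ⟦ Θ ⟧ f ⊞ ⟦ Θ ⟧ f
  Θ-double f = h+ Θ f f

  Θ-cube : ∀ f → ⟦ Θ ⟧ (cube f) ≈₃ ⟦ Θ ⟧ f · (⟦ Θ ⟧ f · ⟦ Θ ⟧ f)
  Θ-cube f = Z.trans (h* Θ f (f ∗ f)) (Z.*-congˡ (h* Θ f f))

  Θ-v : ∀ f → ⟦ Θ ⟧ (ℕS.X ∗ double (cube f)) ≈₃ t · (t · (t · (⟦ Θ ⟧ f · (⟦ Θ ⟧ f · ⟦ Θ ⟧ f) ⊞ ⟦ Θ ⟧ f · (⟦ Θ ⟧ f · ⟦ Θ ⟧ f))))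
  Θ-v f = Z.trans (Θ-X (double (cube f))) (Z.*-congˡ (Z.*-congˡ (Z.*-congˡ (Z.trans (Θ-double (cube f)) (Z.+-cong (Θ-cube f) (Θ-cube f))))))

  module Solve {v γ a} (A : Table v γ a) where
    open TableKernel A

    k′ a′ : Carrier
    k′ = ⟦ cast ⟧ k
    a′ = ⟦ cast ⟧ (ℕT.at-y0 q)

    k-Θ : k′ ≈₃ ⟦ Θ ⟧ (weight v γ)
    k-Θ = hcong (cast ∘ₕ embed) {weight v (th (unit γ))} {th (weight v γ)} go
      where
      go : ∀ L → weight v (th (unit γ)) L ≡ th (weight v γ) L
      go zero = refl
      go (suc L) = go′ (third (suc L)) refl
        where
        go′ : ∀ c → third (suc L) ≡ c → v * opt (unit γ) c ≡ opt (weight v γ) c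
        go′ nothing p = ℕₚ.*-zeroʳ v
        go′ (just (suc n)) p = refl
        go′ (just zero) p with third-M (suc L) p
        ... | ()

    k′-0 : k′ 0 R₂.≈ R₂.1#
    k′-0 zero zero = refl
    k′-0 zero (suc j) = refl
    k′-0 (suc i) j = refl

    a′-x0 : at-x0 a′ ≈₃ ⟦ Θ ⟧ (a 0 0)
    a′-x0 L zero zero = refl
    a′-x0 L zero (suc j) = refl
    a′-x0 L (suc i) j = refl

    solved : Invariant R₃ t x k′ a′ (at-x0 a′)
    solved = Z.trans (Z.+-congˡ {k′ · (x · a′)} (Z.+-cong (Z.*-congˡ {t} (Z.sym c-cast)) (Z.*-congˡ {t} (Z.sym c-cast)))) (hom-invariant cast cast-t cast-x table-invariant)
      where
      c-cast : ⟦ cast ⟧ (ℕT.at-xy0 q) ≈₃ at-x0 a′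
      c-cast L zero zero = refl
      c-cast L zero (suc j) = refl
      c-cast L (suc i) j = refl

  -- Here k = 1, and the hypothesis is u = 1 + 2 v with v = 2 z u³, so u serves as P. The value P (1
  -- - v) at x = 0 is `a 0 0`; the equation is then freed of the subtraction.
  total-count : ∀ {γ a} → Table 0 γ a → ∀ {u} → (∀ n → u n ≡ (ℕS.1ₛ n + double (ℕS.X ∗ double (cube u)) n)) → ∀ n → a 0 0 n + (u ∗ (ℕS.X ∗ double (cube u))) n ≡ u n
  total-count {γ} {a} A {u} eu = Θ-injective (Z.trans (h+ Θ (a 0 0) (u ∗ v₀)) (Z.trans (Z.+-cong start (h* Θ u v₀)) (restore Pₛ vᵣ)))
    where
    module T = Solve A
    v₀ : ℕ → ℕ
    v₀ = ℕS.X ∗ double (cube u)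
    Pₛ vᵣ : Carrier
    Pₛ = ⟦ Θ ⟧ u
    vᵣ = ⟦ Θ ⟧ v₀
    P-eq : Pₛ ≈₃ 𝟙 ⊞ (vᵣ ⊞ vᵣ)
    P-eq = Z.trans (hcong Θ {u} {λ n → ℕS.1ₛ n + double v₀ n} eu) (Z.trans (h+ Θ ℕS.1ₛ (double v₀)) (Z.+-cong (h1 Θ) (Θ-double v₀)))
    module E = U.Explicit 𝟙 Pₛ vᵣ minus (Θ-xfree u) (Θ-xfree v₀) minus-xfree (Z.trans (Z.*-identityˡ Pₛ) P-eq) (Θ-v u) minus-one
    k-one : T.k′ ≈₃ 𝟙
    k-one = Z.trans T.k-Θ (Z.trans (hcong Θ {weight 0 γ} {ℕS.1ₛ} (λ { zero → refl ; (suc n) → refl })) (h1 Θ))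
    a-eq : T.a′ ≈₃ E.a
    a-eq = U.unique-a k-one T.k′-0 T.solved E.explicit
    start : ⟦ Θ ⟧ (a 0 0) ≈₃ Pₛ · (𝟙 ⊞ minus · vᵣ)
    start = Z.trans (Z.sym T.a′-x0) (Z.trans (λ { L zero j → a-eq L 0 j ; L (suc i) j → refl }) E.at-x0-a)

  -- Here `a 0 0` is 1 and k is unknown. P (1 - v) = 1 is the equation g = 1 + v g, so g serves as
  -- P, and k P = 1 + 2 v becomes k = (1 + 2 v) (1 - v).
  connected-count : ∀ {γ a} → Table 2 γ a → (∀ n → a 0 0 n ≡ ℕS.1ₛ n) → ∀ {g} → (∀ n → g n ≡ ℕS.1ₛ n + ((ℕS.X ∗ double (cube g)) ∗ g) n) →
    let v₀ = ℕS.X ∗ double (cube g) in ∀ n → weight 2 γ n + ((λ n → ℕS.1ₛ n + double v₀ n) ∗ v₀) n ≡ ℕS.1ₛ n + double v₀ n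
  connected-count {γ} {a} A a1 {g} eg = Θ-injective (Z.trans (h+ Θ (weight 2 γ) (u ∗ v₀)) (Z.trans (Z.+-cong weights (Z.trans (h* Θ u v₀) (Z.*-congʳ u-eq))) (Z.trans (restore (𝟙 ⊞ (vᵣ ⊞ vᵣ)) vᵣ) (Z.sym u-eq))))
    where
    module T = Solve A
    v₀ u : ℕ → ℕ
    v₀ = ℕS.X ∗ double (cube g)
    u n = ℕS.1ₛ n + double v₀ n
    Pₛ vᵣ k″ : Carrier
    Pₛ = ⟦ Θ ⟧ g
    vᵣ = ⟦ Θ ⟧ v₀
    k″ = (𝟙 ⊞ (vᵣ ⊞ vᵣ)) · (𝟙 ⊞ minus · vᵣ)
    u-eq : ⟦ Θ ⟧ u ≈₃ 𝟙 ⊞ (vᵣ ⊞ vᵣ)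
    u-eq = Z.trans (h+ Θ ℕS.1ₛ (double v₀)) (Z.+-cong (h1 Θ) (Θ-double v₀))
    P-eq : Pₛ ≈₃ 𝟙 ⊞ vᵣ · Pₛ
    P-eq = Z.trans (hcong Θ {g} {λ n → ℕS.1ₛ n + (v₀ ∗ g) n} eg) (Z.trans (h+ Θ ℕS.1ₛ (v₀ ∗ g)) (Z.+-cong (h1 Θ) (h* Θ v₀ g)))
    P-inv : Pₛ · (𝟙 ⊞ minus · vᵣ) ≈₃ 𝟙
    P-inv = series-cancels {ℤT.R₂} U.cancel₂ _ _ (Pₛ · vᵣ) (Z.trans (restore Pₛ vᵣ) (Z.trans P-eq (Z.+-congˡ {𝟙} (Z.*-comm vᵣ Pₛ))))
    kP : k″ · Pₛ ≈₃ 𝟙 ⊞ (vᵣ ⊞ vᵣ)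
    kP = Z.trans (Z.*-assoc _ _ Pₛ) (Z.trans (Z.*-congˡ (Z.trans (Z.*-comm _ Pₛ) P-inv)) (Z.*-identityʳ _))
    module E = U.Explicit k″ Pₛ vᵣ minus (Θ-xfree g) (Θ-xfree v₀) minus-xfree kP (Θ-v g) minus-one
    one-xfree : XFree 𝟙
    one-xfree zero i j = refl
    one-xfree (suc L) i j = refl
    k″-xfree : XFree k″
    k″-xfree = XF.sub* {𝟙 ⊞ (vᵣ ⊞ vᵣ)} {𝟙 ⊞ minus · vᵣ} (XF.sub+ {𝟙} {vᵣ ⊞ vᵣ} one-xfree (XF.sub+ {vᵣ} {vᵣ} (Θ-xfree v₀) (Θ-xfree v₀)))
      (XF.sub+ {𝟙} {minus · vᵣ} one-xfree (XF.sub* {minus} {vᵣ} minus-xfree (Θ-xfree v₀)))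
    vᵣ-0 : vᵣ 0 R₂.≈ R₂.0#
    vᵣ-0 zero zero = refl
    vᵣ-0 zero (suc j) = refl
    vᵣ-0 (suc i) j = refl
    k″-0 : k″ 0 R₂.≈ R₂.1#
    k″-0 = R₂.trans (R₂.*-cong (R₂.trans (R₂.+-congˡ {R₂.1#} (R₂.trans (R₂.+-cong vᵣ-0 vᵣ-0) (R₂.+-identityʳ R₂.0#))) (R₂.+-identityʳ R₂.1#))
      (R₂.trans (R₂.+-congˡ {R₂.1#} (R₂.trans (R₂.*-congˡ {minus 0} vᵣ-0) (R₂.zeroʳ (minus 0)))) (R₂.+-identityʳ R₂.1#))) (R₂.*-identityʳ R₂.1#)
    k′-xfree : XFree T.k′
    k′-xfree L i j = refl
    weights : ⟦ Θ ⟧ (weight 2 γ) ≈₃ k″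
    weights = Z.trans (Z.sym T.k-Θ) (U.unique-k {T.k′} {k″} {T.a′} {E.a} k′-xfree k″-xfree (Z.trans T.a′-x0 (Z.trans (hcong Θ {a 0 0} {ℕS.1ₛ} a1) (h1 Θ))) (Z.trans E.at-x0-a P-inv) T.k′-0 k″-0 T.solved E.explicit)

open import Data.Nat using (_!; _∸_)
open import Data.Nat.Combinatorics using (_C_; k![n∸k]!∣n!)
open import Data.Nat.Combinatorics.Specification using (nCk≡n!/k![n-k]!)
open import Data.Nat.DivMod using (m/n*n≡m)
open import Data.Nat.Properties using (_!*_!≢0)

-- Raney numbers

pow : (ℕ → ℕ) → ℕ → ℕ → ℕ
pow f zero = ℕS.1ₛ
pow f (suc r) = f ∗ pow f r

pow-+ : ∀ f p r n → (pow f p ∗ pow f r) n ≡ pow f (p + r) n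
pow-+ f zero r n = ℕS.⊛-identityˡ (pow f r) n
pow-+ f (suc p) r n = trans (ℕS.⊛-assoc f (pow f p) (pow f r) n) (ℕS.⊛-cong {f = f} (λ _ → refl) (pow-+ f p r) n)

pow-agree : ∀ {f h} p n → ℕS.Agree n f h → ℕS.Agree n (pow f p) (pow h p)
pow-agree zero n e m lt = refl
pow-agree (suc p) n e = ℕS.⊛-agree n e (pow-agree p n e)

-- `u` solves u = 1 + c z u^(p′ + 1), and the coefficients of its powers are c^n times Raney
-- numbers.
module Raney (c p′ : ℕ) where

  module Fix = ℕS.Fixpoint 1 (λ f n → c * pow f (suc p′) n) (λ n f h e m lt → cong (c *_) (pow-agree (suc p′) n e m lt))

  u : ℕ → ℕ
  u = Fix.fix

  pow-0 : ∀ r → pow u r 0 ≡ 1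
  pow-0 zero = refl
  pow-0 (suc r) = trans (ℕₚ.+-identityʳ _) (pow-0 r)

  pow-suc : ∀ r n → pow u (suc r) (suc n) ≡ pow u r (suc n) + c * pow u (suc p′ + r) n
  pow-suc r n = cong₂ _+_ (ℕₚ.*-identityˡ _) (begin
    (shift u ∗ pow u r) n  ≡⟨ ℕS.⊛-cong {g = pow u r} Fix.fix-suc (λ _ → refl) n ⟩
    ((λ n → c * pow u (suc p′) n) ∗ pow u r) n  ≡⟨ ℕS.⊛-scale c (pow u (suc p′)) (pow u r) n ⟩
    c * (pow u (suc p′) ∗ pow u r) n  ≡⟨ cong (c *_) (pow-+ u (suc p′) r n) ⟩
    c * pow u (suc p′ + r) n ∎)
    where open ≡-Reasoning

  Closed : ℕ → ℕ → Set
  Closed n r = pow u (suc r) n * (n ! * (p′ * n + suc r) !) ≡ c ^ n * (suc r * (suc p′ * n + r) !)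

  -- `pow-suc` leads to a smaller power with the same n and to a larger power with smaller n, whence
  -- the induction on n and inside it on r. Denominators are cleared throughout.
  closed-form : ∀ n r → Closed n r
  closed-step : ∀ n r → pow u r (suc n) * (suc n ! * (p′ * suc n + r) !) ≡ c ^ suc n * (r * (suc p′ * n + (p′ + r)) !) → Closed n (p′ + r) → Closed (suc n) r
  closed-form zero r = begin
    pow u (suc r) 0 * (1 * (p′ * 0 + suc r) !)  ≡⟨ cong₂ (λ a b → a * (1 * (b + suc r) !)) (pow-0 (suc r)) (ℕₚ.*-zeroʳ p′) ⟩
    1 * (1 * (suc r) !)  ≡⟨ cong (λ z → 1 * (1 * z)) refl ⟩
    1 * (1 * (suc r * r !))  ≡⟨ cong (λ z → 1 * z) (ℕₚ.*-identityˡ _) ⟩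
    1 * (suc r * r !)  ≡⟨ cong (λ z → 1 * (suc r * (z + r) !)) (sym (ℕₚ.*-zeroʳ (suc p′))) ⟩
    1 * (suc r * (suc p′ * 0 + r) !) ∎
    where open ≡-Reasoning
  closed-form (suc n) zero = closed-step n 0 (sym (ℕₚ.*-zeroʳ (c ^ suc n))) (closed-form n (p′ + 0))
  closed-form (suc n) (suc r) = closed-step n (suc r)
    (trans (closed-form (suc n) r) (cong (λ z → c ^ suc n * (suc r * z !)) (lem p′ n r))) (closed-form n (p′ + suc r))
    where
    lem : ∀ p n r → suc p * suc n + r ≡ suc p * n + (p + suc r)
    lem = solve-∀
  closed-step n r e₁ e₂ = begin
    pow u (suc r) (suc n) * (suc n ! * (p′ * suc n + suc r) !)  ≡⟨ cong₂ (λ a b → a * (suc n ! * b !)) (pow-suc r n) (ℕₚ.+-suc (p′ * suc n) r) ⟩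
    (A₁ + c * A₂) * ((suc n * n !) * (suc w′ * D))  ≡⟨ lem₁ A₁ A₂ c (suc n) (n !) (suc w′) D ⟩
    suc w′ * (A₁ * ((suc n * n !) * D)) + c * suc n * (A₂ * (n ! * (suc w′ * D)))  ≡⟨ cong₂ (λ a b → suc w′ * a + c * suc n * b) e₁ e₂′ ⟩
    suc w′ * (c * cn * (r * f₀)) + c * suc n * (cn * (suc (p′ + r) * f₀))  ≡⟨ lem₂ p′ n r c cn f₀ ⟩
    c * cn * (suc r * (suc (suc p′ * n + (p′ + r)) * f₀))  ≡⟨ cong (λ z → c * cn * (suc r * z !)) (lem₃ p′ n r) ⟩
    c ^ suc n * (suc r * (suc p′ * suc n + r) !) ∎
    where
    open ≡-Reasoning
    A₁ A₂ D w′ f₀ cn : ℕ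
    A₁ = pow u r (suc n)
    A₂ = pow u (suc (p′ + r)) n
    w′ = p′ * suc n + r
    D = w′ !
    f₀ = (suc p′ * n + (p′ + r)) !
    cn = c ^ n
    e₂′ : A₂ * (n ! * (suc w′ * D)) ≡ cn * (suc (p′ + r) * f₀)
    e₂′ = trans (cong (λ z → A₂ * (n ! * z !)) (lem₀ p′ n r)) e₂
      where
      lem₀ : ∀ p n r → suc (p * suc n + r) ≡ p * n + suc (p + r)
      lem₀ = solve-∀
    lem₁ : ∀ A B c s m w D → (A + c * B) * ((s * m) * (w * D)) ≡ w * (A * ((s * m) * D)) + c * s * (B * (m * (w * D)))
    lem₁ = solve-∀
    lem₂ : ∀ p n r c k f → suc (p * suc n + r) * (c * k * (r * f)) + c * suc n * (k * (suc (p + r) * f)) ≡ c * k * (suc r * (suc (suc p * n + (p + r)) * f))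
    lem₂ = solve-∀
    lem₃ : ∀ p n r → suc (suc p * n + (p + r)) ≡ suc p * suc n + r
    lem₃ = solve-∀

X-scaled : ∀ c f g n → ((ℕS.X ∗ (λ n → c * f n)) ∗ g) n ≡ (ℕS.X ∗ (λ n → c * (f ∗ g) n)) n
X-scaled c f g n = trans (ℕS.⊛-assoc ℕS.X (λ n → c * f n) g n) (ℕS.⊛-cong {f = ℕS.X} (λ _ → refl) (ℕS.⊛-scale c f g) n)

double-cube : ∀ f n → double (cube f) n ≡ 2 * pow f 3 n
double-cube f n = trans (cong₂ _+_ e e) (cong (pow f 3 n +_) (sym (ℕₚ.+-identityʳ _)))
  where
  e : cube f n ≡ pow f 3 n
  e = ℕS.⊛-cong {f = f} (λ _ → refl) (ℕS.⊛-cong {f = f} (λ _ → refl) (λ n → sym (trans (ℕS.⊛-comm f ℕS.1ₛ n) (ℕS.⊛-identityˡ f n)))) n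

v-pow : ∀ f n → (ℕS.X ∗ double (cube f)) n ≡ (ℕS.X ∗ (λ n → 2 * pow f 3 n)) n
v-pow f = ℕS.⊛-cong {f = ℕS.X} (λ _ → refl) (double-cube f)

v∗pow : ∀ f r n → ((ℕS.X ∗ double (cube f)) ∗ pow f r) (suc n) ≡ 2 * pow f (3 + r) n
v∗pow f r n = trans (ℕS.⊛-cong {g = pow f r} (v-pow f) (λ _ → refl) (suc n)) (trans (X-scaled 2 (pow f 3) (pow f r) (suc n))
  (trans (ℕS.X-⊛ (λ n → 2 * (pow f 3 ∗ pow f r) n) n) (cong (2 *_) (pow-+ f 3 r n))))

pow-1 : ∀ f n → pow f 1 n ≡ f n
pow-1 f n = trans (ℕS.⊛-comm f ℕS.1ₛ n) (ℕS.⊛-identityˡ f n)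

v∗ : ∀ f n → ((ℕS.X ∗ double (cube f)) ∗ f) (suc n) ≡ 2 * pow f 4 n
v∗ f n = trans (ℕS.⊛-cong {f = ℕS.X ∗ double (cube f)} (λ _ → refl) (λ n → sym (pow-1 f n)) (suc n)) (v∗pow f 1 n)

v-suc : ∀ f n → (ℕS.X ∗ double (cube f)) (suc n) ≡ 2 * pow f 3 n
v-suc f n = trans (ℕS.X-⊛ (double (cube f)) n) (double-cube f n)

∗v : ∀ f n → (f ∗ (ℕS.X ∗ double (cube f))) (suc n) ≡ 2 * pow f 4 n
∗v f n = trans (ℕS.⊛-comm f (ℕS.X ∗ double (cube f)) (suc n)) (v∗ f n)

v² : ∀ f n → ((ℕS.X ∗ double (cube f)) ∗ (ℕS.X ∗ double (cube f))) (suc (suc n)) ≡ 4 * pow f 6 n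
v² f n = begin
  (v₀ ∗ v₀) (2 + n)  ≡⟨ ℕS.⊛-cong (v-pow f) (v-pow f) (2 + n) ⟩
  ((ℕS.X ∗ d) ∗ (ℕS.X ∗ d)) (2 + n)  ≡⟨ ℕS.⊛-assoc ℕS.X d (ℕS.X ∗ d) (2 + n) ⟩
  (ℕS.X ∗ (d ∗ (ℕS.X ∗ d))) (2 + n)  ≡⟨ ℕS.X-⊛ (d ∗ (ℕS.X ∗ d)) (suc n) ⟩
  (d ∗ (ℕS.X ∗ d)) (suc n)  ≡⟨ ℕS.⊛-comm d (ℕS.X ∗ d) (suc n) ⟩
  ((ℕS.X ∗ d) ∗ d) (suc n)  ≡⟨ trans (ℕS.⊛-assoc ℕS.X d d (suc n)) (ℕS.X-⊛ (d ∗ d) n) ⟩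
  (d ∗ d) n  ≡⟨ ℕS.⊛-scale 2 (pow f 3) d n ⟩
  2 * (pow f 3 ∗ d) n  ≡⟨ cong (2 *_) (trans (ℕS.⊛-comm (pow f 3) d n) (trans (ℕS.⊛-scale 2 (pow f 3) (pow f 3) n) (cong (2 *_) (pow-+ f 3 3 n)))) ⟩
  2 * (2 * pow f 6 n)  ≡⟨ lem (pow f 6 n) ⟩
  4 * pow f 6 n ∎
  where
  open ≡-Reasoning
  v₀ d : ℕ → ℕ
  v₀ = ℕS.X ∗ double (cube f)
  d n = 2 * pow f 3 n
  lem : ∀ a → 2 * (2 * a) ≡ 4 * a
  lem = solve-∀

module Totals {γ a} (A : Table 0 γ a) where
  open Raney 4 2

  u-eq : ∀ n → u n ≡ ℕS.1ₛ n + double (ℕS.X ∗ double (cube u)) n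
  u-eq zero = refl
  u-eq (suc n) = trans (Fix.fix-suc n) (trans (lem (pow u 3 n)) (sym (cong₂ _+_ (v-suc u n) (v-suc u n))))
    where
    lem : ∀ a → 4 * a ≡ 2 * a + 2 * a
    lem = solve-∀

  -- From `a 0 0` = u - u v with v = 2 z u³: the coefficient of z^n in u less twice that of z^(n-1)
  -- in u⁴. The common denominator of these two Raney numbers is cleared, and the subtracted term is
  -- kept on both sides.
  total-binomial : ∀ n → a 0 0 n * ((n + 1) * (2 * n + 1)) ≡ 4 ^ n * ((3 * n) C n)
  total-binomial zero = trans (ℕₚ.*-identityʳ _) (trans (sym (ℕₚ.+-identityʳ _)) (total-count A u-eq 0))
  total-binomial (suc m) = ℕₚ.*-cancelʳ-≡ _ _ (n ! * (2 * n) !) {{n !* (2 * n) !≢0}} (begin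
    N₀ * ((n + 1) * (2 * n + 1)) * (n ! * (2 * n) !)  ≡⟨ ℕₚ.*-cancelˡ-≡ _ _ 2 (ℕₚ.+-cancelʳ-≡ (2 * n * (4 ^ n * F₀)) _ _ count₂) ⟩
    4 ^ n * F₀  ≡⟨ cong (4 ^ n *_) (sym binomial) ⟩
    4 ^ n * (((3 * n) C n) * (n ! * (2 * n) !))  ≡⟨ sym (ℕₚ.*-assoc (4 ^ n) _ _) ⟩
    4 ^ n * ((3 * n) C n) * (n ! * (2 * n) !) ∎)
    where
    open ≡-Reasoning
    n N₀ F₀ : ℕ
    n = suc m
    N₀ = a 0 0 n
    F₀ = (3 * n) !
    A₁ A₄ D : ℕ
    A₁ = pow u 1 n
    A₄ = pow u 4 m
    D = (2 * n) !
    count₁ : N₀ + 2 * A₄ ≡ A₁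
    count₁ = trans (cong (N₀ +_) (sym (∗v u m))) (trans (total-count A u-eq n) (sym (pow-1 u n)))
    A₁-closed : A₁ * (n ! * (suc (2 * n) * D)) ≡ 4 ^ n * F₀
    A₁-closed = trans (cong (λ z → A₁ * (n ! * z !)) (sym (ℕₚ.+-comm (2 * n) 1))) (trans (closed-form n 0) (cong (4 ^ n *_) (trans (ℕₚ.+-identityʳ _) (cong _! (ℕₚ.+-identityʳ (3 * n))))))
    A₄-closed : A₄ * (m ! * (suc (suc (2 * n)) * (suc (2 * n) * D))) ≡ 4 ^ m * (4 * F₀)
    A₄-closed = trans (cong (λ z → A₄ * (m ! * z !)) (lem₁ m)) (trans (closed-form m 3) (cong (λ z → 4 ^ m * (4 * z !)) (lem₂ m)))
      where
      lem₁ : ∀ m → suc (suc (2 * suc m)) ≡ 2 * m + 4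
      lem₁ = solve-∀
      lem₂ : ∀ m → 3 * m + 3 ≡ 3 * suc m
      lem₂ = solve-∀
    count₂ : 2 * (N₀ * ((n + 1) * (2 * n + 1)) * (n ! * D)) + 2 * n * (4 ^ n * F₀) ≡ 2 * (4 ^ n * F₀) + 2 * n * (4 ^ n * F₀)
    count₂ = begin
      2 * (N₀ * ((n + 1) * (2 * n + 1)) * (n ! * D)) + 2 * n * (4 ^ n * F₀)  ≡⟨ lem₁ N₀ m (m !) D (4 ^ m) F₀ ⟩
      N₀ * (suc m * m ! * (suc (suc (2 * n)) * (suc (2 * n) * D))) + 2 * n * (4 ^ m * (4 * F₀))  ≡⟨ cong (λ z → N₀ * (suc m * m ! * (suc (suc (2 * n)) * (suc (2 * n) * D))) + 2 * n * z) (sym A₄-closed) ⟩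
      N₀ * (suc m * m ! * (suc (suc (2 * n)) * (suc (2 * n) * D))) + 2 * n * (A₄ * (m ! * (suc (suc (2 * n)) * (suc (2 * n) * D))))  ≡⟨ lem₂ N₀ A₄ m (m !) (suc (2 * n)) D ⟩
      suc (suc (2 * n)) * ((N₀ + 2 * A₄) * (suc m * m ! * (suc (2 * n) * D)))  ≡⟨ cong (λ z → suc (suc (2 * n)) * (z * (suc m * m ! * (suc (2 * n) * D)))) count₁ ⟩
      suc (suc (2 * n)) * (A₁ * (n ! * (suc (2 * n) * D)))  ≡⟨ cong (suc (suc (2 * n)) *_) A₁-closed ⟩
      suc (suc (2 * n)) * (4 ^ n * F₀)  ≡⟨ lem₃ n (4 ^ n * F₀) ⟩
      2 * (4 ^ n * F₀) + 2 * n * (4 ^ n * F₀) ∎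
      where
      lem₁ : ∀ N m k D p F → 2 * (N * ((suc m + 1) * (2 * suc m + 1)) * (suc m * k * D)) + 2 * suc m * (4 * p * F) ≡ N * (suc m * k * (suc (suc (2 * suc m)) * (suc (2 * suc m) * D))) + 2 * suc m * (p * (4 * F))
      lem₁ = solve-∀
      lem₂ : ∀ N A m k q D → N * (suc m * k * (suc (suc (2 * suc m)) * (q * D))) + 2 * suc m * (A * (k * (suc (suc (2 * suc m)) * (q * D)))) ≡ suc (suc (2 * suc m)) * ((N + 2 * A) * (suc m * k * (q * D)))
      lem₂ = solve-∀
      lem₃ : ∀ n p → suc (suc (2 * n)) * p ≡ 2 * p + 2 * n * p
      lem₃ = solve-∀
    binomial : ((3 * n) C n) * (n ! * (2 * n) !) ≡ F₀
    binomial = trans (cong (λ z → ((3 * n) C n) * (n ! * z !)) (sym (trans (cong (_∸ n) (lem n)) (ℕₚ.m+n∸m≡n n (2 * n))))) (choose (3 * n) n (ℕₚ.m≤m+n n (2 * n)))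
      where
      lem : ∀ n → 3 * n ≡ n + 2 * n
      lem = solve-∀
      choose : ∀ n k → k ≤ n → (n C k) * (k ! * (n ∸ k) !) ≡ n !
      choose n k le = trans (cong (_* (k ! * (n ∸ k) !)) (nCk≡n!/k![n-k]! le)) (m/n*n≡m {{k !* (n ∸ k) !≢0}} (k![n∸k]!∣n! le))

module Connecteds {γ a} (A : Table 2 γ a) (a-nil : ∀ n → a 0 0 n ≡ ℕS.1ₛ n) where
  open Raney 2 3 renaming (u to g₀)

  g-eq : ∀ n → g₀ n ≡ ℕS.1ₛ n + ((ℕS.X ∗ double (cube g₀)) ∗ g₀) n
  g-eq zero = refl
  g-eq (suc n) = trans (Fix.fix-suc n) (sym (v∗ g₀ n))

  v₀ : ℕ → ℕ
  v₀ = ℕS.X ∗ double (cube g₀)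

  -- In positive degree 1 + 2 γ = (1 + 2 v) (1 - v) gives γ + v² = v / 2, and v / 2 = z g³.
  γ-eq : ∀ m → γ (suc m) + (v₀ ∗ v₀) (suc m) ≡ pow g₀ 3 m
  γ-eq m = ℕₚ.*-cancelˡ-≡ _ _ 2 (ℕₚ.+-cancelʳ-≡ (v₀ (suc m)) _ _ (begin
    2 * (γ (suc m) + (v₀ ∗ v₀) (suc m)) + v₀ (suc m)  ≡⟨ lem (γ (suc m)) ((v₀ ∗ v₀) (suc m)) (v₀ (suc m)) ⟩
    2 * γ (suc m) + (v₀ (suc m) + ((v₀ ∗ v₀) (suc m) + (v₀ ∗ v₀) (suc m)))  ≡⟨ cong (2 * γ (suc m) +_) (sym expand) ⟩
    2 * γ (suc m) + ((λ n → ℕS.1ₛ n + double v₀ n) ∗ v₀) (suc m)  ≡⟨ connected-count A a-nil g-eq (suc m) ⟩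
    v₀ (suc m) + v₀ (suc m)  ≡⟨ cong (_+ v₀ (suc m)) (v-suc g₀ m) ⟩
    2 * pow g₀ 3 m + v₀ (suc m) ∎))
    where
    open ≡-Reasoning
    expand : ((λ n → ℕS.1ₛ n + double v₀ n) ∗ v₀) (suc m) ≡ v₀ (suc m) + ((v₀ ∗ v₀) (suc m) + (v₀ ∗ v₀) (suc m))
    expand = trans (ℕS.⊛-distribʳ v₀ ℕS.1ₛ (double v₀) (suc m)) (cong₂ _+_ (ℕS.⊛-identityˡ v₀ (suc m)) (ℕS.⊛-distribʳ v₀ v₀ v₀ (suc m)))
    lem : ∀ g w v → 2 * (g + w) + v ≡ 2 * g + (v + (w + w))
    lem = solve-∀

  -- γ = z g³ - 4 z² g⁶ combines two Raney numbers. The first coefficient is separate because z² g⁶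
  -- does not reach it.
  connected-closed : ∀ m → γ (suc m) * ((3 * suc m ∸ 1) ! * suc m !) ≡ 2 ^ suc m * (4 * suc m ∸ 3) !
  connected-closed zero = cong (_* 2) (trans (sym (ℕₚ.+-identityʳ _)) (γ-eq 0))
  connected-closed (suc m) = trans (cong (λ z → γ n * (z ! * n !)) (cong (_∸ 1) (lem₁ m))) (trans (ℕₚ.*-cancelˡ-≡ _ _ 3 (ℕₚ.+-cancelʳ-≡ (24 * suc m * (2 ^ m * f₀)) _ _ count₂)) (cong (λ z → 2 ^ n * z !) (sym (cong (_∸ 3) (lem₂ m)))))
    where
    open ≡-Reasoning
    n f₀ D B₃ B₆ : ℕ
    n = suc (suc m)
    f₀ = (4 * m + 5) !
    D = (3 * m + 5) !
    B₃ = pow g₀ 3 (suc m)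
    B₆ = pow g₀ 6 m
    lem₁ : ∀ m → 3 * suc (suc m) ≡ 1 + (3 * m + 5)
    lem₁ = solve-∀
    lem₂ : ∀ m → 4 * suc (suc m) ≡ 3 + (4 * m + 5)
    lem₂ = solve-∀
    count₁ : γ n + 4 * B₆ ≡ B₃
    count₁ = trans (cong (γ n +_) (sym (v² g₀ m))) (γ-eq (suc m))
    B₃-closed : B₃ * (suc m ! * (suc (3 * m + 5) * D)) ≡ 2 ^ suc m * (3 * (suc (4 * m + 5) * f₀))
    B₃-closed = trans (cong (λ z → B₃ * (suc m ! * z !)) (lem m)) (trans (closed-form (suc m) 2) (cong (λ z → 2 ^ suc m * (3 * z !)) (lem′ m)))
      where
      lem : ∀ m → suc (3 * m + 5) ≡ 3 * suc m + 3
      lem = solve-∀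
      lem′ : ∀ m → 4 * suc m + 2 ≡ suc (4 * m + 5)
      lem′ = solve-∀
    B₆-closed : B₆ * (m ! * (suc (3 * m + 5) * D)) ≡ 2 ^ m * (6 * f₀)
    B₆-closed = trans (cong (λ z → B₆ * (m ! * z !)) (sym (ℕₚ.+-suc (3 * m) 5))) (closed-form m 5)
    count₂ : 3 * (γ n * (D * n !)) + 24 * suc m * (2 ^ m * f₀) ≡ 3 * (2 ^ n * f₀) + 24 * suc m * (2 ^ m * f₀)
    count₂ = begin
      3 * (γ n * (D * n !)) + 24 * suc m * (2 ^ m * f₀)  ≡⟨ lem₃ (γ n) D m (m !) (2 ^ m) f₀ ⟩
      γ n * (suc m * m ! * (suc (3 * m + 5) * D)) + 4 * suc m * (2 ^ m * (6 * f₀))  ≡⟨ cong (λ z → γ n * (suc m * m ! * (suc (3 * m + 5) * D)) + 4 * suc m * z) (sym B₆-closed) ⟩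
      γ n * (suc m * m ! * (suc (3 * m + 5) * D)) + 4 * suc m * (B₆ * (m ! * (suc (3 * m + 5) * D)))  ≡⟨ lem₄ (γ n) B₆ (suc m) (m !) (suc (3 * m + 5) * D) ⟩
      (γ n + 4 * B₆) * (suc m * m ! * (suc (3 * m + 5) * D))  ≡⟨ cong (_* (suc m * m ! * (suc (3 * m + 5) * D))) count₁ ⟩
      B₃ * (suc m ! * (suc (3 * m + 5) * D))  ≡⟨ B₃-closed ⟩
      2 ^ suc m * (3 * (suc (4 * m + 5) * f₀))  ≡⟨ lem₅ m (2 ^ m) f₀ ⟩
      3 * (2 ^ n * f₀) + 24 * suc m * (2 ^ m * f₀) ∎
      where
      lem₃ : ∀ g D m k p f → 3 * (g * (D * (suc (suc m) * (suc m * k)))) + 24 * suc m * (p * f) ≡ g * (suc m * k * (suc (3 * m + 5) * D)) + 4 * suc m * (p * (6 * f))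
      lem₃ = solve-∀
      lem₄ : ∀ g B s k D → g * (s * k * D) + 4 * s * (B * (k * D)) ≡ (g + 4 * B) * (s * k * D)
      lem₄ = solve-∀
      lem₅ : ∀ m p f → 2 * p * (3 * (suc (4 * m + 5) * f)) ≡ 3 * (2 * (2 * p) * f) + 24 * suc m * (p * f)
      lem₅ = solve-∀

-- Transversals

-- `root` recovers from an element the x whose list contains it, so lists of different x are
-- disjoint.
concatMap-unique : ∀ {A B : Set} (f : A → List B) (root : B → A) → (∀ x {y} → y ∈ f x → root y ≡ x) → (∀ x → Unique (f x)) →
  ∀ {xs} → Unique xs → Unique (concatMap f xs)
concatMap-unique f root rt uf AllPairs.[] = AllPairs.[]
concatMap-unique f root rt uf {x ∷ xs} (p AllPairs.∷ u) = Uniqueₚ.++⁺ (uf x) (concatMap-unique f root rt uf u) disjoint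
  where
  disjoint : ∀ {v} → ¬ (v ∈ f x × v ∈ concatMap f xs)
  disjoint (a , b) with ∈-concatMap⁻ f xs b
  ... | x′ , x′∈ , c = All′.lookup p x′∈ (trans (sym (rt x a)) (rt x′ c))

rootU : ∀ {n E} → UW (suc n) E → AnyAct n
rootU (drop d) = rootU d
rootU (done {i = i} {g} {E} α _) = i , g , E , α

rootA : ∀ {n i g E} → Act n i g E → CodeU n
rootA (trip {E = E} d) = E , d
rootA (hop α _) = rootA α

drops-root : ∀ {n E} (d : UW (suc n) E) {E′ d′} → (E′ , d′) ∈ drops d → rootU d′ ≡ rootU d
drops-root {E = []} d (here refl) = refl
drops-root {E = g ∷ E} d (here refl) = refl
drops-root {E = g ∷ E} d (there p) = drops-root (drop d) p

drops-length : ∀ {n E} (d : UW n E) {u} → u ∈ drops d → length (proj₁ u) ≤ length E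
drops-length {E = []} d (here refl) = z≤n
drops-length {E = g ∷ E} d (here refl) = ℕₚ.≤-refl
drops-length {E = g ∷ E} d (there p) = ℕₚ.m≤n⇒m≤1+n (drops-length (drop d) p)

drops-unique : ∀ {n E} (d : UW n E) → Unique (drops d)
drops-unique {E = []} d = All′.[] AllPairs.∷ AllPairs.[]
drops-unique {E = g ∷ E} d = All′.tabulate (λ { p refl → ℕₚ.<-irrefl refl (drops-length (drop d) p) }) AllPairs.∷ drops-unique (drop d)

hops-root : ∀ {n i g E} (α : Act n i g E) {i′ g′ E′ α′} → (i′ , g′ , E′ , α′) ∈ hops α → rootA α′ ≡ rootA α
hopsIf-root : ∀ {n i g h E} (α : Act n i g (h ∷ E)) b (q : hop? g ≡ b) {i′ g′ E′ α′} → (i′ , g′ , E′ , α′) ∈ hopsIf α b q → rootA α′ ≡ rootA α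
hops-root {E = []} α (here refl) = refl
hops-root {E = h ∷ E} α (here refl) = refl
hops-root {g = g} {E = h ∷ E} α (there p) = hopsIf-root α (hop? g) refl p
hopsIf-root α true q p = hops-root (hop α q) p

hops-index : ∀ {n i g E} (α : Act n i g E) {β} → β ∈ hops α → i ≤ proj₁ β
hopsIf-index : ∀ {n i g h E} (α : Act n i g (h ∷ E)) b (q : hop? g ≡ b) {β} → β ∈ hopsIf α b q → i < proj₁ β
hops-index {E = []} α (here refl) = ℕₚ.≤-refl
hops-index {E = h ∷ E} α (here refl) = ℕₚ.≤-refl
hops-index {g = g} {E = h ∷ E} α (there p) = ℕₚ.<⇒≤ (hopsIf-index α (hop? g) refl p)
hopsIf-index α true q p = hops-index (hop α q) p

hops-unique : ∀ {n i g E} (α : Act n i g E) → Unique (hops α)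
hopsIf-unique : ∀ {n i g h E} (α : Act n i g (h ∷ E)) b (q : hop? g ≡ b) → Unique (hopsIf α b q)
hops-unique {E = []} α = All′.[] AllPairs.∷ AllPairs.[]
hops-unique {g = g} {E = h ∷ E} α = All′.tabulate (λ { p refl → ℕₚ.<-irrefl refl (hopsIf-index α (hop? g) refl p) }) AllPairs.∷ hopsIf-unique α (hop? g) refl
hopsIf-unique α true q = hops-unique (hop α q)
hopsIf-unique α false q = AllPairs.[]

ucodes-unique : ∀ n → Unique (ucodes n)
acts-unique : ∀ n → Unique (acts n)
ucodes-unique zero = All′.[] AllPairs.∷ AllPairs.[]
ucodes-unique (suc n) = concatMap-unique _ (λ { (_ , d) → rootU d }) (λ { (i , g , E , α) p → drops-root (done α refl) p }) (λ { (i , g , E , α) → drops-unique (done α refl) }) (acts-unique n)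
acts-unique n = concatMap-unique _ (λ { (_ , _ , _ , α) → rootA α }) (λ { (E , d) p → hops-root (trip d) p }) (λ { (E , d) → hops-unique (trip d) }) (ucodes-unique n)

select : ∀ {n} → CodeU n → List (UW n [])
select ([] , d) = d ∷ []
select (_ ∷ _ , _) = []

keep : ∀ {A : Set} → ℕ → A → List A
keep 1 x = x ∷ []
keep _ x = []

selectOne : ∀ {n} → CodeU n → List (UW n [])
selectOne ([] , d) = keep (κU d) d
selectOne (_ ∷ _ , _) = []

webs connectedWebs : ∀ n → List (UW n [])
webs n = concatMap select (ucodes n)
connectedWebs n = concatMap selectOne (ucodes n)

∈-keep : ∀ {A : Set} {k} {x y : A} → y ∈ keep k x → k ≡ 1 × y ≡ x
∈-keep {k = 1} (here refl) = refl , refl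

keep-∈ : ∀ {A : Set} {k} {x : A} → k ≡ 1 → x ∈ keep k x
keep-∈ refl = here refl

select-root : ∀ {n} (u : CodeU n) {d} → d ∈ select u → ([] , d) ≡ u
select-root ([] , d) (here refl) = refl

selectOne-root : ∀ {n} (u : CodeU n) {d} → d ∈ selectOne u → ([] , d) ≡ u
selectOne-root ([] , d) p = cong ([] ,_) (proj₂ (∈-keep {k = κU d} p))

webs-unique : ∀ n → Unique (webs n)
webs-unique n = concatMap-unique select ([] ,_) select-root (λ { ([] , d) → All′.[] AllPairs.∷ AllPairs.[] ; (_ ∷ _ , d) → AllPairs.[] }) (ucodes-unique n)

connectedWebs-unique : ∀ n → Unique (connectedWebs n)
connectedWebs-unique n = concatMap-unique selectOne ([] ,_) selectOne-root (λ { ([] , d) → kept (κU d) d ; (_ ∷ _ , d) → AllPairs.[] }) (ucodes-unique n)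
  where
  kept : ∀ {A : Set} k (x : A) → Unique (keep k x)
  kept zero x = AllPairs.[]
  kept (suc zero) x = All′.[] AllPairs.∷ AllPairs.[]
  kept (suc (suc k)) x = AllPairs.[]

webs-complete : ∀ {n} (d : UW n []) → d ∈ webs n
webs-complete {n} d = ∈-concatMap select (ucodes-complete d) (here refl)

connectedWebs-complete : ∀ {n} (d : UW n []) → κU d ≡ 1 → d ∈ connectedWebs n
connectedWebs-complete {n} d e = ∈-concatMap selectOne (ucodes-complete d) (keep-∈ e)

connectedWebs-κ : ∀ {n} (d : UW n []) → d ∈ connectedWebs n → κU d ≡ 1
connectedWebs-κ {n} d p with ∈-concatMap⁻ selectOne (ucodes n) p
... | ([] , d′) , _ , q with ∈-keep {k = κU d′} q
...   | e , refl = e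

sum-ΣL : ∀ {A : Set} (f : A → ℕ) xs → sum (map f xs) ≡ ΣL xs f
sum-ΣL f [] = refl
sum-ΣL f (x ∷ xs) = cong (f x +_) (sum-ΣL f xs)

length-ΣL : ∀ {A : Set} (xs : List A) → length xs ≡ ΣL xs (λ _ → 1)
length-ΣL [] = refl
length-ΣL (x ∷ xs) = cong suc (length-ΣL xs)

webs-sum : ∀ n → ΣL (webs n) (λ d → 2 ^ κU d) ≡ Tot.S n []
webs-sum n = trans (ΣL-concatMap select (ucodes n) _) (ΣL-cong (ucodes n)
  (λ { ([] , d) → trans (ℕₚ.+-identityʳ _) (sym (ℕₚ.*-identityʳ _)) ; (nothing ∷ E , d) → sym (ℕₚ.*-zeroʳ (2 ^ κU d)) ; (just _ ∷ E , d) → sym (ℕₚ.*-zeroʳ (2 ^ κU d)) }))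

kept-weight : ∀ {n} → CodeU n → ℕ
kept-weight u = ΣL (selectOne u) (λ _ → 1)

-- Dropping everything ends with the drop of the last open gap. The resulting web is connected
-- exactly when no component was finished before this drop, which is what the word of one letter
-- records.
drops-connected : ∀ {n E} (d : UW n E) → 1 ≤ length E → ΣL (drops d) kept-weight ≡ ΣL (drops d) (One.term (plain true ∷ []))
drops-connected {E = g ∷ []} d _ = last-gap g d (ends-uw d)
  where
  cancelled : ∀ {A : Set} k (x : A) → ΣL (keep (suc k) x) (λ _ → 1) + 0 ≡ 0 ^ k * 1 + (0 ^ suc k * 0 + 0)
  cancelled zero x = refl
  cancelled (suc k) x = refl
  last-gap : ∀ g (d : UW _ (g ∷ [])) → g ≡ nothing → ΣL (drops d) kept-weight ≡ ΣL (drops d) (One.term (plain true ∷ []))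
  last-gap nothing d refl = cancelled (κU d) (drop d)
drops-connected {E = g ∷ h ∷ E} d _ = trans (drops-connected (drop d) (s≤s z≤n)) (cong (_+ ΣL (drops (drop d)) (One.term (plain true ∷ []))) (sym (trans (cong (0 ^ κU d *_) (miss g)) (ℕₚ.*-zeroʳ (0 ^ κU d)))))
  where
  tail-miss : ∀ h → cmp (h ∷ E) [] ≡ 0
  tail-miss nothing = refl
  tail-miss (just _) = refl
  miss : ∀ g → cmp (g ∷ h ∷ E) (plain true ∷ []) ≡ 0
  miss nothing = tail-miss h
  miss (just _) = refl

connectedWebs-length : ∀ n → length (connectedWebs (suc n)) ≡ connected (suc n)
connectedWebs-length n = begin
  length (connectedWebs (suc n))  ≡⟨ trans (length-ΣL (connectedWebs (suc n))) (ΣL-concatMap selectOne (ucodes (suc n)) (λ _ → 1)) ⟩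
  ΣL (ucodes (suc n)) kept-weight  ≡⟨ ΣL-concatMap rooted (acts n) kept-weight ⟩
  ΣL (acts n) (λ a → ΣL (rooted a) kept-weight)  ≡⟨ ΣL-cong (acts n) (λ { (i , g , E , α) → drops-connected (done α refl) (subst (1 ≤_) (sym (length-stack i g E)) (ℕₚ.≤-trans (s≤s z≤n) (ℕₚ.m≤n+m _ i))) }) ⟩
  ΣL (acts n) (λ a → ΣL (rooted a) (One.term (plain true ∷ [])))  ≡⟨ sym (ΣL-concatMap rooted (acts n) (One.term (plain true ∷ []))) ⟩
  connected (suc n) ∎
  where
  open ≡-Reasoning
  rooted : AnyAct n → List (CodeU (suc n))
  rooted (i , g , E , α) = drops (done α refl)

num-≤ : ∀ {d S R N N′} → NumClasses {d} S R N → NumClasses S R N′ → N ≤ N′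
num-≤ {S = S} {R} {N} {N′} K K′ = Finₚ.injective⇒≤ {f = λ i → proj₁ (cv i)} (λ {i} {j} e → KA.distinct i j (E-sym (proj₂ (cv i)) ◅◅ (E-≡ (cong KB.rep e) ◅◅ proj₂ (cv j))))
  where
  module KA = NumClasses K
  module KB = NumClasses K′
  cv : ∀ i → ∃ λ j → EqClosure R (KB.rep j) (KA.rep i)
  cv i = KB.cover (KA.rep i) (KA.rep-in i)

M-injective : ∀ j k → M j ≡ M k → j ≡ k
M-injective zero zero e = refl
M-injective (suc j) (suc k) e = cong suc (M-injective j k (ℕₚ.suc-injective (ℕₚ.suc-injective (ℕₚ.suc-injective e))))

codeWeb : ∀ {n} → UW (suc n) [] → KWeb (M (suc n))
codeWeb d = kweb (webU d) (ufine (uinv d) refl) (cls (ust (uinv d)))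

codeWeb-κ : ∀ {n} (d : UW (suc n) []) → κ (codeWeb d) ≡ κU d
codeWeb-κ d = trans (count (ust (uinv d))) (ℕₚ.+-identityʳ (κU d))

codeWeb-distinct : ∀ {n} {d d′ : UW (suc n) []} → d ≢ d′ → ¬ Iso (web (codeWeb d)) (web (codeWeb d′))
codeWeb-distinct {d = d} {d′} ne I with unique-U d d′ (≅-of-iso (raw-pres (webU d)) (raw-pres (webU d′)) I) refl
... | refl = ne refl

record Decoded {n} (W : RawWeb (M (suc n))) : Set where
  field
    code  : UW (suc n) []
    iso   : Iso W (web (codeWeb code))
    parts : NumComponents W (κU code)

decoded : ∀ {n} (W : RawWeb (M (suc n))) → IsWeb W → IsKreweras W → Decoded W
decoded {n} W iw kw = go (decode W iw kw)
  where
  go : (∃ λ X → Pres W X × Good X) → Decoded W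
  go (X , p , G) = go′ (coded (3+ (M n)) X ℕₚ.≤-refl G)
    where
    go′ : Coded X → Decoded W
    go′ (k , e , d , I) = go″ k e (M-injective (suc n) k e) d I
      where
      go″ : ∀ k (e : M (suc n) ≡ M k) → suc n ≡ k → (d : UW k []) → subst Dessin e X ≅ webU d → Decoded W
      go″ k e refl d I with uip e refl
      ... | refl = record { code = d ; iso = iso-of-≅ p (raw-pres (webU d)) I
        ; parts = subst (NumComponents W) (codeWeb-κ d) (components p (link-classes-to (proj₁ (≅-sym I)) (cls (ust (uinv d))))) }

Counted : (ℕ → Set) → ℕ → Set
Counted R m = Σ (List (KWeb m)) λ L → IsTransversal (λ _ → ⊤) L × R (sum (map (λ e → 2 ^ κ e) L))

CountedConnected : (ℕ → Set) → ℕ → Set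
CountedConnected R m = Σ (List (KWeb m)) λ L → IsTransversal (λ W → NumComponents W 1) L × R (length L)

transversal : ∀ n → Counted (_≡ Tot.S (suc n) []) (M (suc n))
transversal n = map codeWeb (webs (suc n)) , (All′.tabulate (λ _ → tt) , complete′ , AllPairsₚ.map⁺ (AllPairs.map codeWeb-distinct (webs-unique (suc n)))) , total
  where
  complete′ : ∀ W → IsWeb W → IsKreweras W → ⊤ → Any (λ e → Iso W (web e)) (map codeWeb (webs (suc n)))
  complete′ W iw kw _ = lose (Memₚ.∈-map⁺ codeWeb (webs-complete (Decoded.code D))) (Decoded.iso D)
    where
    D : Decoded W
    D = decoded W iw kw
  total : sum (map (λ e → 2 ^ κ e) (map codeWeb (webs (suc n)))) ≡ Tot.S (suc n) []
  total = trans (cong sum (sym (Listₚ.map-∘ (webs (suc n))))) (trans (sum-ΣL _ (webs (suc n))) (trans (ΣL-cong (webs (suc n)) (λ d → cong (2 ^_) (codeWeb-κ d))) (webs-sum (suc n))))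

transversal-connected : ∀ n → CountedConnected (_≡ connected (suc n)) (M (suc n))
transversal-connected n = map codeWeb (connectedWebs (suc n)) ,
  (Allₚ.map⁺ (All′.tabulate (λ {d} p → subst (NumComponents (web (codeWeb d))) (trans (codeWeb-κ d) (connectedWebs-κ d p)) (κ-ok (codeWeb d)))) ,
    complete′ , AllPairsₚ.map⁺ (AllPairs.map codeWeb-distinct (connectedWebs-unique (suc n)))) ,
  trans (Listₚ.length-map codeWeb (connectedWebs (suc n))) (connectedWebs-length n)
  where
  complete′ : ∀ W → IsWeb W → IsKreweras W → NumComponents W 1 → Any (λ e → Iso W (web e)) (map codeWeb (connectedWebs (suc n)))
  complete′ W iw kw one = lose (Memₚ.∈-map⁺ codeWeb (connectedWebs-complete (Decoded.code D) (ℕₚ.≤-antisym (num-≤ (Decoded.parts D) one) (num-≤ one (Decoded.parts D))))) (Decoded.iso D)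
    where
    D : Decoded W
    D = decoded W iw kw

emptyWeb : KWeb 0
emptyWeb = record
  { web = record { k = 0 ; α = λ x → x ; σ = λ x → x ; σ⁻ = λ x → x ; col = λ () }
  ; isWeb = record { α-invol = λ () ; α-nofix = λ () ; σ-inv₁ = λ () ; σ-inv₂ = λ () ; hub-rot = λ () ; bnd-nonhub = λ () ; bnd-deg = λ () ; bnd-sep = λ ()
    ; int-deg = λ () ; col-vertex = λ () ; col-edge = λ () ; planar = inj₁ refl }
  ; isKr = record { bnd-white = λ () ; faces = λ () }
  ; κ = 0
  ; κ-ok = record { rep = λ () ; rep-in = λ () ; cover = λ () ; distinct = λ () } }

empty-iso : (W : RawWeb 0) → RawWeb.k W ≡ 0 → Iso W (web emptyWeb)
empty-iso W e = record { f = λ x → ⊥-elim (none x) ; g = λ () ; gf = λ x → ⊥-elim (none x) ; fg = λ () ; f-hub = λ () ; f-α = λ x → ⊥-elim (none x)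
  ; f-σ = λ x → ⊥-elim (none x) ; f-col = λ x → ⊥-elim (none x) }
  where
  none : ¬ Fin (RawWeb.k W)
  none = subst (λ k → ¬ Fin k) (sym e) (λ ())

-- Hexagons or larger faces cannot tile a sphere cubically.
closed-empty : ∀ {W : RawWeb 0} {X : Dessin 0} → Pres W X → IsWeb W → IsKreweras W → RawWeb.k W ≡ 0
closed-empty {W} {X} pres iw kw = go (IsWeb.planar iw)
  where
  open RawWeb W
  kr° : Kr X
  kr° = kr-pres pres kw
  runs : ∀ x → Run X x 1 (ψ X x)
  runs x = via (τ X x) refl
    where
    via : ∀ y → τ X x ≡ y → Run X x 1 (ψ X x)
    via (inj₂ u) e = subst (Run X x 1) (sym (cong (hubρ X) e)) (there e here)
  run-1 : ∀ {x y} → Run X x 1 y → y ≡ ψ X x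
  run-1 {x} (there e here) = sym (cong (hubρ X) e)
  runs₂ : ∀ {x y z} → Run X x 1 y → Run X y 1 z → Run X x 2 z
  runs₂ (there e here) r = there e r
  ψ≢₁ : ∀ x → x ≢ ψ X x
  ψ≢₁ x e with kr° x 1 (s≤s z≤n) (subst (Run X x 1) (sym e) (runs x)) (λ j 1≤j j< _ → ℕₚ.<-irrefl refl (ℕₚ.<-≤-trans j< 1≤j))
  ... | s≤s () , _
  ψ≢₂ : ∀ x → x ≢ ψ X (ψ X x)
  ψ≢₂ x e with kr° x 2 (s≤s z≤n) (subst (Run X x 2) (sym e) (runs₂ (runs x) (runs (ψ X x)))) never
    where
    never : ∀ j → 1 ≤ j → j < 2 → ¬ Run X x j x
    never 1 _ _ r = ψ≢₁ x (run-1 r)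
    never (suc (suc j)) _ (s≤s (s≤s ())) _
  ... | s≤s (s≤s ()) , _
  fO = edge-orbits X (ψ X)
  J : Edge X → Fin (s X)
  J = Fin.join 0 (s X)
  SJ : ∀ x → splitAt 0 (J x) ≡ x
  SJ = Finₚ.splitAt-join 0 (s X)
  3F≤ : proj₁ fO * 3 ≤ s X
  3F≤ = three-distinct (flat-classes X (proj₂ fO)) (λ i e → ψ≢₁ (splitAt 0 i) (trans (cong (splitAt 0) e) (SJ _)))
    (λ i e → ψ≢₂ (splitAt 0 i) (trans (cong (splitAt 0) e) (trans (SJ _) (cong (ψ X) (SJ _)))))
  k≤ : k ≤ s X + s X
  k≤ = Finₚ.injective⇒≤ {f = λ x → flat (Q pres x)} (λ {x} {y} e → trans (sym (PQ pres x)) (trans (cong (P pres) (flat-inj _ _ e)) (PQ pres y)))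
    where
    flat : Dart 0 (Edge X) → Fin (s X + s X)
    flat (whte x) = J x ↑ˡ s X
    flat (blck x) = s X ↑ʳ J x
    J-inj : ∀ {x y} → J x ≡ J y → x ≡ y
    J-inj {x} {y} e = trans (sym (SJ x)) (trans (cong (splitAt 0) e) (SJ y))
    left≢right : ∀ {a b} {A : Set} → a ↑ˡ s X ≡ s X ↑ʳ b → A
    left≢right {a} {b} e with trans (sym (Finₚ.splitAt-↑ˡ (s X) a (s X))) (trans (cong (splitAt (s X)) e) (Finₚ.splitAt-↑ʳ (s X) (s X) b))
    ... | ()
    flat-inj : ∀ c d → flat c ≡ flat d → c ≡ d
    flat-inj (whte x) (whte y) e = cong whte (J-inj (Finₚ.↑ˡ-injective (s X) _ _ e))
    flat-inj (whte x) (blck y) e = left≢right e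
    flat-inj (blck x) (whte y) e = left≢right (sym e)
    flat-inj (blck x) (blck y) e = cong blck (J-inj (Finₚ.↑ʳ-injective (s X) _ _ e))
  deg : ∀ x → (σ x ≢ x) × (σ (σ (σ x)) ≡ x)
  deg x = IsWeb.int-deg iw x (λ ()) (λ ()) (λ ())
  go : (0 + k ≡ 0) ⊎ (Connected W × Spherical W) → k ≡ 0
  go (inj₁ e) = e
  go (inj₂ (cn , V , E , F , nV , nE , nF , eul)) = ⊥-elim (absurd V E F (proj₁ fO) (s X) k (three-each (classes-num nV) (λ x → proj₁ (deg x)) (λ x → proj₂ (deg x)))
      k≤ 3F≤ (classes-unique (classes-num nF) (φ-classes pres (proj₂ fO))) (classes-unique (classes-num nE) (α-classes pres)) eul)
    where
    absurd : ∀ V E F F′ s k → V * 3 ≤ k → k ≤ s + s → F′ * 3 ≤ s → F ≡ F′ → E ≡ s → V + F ≡ 2 + E → ⊥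
    absurd V E F .F .E k h₁ h₂ h₃ refl refl e = ℕₚ.<-irrefl refl (begin-strict
      (V + F) * 3        ≡⟨ ℕₚ.*-distribʳ-+ 3 V F ⟩
      V * 3 + F * 3      ≤⟨ ℕₚ.+-mono-≤ (ℕₚ.≤-trans h₁ h₂) h₃ ⟩
      E + E + E          ≡⟨ lem E ⟩
      E * 3              <⟨ ℕₚ.*-monoˡ-< 3 (ℕₚ.≤-trans (ℕₚ.n<1+n E) (ℕₚ.n≤1+n (suc E))) ⟩
      (2 + E) * 3        ≡⟨ cong (_* 3) (sym e) ⟩
      (V + F) * 3        ∎)
      where
      open ℕₚ.≤-Reasoning
      lem : ∀ e → e + e + e ≡ e * 3
      lem = solve-∀

closed-web-empty : (W : RawWeb 0) → IsWeb W → IsKreweras W → RawWeb.k W ≡ 0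
closed-web-empty W iw kw = closed-empty (Decode.pres W iw kw) iw kw

M≡3* : ∀ n → M n ≡ 3 * n
M≡3* zero = refl
M≡3* (suc n) = trans (cong (3 +_) (M≡3* n)) (lem n)
  where
  lem : ∀ n → 3 + 3 * n ≡ 3 * suc n
  lem = solve-∀

theorem1p4 :
  ((n : ℕ) → Σ (List (KWeb (3 * n))) λ L →
    IsTransversal (λ _ → ⊤) L ×
    (sum (map (λ e → 2 ^ κ e) L) * ((n + 1) * (2 * n + 1)) ≡ 4 ^ n * ((3 * n) C n)))
  ×
  ((n : ℕ) → 1 ≤ n → Σ (List (KWeb (3 * n))) λ L →
    IsTransversal (λ W → NumComponents W 1) L ×
    (length L * (((3 * n) ∸ 1) ! * n !) ≡ 2 ^ n * ((4 * n) ∸ 3) !))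
theorem1p4 = counted , counted-connected
  where
  open Totals (Content.table (all-family (λ _ → 0)))
  open Connecteds (Content.table one-family) counts-nil
  counted : (n : ℕ) → Counted (λ t → t * ((n + 1) * (2 * n + 1)) ≡ 4 ^ n * ((3 * n) C n)) (3 * n)
  -- Without boundary edges there is no hub to discharge against, so this case is separate: only the
  -- empty web exists, with weight 1.
  counted zero = emptyWeb ∷ [] , (tt All′.∷ All′.[] , (λ W iw kw _ → here (empty-iso W (closed-web-empty W iw kw))) , All′.[] AllPairs.∷ AllPairs.[]) , refl
  counted (suc n) = let (L , tr , e) = subst (Counted (_≡ Tot.S (suc n) [])) (M≡3* (suc n)) (transversal n) in
    L , tr , trans (cong (_* ((suc n + 1) * (2 * suc n + 1))) e) (total-binomial (suc n))
  counted-connected : (n : ℕ) → 1 ≤ n → CountedConnected (λ l → l * (((3 * n) ∸ 1) ! * n !) ≡ 2 ^ n * ((4 * n) ∸ 3) !) (3 * n)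
  counted-connected (suc n) _ = let (L , tr , e) = subst (CountedConnected (_≡ connected (suc n))) (M≡3* (suc n)) (transversal-connected n) in
    L , tr , trans (cong (_* (((3 * suc n) ∸ 1) ! * suc n !)) e) (connected-closed n)
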